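{- Given a theory $\mathcal{T}$ consisting of binary denial constraints and a (finite) set $\Sigma$ of preference rules from $\mathcal{PL}_{\mathsf{pos}}$, it is decidable whether $\Sigma$ is $\mathcal{T}$-acyclic. Moreover, the problem can be decided in $\mathrm{coNP}$ if the predicate arity is bounded (by a constant).
   Context: **Knowledge bases.** Fix disjoint sets of predicates $\mathbf{P}$ (each with an arity $\ge 1$; $\mathbf{P}_n$ is the set of $n$-ary ones), constants $\mathbf{C}$ and variables $\mathbf{V}$ (infinite, as usual). A dataset is a finite set of facts $P(c_1,\dots,c_n)$ with $P\in\mathbf{P}_n$, $c_i\in\mathbf{C}$. A logical theory $\mathcal{T}$ is a finite set of first-order sentences over $\mathbf{P},\mathbf{C},\mathbf{V}$. A denial constraint is a sentence of the form $\alpha_1\wedge\dots\wedge\alpha_n\rightarrow\bot$ (universally quantified), where each $\alpha_i$ is a relational or inequality atom; it is binary if it has at most two relational atoms. A knowledge base (KB) is a pair $\mathcal{K}=(\mathcal{D},\mathcal{T})$; it is inconsistent, $\mathcal{K}\models\bot$, if $\mathcal{D}\cup\mathcal{T}$ has no model (for denial constraints, equivalently, if the body of some constraint is satisfied in $\mathcal{D}$, with distinct constants considered different). A conflict of $\mathcal{K}$ is an inclusion-minimal $\mathcal{D}'\subseteq\mathcal{D}$ with $(\mathcal{D}',\mathcal{T})\models\bot$; $\mathrm{Conf}(\mathcal{K})$ is the set of conflicts. **Meta-databases.** Fix $\mathbf{P}_{\mathbf{M}}\subsetneq\mathbf{P}$ (metadata predicates) and $\mathbf{C}_{\mathbf{ID}}\subsetneq\mathbf{C}$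 (fact identifiers), assumed distinct from the predicates and constants used in the considered dataset. Each $n$-ary $P\in\mathbf{P}_{\mathbf{M}}$ has an associated set of $\mathbf{C}_{\mathbf{ID}}$-positions $\mathsf{pos}_{\mathbf{ID}}(P)\subseteq\{1,\dots,n\}$. A meta-database for $\mathcal{K}=(\mathcal{D},\mathcal{T})$ is a pair $\mathcal{M}=(\mathbf{id},\mathcal{F})$ with $\mathbf{id}:\mathcal{D}\to\mathbf{C}_{\mathbf{ID}}$ injective and $\mathcal{F}$ a dataset over predicates from $\mathbf{P}_{\mathbf{M}}$ such that (i) if $P(c_1,\dots,c_n)\in\mathcal{F}$ then $c_j\in\mathbf{C}_{\mathbf{ID}}$ iff $j\in\mathsf{pos}_{\mathbf{ID}}(P)$, and (ii) every constant of $\mathbf{C}_{\mathbf{ID}}$ occurring in $\mathcal{F}$ equals $\mathbf{id}(\alpha)$ for some $\alpha\in\mathcal{D}$. **Preference rules.** A preference rule has the form $\mathsf{Cond}(x_1,x_2)\rightarrow\mathsf{pref}(x_1,x_2)$, where $\mathsf{pref}$ is a special predicate not occurring in rule bodies, KBs or meta-databases, and the distinguished free variables $x_1,x_2$ occur in the body $\mathsf{Cond}(x_1,x_2)$ only in $\mathbf{C}_{\mathbf{ID}}$-positions of relational atoms over metadata predicates or in equality atoms of the form $x_i=\mathbf{id}(P(\vec t))$. **The language $\mathcal{PL}_{\mathsf{pos}}$.** It consists of the preference rules whose body is built, using only $\wedge$ and $\exists$, from the following atomic statements: relational atoms $P(t_1,\dots,t_n)$ with $P\in\mathbf{P}_n$,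 $t_i\in\mathbf{V}\cup\mathbf{C}$; atoms $x=\mathbf{id}(P(t_1,\dots,t_n))$ with $x\in\mathbf{V}$, $t_i\in\mathbf{V}\cup\mathbf{C}$, $P\in\mathbf{P}_n\setminus\mathbf{P}_{\mathbf{M}}$; inequality atoms $x\neq t$ with $x\in\mathbf{V}$, $t\in\mathbf{V}\cup\mathbf{C}$. **Semantics.** For identifiers $id_1,id_2$ of facts of $\mathcal{D}$, $(\mathcal{K},\mathcal{M})\models\mathsf{Cond}(id_1,id_2)$ iff there is an assignment $\nu$ of constants to the free variables of the body with $\nu(x_1)=id_1$, $\nu(x_2)=id_2$ making the body true, where $\wedge$ is interpreted as usual, $\exists$ ranges over $\mathbf{C}$, an atom $P(\vec c)$ is true iff $P(\vec c)\in\mathcal{F}$ (for $P$ occurring in $\mathcal{F}$) resp. $P(\vec c)\in\mathcal{D}$ (for $P$ occurring in $\mathcal{K}$) and false for other $P$, an atom $id=\mathbf{id}(P(\vec c))$ is true iff $P(\vec c)\in\mathcal{D}$ and $id=\mathbf{id}(P(\vec c))$, and $c\neq d$ is true iff $c,d$ are distinct constants. For a set $\Sigma$ of rules, $\Sigma(\mathcal{K},\mathcal{M})$ is the set of all $\mathsf{pref}(id_1,id_2)$ such that some rule of $\Sigma$ with body $\mathsf{Cond}$ satisfies $(\mathcal{K},\mathcal{M})\models\mathsf{Cond}(id_1,id_2)$. **$\mathcal{T}$-acyclicity.** For $\alpha,\beta\in\mathcal{D}$, set $\alpha\succ_{\Sigma,\mathcal{K},\mathcal{M}}\beta$ iff $\mathsf{pref}(\mathbf{id}(\alpha),\mathbf{id}(\beta))\in\Sigma(\mathcal{K},\mathcal{M})$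 and $\{\alpha,\beta\}\subseteq\mathcal{C}$ for some $\mathcal{C}\in\mathrm{Conf}(\mathcal{K})$. $\Sigma$ is $\mathcal{T}$-acyclic if for every dataset $\mathcal{D}$ and every meta-database $\mathcal{M}$ for $\mathcal{K}=(\mathcal{D},\mathcal{T})$, the relation $\succ_{\Sigma,\mathcal{K},\mathcal{M}}$ is acyclic (there are no $\alpha_1,\dots,\alpha_k$, $k\ge1$, with $\alpha_1\succ\alpha_2\succ\dots\succ\alpha_k\succ\alpha_1$). -}

module Defs where

open import Level using (_⊔_; 0ℓ) renaming (suc to lsuc)
open import Data.Bool using (Bool; true; false; T; if_then_else_)
import Data.Bool.Properties as Bool
open import Data.Empty using (⊥)
open import Data.Fin using (Fin; zero; suc)
open import Data.Fin.Subset using (Subset) renaming (_∈_ to _∈ₛ_)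
open import Data.List using (List; []; _∷_; [_]; _++_; concatMap; length; map; mapMaybe)
import Data.List.Properties as List
open import Data.List.Membership.Propositional using (_∈_)
open import Data.List.Relation.Binary.Subset.Propositional using (_⊆_)
open import Data.List.Relation.Unary.All using (All)
open import Data.Maybe using (just; nothing)
open import Data.Nat using (ℕ; suc; _+_; _*_; _^_; _≤_)
open import Data.Product using (Σ; ∃; ∃-syntax; _×_; _,_; proj₁; proj₂)
open import Data.Sum using (_⊎_)
open import Data.Unit using (⊤)
open import Data.Vec as Vec using (Vec)
import Data.Vec.Membership.Propositional as Vec∈
open import Function using (_∘_; _⇔_)
open import Function.Definitions using (Injective)
open import Relation.Binary.Construct.Closure.Transitive using (TransClosure)
open import Relation.Binary.Core using (Rel)
open import Relation.Binary.Definitions using (DecidableEquality)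
open import Relation.Binary.PropositionalEquality using (_≡_; _≢_)
open import Relation.Nullary using (¬_; does)

Acyclic : ∀ {a ℓ} {A : Set a} → Rel A ℓ → Set (a ⊔ ℓ)
Acyclic _∼_ = ∀ x → ¬ TransClosure _∼_ x x

------------------------------------------------------------------------
-- Nondeterministic multi-tape Turing machines and coNP

data Symbol (k e : ℕ) : Set where
  blank : Symbol k e
  input : Fin k → Symbol k e
  aux   : Fin e → Symbol k e

data Move : Set where
  left stay right : Move

-- A two-way infinite tape: the scanned cell and the cells on either side of
-- it, nearest first.  All cells beyond the two lists are blank.
record Tape (A : Set) : Set where
  constructor tape
  field
    before  : List A
    scanned : A
    after   : List A

module _ {A : Set} (blank : A) where

  load : List A → Tape A
  load []       = tape [] blank []
  load (a ∷ as) = tape [] a as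

  act : Tape A → A × Move → Tape A
  act (tape ls       _ rs)       (b , stay)  = tape ls b rs
  act (tape []       _ rs)       (b , left)  = tape [] blank (b ∷ rs)
  act (tape (l ∷ ls) _ rs)       (b , left)  = tape ls l (b ∷ rs)
  act (tape ls       _ [])       (b , right) = tape (b ∷ ls) blank []
  act (tape ls       _ (r ∷ rs)) (b , right) = tape (b ∷ ls) r rs

record NTM (k : ℕ) : Set where
  field
    states workTapes auxSymbols : ℕ

  Sym : Set
  Sym = Symbol k auxSymbols

  tapes : ℕ
  tapes = suc workTapes

  field
    start accept : Fin states
    δ : Fin states → Vec Sym tapes → List (Fin states × Vec (Sym × Move) tapes)

  record Config : Set where
    constructor config
    field
      state    : Fin states
      contents : Vec (Tape Sym) tapes

  open Config public

  initial : List (Fin k) → Config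
  initial w = config start
    (load blank (map input w) Vec.∷ Vec.replicate workTapes (load blank []))

  data _⟶_ (c : Config) : Config → Set where
    step : ∀ {q as} →
           (q , as) ∈ δ (state c) (Vec.map Tape.scanned (contents c)) →
           c ⟶ config q (Vec.zipWith (act blank) (contents c) as)

  data _⟶[_]_ : Config → ℕ → Config → Set where
    done : ∀ {c} → c ⟶[ 0 ] c
    _then_ : ∀ {c d e n} → c ⟶ d → d ⟶[ n ] e → c ⟶[ suc n ] e

  AcceptsIn : List (Fin k) → ℕ → Set
  AcceptsIn w n = ∃[ c ] (initial w ⟶[ n ] c) × state c ≡ accept

-- A decision problem is a set X of instances, an encoding of the instances as
-- words and a predicate on instances.  As usual for nondeterministic time,
-- the polynomial bounds the shortest accepting computation on yes-instances;
-- no-instances have no accepting computation of any length.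
InNP : ∀ {a p k} {X : Set a} → (X → List (Fin k)) → (X → Set p) → Set (a ⊔ p)
InNP {k = k} {X} encode P =
  ∃[ M ] ∃[ c ] ∃[ d ]
    ((x : X) →
      (P x → ∃[ n ] n ≤ c * length (encode x) ^ d + c × NTM.AcceptsIn {k} M (encode x) n)
      × (∀ n → NTM.AcceptsIn M (encode x) n → P x))

InCoNP : ∀ {a p k} {X : Set a} → (X → List (Fin k)) → (X → Set p) → Set (a ⊔ p)
InCoNP encode P = InNP encode (λ x → ¬ P x)

------------------------------------------------------------------------
-- Symbols

Word : Set
Word = List Bool

Var : Set
Var = Word

_≟ᵛ_ : DecidableEquality Var
_≟ᵛ_ = List.≡-dec Bool._≟_

-- The elements of C_ID.
ID : Set
ID = Word

data Const : Set where
  ident : ID → Const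
  value : Word → Const

IsId : Const → Set
IsId (ident _) = ⊤
IsId (value _) = ⊥

data Term : Set where
  var : Var → Term
  con : Const → Term

record Signature : Set₁ where
  field
    Pred           : Set
    name           : Pred → Word
    name-injective : Injective _≡_ _≡_ name
    arity          : Pred → ℕ
    arity≥1        : ∀ P → 1 ≤ arity P
    meta?          : Pred → Bool
    -- Meaningful for metadata predicates only.
    posID          : ∀ P → Subset (arity P)

  IsMeta : Pred → Set
  IsMeta P = T (meta? P)

  field
    someNonMeta : ∃[ P ] ¬ IsMeta P

module Preferences (S : Signature) where
  open Signature S

  infix 8 _·_

  record Atom (A : Set) : Set where
    constructor _·_
    field
      pred : Pred
      args : Vec A (arity pred)

  open Atom public

  mapAtom : ∀ {A B} → (A → B) → Atom A → Atom B
  mapAtom f (P · ts) = P · Vec.map f ts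

  Fact : Set
  Fact = Atom Const

  ----------------------------------------------------------------------
  -- Denial constraints and knowledge bases

  data Literal : Set where
    rel : Atom Term → Literal
    neq : Term → Term → Literal

  -- The list α₁, …, αₙ stands for the universal closure of
  -- α₁ ∧ … ∧ αₙ → ⊥.
  DenialConstraint : Set
  DenialConstraint = List Literal

  relationalAtoms : DenialConstraint → List (Atom Term)
  relationalAtoms = mapMaybe λ { (rel α) → just α ; (neq _ _) → nothing }

  Binary : DenialConstraint → Set
  Binary κ = length (relationalAtoms κ) ≤ 2

  Theory : Set
  Theory = List DenialConstraint

  -- First-order structures in which distinct constants denote distinct
  -- elements.
  record Structure : Set₁ where
    field
      Dom             : Set
      constant        : Const → Dom
      unique-names    : Injective _≡_ _≡_ constant
      relation        : (P : Pred) → Vec Dom (arity P) → Set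

    term : (Var → Dom) → Term → Dom
    term ν (var x) = ν x
    term ν (con c) = constant c

    True : Atom Dom → Set
    True (P · ds) = relation P ds

    ⟦_⟧ : Literal → (Var → Dom) → Set
    ⟦ rel α ⟧   ν = True (mapAtom (term ν) α)
    ⟦ neq s t ⟧ ν = term ν s ≢ term ν t

    SatisfiesFact : Fact → Set
    SatisfiesFact α = True (mapAtom constant α)

    SatisfiesConstraint : DenialConstraint → Set
    SatisfiesConstraint κ = (ν : Var → Dom) → ¬ All (λ ℓ → ⟦ ℓ ⟧ ν) κ

  Inconsistent : List Fact → Theory → Set₁
  Inconsistent D 𝒯 =
    ¬ (Σ Structure λ 𝔄 → let open Structure 𝔄 in
         All SatisfiesFact D × All SatisfiesConstraint 𝒯)

  -- Finite sets are lists up to mutual inclusion.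
  record IsConflict (D : List Fact) (𝒯 : Theory) (C : List Fact) : Set₁ where
    field
      subset       : C ⊆ D
      inconsistent : Inconsistent C 𝒯
      minimal      : ∀ {C′} → C′ ⊆ C → Inconsistent C′ 𝒯 → C ⊆ C′

  ----------------------------------------------------------------------
  -- Datasets and meta-databases

  -- The facts of a dataset use neither metadata predicates nor identifiers.
  record Dataset : Set where
    field
      facts       : List Fact
      no-metadata : ∀ {α} → α ∈ facts → ¬ IsMeta (pred α)
      no-ids      : ∀ {α c} → α ∈ facts → c Vec∈.∈ args α → ¬ IsId c

  open Dataset public

  -- id is a function on the facts of the dataset; it is extended to all facts,
  -- and its values outside the dataset are never used.
  record MetaDatabase (D : Dataset) : Set where
    field
      id           : Fact → ID
      id-injective : ∀ {α β} → α ∈ facts D → β ∈ facts D → id α ≡ id β → α ≡ β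
      metafacts    : List Fact
      metadata     : ∀ {φ} → φ ∈ metafacts → IsMeta (pred φ)
      positions    : ∀ {φ} → φ ∈ metafacts →
                     ∀ j → IsId (Vec.lookup (args φ) j) ⇔ j ∈ₛ posID (pred φ)
      known-ids    : ∀ {φ i} → φ ∈ metafacts → ident i Vec∈.∈ args φ →
                     ∃[ α ] α ∈ facts D × i ≡ id α

  ----------------------------------------------------------------------
  -- The preference language PL_pos

  infixr 6 _∧_

  data Cond : Set where
    rel  : Atom Term → Cond
    idEq : Var → (α : Atom Term) → ¬ IsMeta (pred α) → Cond
    neq  : Var → Term → Cond
    _∧_  : Cond → Cond → Cond
    ex   : Var → Cond → Cond

  -- Every free occurrence of x is in an identifier position of a relational
  -- atom over a metadata predicate or on the left of an atom x = id(α).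
  OnlyAsId : Var → Cond → Set
  OnlyAsId x (rel (P · ts))        = ∀ j → Vec.lookup ts j ≡ var x → IsMeta P × j ∈ₛ posID P
  OnlyAsId x (idEq y (P · ts) _)   = ¬ (var x Vec∈.∈ ts)
  OnlyAsId x (neq y t)             = x ≢ y × var x ≢ t
  OnlyAsId x (φ ∧ ψ)               = OnlyAsId x φ × OnlyAsId x ψ
  OnlyAsId x (ex y φ)              = x ≡ y ⊎ OnlyAsId x φ

  record Rule : Set where
    field
      x₁ x₂   : Var
      x₁≢x₂   : x₁ ≢ x₂
      body    : Cond
      x₁-asId : OnlyAsId x₁ body
      x₂-asId : OnlyAsId x₂ body

  Assignment : Set
  Assignment = Var → Const

  _[_≔_] : Assignment → Var → Const → Assignment
  (ν [ x ≔ c ]) y = if does (x ≟ᵛ y) then c else ν y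

  value-of : Assignment → Term → Const
  value-of ν (var x) = ν x
  value-of ν (con c) = c

  module _ {D : Dataset} (M : MetaDatabase D) where
    open MetaDatabase M

    Holds : Assignment → Cond → Set
    Holds ν (rel α)      = let f = mapAtom (value-of ν) α in f ∈ metafacts ⊎ f ∈ facts D
    Holds ν (idEq x α _) = let f = mapAtom (value-of ν) α in f ∈ facts D × ν x ≡ ident (id f)
    Holds ν (neq x t)    = ν x ≢ value-of ν t
    Holds ν (φ ∧ ψ)      = Holds ν φ × Holds ν ψ
    Holds ν (ex x φ)     = ∃[ c ] Holds (ν [ x ≔ c ]) φ

    -- pref(i , j) ∈ Σ(K, M)
    Pref : List Rule → ID → ID → Set
    Pref rules i j =
      ∃[ r ] r ∈ rules × (let open Rule r in
        ∃[ ν ] ν x₁ ≡ ident i × ν x₂ ≡ ident j × Holds ν body)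

    Preferred : Theory → List Rule → Rel Fact (lsuc 0ℓ)
    Preferred 𝒯 rules α β =
      Pref rules (id α) (id β) ×
      (∃[ C ] IsConflict (facts D) 𝒯 C × α ∈ C × β ∈ C)

  TheoryAcyclic : Theory → List Rule → Set₁
  TheoryAcyclic 𝒯 rules =
    (D : Dataset) (M : MetaDatabase D) → Acyclic (Preferred M 𝒯 rules)

  ----------------------------------------------------------------------
  -- The decision problem

  record Instance : Set where
    field
      theory : Theory
      binary : All Binary theory
      rules  : List Rule

  open Instance public

  IsAcyclic : Instance → Set₁
  IsAcyclic I = TheoryAcyclic (theory I) (rules I)

  predsCond : Cond → List Pred
  predsCond (rel α)      = [ pred α ]
  predsCond (idEq _ α _) = [ pred α ]
  predsCond (neq _ _)    = []
  predsCond (φ ∧ ψ)      = predsCond φ ++ predsCond ψ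
  predsCond (ex _ φ)     = predsCond φ

  preds : Instance → List Pred
  preds I = concatMap (map pred ∘ relationalAtoms) (theory I)
         ++ concatMap (predsCond ∘ Rule.body) (rules I)

  record BoundedInstance (k : ℕ) : Set where
    field
      inst    : Instance
      bounded : All (λ P → arity P ≤ k) (preds inst)

  open BoundedInstance public

  ----------------------------------------------------------------------
  -- Instances as words over a four-letter alphabet.  Names are written bit
  -- by bit, so a name of length n takes n + 2 letters.

  Letter : Set
  Letter = Fin 4

  pattern 𝟎 = zero
  pattern 𝟏 = suc zero
  pattern ⟨ = suc (suc zero)
  pattern ⟩ = suc (suc (suc zero))

  bit : Bool → Letter
  bit false = 𝟎
  bit true  = 𝟏

  encodeList : ∀ {A : Set} → (A → List Letter) → List A → List Letter
  encodeList f xs = ⟨ ∷ concatMap f xs ++ [ ⟩ ]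

  encodeWord : Word → List Letter
  encodeWord = encodeList ([_] ∘ bit)

  encodeConst : Const → List Letter
  encodeConst (ident w) = 𝟎 ∷ encodeWord w
  encodeConst (value w) = 𝟏 ∷ encodeWord w

  encodeTerm : Term → List Letter
  encodeTerm (var x) = 𝟎 ∷ encodeWord x
  encodeTerm (con c) = 𝟏 ∷ encodeConst c

  -- The fixed data about a predicate are part of its encoding, so that one
  -- finite machine can read them off even if the signature is infinite.
  encodePred : Pred → List Letter
  encodePred P = encodeWord (name P) ++
    (if meta? P then 𝟏 ∷ encodeWord (Vec.toList (posID P)) else [ 𝟎 ])

  encodeAtom : Atom Term → List Letter
  encodeAtom (P · ts) = encodePred P ++ encodeList encodeTerm (Vec.toList ts)

  encodeLiteral : Literal → List Letter
  encodeLiteral (rel α)   = 𝟎 ∷ encodeAtom α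
  encodeLiteral (neq s t) = 𝟏 ∷ encodeTerm s ++ encodeTerm t

  encodeCond : Cond → List Letter
  encodeCond (rel α)      = 𝟎 ∷ 𝟎 ∷ encodeAtom α
  encodeCond (idEq x α _) = 𝟎 ∷ 𝟏 ∷ encodeWord x ++ encodeAtom α
  encodeCond (neq x t)    = 𝟏 ∷ 𝟎 ∷ encodeWord x ++ encodeTerm t
  encodeCond (φ ∧ ψ)      = 𝟏 ∷ 𝟏 ∷ 𝟎 ∷ encodeCond φ ++ encodeCond ψ
  encodeCond (ex x φ)     = 𝟏 ∷ 𝟏 ∷ 𝟏 ∷ encodeWord x ++ encodeCond φ

  encodeRule : Rule → List Letter
  encodeRule r = encodeWord x₁ ++ encodeWord x₂ ++ encodeCond body
    where open Rule r

  encode : Instance → List Letter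
  encode I = encodeList (encodeList encodeLiteral) (theory I)
          ++ encodeList encodeRule (rules I)

{-# OPTIONS --safe #-}
-- A violation of acyclicity is a cycle of preferences that finitely many words
-- describe. Constraints are binary, so that two facts share a conflict iff they
-- violate a constraint together and no fewer facts violate one; and rule bodies
-- are positive, so that the facts and metafacts that witness the edges of the
-- cycle can be thrown together into one dataset and one meta-database, where
-- every edge is still there. The witnesses of an edge matter only for this edge,
-- so the constants outside the instance can be renamed from edge to edge into
-- a finite pool, and by the pigeonhole principle there is a cycle that is not
-- longer than the number of facts over the pool. This number is polynomial for
-- bounded arity, whereas the cycle itself is guessed edge by edge.
--
-- The existence of a cycle is expressed by a formula over words, built from
-- concatenation, existential quantifiers and transitive closure. Satisfaction
-- is decidable when all words and chains have bounded length, and the formula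
-- compiles into a nondeterministic machine that guesses the words, in time
-- polynomial in the bound.

module Submission where

open import Defs
open import Data.Bool using (Bool; true; false; if_then_else_)
import Data.Bool.Properties as Bool
open import Data.Empty using (⊥)
open import Data.Fin as Fin using (Fin; zero; suc; _↑ˡ_; _↑ʳ_; splitAt)
import Data.Fin.Properties as Fin
open import Data.List as List using (List; []; _∷_; _++_; [_]; length; map; mapMaybe; concatMap; _ʳ++_; replicate)
open import Data.List.Membership.Propositional using (_∈_; _∉_)
open import Data.List.Membership.Propositional.Properties using (∈-map⁺; ∈-map⁻; ∈-++⁺ˡ; ∈-++⁺ʳ; ∈-++⁻; ∈-concatMap⁺; ∈-filter⁺; ∈-filter⁻; ∈-concat⁺′; ∈-upTo⁺; ∈-upTo⁻)
import Data.List.Properties as List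
open import Data.List.Relation.Binary.Pointwise as Pointwise using (Pointwise; []; _∷_)
open import Data.List.Relation.Binary.Subset.Propositional using (_⊆_)
open import Data.List.Relation.Unary.All as All using (All; []; _∷_)
import Data.List.Relation.Unary.All.Properties as All
open import Data.List.Relation.Unary.Any as Any using (here; there; Any)
import Data.List.Relation.Unary.Any.Properties as Any
open import Data.Maybe as Maybe using (Maybe; just; nothing; maybe)
open import Data.Nat as ℕ using (ℕ; zero; suc; _+_; _*_; _^_; _⊔_; _≤_; z≤n; s≤s; _<_; _≤?_; _∸_; NonZero)
import Data.Nat.Properties as ℕ
open import Data.Product as Product using (Σ; ∃-syntax; ∃₂; _×_; _,_; proj₁; proj₂)
open import Data.Sum as Sum using (_⊎_; inj₁; inj₂)
open import Data.Sum.Properties using (inj₂-injective)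
open import Data.Unit using (⊤; tt)
open import Data.Vec as Vec using (Vec; []; _∷_; lookup; _[_]≔_)
import Data.Vec.Membership.Propositional as Vec∈
import Data.Vec.Properties as Vec
import Data.Vec.Relation.Unary.Any as VecAny
open import Function using (_∘_; case_of_; mk⇔; module Equivalence)
open import Relation.Binary.Construct.Closure.Transitive using (TransClosure) renaming ([_] to [_]⁺; _∷_ to _∷⁺_; _++_ to _++⁺_)
open import Relation.Binary.PropositionalEquality using (_≡_; _≢_; refl; sym; trans; cong; cong₂; subst; module ≡-Reasoning; subst₂)
open import Relation.Nullary using (¬_; Dec; yes; no; contradiction)
open import Relation.Nullary.Decidable as Dec using (_×-dec_; _⊎-dec_; decidable-stable; ¬?)

-- On the machine side the obstacle is that the logic has no negation, while conflicts must be
-- minimal and values may have to differ. Both negative statements get positive witnesses: a place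
-- at which two words part, and a finite list of reasons why a single fact cannot violate a
-- constraint. The list is complete because mapping all atoms of a constraint to one fact leaves the
-- terms in them no choice. On the database side the obstacle is the function `id`. It is never
-- guessed: a fact itself serves as the value of a variable that stands for its identifier. Nor is a
-- dataset guessed, since an atom of a positive body becomes true by adding a fact, provided that
-- identifiers stand exactly where they may. Inconsistency is a negated existence statement, so a
-- genuine cycle yields one of words only under double negation; the search within the bound is
-- decidable, and this removes the double negation. Soundness, on the other hand, must hold for
-- words of any length, since no computation on a no-instance may accept.

-- Stack programs and their Turing machines

module Programs where

  -- Nondeterministic programs over stacks

  private variable T n m k : ℕ

  Letters : Set
  Letters = List (Fin 4)

  Store : ℕ → Set
  Store = Vec Letters

  infixr 5 _⨾_ _⊹_

  -- A command that does not apply has no run, so `pop` and `empty` double as tests. Nondeterminism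
  -- is confined to `_⊹_` and `star`.
  data Prog (T : ℕ) : Set where
    pop push : Fin T → Fin 4 → Prog T
    empty    : Fin T → Prog T
    fail     : Prog T
    _⨾_ _⊹_  : Prog T → Prog T → Prog T
    star     : Prog T → Prog T

  data Run {T : ℕ} : Prog T → Store T → ℕ → Store T → Set where
    pop   : ∀ {i a w σ} → lookup σ i ≡ a ∷ w → Run (pop i a) σ 1 (σ [ i ]≔ w)
    push  : ∀ {i a σ} → Run (push i a) σ 2 (σ [ i ]≔ (a ∷ lookup σ i))
    empty : ∀ {i σ} → lookup σ i ≡ [] → Run (empty i) σ 1 σ
    _⨾_   : ∀ {p q σ τ υ m n} → Run p σ m τ → Run q τ n υ → Run (p ⨾ q) σ (m + n) υ
    inl   : ∀ {p q σ τ n} → Run p σ n τ → Run (p ⊹ q) σ (suc n) τ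
    inr   : ∀ {p q σ τ n} → Run q σ n τ → Run (p ⊹ q) σ (suc n) τ
    stop  : ∀ {p σ} → Run (star p) σ 1 σ
    _∷_   : ∀ {p σ τ υ m n} → Run p σ m τ → Run (star p) τ n υ → Run (star p) σ (suc (m + n)) υ

  -- Programs as Turing machines

  Cell : Set
  Cell = Symbol 4 0

  Tapes : ℕ → Set
  Tapes = Vec (Tape Cell)

  decode : List Cell → Letters
  decode (input a ∷ s) = a ∷ decode s
  decode _             = []

  -- The stack on a tape starts at the scanned cell and ends before the first
  -- blank; whatever lies to the left is garbage.
  stack : Tape Cell → Letters
  stack (tape _ s rs) = decode (s ∷ rs)

  stacks : Tapes T → Store T
  stacks = Vec.map stack

  data Micro (T : ℕ) : Set where
    nop : Micro T
    on  : Fin T → (Cell → Maybe (Cell × Move)) → Micro T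

  exec : Micro T → Tapes T → Maybe (Tapes T)
  exec nop      ts = just ts
  exec (on i g) ts =
    Maybe.map (λ a → ts [ i ]≔ act blank (lookup ts i) a) (g (Tape.scanned (lookup ts i)))

  -- The extra control state of `_⊹_` and of `star` is where the choice is made, before a component
  -- is entered or left for good.
  State : Prog T → Set
  State (pop _ _)  = ⊤
  State (push _ _) = Bool
  State (empty _)  = ⊤
  State fail       = ⊤
  State (p ⨾ q)    = State p ⊎ State q
  State (p ⊹ q)    = Maybe (State p ⊎ State q)
  State (star p)   = Maybe (State p)

  entry : (p : Prog T) → State p
  entry (pop _ _)  = tt
  entry (push _ _) = false
  entry (empty _)  = tt
  entry fail       = tt
  entry (p ⨾ q)    = inj₁ (entry p)
  entry (p ⊹ q)    = nothing
  entry (star p)   = nothing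

  popping : Fin 4 → Cell → Maybe (Cell × Move)
  popping a (input b) with a Fin.≟ b
  ... | yes _ = just (blank , right)
  ... | no _  = nothing
  popping a _ = nothing

  emptying : Cell → Maybe (Cell × Move)
  emptying (input _) = nothing
  emptying s         = just (s , stay)

  -- The target `nothing` leaves the program. An enclosing program redirects it to the entry of what
  -- comes next.
  Edges : ℕ → Set → Set
  Edges T A = List (Micro T × Maybe A)

  retarget : {A B : Set} → (A → B) → Maybe B → Edges T A → Edges T B
  retarget f exit = map (Product.map₂ (maybe (just ∘ f) exit))

  edges : (p : Prog T) → State p → Edges T (State p)
  edges (pop i a)  _            = [ on i (popping a) , nothing ]
  -- The cell to the left may hold garbage, and it can be overwritten only after the move. This is
  -- why a push costs two steps.
  edges (push i a) false        = [ on i (λ s → just (s , left)) , just true ]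
  edges (push i a) true         = [ on i (λ _ → just (input a , stay)) , nothing ]
  edges (empty i)  _            = [ on i emptying , nothing ]
  edges fail       _            = []
  edges (p ⨾ q)    (inj₁ s)     = retarget inj₁ (just (inj₂ (entry q))) (edges p s)
  edges (p ⨾ q)    (inj₂ s)     = retarget inj₂ nothing (edges q s)
  edges (p ⊹ q)    nothing      = (nop , just (just (inj₁ (entry p)))) ∷ (nop , just (just (inj₂ (entry q)))) ∷ []
  edges (p ⊹ q)    (just (inj₁ s)) = retarget (just ∘ inj₁) nothing (edges p s)
  edges (p ⊹ q)    (just (inj₂ s)) = retarget (just ∘ inj₂) nothing (edges q s)
  edges (star p)   nothing      = (nop , nothing) ∷ (nop , just (just (entry p))) ∷ []
  edges (star p)   (just s)     = retarget just (just nothing) (edges p s)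

  data Path (p : Prog T) : State p → Tapes T → ℕ → Tapes T → Set where
    last : ∀ {s μ ts ts′} → (μ , nothing) ∈ edges p s → exec μ ts ≡ just ts′ → Path p s ts 1 ts′
    more : ∀ {s μ s′ ts ts′ ts″ n} → (μ , just s′) ∈ edges p s → exec μ ts ≡ just ts′ →
           Path p s′ ts′ n ts″ → Path p s ts (suc n) ts″

  -- A computation that starts at an inner state is not a run of the program. `Rest p s ts σ` states
  -- what is still owed between the state `s` and the result `σ`; it is the invariant by which a
  -- path is read, from its end backwards, as a run.
  Rest : (p : Prog T) → State p → Tapes T → Store T → Set
  Rest (push i a) true ts σ = σ ≡ stacks (ts [ i ]≔ act blank (lookup ts i) (input a , stay))
  Rest p@(push i a) false ts σ = ∃[ n ] Run p (stacks ts) n σ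
  Rest p@(pop _ _) _ ts σ = ∃[ n ] Run p (stacks ts) n σ
  Rest p@(empty _) _ ts σ = ∃[ n ] Run p (stacks ts) n σ
  Rest fail       _ ts σ = ⊥
  Rest (p ⨾ q) (inj₁ s) ts σ = ∃[ τ ] Rest p s ts τ × (∃[ n ] Run q τ n σ)
  Rest (p ⨾ q) (inj₂ s) ts σ = Rest q s ts σ
  Rest r@(p ⊹ q) nothing ts σ = ∃[ n ] Run r (stacks ts) n σ
  Rest (p ⊹ q) (just (inj₁ s)) ts σ = Rest p s ts σ
  Rest (p ⊹ q) (just (inj₂ s)) ts σ = Rest q s ts σ
  Rest r@(star p) nothing ts σ = ∃[ n ] Run r (stacks ts) n σ
  Rest (star p) (just s) ts σ = ∃[ τ ] Rest p s ts τ × (∃[ n ] Run (star p) τ n σ)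

  Rest? : (p : Prog T) → Maybe (State p) → Tapes T → Store T → Set
  Rest? p (just s) ts σ = Rest p s ts σ
  Rest? p nothing  ts σ = σ ≡ stacks ts

  rest-entry : (p : Prog T) {ts : Tapes T} {σ : Store T} → Rest p (entry p) ts σ → ∃[ n ] Run p (stacks ts) n σ
  rest-entry (pop _ _)  r = r
  rest-entry (push _ _) r = r
  rest-entry (empty _)  r = r
  rest-entry (p ⨾ q) (τ , r , _ , r′) = _ , proj₂ (rest-entry p r) ⨾ r′
  rest-entry (p ⊹ q) r = r
  rest-entry (star p) r = r

  stacks-update : (ts : Tapes T) (i : Fin T) (t : Tape Cell) → stacks (ts [ i ]≔ t) ≡ stacks ts [ i ]≔ stack t
  stacks-update ts i t = Vec.map-[]≔ stack ts i

  stacks-lookup : (ts : Tapes T) (i : Fin T) → lookup (stacks ts) i ≡ stack (lookup ts i)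
  stacks-lookup ts i = Vec.lookup-map i stack ts

  popping-stack : ∀ {a b} (t : Tape Cell) → popping a (Tape.scanned t) ≡ just b →
                  stack t ≡ a ∷ stack (act blank t b)
  popping-stack {a} (tape ls (input b) rs) eq with a Fin.≟ b
  popping-stack (tape ls (input b) []) refl | yes refl = refl
  popping-stack (tape ls (input b) (r ∷ rs)) refl | yes refl = refl

  pop-tape : ∀ {a w} (t : Tape Cell) → stack t ≡ a ∷ w →
             ∃[ b ] popping a (Tape.scanned t) ≡ just b × stack (act blank t b) ≡ w
  pop-tape (tape ls (input a) rs) refl with a Fin.≟ a
  pop-tape (tape ls (input a) [])       refl | yes _ = _ , refl , refl
  pop-tape (tape ls (input a) (r ∷ rs)) refl | yes _ = _ , refl , refl
  ... | no ≢ = contradiction refl ≢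

  push-tape : ∀ {a} (t : Tape Cell) →
              stack (act blank (act blank t (Tape.scanned t , left)) (input a , stay)) ≡ a ∷ stack t
  push-tape (tape []       s rs) = refl
  push-tape (tape (l ∷ ls) s rs) = refl

  push-stacks : ∀ {a} (ts : Tapes T) (i : Fin T) →
                let t = lookup ts i ; ts′ = ts [ i ]≔ act blank t (Tape.scanned t , left) in
                stacks (ts′ [ i ]≔ act blank (lookup ts′ i) (input a , stay)) ≡
                stacks ts [ i ]≔ (a ∷ lookup (stacks ts) i)
  push-stacks {a = a} ts i = begin
    stacks (ts′ [ i ]≔ act blank (lookup ts′ i) (input a , stay))
      ≡⟨ stacks-update ts′ i _ ⟩
    stacks ts′ [ i ]≔ stack (act blank (lookup ts′ i) (input a , stay))
      ≡⟨ cong₂ (λ u t → u [ i ]≔ stack (act blank t (input a , stay)))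
           (stacks-update ts i t′) (Vec.lookup∘update i ts t′) ⟩
    (stacks ts [ i ]≔ stack t′) [ i ]≔ stack (act blank t′ (input a , stay))
      ≡⟨ Vec.[]≔-idempotent (stacks ts) i ⟩
    stacks ts [ i ]≔ stack (act blank t′ (input a , stay))
      ≡⟨ cong (stacks ts [ i ]≔_) (trans (push-tape (lookup ts i)) (cong (a ∷_) (sym (stacks-lookup ts i)))) ⟩
    stacks ts [ i ]≔ (a ∷ lookup (stacks ts) i) ∎
    where
    open ≡-Reasoning
    t′ = act blank (lookup ts i) (Tape.scanned (lookup ts i) , left)
    ts′ = ts [ i ]≔ t′

  emptying-stack : ∀ {b} (t : Tape Cell) → emptying (Tape.scanned t) ≡ just b →
                   stack t ≡ [] × act blank t b ≡ t
  emptying-stack (tape ls blank rs)   refl = refl , refl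

  empty-tape : (t : Tape Cell) → stack t ≡ [] → ∃[ b ] emptying (Tape.scanned t) ≡ just b × act blank t b ≡ t
  empty-tape (tape ls blank rs) eq = _ , refl , refl

  update-same : {A : Set} (v : Vec A T) (i : Fin T) {x : A} → x ≡ lookup v i → v [ i ]≔ x ≡ v
  update-same v i refl = Vec.[]≔-lookup v i

  rest-exit : (p : Prog T) {A : Set} {f : A → State p} {exit : Maybe (State p)} {E : Edges T A} →
              ∀ {μ ms} → (μ , ms) ∈ retarget f exit E →
              ∃[ ms′ ] (μ , ms′) ∈ E × ms ≡ maybe (just ∘ f) exit ms′
  rest-exit p μ∈ with ∈-map⁻ _ μ∈
  ... | (_ , ms′) , ∈E , refl = ms′ , ∈E , refl

  rest-step : (p : Prog T) (s : State p) {μ : Micro T} {ms : Maybe (State p)} {ts ts′ : Tapes T} {σ : Store T} →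
              (μ , ms) ∈ edges p s → exec μ ts ≡ just ts′ → Rest? p ms ts′ σ → Rest p s ts σ
  rest-step (pop i a) tt {ts = ts} (here refl) eq refl with popping a (Tape.scanned (lookup ts i)) in g
  rest-step (pop i a) tt {ts = ts} (here refl) refl refl | just b =
    1 , subst (Run _ _ _) (sym (stacks-update ts i _)) (pop (trans (stacks-lookup ts i) (popping-stack (lookup ts i) g)))
  rest-step (push i a) false {ts = ts} (here refl) refl refl = 2 , subst (Run _ _ _) (sym (push-stacks ts i)) push
  rest-step (push i a) true (here refl) refl refl = refl
  rest-step (empty i) tt {ts = ts} (here refl) eq refl with emptying (Tape.scanned (lookup ts i)) in g
  rest-step (empty i) tt {ts = ts} (here refl) refl refl | just b with emptying-stack (lookup ts i) g
  ... | e , same rewrite same | Vec.[]≔-lookup ts i = 1 , empty (trans (stacks-lookup ts i) e)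
  rest-step (p ⨾ q) (inj₁ s) ∈E eq r with rest-exit (p ⨾ q) {f = inj₁} ∈E
  ... | just s′ , ∈E′ , refl = _ , rest-step p s ∈E′ eq (proj₁ (proj₂ r)) , proj₂ (proj₂ r)
  ... | nothing , ∈E′ , refl = _ , rest-step p s ∈E′ eq refl , rest-entry q r
  rest-step (p ⨾ q) (inj₂ s) ∈E eq r with rest-exit (p ⨾ q) {f = inj₂} ∈E
  ... | just s′ , ∈E′ , refl = rest-step q s ∈E′ eq r
  ... | nothing , ∈E′ , refl = rest-step q s ∈E′ eq r
  rest-step (p ⊹ q) nothing (here refl) refl r = _ , inl (proj₂ (rest-entry p r))
  rest-step (p ⊹ q) nothing (there (here refl)) refl r = _ , inr (proj₂ (rest-entry q r))
  rest-step (p ⊹ q) (just (inj₁ s)) ∈E eq r with rest-exit (p ⊹ q) {f = just ∘ inj₁} ∈E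
  ... | just s′ , ∈E′ , refl = rest-step p s ∈E′ eq r
  ... | nothing , ∈E′ , refl = rest-step p s ∈E′ eq r
  rest-step (p ⊹ q) (just (inj₂ s)) ∈E eq r with rest-exit (p ⊹ q) {f = just ∘ inj₂} ∈E
  ... | just s′ , ∈E′ , refl = rest-step q s ∈E′ eq r
  ... | nothing , ∈E′ , refl = rest-step q s ∈E′ eq r
  rest-step (star p) nothing (here refl) refl refl = _ , stop
  rest-step (star p) nothing (there (here refl)) refl (τ , r , _ , r′) = _ , (proj₂ (rest-entry p r) ∷ r′)
  rest-step (star p) (just s) ∈E eq r with rest-exit (star p) {f = just} ∈E
  ... | just s′ , ∈E′ , refl = _ , rest-step p s ∈E′ eq (proj₁ (proj₂ r)) , proj₂ (proj₂ r)
  ... | nothing , ∈E′ , refl = _ , rest-step p s ∈E′ eq refl , r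

  path-sound : (p : Prog T) {s : State p} {ts ts′ : Tapes T} → Path p s ts n ts′ → Rest p s ts (stacks ts′)
  path-sound p (last ∈E eq)   = rest-step p _ ∈E eq refl
  path-sound p (more ∈E eq π) = rest-step p _ ∈E eq (path-sound p π)

  module _ {p r : Prog T} (f : State p → State r) where

    path-embed : (∀ s → edges r (f s) ≡ retarget f nothing (edges p s)) →
                 ∀ {s ts ts′} → Path p s ts n ts′ → Path r (f s) ts n ts′
    path-embed E (last {s} ∈E eq)   = last (subst (_ ∈_) (sym (E s)) (∈-map⁺ _ ∈E)) eq
    path-embed E (more {s} ∈E eq π) = more (subst (_ ∈_) (sym (E s)) (∈-map⁺ _ ∈E)) eq (path-embed E π)

    path-then : ∀ {s₀} → (∀ s → edges r (f s) ≡ retarget f (just s₀) (edges p s)) →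
                ∀ {s ts ts′ ts″} → Path p s ts m ts′ → Path r s₀ ts′ n ts″ → Path r (f s) ts (m + n) ts″
    path-then E (last {s} ∈E eq)   π′ = more (subst (_ ∈_) (sym (E s)) (∈-map⁺ _ ∈E)) eq π′
    path-then E (more {s} ∈E eq π) π′ = more (subst (_ ∈_) (sym (E s)) (∈-map⁺ _ ∈E)) eq (path-then E π π′)

  -- The numbers of steps agree exactly, because `Run` also charges for the control steps of `_⊹_`
  -- and `star`.
  path-complete : (p : Prog T) {ts : Tapes T} {σ : Store T} → Run p (stacks ts) n σ →
                  ∃[ ts′ ] stacks ts′ ≡ σ × Path p (entry p) ts n ts′
  path-complete (pop i a) {ts} (pop {w = w} eq) with pop-tape (lookup ts i) (trans (sym (stacks-lookup ts i)) eq)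
  ... | b , g , eq′ = _ , trans (stacks-update ts i _) (cong (stacks ts [ i ]≔_) eq′)
                        , last (here refl) (cong (Maybe.map _) g)
  path-complete (push i a) {ts} push =
    _ , push-stacks ts i , more (here refl) refl (last (here refl) refl)
  path-complete (empty i) {ts} (empty eq) with empty-tape (lookup ts i) (trans (sym (stacks-lookup ts i)) eq)
  ... | b , g , eq′ = ts , refl , last (here refl) (trans (cong (Maybe.map _) g)
                        (cong just (update-same ts i eq′)))
  path-complete (p ⨾ q) (r ⨾ r′) with path-complete p r
  ... | ts , refl , π with path-complete q r′
  ... | ts′ , eq , π′ = ts′ , eq , path-then inj₁ (λ _ → refl) π (path-embed inj₂ (λ _ → refl) π′)
  path-complete (p ⊹ q) (inl r) with path-complete p r
  ... | ts , eq , π = ts , eq , more (here refl) refl (path-embed (just ∘ inj₁) (λ _ → refl) π)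
  path-complete (p ⊹ q) (inr r) with path-complete q r
  ... | ts , eq , π = ts , eq , more (there (here refl)) refl (path-embed (just ∘ inj₂) (λ _ → refl) π)
  path-complete (star p) stop = _ , refl , last (here refl) refl
  path-complete (star p) (r ∷ r′) with path-complete p r
  ... | ts , refl , π with path-complete (star p) r′
  ... | ts′ , eq , π′ = ts′ , eq , more (there (here refl)) refl (path-then just (λ _ → refl) π π′)

  size : Prog T → ℕ
  size (pop _ _)  = 1
  size (push _ _) = 2
  size (empty _)  = 1
  size fail       = 1
  size (p ⨾ q)    = size p + size q
  size (p ⊹ q)    = suc (size p + size q)
  size (star p)   = suc (size p)

  number : (p : Prog T) → State p → Fin (size p)
  number (pop _ _)  _            = zero
  number (push _ _) false        = zero
  number (push _ _) true         = suc zero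
  number (empty _)  _            = zero
  number fail       _            = zero
  number (p ⨾ q)    (inj₁ s)     = number p s ↑ˡ size q
  number (p ⨾ q)    (inj₂ s)     = size p ↑ʳ number q s
  number (p ⊹ q)    nothing      = zero
  number (p ⊹ q)    (just (inj₁ s)) = suc (number p s ↑ˡ size q)
  number (p ⊹ q)    (just (inj₂ s)) = suc (size p ↑ʳ number q s)
  number (star p)   nothing      = zero
  number (star p)   (just s)     = suc (number p s)

  unnumber : (p : Prog T) → Fin (size p) → State p
  unnumber (pop _ _)  _          = tt
  unnumber (push _ _) zero       = false
  unnumber (push _ _) (suc zero) = true
  unnumber (empty _)  _          = tt
  unnumber fail       _          = tt
  unnumber (p ⨾ q)    i          = Sum.map (unnumber p) (unnumber q) (splitAt (size p) i)
  unnumber (p ⊹ q)    zero       = nothing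
  unnumber (p ⊹ q)    (suc i)    = just (Sum.map (unnumber p) (unnumber q) (splitAt (size p) i))
  unnumber (star p)   zero       = nothing
  unnumber (star p)   (suc i)    = just (unnumber p i)

  unnumber-number : (p : Prog T) (s : State p) → unnumber p (number p s) ≡ s
  unnumber-number (pop _ _)  _            = refl
  unnumber-number (push _ _) false        = refl
  unnumber-number (push _ _) true         = refl
  unnumber-number (empty _)  _            = refl
  unnumber-number fail       _            = refl
  unnumber-number (p ⨾ q)    (inj₁ s)
    rewrite Fin.splitAt-↑ˡ (size p) (number p s) (size q) = cong inj₁ (unnumber-number p s)
  unnumber-number (p ⨾ q)    (inj₂ s)
    rewrite Fin.splitAt-↑ʳ (size p) (size q) (number q s) = cong inj₂ (unnumber-number q s)
  unnumber-number (p ⊹ q)    nothing      = refl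
  unnumber-number (p ⊹ q)    (just (inj₁ s))
    rewrite Fin.splitAt-↑ˡ (size p) (number p s) (size q) = cong (just ∘ inj₁) (unnumber-number p s)
  unnumber-number (p ⊹ q)    (just (inj₂ s))
    rewrite Fin.splitAt-↑ʳ (size p) (size q) (number q s) = cong (just ∘ inj₂) (unnumber-number q s)
  unnumber-number (star p)   nothing      = refl
  unnumber-number (star p)   (just s)     = cong just (unnumber-number p s)

  idle : Vec Cell T → Vec (Cell × Move) T
  idle = Vec.map (_, stay)

  fire : Micro T → Vec Cell T → Maybe (Vec (Cell × Move) T)
  fire nop      ss = just (idle ss)
  fire (on i g) ss = Maybe.map (idle ss [ i ]≔_) (g (lookup ss i))

  idle-act : (ts : Tapes T) → Vec.zipWith (act blank) ts (idle (Vec.map Tape.scanned ts)) ≡ ts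
  idle-act []               = refl
  idle-act (tape ls s rs ∷ ts) = cong (_ ∷_) (idle-act ts)

  update-act : (ts : Tapes T) (i : Fin T) (a : Cell × Move) →
               Vec.zipWith (act blank) ts (idle (Vec.map Tape.scanned ts) [ i ]≔ a) ≡
               ts [ i ]≔ act blank (lookup ts i) a
  update-act (t ∷ ts) zero a = cong (_ ∷_) (idle-act ts)
  update-act (tape ls s rs ∷ ts) (suc i) a = cong (_ ∷_) (update-act ts i a)

  fire-exec : (μ : Micro T) (ts : Tapes T) →
              exec μ ts ≡ Maybe.map (Vec.zipWith (act blank) ts) (fire μ (Vec.map Tape.scanned ts))
  fire-exec nop ts = cong just (sym (idle-act ts))
  fire-exec (on i g) ts rewrite Vec.lookup-map i Tape.scanned ts with g (Tape.scanned (lookup ts i))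
  ... | nothing = refl
  ... | just a  = cong just (sym (update-act ts i a))

  mapMaybe-∈⁺ : {A B : Set} (f : A → Maybe B) {x : A} {y : B} {xs : List A} → x ∈ xs → f x ≡ just y → y ∈ mapMaybe f xs
  mapMaybe-∈⁺ f {xs = x ∷ xs} (here refl) eq with f x
  mapMaybe-∈⁺ f {xs = x ∷ xs} (here refl) refl | just _ = here refl
  mapMaybe-∈⁺ f {xs = x ∷ xs} (there x∈) eq with f x
  ... | nothing = mapMaybe-∈⁺ f x∈ eq
  ... | just _  = there (mapMaybe-∈⁺ f x∈ eq)

  mapMaybe-∈⁻ : {A B : Set} (f : A → Maybe B) {y : B} (xs : List A) → y ∈ mapMaybe f xs → ∃[ x ] x ∈ xs × f x ≡ just y
  mapMaybe-∈⁻ f (x ∷ xs) y∈ with f x in eq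
  ... | nothing = let _ , x∈ , e = mapMaybe-∈⁻ f xs y∈ in _ , there x∈ , e
  mapMaybe-∈⁻ f (x ∷ xs) (here refl) | just _ = _ , here refl , eq
  mapMaybe-∈⁻ f (x ∷ xs) (there y∈)  | just _ = let _ , x∈ , e = mapMaybe-∈⁻ f xs y∈ in _ , there x∈ , e

  map-just : {A B : Set} {f : A → B} {y : B} (m : Maybe A) → Maybe.map f m ≡ just y → ∃[ x ] m ≡ just x × f x ≡ y
  map-just (just x) refl = x , refl , refl

  module Machine (t : ℕ) (p : Prog (suc t)) where

    -- Leaving the program means accepting: zero is the accepting state, and all states of the
    -- program are shifted by one.
    target : Maybe (State p) → Fin (suc (size p))
    target nothing  = zero
    target (just s) = suc (number p s)

    transition : Vec Cell (suc t) → Micro (suc t) × Maybe (State p) →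
                 Maybe (Fin (suc (size p)) × Vec (Cell × Move) (suc t))
    transition ss (μ , ms) = Maybe.map (target ms ,_) (fire μ ss)

    M : NTM 4
    M = record
      { states = suc (size p) ; workTapes = t ; auxSymbols = 0
      ; start = suc (number p (entry p)) ; accept = zero
      ; δ = λ { zero _ → [] ; (suc q) ss → mapMaybe (transition ss) (edges p (unnumber p q)) } }

    open NTM M hiding (step; start; accept)
    open NTM using (step)

    machine-step : ∀ {s μ ms ts ts′} → (μ , ms) ∈ edges p s → exec μ ts ≡ just ts′ →
                   config (suc (number p s)) ts ⟶ config (target ms) ts′
    machine-step {s} {μ} {ms} {ts} ∈E eq with map-just (fire μ (Vec.map Tape.scanned ts)) (trans (sym (fire-exec μ ts)) eq)
    ... | as , f , refl = step (mapMaybe-∈⁺ (transition _)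
            (subst (λ s → _ ∈ edges p s) (sym (unnumber-number p s)) ∈E) (cong (Maybe.map _) f))

    machine-path : ∀ {s ts ts′ n} → Path p s ts n ts′ → config (suc (number p s)) ts ⟶[ n ] config zero ts′
    machine-path (last ∈E eq)   = machine-step ∈E eq then done
    machine-path (more ∈E eq π) = machine-step ∈E eq then machine-path π

    -- The computation starts in a state that does not accept, so it has a first step; and a step
    -- that leaves the program completes a path, whatever follows.
    path-of : ∀ s {ts n c} → config (suc (number p s)) ts ⟶[ n ] c → state c ≡ zero →
              ∃[ m ] ∃[ ts′ ] Path p s ts m ts′
    path-of s {ts} (step δ∈ then r) acc
      with mapMaybe-∈⁻ (transition (Vec.map Tape.scanned ts)) (edges p s)
             (subst (λ s → _ ∈ mapMaybe (transition _) (edges p s)) (unnumber-number p s) δ∈)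
    ... | (μ , ms) , ∈E , eq with map-just (fire μ _) eq
    path-of s r acc | (μ , nothing) , ∈E , eq | as , f , refl =
      _ , _ , last ∈E (trans (fire-exec μ _) (cong (Maybe.map _) f))
    path-of s (_ then r) acc | (μ , just s′) , ∈E , eq | as , f , refl with path-of s′ r acc
    ... | m , ts′ , π = _ , _ , more ∈E (trans (fire-exec μ _) (cong (Maybe.map _) f)) π

    start-stacks : ∀ w → stacks (contents (initial w)) ≡ w ∷ Vec.replicate t []
    start-stacks w = cong₂ _∷_ (stack-load w) (trans (Vec.map-replicate stack _ t) refl)
      where
      decode-input : ∀ w → decode (map input w) ≡ w
      decode-input []      = refl
      decode-input (a ∷ w) = cong (a ∷_) (decode-input w)
      stack-load : ∀ w → stack (load blank (map input w)) ≡ w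
      stack-load []      = refl
      stack-load (a ∷ w) = decode-input (a ∷ w)

    machine-complete : ∀ {w n σ} → Run p (w ∷ Vec.replicate t []) n σ → AcceptsIn w n
    machine-complete {w} {n} {σ} r with path-complete p (subst (λ τ → Run p τ n σ) (sym (start-stacks w)) r)
    ... | ts , _ , π = _ , machine-path π , refl

    machine-sound : ∀ {w n} → AcceptsIn w n → ∃[ m ] ∃[ σ ] Run p (w ∷ Vec.replicate t []) m σ
    machine-sound {w} (c , r , acc) with path-of (entry p) r acc
    ... | _ , ts′ , π with rest-entry p (path-sound p π)
    ... | m , r′ = m , _ , subst (λ τ → Run p τ m (stacks ts′)) (start-stacks w) r′

open Programs

-- A logic of words, its compilation and its running time

module Formulas where

  -- A logic of words

  infix  4 _≐_
  infixr 3 _⩓_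
  infixr 2 _⩔_

  Expr : ℕ → Set
  Expr n = List (Fin n ⊎ Fin 4)

  -- The closure `tc` runs over pairs of words, so that two lists, or a list and a stack, can be
  -- traversed together. In its formula the variables 0 and 1 are the next pair, and 2 and 3 the
  -- current one.
  data Fm (n : ℕ) : Set where
    _≐_     : Expr n → Expr n → Fm n
    _⩓_ _⩔_ : Fm n → Fm n → Fm n
    ex      : Fm (suc n) → Fm n
    tc      : Fm (4 + n) → (a b c d : Expr n) → Fm n

  private variable n m : ℕ

  eval : Expr n → Store n → Letters
  eval []           ρ = []
  eval (inj₁ x ∷ t) ρ = lookup ρ x ++ eval t ρ
  eval (inj₂ a ∷ t) ρ = a ∷ eval t ρ

  -- The first pair is exempt from `ok`: it is computed from the expressions of `tc` and not
  -- guessed.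
  data Chain (ok : ℕ → Set) (R : Letters × Letters → Letters × Letters → Set) :
             ℕ → Letters × Letters → Letters × Letters → Set where
    end  : ∀ {p} → Chain ok R 0 p p
    link : ∀ {ℓ p q r} → ok (length (proj₁ q)) → ok (length (proj₂ q)) →
           R p q → Chain ok R ℓ q r → Chain ok R (suc ℓ) p r

  -- Satisfaction with the lengths of all quantified words, and of the chains
  -- of tc, restricted to ok.
  data Sat (ok : ℕ → Set) {n} : Fm n → Store n → Set where
    same  : ∀ {s t ρ} → eval s ρ ≡ eval t ρ → Sat ok (s ≐ t) ρ
    _&_   : ∀ {φ ψ ρ} → Sat ok φ ρ → Sat ok ψ ρ → Sat ok (φ ⩓ ψ) ρ
    left  : ∀ {φ ψ ρ} → Sat ok φ ρ → Sat ok (φ ⩔ ψ) ρ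
    right : ∀ {φ ψ ρ} → Sat ok ψ ρ → Sat ok (φ ⩔ ψ) ρ
    word  : ∀ {φ ρ} w → ok (length w) → Sat ok φ (w ∷ ρ) → Sat ok (ex φ) ρ
    chain : ∀ {φ a b c d ρ} ℓ → ok ℓ →
            Chain ok (λ (x , y) (x′ , y′) → Sat ok φ (x′ ∷ y′ ∷ x ∷ y ∷ ρ)) ℓ
              (eval a ρ , eval b ρ) (eval c ρ , eval d ρ) → Sat ok (tc φ a b c d) ρ

  infixr 4 _&_

  Anything : ℕ → Set
  Anything _ = ⊤

  bounded-word? : {P : Letters → Set} → (∀ w → Dec (P w)) → ∀ B → Dec (∃[ w ] length w ≤ B × P w)
  bounded-word? P? zero = Dec.map′ (λ p → [] , z≤n , p) (λ { ([] , _ , p) → p }) (P? [])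
  bounded-word? P? (suc B) = Dec.map′
    (λ { (inj₁ p) → [] , z≤n , p ; (inj₂ (a , w , w≤ , p)) → a ∷ w , s≤s w≤ , p })
    (λ { ([] , _ , p) → inj₁ p ; (a ∷ w , s≤s w≤ , p) → inj₂ (a , w , w≤ , p) })
    (P? [] ⊎-dec Fin.any? (λ a → bounded-word? (λ w → P? (a ∷ w)) B))

  bounded-number? : {P : ℕ → Set} → (∀ k → Dec (P k)) → ∀ B → Dec (∃[ k ] k ≤ B × P k)
  bounded-number? P? zero = Dec.map′ (λ p → 0 , z≤n , p) (λ { (zero , _ , p) → p }) (P? 0)
  bounded-number? P? (suc B) = Dec.map′
    (λ { (inj₁ p) → 0 , z≤n , p ; (inj₂ (k , k≤ , p)) → suc k , s≤s k≤ , p })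
    (λ { (zero , _ , p) → inj₁ p ; (suc k , s≤s k≤ , p) → inj₂ (k , k≤ , p) })
    (P? 0 ⊎-dec bounded-number? (P? ∘ suc) B)

  _≟ˡ_ : (v w : Letters) → Dec (v ≡ w)
  _≟ˡ_ = List.≡-dec Fin._≟_

  chain? : ∀ {R : Letters × Letters → Letters × Letters → Set} (B : ℕ) → (∀ p q → Dec (R p q)) →
           ∀ ℓ p r → Dec (Chain (_≤ B) R ℓ p r)
  chain? B R? zero (x , y) (x′ , y′) =
    Dec.map′ (λ { (refl , refl) → end }) (λ { end → refl , refl }) (x ≟ˡ x′ ×-dec y ≟ˡ y′)
  chain? B R? (suc ℓ) p r = Dec.map′
    (λ (x , x≤ , y , y≤ , s , c) → link x≤ y≤ s c) (λ { (link x≤ y≤ s c) → _ , x≤ , _ , y≤ , s , c })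
    (bounded-word? (λ x → bounded-word? (λ y → R? p (x , y) ×-dec chain? B R? ℓ (x , y) r) B) B)

  sat? : ∀ (B : ℕ) (φ : Fm n) ρ → Dec (Sat (_≤ B) φ ρ)
  sat? B (s ≐ t) ρ = Dec.map′ same (λ { (same eq) → eq }) (eval s ρ ≟ˡ eval t ρ)
  sat? B (φ ⩓ ψ) ρ = Dec.map′ (λ (p , q) → p & q) (λ { (p & q) → p , q }) (sat? B φ ρ ×-dec sat? B ψ ρ)
  sat? B (φ ⩔ ψ) ρ = Dec.map′ Sum.[ left , right ] (λ { (left p) → inj₁ p ; (right q) → inj₂ q })
                       (sat? B φ ρ ⊎-dec sat? B ψ ρ)
  sat? B (ex φ) ρ = Dec.map′ (λ (w , w≤ , p) → word w w≤ p) (λ { (word w w≤ p) → w , w≤ , p })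
                      (bounded-word? (λ w → sat? B φ (w ∷ ρ)) B)
  sat? B (tc φ a b c d) ρ = Dec.map′ (λ (ℓ , ℓ≤ , ch) → chain ℓ ℓ≤ ch) (λ { (chain ℓ ℓ≤ ch) → ℓ , ℓ≤ , ch })
    (bounded-number? (λ ℓ → chain? B (λ (x , y) (x′ , y′) → sat? B φ (x′ ∷ y′ ∷ x ∷ y ∷ ρ)) ℓ _ _) B)

  -- Programs for formulas

  -- The two directions need different information. Soundness inverts runs of any cost (`Reach`, the
  -- lemmas ending in `inv`); completeness exhibits runs with a bound on the cost (`Within`, the
  -- lemmas ending in `ʷ`).
  Reach : ∀ {T} → Prog T → Store T → Store T → Set
  Reach p σ τ = ∃[ n ] Run p σ n τ

  Within : ∀ {T} → Prog T → Store T → ℕ → Store T → Set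
  Within p σ b τ = ∃[ n ] n ≤ b × Run p σ n τ

  module _ {T : ℕ} where

    private variable
      p q : Prog T
      σ τ υ : Store T
      b c : ℕ

    infixr 5 _⨾ʷ_

    _⨾ʷ_ : Within p σ b τ → Within q τ c υ → Within (p ⨾ q) σ (b + c) υ
    (_ , b≤ , r) ⨾ʷ (_ , c≤ , r′) = _ , ℕ.+-mono-≤ b≤ c≤ , r ⨾ r′

    popʷ : ∀ {i a w} → lookup σ i ≡ a ∷ w → σ [ i ]≔ w ≡ τ → Within (pop i a) σ 1 τ
    popʷ eq refl = 1 , ℕ.≤-refl , pop eq

    pushʷ : ∀ {i a w} → lookup σ i ≡ w → σ [ i ]≔ (a ∷ w) ≡ τ → Within (push i a) σ 2 τ
    pushʷ refl refl = 2 , ℕ.≤-refl , push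

    emptyʷ : ∀ {i} → lookup σ i ≡ [] → Within (empty i) σ 1 σ
    emptyʷ eq = 1 , ℕ.≤-refl , empty eq

    weaken : b ≤ c → Within p σ b τ → Within p σ c τ
    weaken b≤c (n , n≤ , r) = n , ℕ.≤-trans n≤ b≤c , r

    inlʷ : Within p σ b τ → Within (p ⊹ q) σ (suc b) τ
    inlʷ (n , n≤ , r) = _ , s≤s n≤ , inl r

    inrʷ : Within q σ b τ → Within (p ⊹ q) σ (suc b) τ
    inrʷ (n , n≤ , r) = _ , s≤s n≤ , inr r

    stopʷ : Within (star p) σ 1 σ
    stopʷ = 1 , ℕ.≤-refl , stop

    _∷ʷ_ : Within p σ b τ → Within (star p) τ c υ → Within (star p) σ (suc (b + c)) υ
    (_ , b≤ , r) ∷ʷ (_ , c≤ , r′) = _ , s≤s (ℕ.+-mono-≤ b≤ c≤) , r ∷ r′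

    anyOf : (Fin 4 → Prog T) → Prog T
    anyOf p = p zero ⊹ p (suc zero) ⊹ p (suc (suc zero)) ⊹ p (suc (suc (suc zero)))

    anyʷ : ∀ (p : Fin 4 → Prog T) {σ τ b} a → Within (p a) σ b τ → Within (anyOf p) σ (3 + b) τ
    anyʷ _ zero                   r = weaken (s≤s (ℕ.m≤n+m _ 2)) (inlʷ r)
    anyʷ _ (suc zero)             r = weaken (s≤s (s≤s (ℕ.n≤1+n _))) (inrʷ (inlʷ r))
    anyʷ _ (suc (suc zero))       r = inrʷ (inrʷ (inlʷ r))
    anyʷ _ (suc (suc (suc zero))) r = inrʷ (inrʷ (inrʷ r))

    any-inv : ∀ (p : Fin 4 → Prog T) {σ τ} → Reach (anyOf p) σ τ → ∃[ a ] Reach (p a) σ τ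
    any-inv _ (_ , inl r)             = _ , _ , r
    any-inv _ (_ , inr (inl r))       = _ , _ , r
    any-inv _ (_ , inr (inr (inl r))) = _ , _ , r
    any-inv _ (_ , inr (inr (inr r))) = _ , _ , r

    loop : Fin T → (Fin 4 → Prog T) → Prog T
    loop i p = star (anyOf p) ⨾ empty i

    -- A loop that consumes stack i letter by letter; G w v is the store when w
    -- is still to be consumed and v is the reverse of what has been.
    module Loop (i : Fin T) (p : Fin 4 → Prog T) (G : Letters → Letters → Store T)
                (read : ∀ w v → lookup (G w v) i ≡ w) where

      -- For each letter, selecting the branch in `anyOf` costs at most 3 steps and entering the
      -- star one more. The final 2 pays for leaving the star and for the test of emptiness.
      loopʷ : (∀ a w v → Within (p a) (G (a ∷ w) v) c (G w (a ∷ v))) →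
              ∀ w v → Within (loop i p) (G w v) ((4 + c) * length w + 2) (G [] (w ʳ++ v))
      loopʷ {c} body w v = weaken (ℕ.≤-reflexive (ℕ.+-assoc ((4 + c) * length w) 1 1))
                             (stars w v ⨾ʷ emptyʷ (read [] _))
        where
        stars : ∀ w v → Within (star (anyOf p)) (G w v) ((4 + c) * length w + 1) (G [] (w ʳ++ v))
        stars [] v = weaken (ℕ.m≤n+m 1 _) stopʷ
        stars (a ∷ w) v = weaken (ℕ.≤-reflexive eq) (anyʷ p a (body a w v) ∷ʷ stars w (a ∷ v))
          where
          eq : suc (3 + c + ((4 + c) * length w + 1)) ≡ (4 + c) * suc (length w) + 1
          eq = trans (sym (ℕ.+-assoc (4 + c) ((4 + c) * length w) 1)) (cong (_+ 1) (sym (ℕ.*-suc (4 + c) (length w))))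

      -- The star may stop at any time, but the test of emptiness rejects unless everything has been
      -- consumed.
      loop-inv : (∀ a w v {τ} → Reach (p a) (G w v) τ → ∃[ w′ ] w ≡ a ∷ w′ × τ ≡ G w′ (a ∷ v)) →
                 ∀ w v {τ} → Reach (loop i p) (G w v) τ → τ ≡ G [] (w ʳ++ v)
      loop-inv body w v (_ , rs ⨾ r) = stars w v rs r
        where
        stars : ∀ w v {m n σ τ} → Run (star (anyOf p)) (G w v) m σ → Run (empty i) σ n τ → τ ≡ G [] (w ʳ++ v)
        stars w v stop (empty eq) with trans (sym (read w v)) eq
        ... | refl = refl
        stars w v (r ∷ rs) e with any-inv p (_ , r)
        ... | a , r′ with body a w v r′
        ... | w′ , refl , refl = stars w′ _ rs e

  -- The first three stacks are scratch; the others are addressed by k, and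
  -- R w is their contents when w is on stack k.
  module _ {T : ℕ} (k : Fin T) where

    private
      r : Fin (3 + T)
      r = suc (suc (suc k))

    -- Reading a stack destroys and reverses it, so copying takes two passes: `save` reverses the
    -- stack onto the third scratch stack, and `restore` reverses it back while also putting a copy
    -- on top of the first scratch stack. `guess` expects the stack to be empty.
    save unsave restore clear guess : Prog (3 + T)
    save    = loop r λ a → pop r a ⨾ push (suc (suc zero)) a
    unsave  = loop (suc (suc zero)) λ a → pop (suc (suc zero)) a ⨾ push r a
    restore = loop (suc (suc zero)) λ a → pop (suc (suc zero)) a ⨾ push r a ⨾ push zero a
    clear   = loop r (pop r)
    guess   = star (anyOf (push r))

    module _ (R : Letters → Store T) (read : ∀ w → lookup (R w) k ≡ w)
             (write : ∀ w w′ → R w [ k ]≔ w′ ≡ R w′) where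

      private
        pop-inv : ∀ {a x y z n τ} w → Run (pop r a) (x ∷ y ∷ z ∷ R w) n τ →
                  ∃[ w′ ] w ≡ a ∷ w′ × τ ≡ x ∷ y ∷ z ∷ R w′
        pop-inv w (pop eq) = _ , trans (sym (read w)) eq , cong (λ V → _ ∷ _ ∷ _ ∷ V) (write w _)

        push-inv : ∀ {a x y z n τ} w → Run (push r a) (x ∷ y ∷ z ∷ R w) n τ → τ ≡ x ∷ y ∷ z ∷ R (a ∷ w)
        push-inv w push = cong (λ V → _ ∷ _ ∷ _ ∷ V) (trans (cong (λ v → R w [ k ]≔ (_ ∷ v)) (read w)) (write w _))

        popᵏ : ∀ {a x y z w} → Within (pop r a) (x ∷ y ∷ z ∷ R (a ∷ w)) 1 (x ∷ y ∷ z ∷ R w)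
        popᵏ = popʷ (read _) (cong (λ V → _ ∷ _ ∷ _ ∷ V) (write _ _))

        pushᵏ : ∀ {a x y z w} → Within (push r a) (x ∷ y ∷ z ∷ R w) 2 (x ∷ y ∷ z ∷ R (a ∷ w))
        pushᵏ = pushʷ (read _) (cong (λ V → _ ∷ _ ∷ _ ∷ V) (write _ _))

      module _ (x y : Letters) where

        private
          module Save = Loop r (λ a → pop r a ⨾ push (suc (suc zero)) a) (λ w v → x ∷ y ∷ v ∷ R w) (λ w v → read w)
          module Unsave = Loop (suc (suc zero)) (λ a → pop (suc (suc zero)) a ⨾ push r a)
                            (λ w v → x ∷ y ∷ w ∷ R v) (λ w v → refl)
          module Restore = Loop (suc (suc zero)) (λ a → pop (suc (suc zero)) a ⨾ push r a ⨾ push zero a)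
                            (λ w v → (v ++ x) ∷ y ∷ w ∷ R v) (λ w v → refl)
          module Clear = Loop r (pop r) (λ w v → x ∷ y ∷ [] ∷ R w) (λ w v → read w)

        saveʷ : ∀ w → Within save (x ∷ y ∷ [] ∷ R w) (7 * length w + 2) (x ∷ y ∷ (w ʳ++ []) ∷ R [])
        saveʷ w = Save.loopʷ (λ a w v → popᵏ ⨾ʷ pushʷ refl refl) w []

        save-inv : ∀ w {τ} → Reach save (x ∷ y ∷ [] ∷ R w) τ → τ ≡ x ∷ y ∷ (w ʳ++ []) ∷ R []
        save-inv w = Save.loop-inv body w []
          where
          body : ∀ a w v {τ} → Reach (pop r a ⨾ push (suc (suc zero)) a) (x ∷ y ∷ v ∷ R w) τ →
                 ∃[ w′ ] w ≡ a ∷ w′ × τ ≡ x ∷ y ∷ (a ∷ v) ∷ R w′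
          body a w v (_ , q ⨾ s) with pop-inv w q
          body a w v (_ , q ⨾ push) | _ , refl , refl = _ , refl , refl

        unsaveʷ : ∀ w → Within unsave (x ∷ y ∷ w ∷ R []) (7 * length w + 2) (x ∷ y ∷ [] ∷ R (w ʳ++ []))
        unsaveʷ w = Unsave.loopʷ (λ a w v → popʷ refl refl ⨾ʷ pushᵏ) w []

        unsave-inv : ∀ w {τ} → Reach unsave (x ∷ y ∷ w ∷ R []) τ → τ ≡ x ∷ y ∷ [] ∷ R (w ʳ++ [])
        unsave-inv w = Unsave.loop-inv body w []
          where
          body : ∀ a w v {τ} → Reach (pop (suc (suc zero)) a ⨾ push r a) (x ∷ y ∷ w ∷ R v) τ →
                 ∃[ w′ ] w ≡ a ∷ w′ × τ ≡ x ∷ y ∷ w′ ∷ R (a ∷ v)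
          body a w v (_ , pop refl ⨾ s) = _ , refl , push-inv v s

        restoreʷ : ∀ w → Within restore (x ∷ y ∷ w ∷ R []) (9 * length w + 2)
                     (((w ʳ++ []) ++ x) ∷ y ∷ [] ∷ R (w ʳ++ []))
        restoreʷ w = Restore.loopʷ (λ a w v → popʷ refl refl ⨾ʷ pushᵏ ⨾ʷ pushʷ refl refl) w []

        restore-inv : ∀ w {τ} → Reach restore (x ∷ y ∷ w ∷ R []) τ →
                      τ ≡ ((w ʳ++ []) ++ x) ∷ y ∷ [] ∷ R (w ʳ++ [])
        restore-inv w = Restore.loop-inv body w []
          where
          body : ∀ a w v {τ} → Reach (pop (suc (suc zero)) a ⨾ push r a ⨾ push zero a) ((v ++ x) ∷ y ∷ w ∷ R v) τ →
                 ∃[ w′ ] w ≡ a ∷ w′ × τ ≡ (a ∷ v ++ x) ∷ y ∷ w′ ∷ R (a ∷ v)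
          body a w v (_ , pop refl ⨾ s ⨾ s′) with push-inv v s
          body a w v (_ , pop refl ⨾ s ⨾ push) | refl = _ , refl , refl

        clearʷ : ∀ w → Within clear (x ∷ y ∷ [] ∷ R w) (5 * length w + 2) (x ∷ y ∷ [] ∷ R [])
        clearʷ w = Clear.loopʷ (λ a w v → popᵏ) w []

        clear-inv : ∀ w {τ} → Reach clear (x ∷ y ∷ [] ∷ R w) τ → τ ≡ x ∷ y ∷ [] ∷ R []
        clear-inv w = Clear.loop-inv (λ a w v (_ , q) → pop-inv w q) w []

      guessʷ : ∀ w {x y z} → Within guess (x ∷ y ∷ z ∷ R []) (6 * length w + 1) (x ∷ y ∷ z ∷ R w)
      guessʷ w {x} {y} {z} = subst (λ v → Within guess _ (6 * length w + 1) (x ∷ y ∷ z ∷ R v))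
          (List.reverse-involutive w)
          (weaken {p = guess} (ℕ.≤-reflexive (cong (λ n → 6 * n + 1) (List.length-reverse w)))
            (stars (List.reverse w) []))
        where
        stars : ∀ w v → Within guess (x ∷ y ∷ z ∷ R v) (6 * length w + 1) (x ∷ y ∷ z ∷ R (w ʳ++ v))
        stars [] v = stopʷ
        stars (a ∷ w) v = weaken (ℕ.≤-reflexive eq) (anyʷ (push r) a pushᵏ ∷ʷ stars w (a ∷ v))
          where
          eq : 6 + (6 * length w + 1) ≡ 6 * suc (length w) + 1
          eq = trans (sym (ℕ.+-assoc 6 (6 * length w) 1)) (cong (_+ 1) (sym (ℕ.*-suc 6 (length w))))

      guess-inv : ∀ {x y z τ} → Reach guess (x ∷ y ∷ z ∷ R []) τ → ∃[ w ] τ ≡ x ∷ y ∷ z ∷ R w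
      guess-inv {x} {y} {z} (_ , rs) = stars [] rs
        where
        stars : ∀ w {n τ} → Run guess (x ∷ y ∷ z ∷ R w) n τ → ∃[ w ] τ ≡ x ∷ y ∷ z ∷ R w
        stars w stop = w , refl
        stars w (q ∷ rs) with any-inv (push r) (_ , q)
        ... | a , _ , q′ with push-inv w q′
        ... | refl = stars (a ∷ w) rs

  module _ {T : ℕ} where

    -- For an equality test both sides are built in turn on the first scratch stack and moved to the
    -- other two. Both arrive reversed, which does not affect whether they are equal.
    shift₁ shift₂ match : Prog (3 + T)
    shift₁ = loop zero λ a → pop zero a ⨾ push (suc zero) a
    shift₂ = loop zero λ a → pop zero a ⨾ push (suc (suc zero)) a
    match  = loop (suc zero) (λ a → pop (suc zero) a ⨾ pop (suc (suc zero)) a) ⨾ empty (suc (suc zero))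

    module _ (V : Store T) where

      private
        module Shift₁ z = Loop zero (λ a → pop zero a ⨾ push (suc zero) a) (λ w v → w ∷ v ∷ z ∷ V) (λ w v → refl)
        module Shift₂ y = Loop zero (λ a → pop zero a ⨾ push (suc (suc zero)) a) (λ w v → w ∷ y ∷ v ∷ V) (λ w v → refl)

      shift₁ʷ : ∀ w {z} → Within shift₁ (w ∷ [] ∷ z ∷ V) (7 * length w + 2) ([] ∷ (w ʳ++ []) ∷ z ∷ V)
      shift₁ʷ w = Shift₁.loopʷ _ (λ a w v → popʷ refl refl ⨾ʷ pushʷ refl refl) w []

      shift₁-inv : ∀ w {z τ} → Reach shift₁ (w ∷ [] ∷ z ∷ V) τ → τ ≡ [] ∷ (w ʳ++ []) ∷ z ∷ V
      shift₁-inv w {z} = Shift₁.loop-inv _ (λ { a w v (_ , pop refl ⨾ push) → _ , refl , refl }) w []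

      shift₂ʷ : ∀ w {y} → Within shift₂ (w ∷ y ∷ [] ∷ V) (7 * length w + 2) ([] ∷ y ∷ (w ʳ++ []) ∷ V)
      shift₂ʷ w = Shift₂.loopʷ _ (λ a w v → popʷ refl refl ⨾ʷ pushʷ refl refl) w []

      shift₂-inv : ∀ w {y τ} → Reach shift₂ (w ∷ y ∷ [] ∷ V) τ → τ ≡ [] ∷ y ∷ (w ʳ++ []) ∷ V
      shift₂-inv w = Shift₂.loop-inv _ (λ { a w v (_ , pop refl ⨾ push) → _ , refl , refl }) w []

      matchʷ : ∀ w → Within match ([] ∷ w ∷ w ∷ V) (6 * length w + 2 + 1) ([] ∷ [] ∷ [] ∷ V)
      matchʷ w = Loop.loopʷ (suc zero) (λ a → pop (suc zero) a ⨾ pop (suc (suc zero)) a) (λ w v → [] ∷ w ∷ w ∷ V) (λ w v → refl)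
                   (λ a w v → popʷ refl refl ⨾ʷ popʷ refl refl) w [] ⨾ʷ emptyʷ refl

      match-inv : ∀ w v {τ} → Reach match ([] ∷ w ∷ v ∷ V) τ → w ≡ v × τ ≡ [] ∷ [] ∷ [] ∷ V
      match-inv w v (_ , (rs ⨾ e) ⨾ e′) = stars w v rs e e′
        where
        stars : ∀ w v {l m n σ τ υ} →
                Run (star (anyOf λ a → pop (suc zero) a ⨾ pop (suc (suc zero)) a)) ([] ∷ w ∷ v ∷ V) l σ →
                Run (empty (suc zero)) σ m τ → Run (empty (suc (suc zero))) τ n υ →
                w ≡ v × υ ≡ [] ∷ [] ∷ [] ∷ V
        stars w v stop (empty refl) (empty refl) = refl , refl
        stars w v (q ∷ rs) e e′ with any-inv (λ a → pop (suc zero) a ⨾ pop (suc (suc zero)) a) (_ , q)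
        ... | a , _ , pop refl ⨾ pop refl with stars _ _ rs e e′
        ... | refl , refl = refl , refl

  infixr 6 _⊕_

  -- Addition with the recursion arranged so that `suc f ⊕ n` and `f ⊕ suc n` are the same by
  -- definition. Below a quantifier one spare stack becomes a stack in scope, and the program keeps
  -- its type.
  _⊕_ : ℕ → ℕ → ℕ
  zero  ⊕ n = n
  suc f ⊕ n = f ⊕ suc n

  -- The values of the variables in scope, and f stacks for further variables.
  pad : ∀ f → Store n → Store (f ⊕ n)
  pad zero    ρ = ρ
  pad (suc f) ρ = pad f ([] ∷ ρ)

  reg : ∀ f → Fin n → Fin (f ⊕ n)
  reg zero    x = x
  reg (suc f) x = reg f (suc x)

  lookup-reg : ∀ f (ρ : Store n) x → lookup (pad f ρ) (reg f x) ≡ lookup ρ x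
  lookup-reg zero    ρ x = refl
  lookup-reg (suc f) ρ x = lookup-reg f ([] ∷ ρ) (suc x)

  update-reg : ∀ f (ρ : Store n) x {w} → pad f ρ [ reg f x ]≔ w ≡ pad f (ρ [ x ]≔ w)
  update-reg zero    ρ x = refl
  update-reg (suc f) ρ x = update-reg f ([] ∷ ρ) (suc x)

  blanks : ∀ f → Store n → Store (3 + (f ⊕ n))
  blanks f ρ = [] ∷ [] ∷ [] ∷ pad f ρ

  module Stack (f : ℕ) (ρ : Store n) (x : Fin n) where

    R : Letters → Store (f ⊕ n)
    R w = pad f (ρ [ x ]≔ w)

    read : ∀ w → lookup (R w) (reg f x) ≡ w
    read w = trans (lookup-reg f (ρ [ x ]≔ w) x) (Vec.lookup∘update x ρ w)

    write : ∀ w w′ → R w [ reg f x ]≔ w′ ≡ R w′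
    write w w′ = trans (update-reg f (ρ [ x ]≔ w) x) (cong (pad f) (Vec.[]≔-idempotent ρ x))

  skip : ∀ {T} → Prog T
  skip = star fail

  -- The word is assembled from its last item on, since pushing extends a word at its front.
  build : ∀ f → Expr n → Prog (3 + (f ⊕ n))
  build f []           = skip
  build f (inj₁ x ∷ t) = build f t ⨾ save (reg f x) ⨾ restore (reg f x)
  build f (inj₂ a ∷ t) = build f t ⨾ push zero a

  buildTime exprLength : Expr n → ℕ → ℕ
  buildTime []           B = 1
  buildTime (inj₁ _ ∷ t) B = buildTime t B + ((7 * B + 2) + (9 * B + 2))
  buildTime (inj₂ _ ∷ t) B = buildTime t B + 2
  exprLength []           B = 0
  exprLength (inj₁ _ ∷ t) B = B + exprLength t B
  exprLength (inj₂ _ ∷ t) B = suc (exprLength t B)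

  Short : ℕ → Store n → Set
  Short B ρ = ∀ x → length (lookup ρ x) ≤ B

  short-∷ : ∀ {B w} {ρ : Store n} → length w ≤ B → Short B ρ → Short B (w ∷ ρ)
  short-∷ w≤ ρ≤ zero    = w≤
  short-∷ w≤ ρ≤ (suc x) = ρ≤ x

  length-eval : ∀ (t : Expr n) {B ρ} → Short B ρ → length (eval t ρ) ≤ exprLength t B
  length-eval []           ρ≤ = z≤n
  length-eval (inj₁ x ∷ t) {ρ = ρ} ρ≤ =
    ℕ.≤-trans (ℕ.≤-reflexive (List.length-++ (lookup ρ x))) (ℕ.+-mono-≤ (ρ≤ x) (length-eval t ρ≤))
  length-eval (inj₂ a ∷ t) ρ≤ = s≤s (length-eval t ρ≤)

  reverse²  : (w : Letters) → (w ʳ++ []) ʳ++ [] ≡ w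
  reverse² w = List.reverse-involutive w

  length-ʳ : (w : Letters) → length (w ʳ++ []) ≡ length w
  length-ʳ w = List.length-reverse w

  module _ (f : ℕ) (ρ : Store n) where

    private
      saved : ∀ x → pad f ρ ≡ Stack.R f ρ x (lookup ρ x)
      saved x = cong (pad f) (sym (Vec.[]≔-lookup ρ x))

      restored : ∀ x (v y : Letters) → let w = (lookup ρ x ʳ++ []) ʳ++ [] in
                 _≡_ {A = Store (3 + (f ⊕ n))} ((w ++ v) ∷ y ∷ [] ∷ Stack.R f ρ x w)
                                               ((lookup ρ x ++ v) ∷ y ∷ [] ∷ pad f ρ)
      restored x v y = trans (cong (λ w → _∷_ (w ++ v) (y ∷ [] ∷ Stack.R f ρ x w)) (reverse² (lookup ρ x)))
                                 (cong (λ V → _∷_ (lookup ρ x ++ v) (y ∷ [] ∷ V)) (sym (saved x)))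

    build-inv : ∀ t {y τ} → Reach (build f t) ([] ∷ y ∷ [] ∷ pad f ρ) τ → τ ≡ eval t ρ ∷ y ∷ [] ∷ pad f ρ
    build-inv [] (_ , stop) = refl
    build-inv (inj₂ a ∷ t) (_ , r ⨾ s) with build-inv t (_ , r)
    build-inv (inj₂ a ∷ t) (_ , r ⨾ push) | refl = refl
    build-inv (inj₁ x ∷ t) {y} (_ , r ⨾ s ⨾ s′) with build-inv t (_ , r)
    ... | refl = trans (restore-inv (reg f x) R read write (eval t ρ) y _ (_ , subst (λ σ → Run _ σ _ _)
                   (save-inv (reg f x) R read write (eval t ρ) y (lookup ρ x)
                     (_ , subst (λ V → Run _ (_ ∷ _ ∷ _ ∷ V) _ _) (saved x) s)) s′)) (restored x (eval t ρ) y)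
      where open Stack f ρ x

    buildʷ : ∀ t {B y} → Short B ρ → Within (build f t) ([] ∷ y ∷ [] ∷ pad f ρ) (buildTime t B) (eval t ρ ∷ y ∷ [] ∷ pad f ρ)
    buildʷ [] ρ≤ = stopʷ
    buildʷ (inj₂ a ∷ t) ρ≤ = buildʷ t ρ≤ ⨾ʷ pushʷ refl refl
    buildʷ (inj₁ x ∷ t) {B} {y} ρ≤ = buildʷ t ρ≤ ⨾ʷ
        weaken (ℕ.+-monoˡ-≤ 2 (ℕ.*-monoʳ-≤ 7 (ρ≤ x)))
          (subst (λ V → Within (save (reg f x)) (_ ∷ _ ∷ _ ∷ V) (7 * length (lookup ρ x) + 2)
                          (eval t ρ ∷ y ∷ (lookup ρ x ʳ++ []) ∷ R [])) (sym (saved x))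
            (saveʷ (reg f x) R read write (eval t ρ) y (lookup ρ x))) ⨾ʷ
        weaken (ℕ.+-monoˡ-≤ 2 (ℕ.*-monoʳ-≤ 9 (ℕ.≤-trans (ℕ.≤-reflexive (length-ʳ (lookup ρ x))) (ρ≤ x))))
          (subst (Within (restore (reg f x)) _ _) (restored x (eval t ρ) y)
            (restoreʷ (reg f x) R read write (eval t ρ) y (lookup ρ x ʳ++ [])))
      where open Stack f ρ x

  equal : ∀ f → Expr n → Expr n → Prog (3 + (f ⊕ n))
  equal f s t = build f s ⨾ shift₁ ⨾ build f t ⨾ shift₂ ⨾ match

  equalTime : Expr n → Expr n → ℕ → ℕ
  equalTime s t B = buildTime s B + (7 * exprLength s B + 2 + (buildTime t B + (7 * exprLength t B + 2 + (6 * exprLength t B + 2 + 1))))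

  module _ (f : ℕ) (ρ : Store n) where

    equal-inv : ∀ s t {τ} → Reach (equal f s t) (blanks f ρ) τ → eval s ρ ≡ eval t ρ × τ ≡ blanks f ρ
    equal-inv s t (_ , r₁ ⨾ r₂ ⨾ r₃ ⨾ r₄ ⨾ r₅) with build-inv f ρ s (_ , r₁)
    ... | refl with shift₁-inv (pad f ρ) (eval s ρ) (_ , r₂)
    ... | refl with build-inv f ρ t (_ , r₃)
    ... | refl with shift₂-inv (pad f ρ) (eval t ρ) (_ , r₄)
    ... | refl with match-inv (pad f ρ) _ _ (_ , r₅)
    ... | eq , eq′ = List.reverse-injective eq , eq′

    equalʷ : ∀ s t {B} → Short B ρ → eval s ρ ≡ eval t ρ → Within (equal f s t) (blanks f ρ) (equalTime s t B) (blanks f ρ)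
    equalʷ s t {B} ρ≤ eq =
      buildʷ f ρ s ρ≤ ⨾ʷ
      weaken (ℕ.+-monoˡ-≤ 2 (ℕ.*-monoʳ-≤ 7 (length-eval s ρ≤))) (shift₁ʷ (pad f ρ) (eval s ρ)) ⨾ʷ
      subst (λ w → Within (build f t) ([] ∷ (w ʳ++ []) ∷ [] ∷ pad f ρ) _ _) (sym eq) (buildʷ f ρ t ρ≤) ⨾ʷ
      weaken (ℕ.+-monoˡ-≤ 2 (ℕ.*-monoʳ-≤ 7 (length-eval t ρ≤))) (shift₂ʷ (pad f ρ) (eval t ρ)) ⨾ʷ
      weaken (ℕ.+-monoˡ-≤ 1 (ℕ.+-monoˡ-≤ 2 (ℕ.*-monoʳ-≤ 6
               (ℕ.≤-trans (ℕ.≤-reflexive (length-ʳ (eval t ρ))) (length-eval t ρ≤)))))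
        (matchʷ (pad f ρ) (eval t ρ ʳ++ []))

  wk : ∀ m → Expr n → Expr (m + n)
  wk m = map (Sum.map₁ (m Fin.↑ʳ_))

  eval-wk : ∀ (t : Expr n) (xs : Store m) ρ → eval (wk m t) (xs Vec.++ ρ) ≡ eval t ρ
  eval-wk [] xs ρ = refl
  eval-wk (inj₁ x ∷ t) xs ρ = cong₂ _++_ (Vec.lookup-++ʳ xs ρ x) (eval-wk t xs ρ)
  eval-wk (inj₂ a ∷ t) xs ρ = cong (a ∷_) (eval-wk t xs ρ)

  pattern #0 = zero
  pattern #1 = suc zero
  pattern #2 = suc (suc zero)
  pattern #3 = suc (suc (suc zero))
  pattern #4 = suc #3
  pattern #5 = suc #4
  pattern #6 = suc #5
  pattern #7 = suc #6
  pattern #8 = suc #7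

  depth : Fm n → ℕ
  depth (_ ≐ _)        = 0
  depth (φ ⩓ ψ)        = depth φ ⊔ depth ψ
  depth (φ ⩔ ψ)        = depth φ ⊔ depth ψ
  depth (ex φ)       = suc (depth φ)
  depth (tc φ _ _ _ _) = 4 + depth φ

  -- The states of tc live on four stacks: #2 and #3 hold the current state, and
  -- #0 and #1 the next one.
  module TC (f : ℕ) (p : Prog (3 + (f ⊕ (4 + n)))) where

    r : Fin (4 + n) → Fin (f ⊕ (4 + n))
    r = reg f

    load⟨_⟩ : Fin (4 + n) → Expr n → Prog (3 + (f ⊕ (4 + n)))
    load⟨ x ⟩ t = build f (wk 4 t) ⨾ shift₂ ⨾ unsave (r x)

    move : (i j : Fin (4 + n)) → Prog (3 + (f ⊕ (4 + n)))
    move i j = save (r i) ⨾ unsave (r j)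

    next : Prog (3 + (f ⊕ (4 + n)))
    next = guess (r #0) ⨾ guess (r #1) ⨾ p ⨾ clear (r #2) ⨾ clear (r #3) ⨾
           move #0 #2 ⨾ move #1 #3

    -- Rounds are not counted: the star stops at will, and the equality tests reject a stop at the
    -- wrong pair.
    prog : (a b c d : Expr n) → Prog (3 + (f ⊕ (4 + n)))
    prog a b c d = load⟨ #2 ⟩ a ⨾ load⟨ #3 ⟩ b ⨾ star next ⨾
      equal f [ inj₁ #2 ] (wk 4 c) ⨾ equal f [ inj₁ #3 ] (wk 4 d) ⨾ clear (r #2) ⨾ clear (r #3)

  -- Where spare stacks run out the program fails. This keeps soundness unconditional, while
  -- completeness asks for as many spare stacks as `depth` counts.
  compile : ∀ f → Fm n → Prog (3 + (f ⊕ n))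
  compile f       (s ≐ t)  = equal f s t
  compile f       (φ ⩓ ψ)  = compile f φ ⨾ compile f ψ
  compile f       (φ ⩔ ψ)  = compile f φ ⊹ compile f ψ
  compile zero    (ex _) = fail
  compile (suc f) (ex φ) = guess (reg f zero) ⨾ compile f φ ⨾ clear (reg f zero)
  compile (suc (suc (suc (suc f)))) (tc φ a b c d) = TC.prog f (compile f φ) a b c d
  compile _ (tc _ _ _ _ _) = fail

  nextTime : ℕ → ℕ → ℕ
  nextTime t B = 6 * B + 1 + (6 * B + 1 + (t + (5 * B + 2 + (5 * B + 2 +
    ((7 * B + 2 + (7 * B + 2)) + (7 * B + 2 + (7 * B + 2)))))))

  time : Fm n → ℕ → ℕ
  time (s ≐ t)  B = equalTime s t B
  time (φ ⩓ ψ)  B = time φ B + time ψ B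
  time (φ ⩔ ψ)  B = suc (time φ B + time ψ B)
  time (ex φ) B = 6 * B + 1 + (time φ B + (5 * B + 2))
  time (tc φ a b c d) B =
    loadTime a + (loadTime b + (B * suc (nextTime (time φ B′) B′) + 1 +
    (equalTime [ inj₁ #2 ] (wk 4 c) B′ + (equalTime [ inj₁ #3 ] (wk 4 d) B′ +
    (5 * B′ + 2 + (5 * B′ + 2))))))
    where
    -- The first pair of a chain consists of the values of `a` and `b`, which may be longer than all
    -- words in scope. Inside `tc` the bound has to cover them as well.
    B′ = B + (exprLength a B + exprLength b B)
    loadTime : Expr _ → ℕ
    loadTime t = buildTime (wk 4 t) B′ + (7 * exprLength (wk 4 t) B′ + 2 + (7 * exprLength (wk 4 t) B′ + 2))

  module _ (f : ℕ) (ρ : Store n) (i : Fin n) where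
    open Stack f ρ i

    private
      set : ∀ {x y z} w {v} → v ≡ w → _≡_ {A = Store (3 + (f ⊕ n))} (x ∷ y ∷ z ∷ R v) (x ∷ y ∷ z ∷ R w)
      set w refl = refl

    varSave-inv : ∀ w {τ} → Reach (save (reg f i)) (blanks f (ρ [ i ]≔ w)) τ → τ ≡ [] ∷ [] ∷ (w ʳ++ []) ∷ R []
    varSave-inv w = save-inv (reg f i) R read write [] [] w

    varSaveʷ : ∀ w {B} → length w ≤ B →
               Within (save (reg f i)) (blanks f (ρ [ i ]≔ w)) (7 * B + 2) ([] ∷ [] ∷ (w ʳ++ []) ∷ R [])
    varSaveʷ w w≤ = weaken (ℕ.+-monoˡ-≤ 2 (ℕ.*-monoʳ-≤ 7 w≤)) (saveʷ (reg f i) R read write [] [] w)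

    varUnsave-inv : ∀ w {τ} → Reach (unsave (reg f i)) ([] ∷ [] ∷ (w ʳ++ []) ∷ R []) τ → τ ≡ blanks f (ρ [ i ]≔ w)
    varUnsave-inv w r = trans (unsave-inv (reg f i) R read write [] [] _ r) (set w (reverse² w))

    varUnsaveʷ : ∀ w {B} → length w ≤ B →
                 Within (unsave (reg f i)) ([] ∷ [] ∷ (w ʳ++ []) ∷ R []) (7 * B + 2) (blanks f (ρ [ i ]≔ w))
    varUnsaveʷ w {B} w≤ = subst (Within _ _ (7 * B + 2)) (set w (reverse² w))
      (weaken (ℕ.+-monoˡ-≤ 2 (ℕ.*-monoʳ-≤ 7 (ℕ.≤-trans (ℕ.≤-reflexive (length-ʳ w)) w≤)))
        (unsaveʷ (reg f i) R read write [] [] (w ʳ++ [])))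

    varClear-inv : ∀ w {τ} → Reach (clear (reg f i)) (blanks f (ρ [ i ]≔ w)) τ → τ ≡ blanks f (ρ [ i ]≔ [])
    varClear-inv w = clear-inv (reg f i) R read write [] [] w

    varClearʷ : ∀ w {B} → length w ≤ B →
                Within (clear (reg f i)) (blanks f (ρ [ i ]≔ w)) (5 * B + 2) (blanks f (ρ [ i ]≔ []))
    varClearʷ w w≤ = weaken (ℕ.+-monoˡ-≤ 2 (ℕ.*-monoʳ-≤ 5 w≤)) (clearʷ (reg f i) R read write [] [] w)

    varGuess-inv : ∀ {τ} → Reach (guess (reg f i)) (blanks f (ρ [ i ]≔ [])) τ → ∃[ w ] τ ≡ blanks f (ρ [ i ]≔ w)
    varGuess-inv = guess-inv (reg f i) R read write

    varGuessʷ : ∀ w {B} → length w ≤ B →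
                Within (guess (reg f i)) (blanks f (ρ [ i ]≔ [])) (6 * B + 1) (blanks f (ρ [ i ]≔ w))
    varGuessʷ w w≤ = weaken (ℕ.+-monoˡ-≤ 1 (ℕ.*-monoʳ-≤ 6 w≤)) (guessʷ (reg f i) R read write w)

  module TCEffects (f : ℕ) (p : Prog (3 + (f ⊕ (4 + n)))) (ρ : Store n) where
    open TC f p

    at : (x′ y′ x y : Letters) → Store (3 + (f ⊕ (4 + n)))
    at x′ y′ x y = blanks f (x′ ∷ y′ ∷ x ∷ y ∷ ρ)

    load₁-inv : ∀ t {τ} → Reach (load⟨ #2 ⟩ t) (at [] [] [] []) τ → τ ≡ at [] [] (eval t ρ) []
    load₁-inv t (_ , q ⨾ q′ ⨾ q″) with build-inv f ([] ∷ [] ∷ [] ∷ [] ∷ ρ) (wk 4 t) (_ , q)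
    ... | refl rewrite eval-wk t ([] ∷ [] ∷ [] ∷ [] ∷ []) ρ with shift₂-inv _ _ (_ , q′)
    ... | refl = varUnsave-inv f ([] ∷ [] ∷ [] ∷ [] ∷ ρ) #2 (eval t ρ) (_ , q″)

    load₂-inv : ∀ t {x τ} → Reach (load⟨ #3 ⟩ t) (at [] [] x []) τ → τ ≡ at [] [] x (eval t ρ)
    load₂-inv t {x} (_ , q ⨾ q′ ⨾ q″) with build-inv f ([] ∷ [] ∷ x ∷ [] ∷ ρ) (wk 4 t) (_ , q)
    ... | refl rewrite eval-wk t ([] ∷ [] ∷ x ∷ [] ∷ []) ρ with shift₂-inv _ _ (_ , q′)
    ... | refl = varUnsave-inv f ([] ∷ [] ∷ x ∷ [] ∷ ρ) #3 (eval t ρ) (_ , q″)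

    next-inv : ∀ {P : Store (4 + n) → Set} →
               (∀ ρ {τ} → Reach p (blanks f ρ) τ → P ρ × τ ≡ blanks f ρ) →
               ∀ x y {τ} → Reach next (at [] [] x y) τ →
               ∃₂ λ x′ y′ → P (x′ ∷ y′ ∷ x ∷ y ∷ ρ) × τ ≡ at [] [] x′ y′
    next-inv body x y (_ , q₀ ⨾ q₁ ⨾ q ⨾ q₂ ⨾ q₃ ⨾ (q₄ ⨾ q₅) ⨾ (q₆ ⨾ q₇))
      with varGuess-inv f ([] ∷ [] ∷ x ∷ y ∷ ρ) #0  (_ , q₀)
    ... | x′ , refl with varGuess-inv f (x′ ∷ [] ∷ x ∷ y ∷ ρ) #1  (_ , q₁)
    ... | y′ , refl with body _ (_ , q)
    ... | holds , refl with varClear-inv f (x′ ∷ y′ ∷ x ∷ y ∷ ρ) #2 x (_ , q₂)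
    ... | refl with varClear-inv f (x′ ∷ y′ ∷ [] ∷ y ∷ ρ) #3 y (_ , q₃)
    ... | refl with varSave-inv f (x′ ∷ y′ ∷ [] ∷ [] ∷ ρ) #0 x′ (_ , q₄)
    ... | refl with varUnsave-inv f ([] ∷ y′ ∷ [] ∷ [] ∷ ρ) #2 x′ (_ , q₅)
    ... | refl with varSave-inv f ([] ∷ y′ ∷ x′ ∷ [] ∷ ρ) #1 y′ (_ , q₆)
    ... | refl with varUnsave-inv f ([] ∷ [] ∷ x′ ∷ [] ∷ ρ) #3 y′ (_ , q₇)
    ... | refl = x′ , y′ , holds , refl

    nextʷ : ∀ {B t x y x′ y′} → length x ≤ B → length y ≤ B → length x′ ≤ B → length y′ ≤ B →
            Within p (at x′ y′ x y) t (at x′ y′ x y) →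
            Within next (at [] [] x y) (nextTime t B) (at [] [] x′ y′)
    nextʷ {x = x} {y} {x′} {y′} x≤ y≤ x′≤ y′≤ body =
      varGuessʷ f ([] ∷ [] ∷ x ∷ y ∷ ρ) #0 x′ x′≤ ⨾ʷ
      varGuessʷ f (x′ ∷ [] ∷ x ∷ y ∷ ρ) #1 y′ y′≤ ⨾ʷ
      body ⨾ʷ
      varClearʷ f (x′ ∷ y′ ∷ x ∷ y ∷ ρ) #2 x x≤ ⨾ʷ
      varClearʷ f (x′ ∷ y′ ∷ [] ∷ y ∷ ρ) #3 y y≤ ⨾ʷ
      (varSaveʷ f (x′ ∷ y′ ∷ [] ∷ [] ∷ ρ) #0 x′ x′≤ ⨾ʷ varUnsaveʷ f ([] ∷ y′ ∷ [] ∷ [] ∷ ρ) #2 x′ x′≤) ⨾ʷ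
      (varSaveʷ f ([] ∷ y′ ∷ x′ ∷ [] ∷ ρ) #1 y′ y′≤ ⨾ʷ varUnsaveʷ f ([] ∷ [] ∷ x′ ∷ [] ∷ ρ) #3 y′ y′≤)

    loads : ∀ {B} t {xs : Store 4} {τ} → Short B (xs Vec.++ ρ) → length (eval t ρ) ≤ exprLength (wk 4 t) B →
            ∀ i → Within (unsave (r i)) ([] ∷ [] ∷ (eval t ρ ʳ++ []) ∷ pad f (xs Vec.++ ρ)) (7 * exprLength (wk 4 t) B + 2) τ →
            Within (load⟨ i ⟩ t) (blanks f (xs Vec.++ ρ))
              (buildTime (wk 4 t) B + (7 * exprLength (wk 4 t) B + 2 + (7 * exprLength (wk 4 t) B + 2))) τ
    loads {B} t {xs} xs≤ t≤ i u =
      subst (λ w → Within (build f (wk 4 t)) _ (buildTime (wk 4 t) B) (w ∷ [] ∷ [] ∷ pad f (xs Vec.++ ρ)))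
        (eval-wk t xs ρ) (buildʷ f (xs Vec.++ ρ) (wk 4 t) xs≤) ⨾ʷ
      weaken (ℕ.+-monoˡ-≤ 2 (ℕ.*-monoʳ-≤ 7 t≤)) (shift₂ʷ (pad f (xs Vec.++ ρ)) (eval t ρ)) ⨾ʷ u

  resume : ∀ {T} {p : Prog T} {σ σ′ n τ} → σ ≡ σ′ → Run p σ n τ → Reach p σ′ τ
  resume refl r = _ , r

  -- A successful run leaves the store as it was. Programs of subformulas can therefore simply be
  -- put in sequence.
  compile-inv : ∀ f (φ : Fm n) ρ {τ} → Reach (compile f φ) (blanks f ρ) τ → Sat Anything φ ρ × τ ≡ blanks f ρ
  compile-inv f (s ≐ t) ρ r = Product.map₁ same (equal-inv f ρ s t r)
  compile-inv f (φ ⩓ ψ) ρ (_ , r ⨾ r′) with compile-inv f φ ρ (_ , r)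
  ... | p , refl with compile-inv f ψ ρ (_ , r′)
  ... | q , refl = (p & q) , refl
  compile-inv f (φ ⩔ ψ) ρ (_ , inl r) = Product.map₁ left (compile-inv f φ ρ (_ , r))
  compile-inv f (φ ⩔ ψ) ρ (_ , inr r) = Product.map₁ right (compile-inv f ψ ρ (_ , r))
  compile-inv (suc f) (ex φ) ρ (_ , r ⨾ r′ ⨾ r″) with varGuess-inv f ([] ∷ ρ) zero (_ , r)
  ... | w , refl with compile-inv f φ (w ∷ ρ) (_ , r′)
  ... | p , refl = word w tt p , varClear-inv f (w ∷ ρ) zero w (_ , r″)
  compile-inv (suc (suc (suc (suc f)))) (tc φ a b c d) ρ (_ , ra ⨾ rb ⨾ rs ⨾ rc ⨾ rd ⨾ r₁ ⨾ r₂) = result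
    where
    open TC f (compile f φ)
    open TCEffects f (compile f φ) ρ

    states : ∀ x y {n τ} → Run (star next) (at [] [] x y) n τ →
             ∃₂ λ x′ y′ → (∃[ ℓ ] Chain Anything (λ (x , y) (x′ , y′) → Sat Anything φ (x′ ∷ y′ ∷ x ∷ y ∷ ρ)) ℓ (x , y) (x′ , y′))
               × τ ≡ at [] [] x′ y′
    states x y stop = x , y , (_ , end) , refl
    states x y (r ∷ rs) with next-inv (compile-inv f φ) x y (_ , r)
    ... | x′ , y′ , p , refl with states x′ y′ rs
    ... | x″ , y″ , (_ , ch) , eq = x″ , y″ , (_ , link tt tt p ch) , eq

    result : Sat Anything (tc φ a b c d) ρ × _ ≡ at [] [] [] []
    result =
      let rb′ = resume (load₁-inv a (_ , ra)) rb
          rs′ = resume (load₂-inv b rb′) rs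
      in case states (eval a ρ) (eval b ρ) (proj₂ rs′) of λ
        { (x , y , (ℓ , ch) , eq) →
          let rc′ = resume eq rc
              eq-c , eq₁ = equal-inv f ([] ∷ [] ∷ x ∷ y ∷ ρ) [ inj₁ #2 ] (wk 4 c) rc′
              rd′ = resume eq₁ rd
              eq-d , eq₂ = equal-inv f ([] ∷ [] ∷ x ∷ y ∷ ρ) [ inj₁ #3 ] (wk 4 d) rd′
              r₁′ = resume eq₂ r₁
              r₂′ = resume (varClear-inv f ([] ∷ [] ∷ x ∷ y ∷ ρ) #2 x r₁′) r₂
          in chain ℓ tt (subst₂ (λ x y → Chain Anything (λ (x , y) (x′ , y′) → Sat Anything φ (x′ ∷ y′ ∷ x ∷ y ∷ ρ)) ℓ (eval a ρ , eval b ρ) (x , y))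
                 (trans (sym (List.++-identityʳ x)) (trans eq-c (eval-wk c ([] ∷ [] ∷ x ∷ y ∷ []) ρ)))
                 (trans (sym (List.++-identityʳ y)) (trans eq-d (eval-wk d ([] ∷ [] ∷ x ∷ y ∷ []) ρ))) ch) ,
             varClear-inv f ([] ∷ [] ∷ [] ∷ y ∷ ρ) #3 y r₂′ }

  -- Two bounds are kept apart: `C` limits guessed words and chains and never changes, whereas `B`
  -- limits the words in scope and grows to `B′` below `tc`.
  compileʷ : ∀ f (φ : Fm n) {B C ρ} → depth φ ≤ f → C ≤ B → Short B ρ → Sat (_≤ C) φ ρ →
             Within (compile f φ) (blanks f ρ) (time φ B) (blanks f ρ)
  compileʷ f (s ≐ t) d≤ C≤ ρ≤ (same eq) = equalʷ f _ s t ρ≤ eq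
  compileʷ f (φ ⩓ ψ) d≤ C≤ ρ≤ (p & q) =
    compileʷ f φ (ℕ.m⊔n≤o⇒m≤o _ _ d≤) C≤ ρ≤ p ⨾ʷ compileʷ f ψ (ℕ.m⊔n≤o⇒n≤o (depth φ) _ d≤) C≤ ρ≤ q
  compileʷ f (φ ⩔ ψ) d≤ C≤ ρ≤ (left p) =
    weaken (s≤s (ℕ.m≤m+n _ _)) (inlʷ (compileʷ f φ (ℕ.m⊔n≤o⇒m≤o _ _ d≤) C≤ ρ≤ p))
  compileʷ f (φ ⩔ ψ) {B} d≤ C≤ ρ≤ (right q) =
    weaken (s≤s (ℕ.m≤n+m _ (time φ B))) (inrʷ (compileʷ f ψ (ℕ.m⊔n≤o⇒n≤o (depth φ) _ d≤) C≤ ρ≤ q))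
  compileʷ (suc f) (ex φ) (s≤s d≤) C≤ ρ≤ (word w w≤ p) =
    varGuessʷ f ([] ∷ _) zero w w≤B ⨾ʷ
    compileʷ f φ d≤ C≤ (short-∷ w≤B ρ≤) p ⨾ʷ varClearʷ f (w ∷ _) zero w w≤B
    where w≤B = ℕ.≤-trans w≤ C≤
  compileʷ (suc (suc (suc (suc f)))) (tc φ a b c d) {B} {C} {ρ} (s≤s (s≤s (s≤s (s≤s d≤)))) C≤ ρ≤ (chain ℓ ℓ≤ ch) =
    loads a (short z≤n z≤n) (wkLength a) #2 (varUnsaveʷ f ([] ∷ [] ∷ [] ∷ [] ∷ ρ) #2 (eval a ρ) (wkLength a)) ⨾ʷ
    loads b (short xa≤ z≤n) (wkLength b) #3 (varUnsaveʷ f ([] ∷ [] ∷ eval a ρ ∷ [] ∷ ρ) #3 (eval b ρ) (wkLength b)) ⨾ʷ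
    weaken (ℕ.+-monoˡ-≤ 1 (ℕ.*-monoˡ-≤ (suc step) (ℕ.≤-trans ℓ≤ C≤))) (states ch xa≤ xb≤) ⨾ʷ
    equalʷ f ([] ∷ [] ∷ eval c ρ ∷ eval d ρ ∷ ρ) [ inj₁ #2 ] (wk 4 c) (short xc≤ xd≤)
      (trans (List.++-identityʳ _) (sym (eval-wk c ([] ∷ [] ∷ eval c ρ ∷ eval d ρ ∷ []) ρ))) ⨾ʷ
    equalʷ f ([] ∷ [] ∷ eval c ρ ∷ eval d ρ ∷ ρ) [ inj₁ #3 ] (wk 4 d) (short xc≤ xd≤)
      (trans (List.++-identityʳ _) (sym (eval-wk d ([] ∷ [] ∷ eval c ρ ∷ eval d ρ ∷ []) ρ))) ⨾ʷ
    varClearʷ f ([] ∷ [] ∷ eval c ρ ∷ eval d ρ ∷ ρ) #2 (eval c ρ) xc≤ ⨾ʷ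
    varClearʷ f ([] ∷ [] ∷ [] ∷ eval d ρ ∷ ρ) #3 (eval d ρ) xd≤
    where
    open TC f (compile f φ)
    open TCEffects f (compile f φ) ρ
    B′ = B + (exprLength a B + exprLength b B)
    step = nextTime (time φ B′) B′

    B≤ : B ≤ B′
    B≤ = ℕ.m≤m+n _ _

    short : ∀ {x y} → length x ≤ B′ → length y ≤ B′ → Short B′ ([] ∷ [] ∷ x ∷ y ∷ ρ)
    short x≤ y≤ = short-∷ {w = []} z≤n (short-∷ {w = []} z≤n (short-∷ x≤ (short-∷ y≤ (λ i → ℕ.≤-trans (ρ≤ i) B≤))))

    xa≤ : length (eval a ρ) ≤ B′
    xa≤ = ℕ.≤-trans (length-eval a ρ≤) (ℕ.≤-trans (ℕ.m≤m+n _ _) (ℕ.m≤n+m _ B))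

    xb≤ : length (eval b ρ) ≤ B′
    xb≤ = ℕ.≤-trans (length-eval b ρ≤) (ℕ.≤-trans (ℕ.m≤n+m _ (exprLength a B)) (ℕ.m≤n+m _ B))

    wkLength : ∀ t → length (eval t ρ) ≤ exprLength (wk 4 t) B′
    wkLength t = subst (λ w → length w ≤ exprLength (wk 4 t) B′) (eval-wk t ([] ∷ [] ∷ [] ∷ [] ∷ []) ρ)
                   (length-eval (wk 4 t) (short {[]} {[]} z≤n z≤n))

    states : ∀ {ℓ x y x′ y′} →
             Chain (_≤ C) (λ (x , y) (x′ , y′) → Sat (_≤ C) φ (x′ ∷ y′ ∷ x ∷ y ∷ ρ)) ℓ (x , y) (x′ , y′) →
             length x ≤ B′ → length y ≤ B′ →
             Within (star next) (at [] [] x y) (ℓ * suc step + 1) (at [] [] x′ y′)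
    states end x≤ y≤ = stopʷ
    states (link {ℓ} x′≤ y′≤ p ch) x≤ y≤ = weaken (ℕ.≤-reflexive (sym (ℕ.+-assoc (suc step) (ℓ * suc step) 1)))
      (nextʷ x≤ y≤ x′≤B y′≤B
        (compileʷ f φ d≤ (ℕ.≤-trans C≤ B≤) (short-∷ x′≤B (short-∷ y′≤B (short-∷ x≤ (short-∷ y≤ (λ i → ℕ.≤-trans (ρ≤ i) B≤))))) p)
       ∷ʷ states ch x′≤B y′≤B)
      where
      x′≤B = ℕ.≤-trans x′≤ (ℕ.≤-trans C≤ B≤)
      y′≤B = ℕ.≤-trans y′≤ (ℕ.≤-trans C≤ B≤)

    -- `B′` does not mention `c` and `d`. Their values are the last pair of the chain, which is
    -- either the first pair or a guessed one, and so is short anyway.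
    ends : ∀ {ℓ p q} → Chain (_≤ C) (λ (x , y) (x′ , y′) → Sat (_≤ C) φ (x′ ∷ y′ ∷ x ∷ y ∷ ρ)) ℓ p q →
           length (proj₁ p) ≤ B′ → length (proj₂ p) ≤ B′ → length (proj₁ q) ≤ B′ × length (proj₂ q) ≤ B′
    ends end x≤ y≤ = x≤ , y≤
    ends (link x≤ y≤ _ ch) _ _ = ends ch (ℕ.≤-trans x≤ (ℕ.≤-trans C≤ B≤)) (ℕ.≤-trans y≤ (ℕ.≤-trans C≤ B≤))

    xc≤ = proj₁ (ends ch xa≤ xb≤)
    xd≤ = proj₂ (ends ch xa≤ xb≤)

  -- Polynomial bounds

  -- With the positive base `suc n` a larger exponent never lowers the bound, even at zero, so that
  -- bounds with different exponents can be added.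
  PolyBounded : (ℕ → ℕ) → Set
  PolyBounded g = ∃₂ λ c d → ∀ n → g n ≤ c * suc n ^ d

  private variable g h : ℕ → ℕ

  poly-const : ∀ k → PolyBounded (λ _ → k)
  poly-const k = k , 0 , λ n → ℕ.≤-reflexive (sym (ℕ.*-identityʳ k))

  poly-id : PolyBounded (λ n → n)
  poly-id = 1 , 1 , λ n → ℕ.≤-trans (ℕ.n≤1+n n)
    (ℕ.≤-reflexive (sym (trans (ℕ.*-identityˡ (suc n ^ 1)) (ℕ.*-identityʳ (suc n)))))

  poly-+ : PolyBounded g → PolyBounded h → PolyBounded (λ n → g n + h n)
  poly-+ (c , d , g≤) (c′ , d′ , h≤) = c + c′ , d + d′ , λ n →
    ℕ.≤-trans (ℕ.+-mono-≤
      (ℕ.≤-trans (g≤ n) (ℕ.*-monoʳ-≤ c (ℕ.^-monoʳ-≤ (suc n) (ℕ.m≤m+n d d′))))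
      (ℕ.≤-trans (h≤ n) (ℕ.*-monoʳ-≤ c′ (ℕ.^-monoʳ-≤ (suc n) (ℕ.m≤n+m d′ d)))))
    (ℕ.≤-reflexive (sym (ℕ.*-distribʳ-+ (suc n ^ (d + d′)) c c′)))

  poly-* : PolyBounded g → PolyBounded h → PolyBounded (λ n → g n * h n)
  poly-* (c , d , g≤) (c′ , d′ , h≤) = c * c′ , d + d′ , λ n →
    ℕ.≤-trans (ℕ.*-mono-≤ (g≤ n) (h≤ n))
    (ℕ.≤-reflexive (trans (ℕ.[m*n]*[o*p]≡[m*o]*[n*p] c (suc n ^ d) c′ (suc n ^ d′))
                          (cong (c * c′ *_) (sym (ℕ.^-distribˡ-+-* (suc n) d d′)))))

  poly-suc : PolyBounded g → PolyBounded (suc ∘ g)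
  poly-suc = poly-+ (poly-const 1)

  poly-^ : ∀ k → PolyBounded g → PolyBounded (λ n → g n ^ k)
  poly-^ zero    _ = poly-const 1
  poly-^ (suc k) p = poly-* p (poly-^ k p)

  poly-linear : ∀ k l → PolyBounded g → PolyBounded (λ n → k * g n + l)
  poly-linear k l p = poly-+ (poly-* (poly-const k) p) (poly-const l)

  poly-buildTime : ∀ (t : Expr n) → PolyBounded g → PolyBounded (λ k → buildTime t (g k))
  poly-buildTime []           p = poly-const 1
  poly-buildTime (inj₁ _ ∷ t) p = poly-+ (poly-buildTime t p) (poly-+ (poly-linear 7 2 p) (poly-linear 9 2 p))
  poly-buildTime (inj₂ _ ∷ t) p = poly-+ (poly-buildTime t p) (poly-const 2)

  poly-exprLength : ∀ (t : Expr n) → PolyBounded g → PolyBounded (λ k → exprLength t (g k))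
  poly-exprLength []           p = poly-const 0
  poly-exprLength (inj₁ _ ∷ t) p = poly-+ p (poly-exprLength t p)
  poly-exprLength (inj₂ _ ∷ t) p = poly-suc (poly-exprLength t p)

  poly-equalTime : ∀ (s t : Expr n) → PolyBounded g → PolyBounded (λ k → equalTime s t (g k))
  poly-equalTime s t p =
    poly-+ (poly-buildTime s p) (poly-+ (poly-linear 7 2 (poly-exprLength s p)) (poly-+ (poly-buildTime t p)
      (poly-+ (poly-linear 7 2 (poly-exprLength t p)) (poly-+ (poly-linear 6 2 (poly-exprLength t p)) (poly-const 1)))))

  poly-nextTime : PolyBounded h → PolyBounded g → PolyBounded (λ k → nextTime (h k) (g k))
  poly-nextTime q p = poly-+ (poly-linear 6 1 p) (poly-+ (poly-linear 6 1 p) (poly-+ q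
    (poly-+ (poly-linear 5 2 p) (poly-+ (poly-linear 5 2 p) (poly-+ twice twice)))))
    where twice = poly-+ (poly-linear 7 2 p) (poly-linear 7 2 p)

  poly-time : ∀ (φ : Fm n) → PolyBounded g → PolyBounded (λ k → time φ (g k))
  poly-time (s ≐ t)  p = poly-equalTime s t p
  poly-time (φ ⩓ ψ)  p = poly-+ (poly-time φ p) (poly-time ψ p)
  poly-time (φ ⩔ ψ)  p = poly-suc (poly-+ (poly-time φ p) (poly-time ψ p))
  poly-time (ex φ) p = poly-+ (poly-linear 6 1 p) (poly-+ (poly-time φ p) (poly-linear 5 2 p))
  poly-time {g = g} (tc φ a b c d) p =
    poly-+ (loadP a) (poly-+ (loadP b)
      (poly-+ (poly-+ (poly-* p (poly-suc (poly-nextTime (poly-time φ p′) p′))) (poly-const 1))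
      (poly-+ (poly-equalTime [ inj₁ #2 ] (wk 4 c) p′) (poly-+ (poly-equalTime [ inj₁ #3 ] (wk 4 d) p′)
      (poly-+ (poly-linear 5 2 p′) (poly-linear 5 2 p′))))))
    where
    p′ = poly-+ p (poly-+ (poly-exprLength a p) (poly-exprLength b p))
    loadP : ∀ t → PolyBounded _
    loadP t = poly-+ (poly-buildTime (wk 4 t) p′)
      (poly-+ (poly-linear 7 2 (poly-exprLength (wk 4 t) p′)) (poly-linear 7 2 (poly-exprLength (wk 4 t) p′)))

  *-^ : ∀ d m n → (m * n) ^ d ≡ m ^ d * n ^ d
  *-^ zero    m n = refl
  *-^ (suc d) m n = trans (cong (m * n *_) (*-^ d m n)) (ℕ.[m*n]*[o*p]≡[m*o]*[n*p] m n (m ^ d) (n ^ d))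

  -- For positive `n` the base `suc n` is at most `2 * n`; the summand 1 takes care of zero.
  suc-^-≤ : ∀ d n → suc n ^ d ≤ 2 ^ d * n ^ d + 1
  suc-^-≤ d zero    = ℕ.≤-trans (ℕ.≤-reflexive (ℕ.^-zeroˡ d)) (ℕ.m≤n+m 1 _)
  suc-^-≤ d (suc n) = ℕ.≤-trans (ℕ.^-monoˡ-≤ d {suc (suc n)} {2 * suc n} le)
    (ℕ.≤-trans (ℕ.≤-reflexive (*-^ d 2 (suc n))) (ℕ.m≤m+n _ 1))
    where
    le : suc (suc n) ≤ 2 * suc n
    le = s≤s (ℕ.≤-trans (ℕ.≤-reflexive (ℕ.+-comm 1 n)) (ℕ.+-monoʳ-≤ n (s≤s z≤n)))

  poly-normal : PolyBounded g → ∃₂ λ c d → ∀ n → g n ≤ c * n ^ d + c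
  poly-normal (c , d , g≤) = c * 2 ^ d + c , d , λ n → ℕ.≤-trans (g≤ n) (ℕ.≤-trans (ℕ.*-monoʳ-≤ c (suc-^-≤ d n))
    (ℕ.≤-trans (ℕ.≤-reflexive (eq n)) (ℕ.+-mono-≤ (ℕ.*-monoˡ-≤ (n ^ d) (ℕ.m≤m+n (c * 2 ^ d) c)) (ℕ.m≤n+m c _))))
    where
    eq : ∀ n → c * (2 ^ d * n ^ d + 1) ≡ c * 2 ^ d * n ^ d + c
    eq n = trans (ℕ.*-distribˡ-+ c (2 ^ d * n ^ d) 1) (cong₂ _+_ (sym (ℕ.*-assoc c (2 ^ d) (n ^ d))) (ℕ.*-identityʳ c))

  pad-replicate : ∀ f n → pad f (Vec.replicate n []) ≡ Vec.replicate (f ⊕ n) []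
  pad-replicate zero    n = refl
  pad-replicate (suc f) n = pad-replicate f (suc n)

  module Recognise (φ : Fm 1) where

    private
      f = depth φ

      program : Prog (3 + (f ⊕ 1))
      -- The input is on the first tape, which is a scratch stack. Two reversals bring it, in its
      -- original order, to the stack of the only free variable.
      program = shift₂ ⨾ unsave (reg f zero) ⨾ compile f φ

      start : ∀ w → _≡_ {A = Store (3 + (f ⊕ 1))} (w ∷ Vec.replicate (2 + (f ⊕ 1)) []) (w ∷ [] ∷ [] ∷ pad f ([] ∷ []))
      start w = cong (λ V → _∷_ w ([] ∷ [] ∷ V)) (sym (pad-replicate f 1))

      module Mach = Machine (2 + (f ⊕ 1)) program

    machine : NTM 4
    machine = Mach.M

    steps : ℕ → ℕ
    steps B = 7 * B + 2 + (7 * B + 2 + time φ B)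

    machine-accepts : ∀ {B w} → length w ≤ B → Sat (_≤ B) φ (w ∷ []) →
                      ∃[ n ] n ≤ steps B × NTM.AcceptsIn machine w n
    machine-accepts {B} {w} w≤ sat with
      subst (λ σ → Within program σ (steps B) (blanks f (w ∷ []))) (sym (start w))
        (weaken (ℕ.+-monoˡ-≤ 2 (ℕ.*-monoʳ-≤ 7 w≤)) (shift₂ʷ (pad f ([] ∷ [])) w) ⨾ʷ
         varUnsaveʷ f ([] ∷ []) zero w w≤ ⨾ʷ
         compileʷ f φ ℕ.≤-refl ℕ.≤-refl (λ { zero → w≤ }) sat)
    ... | n , n≤ , r = n , n≤ , Mach.machine-complete r

    accepted : ∀ {w n} → NTM.AcceptsIn machine w n → Sat Anything φ (w ∷ [])
    accepted {w} acc with Mach.machine-sound acc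
    ... | m , σ , r with subst (λ τ → Run program τ m σ) (start w) r
    ... | r₁ ⨾ r₂ ⨾ r₃ with shift₂-inv (pad f ([] ∷ [])) w (_ , r₁)
    ... | refl with varUnsave-inv f ([] ∷ []) zero w (_ , r₂)
    ... | refl = proj₁ (compile-inv f φ (w ∷ []) (_ , r₃))

    poly-steps : PolyBounded g → PolyBounded (steps ∘ g)
    poly-steps p = poly-+ (poly-linear 7 2 p) (poly-+ (poly-linear 7 2 p) (poly-time φ p))

open Formulas

-- Prefix codes and formulas about coded data

module Codes where

  private variable
    n : ℕ
    X Y : Set
    ok : ℕ → Set
    B : ℕ

  pattern 𝟘 = zero
  pattern 𝟙 = suc zero
  pattern ‹ = suc (suc zero)
  pattern › = suc (suc (suc zero))

  pattern 𝐯 x = inj₁ x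
  pattern 𝐥 a = inj₂ a

  -- Like eval, without the empty word at the end.
  value⟦_⟧ : Expr n → Store n → Letters
  value⟦ [] ⟧ ρ            = []
  value⟦ 𝐯 x ∷ [] ⟧ ρ      = lookup ρ x
  value⟦ 𝐯 x ∷ t@(_ ∷ _) ⟧ ρ = lookup ρ x ++ value⟦ t ⟧ ρ
  value⟦ 𝐥 a ∷ t ⟧ ρ       = a ∷ value⟦ t ⟧ ρ

  eval-value : ∀ (t : Expr n) ρ → eval t ρ ≡ value⟦ t ⟧ ρ
  eval-value []                ρ = refl
  eval-value (𝐯 x ∷ [])        ρ = List.++-identityʳ _
  eval-value (𝐯 x ∷ t@(_ ∷ _)) ρ = cong (lookup ρ x ++_) (eval-value t ρ)
  eval-value (𝐥 a ∷ t)         ρ = cong (a ∷_) (eval-value t ρ)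

  infix 4 _≜_

  _≜_ : Fin n → Expr n → Fm n
  x ≜ t = [ 𝐯 x ] ≐ t

  ≜⁻ : ∀ {x : Fin n} {t ρ} → Sat ok (x ≜ t) ρ → lookup ρ x ≡ value⟦ t ⟧ ρ
  ≜⁻ {x = x} {t} {ρ} (same eq) = trans (sym (eval-value [ 𝐯 x ] ρ)) (trans eq (eval-value t ρ))

  ≜⁺ : ∀ {x : Fin n} {t ρ} → lookup ρ x ≡ value⟦ t ⟧ ρ → Sat ok (x ≜ t) ρ
  ≜⁺ {x = x} {t} {ρ} eq = same (trans (eval-value [ 𝐯 x ] ρ) (trans eq (sym (eval-value t ρ))))

  conjˡ : ∀ {φ ψ : Fm n} {ρ} → Sat ok (φ ⩓ ψ) ρ → Sat ok φ ρ
  conjˡ (p & _) = p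

  conjʳ : ∀ {φ ψ : Fm n} {ρ} → Sat ok (φ ⩓ ψ) ρ → Sat ok ψ ρ
  conjʳ (_ & q) = q

  disj : ∀ {R : Set} {φ ψ : Fm n} {ρ} → (Sat ok φ ρ → R) → (Sat ok ψ ρ → R) → Sat ok (φ ⩔ ψ) ρ → R
  disj f g (left p)  = f p
  disj f g (right q) = g q

  exᵉ : ∀ {R : Set} {φ : Fm (suc n)} {ρ} → Sat ok (ex φ) ρ → (∀ w → Sat ok φ (w ∷ ρ) → R) → R
  exᵉ (word w _ p) k = k w p

  tcᵉ : ∀ {R : Set} {φ : Fm (4 + n)} {a b c d : Expr n} {ρ} → Sat ok (tc φ a b c d) ρ →
        (∀ {k} → Chain ok (λ (x , y) (x′ , y′) → Sat ok φ (x′ ∷ y′ ∷ x ∷ y ∷ ρ)) k (eval a ρ , eval b ρ) (eval c ρ , eval d ρ) → R) → R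
  tcᵉ (chain _ _ ch) k = k ch

  fitˡ : ∀ (u w : Letters) → length (u ++ w) ≤ B → length u ≤ B
  fitˡ u w = ℕ.≤-trans (ℕ.≤-trans (ℕ.m≤m+n _ _) (ℕ.≤-reflexive (sym (List.length-++ u))))

  fitʳ : ∀ (u w : Letters) → length (u ++ w) ≤ B → length w ≤ B
  fitʳ u w = ℕ.≤-trans (ℕ.≤-trans (ℕ.m≤n+m _ _) (ℕ.≤-reflexive (sym (List.length-++ u))))

  true′ : Fm n
  true′ = [] ≐ []

  -- Prefix codes

  infixr 4 _×C_

  -- No code starts with the closing bracket, so the end of a list is visible. The two sides of
  -- `sumC` must differ in a way that no continuation can hide. These two conditions give unique
  -- readability.
  data Code : Set → Set₁
  enc  : Code X → X → Letters
  encs : Code X → List X → Letters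

  data Code where
    litC  : (a : Fin 4) → a ≢ › → Code ⊤
    bitC  : Code Bool
    tagC  : (a : Fin 4) → a ≢ › → Code X → Code X
    _×C_  : Code X → Code Y → Code (X × Y)
    sumC  : (c : Code X) (d : Code Y) → (∀ a b {r s} → enc c a ++ r ≢ enc d b ++ s) → Code (X ⊎ Y)
    listC : Code X → Code (List X)

  enc (litC a _)   _        = [ a ]
  enc bitC         false    = [ 𝟘 ]
  enc bitC         true     = [ 𝟙 ]
  enc (tagC a _ c) x        = a ∷ enc c x
  enc (c ×C d)     (x , y)  = enc c x ++ enc d y
  enc (sumC c d _) (inj₁ x) = enc c x
  enc (sumC c d _) (inj₂ y) = enc d y
  enc (listC c)    xs       = ‹ ∷ encs c xs ++ [ › ]

  encs c []       = []
  encs c (x ∷ xs) = enc c x ++ encs c xs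

  head : (c : Code X) (a : X) → ∃₂ λ l w → enc c a ≡ l ∷ w × l ≢ ›
  head (litC a a≢)   _       = a , [] , refl , a≢
  head bitC          false   = 𝟘 , [] , refl , λ ()
  head bitC          true    = 𝟙 , [] , refl , λ ()
  head (tagC a a≢ c) x       = a , enc c x , refl , a≢
  head (c ×C d)      (x , y) = let l , w , eq , l≢ = head c x in l , w ++ enc d y , cong (_++ enc d y) eq , l≢
  head (sumC c d _) (inj₁ x) = head c x
  head (sumC c d _) (inj₂ y) = head d y
  head (listC c)    xs       = ‹ , _ , refl , λ ()

  -- The arbitrary continuations `r` and `s` are what carries the induction through pairs and lists.
  prefix : (c : Code X) (a b : X) {r s : Letters} → enc c a ++ r ≡ enc c b ++ s → a ≡ b × r ≡ s
  encs-prefix : (c : Code X) (xs ys : List X) {r s : Letters} → encs c xs ++ › ∷ r ≡ encs c ys ++ › ∷ s → xs ≡ ys × r ≡ s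

  prefix (litC _ _)     _ _ eq = refl , List.∷-injectiveʳ eq
  prefix bitC false false   eq = refl , List.∷-injectiveʳ eq
  prefix bitC true  true    eq = refl , List.∷-injectiveʳ eq
  prefix (tagC _ _ c) x y   eq = prefix c x y (List.∷-injectiveʳ eq)
  prefix (c ×C d) (x , y) (x′ , y′) eq
    with prefix c x x′ (trans (sym (List.++-assoc (enc c x) (enc d y) _)) (trans eq (List.++-assoc (enc c x′) (enc d y′) _)))
  ... | refl , eq′ with prefix d y y′ eq′
  ... | refl , eq″ = refl , eq″
  prefix (sumC c d _) (inj₁ x) (inj₁ x′) eq = Product.map₁ (cong inj₁) (prefix c x x′ eq)
  prefix (sumC c d _) (inj₂ y) (inj₂ y′) eq = Product.map₁ (cong inj₂) (prefix d y y′ eq)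
  prefix (sumC c d c≢d) (inj₁ x) (inj₂ y) eq = contradiction eq (c≢d x y)
  prefix (sumC c d c≢d) (inj₂ y) (inj₁ x) eq = contradiction (sym eq) (c≢d x y)
  prefix (listC c) xs ys eq = encs-prefix c xs ys
    (trans (sym (List.++-assoc (encs c xs) [ › ] _)) (trans (List.∷-injectiveʳ eq) (List.++-assoc (encs c ys) [ › ] _)))

  encs-prefix c [] [] eq = refl , List.∷-injectiveʳ eq
  encs-prefix c [] (y ∷ ys) eq with head c y
  ... | l , w , e , l≢ = contradiction (sym (List.∷-injectiveˡ (trans eq (cong (λ u → (u ++ encs c ys) ++ _) e)))) l≢
  encs-prefix c (x ∷ xs) [] eq with head c x
  ... | l , w , e , l≢ = contradiction (sym (List.∷-injectiveˡ (trans (sym eq) (cong (λ u → (u ++ encs c xs) ++ _) e)))) l≢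
  encs-prefix c (x ∷ xs) (y ∷ ys) eq
    with prefix c x y (trans (sym (List.++-assoc (enc c x) (encs c xs) _)) (trans eq (List.++-assoc (enc c y) (encs c ys) _)))
  ... | refl , eq′ with encs-prefix c xs ys eq′
  ... | refl , eq″ = refl , eq″

  module _ (c : Code X) where

    enc-injective : ∀ {a b} → enc c a ≡ enc c b → a ≡ b
    enc-injective {a} {b} eq = proj₁ (prefix c a b {[]} {[]} (cong (_++ []) eq))

    encs-++ : ∀ xs ys → encs c (xs ++ ys) ≡ encs c xs ++ encs c ys
    encs-++ []       ys = refl
    encs-++ (x ∷ xs) ys = trans (cong (enc c x ++_) (encs-++ xs ys)) (sym (List.++-assoc (enc c x) _ _))

    uncons : ∀ xs {x s} → encs c xs ≡ enc c x ++ s → ∃[ xs′ ] xs ≡ x ∷ xs′ × s ≡ encs c xs′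
    uncons [] {x} eq with head c x
    ... | l , w , e , _ with trans eq (cong (_++ _) e)
    ... | ()
    uncons (y ∷ ys) {x} eq with prefix c y x eq
    ... | refl , refl = ys , refl , refl

    encs≡[] : ∀ xs → encs c xs ≡ [] → xs ≡ []
    encs≡[] [] _ = refl
    encs≡[] (x ∷ xs) eq with head c x
    ... | l , w , e , _ with trans (sym eq) (cong (_++ encs c xs) e)
    ... | ()

    -- Every code has at least one letter. A bound on a word thus also bounds the chain that scans
    -- it element by element.
    length≤encs : ∀ xs → length xs ≤ length (encs c xs)
    length≤encs [] = z≤n
    length≤encs (x ∷ xs) with head c x
    ... | l , w , e , _ = ℕ.≤-trans (s≤s (ℕ.≤-trans (length≤encs xs) (ℕ.m≤n+m _ (length w))))
          (ℕ.≤-reflexive (trans (cong (λ u → length u + length (encs c xs)) (sym e)) (sym (List.length-++ (enc c x)))))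

  unwrap : ∀ (u w : Letters) → ‹ ∷ u ++ [ › ] ≡ ‹ ∷ w ++ [ › ] → u ≡ w
  unwrap u w eq = List.++-cancelʳ [ › ] u w (List.∷-injectiveʳ eq)

  opaque

    is : Code X → Fin n → Fm n
    is (litC a _)   x = x ≜ [ 𝐥 a ]
    is bitC         x = (x ≜ [ 𝐥 𝟘 ]) ⩔ (x ≜ [ 𝐥 𝟙 ])
    is (tagC a _ c) x = ex (is c #0 ⩓ (suc x ≜ 𝐥 a ∷ 𝐯 #0 ∷ []))
    is (c ×C d)     x = ex (is c #0 ⩓ ex (is d #0 ⩓ (suc (suc x) ≜ 𝐯 #1 ∷ 𝐯 #0 ∷ [])))
    is (sumC c d _) x = is c x ⩔ is d x
    -- In the step of the chain `#0` is the code that is removed, `#1` what remains, and `#3` the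
    -- list before the removal.
    is (listC c)    x = ex (tc (ex (is c #0 ⩓ (#3 ≜ 𝐯 #0 ∷ 𝐯 #1 ∷ []))) [ 𝐯 #0 ] [] [] [] ⩓
                            (suc x ≜ 𝐥 ‹ ∷ 𝐯 #0 ∷ 𝐥 › ∷ []))

    is⁻ : (c : Code X) {x : Fin n} {ρ : Store n} → Sat ok (is c x) ρ → ∃[ a ] lookup ρ x ≡ enc c a
    is⁻ (litC a _) p         = tt , ≜⁻ p
    is⁻ bitC (left p)        = false , ≜⁻ p
    is⁻ bitC (right p)       = true , ≜⁻ p
    is⁻ (tagC a _ c) (word w _ (p & q)) with is⁻ c p
    ... | y , refl = y , ≜⁻ q
    is⁻ (c ×C d) (word w _ (p & word w′ _ (p′ & q))) with is⁻ c p | is⁻ d p′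
    ... | y , refl | y′ , refl = (y , y′) , ≜⁻ q
    is⁻ (sumC c d _) (left p)  = Product.map inj₁ (λ e → e) (is⁻ c p)
    is⁻ (sumC c d _) (right p) = Product.map inj₂ (λ e → e) (is⁻ d p)
    is⁻ {n = n} {ok} (listC c) {ρ = ρ} (word w _ (chain _ _ ch & q)) with go ch refl
      where
      go : ∀ {ℓ p q} → Chain ok (λ (x , y) (x′ , y′) →
             Sat ok (ex (is c #0 ⩓ (#3 ≜ 𝐯 #0 ∷ 𝐯 #1 ∷ []))) (x′ ∷ y′ ∷ x ∷ y ∷ w ∷ ρ)) ℓ p q →
           proj₁ q ≡ [] → ∃[ xs ] proj₁ p ≡ encs c xs
      go end eq = [] , eq
      go (link _ _ (word _ _ (p & e)) ch) eq with is⁻ c p | go ch eq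
      ... | x , refl | xs , refl = x ∷ xs , ≜⁻ e
    ... | xs , eq = xs , trans (≜⁻ q) (cong (λ w → ‹ ∷ w ++ [ › ]) (trans (sym (List.++-identityʳ w)) eq))

    is⁺ : (c : Code X) {x : Fin n} {ρ : Store n} (a : X) → lookup ρ x ≡ enc c a → length (enc c a) ≤ B → Sat (_≤ B) (is c x) ρ
    is⁺ (litC _ _) _    eq le = ≜⁺ eq
    is⁺ bitC false      eq le = left (≜⁺ eq)
    is⁺ bitC true       eq le = right (≜⁺ eq)
    is⁺ {B = B} (tagC _ _ c) a  eq le = word (enc c a) le′ (is⁺ c a refl le′ & ≜⁺ eq)
      where
      le′ : length (enc c a) ≤ B
      le′ = ℕ.≤-trans (ℕ.n≤1+n _) le
    is⁺ {B = B} (c ×C d) (a , b) eq le = word (enc c a) le₁ (is⁺ c a refl le₁ & word (enc d b) le₂ (is⁺ d b refl le₂ & ≜⁺ eq))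
      where
      le₁ : length (enc c a) ≤ B
      le₁ = fitˡ (enc c a) (enc d b) le
      le₂ : length (enc d b) ≤ B
      le₂ = fitʳ (enc c a) (enc d b) le
    is⁺ (sumC c d _) (inj₁ a) eq le = left (is⁺ c a eq le)
    is⁺ (sumC c d _) (inj₂ b) eq le = right (is⁺ d b eq le)
    is⁺ {n = n} {B} (listC c) {ρ = ρ} xs eq le =
      word (encs c xs) le′ (chain (length xs) (ℕ.≤-trans (length≤encs c xs) le′)
        (subst (λ w → Chain (_≤ B) (λ (x , y) (x′ , y′) →
             Sat (_≤ B) (ex (is c #0 ⩓ (#3 ≜ 𝐯 #0 ∷ 𝐯 #1 ∷ []))) (x′ ∷ y′ ∷ x ∷ y ∷ encs c xs ∷ ρ)) (length xs) (w , []) ([] , [])) (sym (List.++-identityʳ _)) (go xs le′)) & ≜⁺ eq)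
      where
      le′ : length (encs c xs) ≤ B
      le′ = fitˡ (encs c xs) _ (ℕ.≤-trans (ℕ.n≤1+n _) le)
      go : ∀ ys → length (encs c ys) ≤ B → Chain (_≤ B) (λ (x , y) (x′ , y′) →
             Sat (_≤ B) (ex (is c #0 ⩓ (#3 ≜ 𝐯 #0 ∷ 𝐯 #1 ∷ []))) (x′ ∷ y′ ∷ x ∷ y ∷ encs c xs ∷ ρ))
             (length ys) (encs c ys , []) ([] , [])
      go []       le = end
      go (y ∷ ys) le = link (fitʳ (enc c y) _ le) z≤n (word (enc c y) y≤ (is⁺ c y refl y≤ & ≜⁺ refl)) (go ys (fitʳ (enc c y) _ le))
        where
        y≤ : length (enc c y) ≤ B
        y≤ = fitˡ (enc c y) _ le

  some∶ : Code X → Fm (suc n) → Fm n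
  some∶ c φ = ex (is c #0 ⩓ φ)

  some∶⁻ : ∀ (c : Code X) {φ : Fm (suc n)} {ρ} → Sat ok (some∶ c φ) ρ → ∃[ a ] Sat ok φ (enc c a ∷ ρ)
  some∶⁻ {ok = ok} c {φ} {ρ} (word w _ (i & p)) = let a , eq = is⁻ c i in a , subst (λ w → Sat ok φ (w ∷ ρ)) eq p

  some∶ᵉ : ∀ {R : Set} (c : Code X) {φ : Fm (suc n)} {ρ} → Sat ok (some∶ c φ) ρ → (∀ a → Sat ok φ (enc c a ∷ ρ) → R) → R
  some∶ᵉ c p k = let a , q = some∶⁻ c p in k a q

  some∶⁺ : ∀ (c : Code X) {φ : Fm (suc n)} {ρ} a → length (enc c a) ≤ B → Sat (_≤ B) φ (enc c a ∷ ρ) → Sat (_≤ B) (some∶ c φ) ρ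
  some∶⁺ c a a≤ p = word (enc c a) a≤ (is⁺ c a refl a≤ & p)

  -- AllTo c φ a b: the list a of codes has the list b as a suffix, and the
  -- elements before b satisfy φ.  The four variables after the element are the
  -- states of tc.
  module _ (c : Code X) where

    AllTo : Fm (5 + n) → (a b : Expr n) → Fm n
    AllTo φ a b = tc (some∶ c ((#3′ ≜ 𝐯 #0 ∷ 𝐯 #1 ∷ []) ⩓ φ)) a [] b []
      where
      #3′ : Fin (5 + n)
      #3′ = suc (suc (suc zero))

    module _ {φ : Fm (5 + n)} {ρ : Store n} where

      private
        R : (ℕ → Set) → Letters × Letters → Letters × Letters → Set
        R ok (x , y) (x′ , y′) = Sat ok (some∶ c ((suc (suc (suc zero)) ≜ 𝐯 #0 ∷ 𝐯 #1 ∷ []) ⩓ φ)) (x′ ∷ y′ ∷ x ∷ y ∷ ρ)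

      allTo⁻ : ∀ {P : X → Set} a b xs → value⟦ a ⟧ ρ ≡ encs c xs →
               (∀ x (σ : Store 4) → Sat ok φ (enc c x ∷ (σ Vec.++ ρ)) → P x) →
               Sat ok (AllTo φ a b) ρ → ∃₂ λ us ws → xs ≡ us ++ ws × value⟦ b ⟧ ρ ≡ encs c ws × All P us
      allTo⁻ {ok} {P} a b xs eq φ⇒P (chain ℓ _ ch)
        with go xs ch (trans (eval-value a ρ) eq)
        where
        go : ∀ {ℓ p q} xs → Chain ok (R ok) ℓ p q → proj₁ p ≡ encs c xs →
             ∃₂ λ us ws → xs ≡ us ++ ws × proj₁ q ≡ encs c ws × All P us
        go xs end eq = [] , xs , refl , eq , []
        go xs (link {q = s , t} _ _ p ch) eq with some∶⁻ c p
        ... | x , e & p′ with uncons c xs (trans (sym eq) (≜⁻ e))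
        ... | xs′ , refl , refl with go xs′ ch refl
        ... | us , ws , refl , eq′ , Ps = x ∷ us , ws , refl , eq′ , φ⇒P x (_ ∷ _ ∷ _ ∷ _ ∷ []) p′ ∷ Ps
      ... | us , ws , eq₁ , eq₂ , Ps = us , ws , eq₁ , trans (sym (eval-value b ρ)) eq₂ , Ps

      allTo⁺ : ∀ a b us ws → value⟦ a ⟧ ρ ≡ encs c (us ++ ws) → value⟦ b ⟧ ρ ≡ encs c ws →
               length (encs c (us ++ ws)) ≤ B →
               All (λ x → length (enc c x) ≤ B → ∀ (σ : Store 4) → Sat (_≤ B) φ (enc c x ∷ (σ Vec.++ ρ))) us →
               Sat (_≤ B) (AllTo φ a b) ρ
      allTo⁺ {B} a b us ws eq eq′ le Ps = chain (length us)
          (ℕ.≤-trans (ℕ.≤-trans (ℕ.≤-trans (ℕ.m≤m+n _ _) (ℕ.≤-reflexive (sym (List.length-++ us)))) (length≤encs c (us ++ ws))) le)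
          (endpoints (trans (eval-value a ρ) eq) (trans (eval-value b ρ) eq′) (go us le Ps))
        where
        endpoints : ∀ {s s′ t t′ ℓ} → s ≡ t → s′ ≡ t′ → Chain (_≤ B) (R (_≤ B)) ℓ (t , []) (t′ , []) →
                 Chain (_≤ B) (R (_≤ B)) ℓ (s , []) (s′ , [])
        endpoints refl refl ch = ch
        go : ∀ us → length (encs c (us ++ ws)) ≤ B →
             All (λ x → length (enc c x) ≤ B → ∀ (σ : Store 4) → Sat (_≤ B) φ (enc c x ∷ (σ Vec.++ ρ))) us →
             Chain (_≤ B) (R (_≤ B)) (length us) (encs c (us ++ ws) , []) (encs c ws , [])
        go [] le [] = end
        go (x ∷ us) le (P ∷ Ps) = link (fitʳ (enc c x) _ le) z≤n
          (some∶⁺ c x (fitˡ (enc c x) _ le)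
            (≜⁺ refl & P (fitˡ (enc c x) _ le) (_ ∷ _ ∷ _ ∷ _ ∷ [])))
          (go us (fitʳ (enc c x) _ le) Ps)

    Every : Fm (5 + n) → Expr n → Fm n
    Every φ a = AllTo φ a []

    module _ {φ : Fm (5 + n)} {ρ : Store n} where

      every⁻ : ∀ {P : X → Set} a xs → value⟦ a ⟧ ρ ≡ encs c xs →
               (∀ x (σ : Store 4) → Sat ok φ (enc c x ∷ (σ Vec.++ ρ)) → P x) →
               Sat ok (Every φ a) ρ → All P xs
      every⁻ a xs eq φ⇒P p with allTo⁻ a [] xs eq φ⇒P p
      ... | us , ws , eq₁ , eq₂ , Ps with encs≡[] c ws (sym eq₂)
      ... | refl = subst (All _) (trans (sym (List.++-identityʳ us)) (sym eq₁)) Ps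

      every⁺ : ∀ a xs → value⟦ a ⟧ ρ ≡ encs c xs → length (encs c xs) ≤ B →
               All (λ x → length (enc c x) ≤ B → ∀ (σ : Store 4) → Sat (_≤ B) φ (enc c x ∷ (σ Vec.++ ρ))) xs →
               Sat (_≤ B) (Every φ a) ρ
      every⁺ {B} a xs eq le Ps = allTo⁺ a [] xs [] (trans eq (cong (encs c) (sym (List.++-identityʳ xs)))) refl
        (subst (λ ys → length (encs c ys) ≤ B) (sym (List.++-identityʳ xs)) le) Ps

    -- The element is found as the head of a suffix. For `φ` the variables are: `#0` the rest behind
    -- the element, `#1` the element, `#2` the suffix.
    Some : Fm (3 + n) → Expr n → Fm n
    Some φ a = ex (AllTo true′ (wk 1 a) [ 𝐯 #0 ] ⩓ some∶ c (ex ((#2 ≜ 𝐯 #1 ∷ 𝐯 #0 ∷ []) ⩓ φ)))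

    module _ {φ : Fm (3 + n)} {ρ : Store n} where

      value-wk : ∀ a {s} → value⟦ wk 1 a ⟧ (s ∷ ρ) ≡ value⟦ a ⟧ ρ
      value-wk a {s} = trans (sym (eval-value (wk 1 a) (s ∷ ρ))) (trans (eval-wk a (s ∷ []) ρ) (eval-value a ρ))

      some⁻∈ : ∀ a xs → value⟦ a ⟧ ρ ≡ encs c xs → Sat ok (Some φ a) ρ →
               ∃[ x ] x ∈ xs × ∃₂ λ s s′ → Sat ok φ (s′ ∷ enc c x ∷ s ∷ ρ)
      some⁻∈ a xs eq (word s _ (p & q)) with allTo⁻ {P = λ _ → ⊤} (wk 1 a) [ 𝐯 #0 ] xs (trans (value-wk a) eq) (λ _ _ _ → tt) p
      ... | us , ws , refl , eq′ , _ with some∶⁻ c q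
      ... | x , word s′ _ (e & r) with uncons c ws (trans (sym eq′) (≜⁻ e))
      ... | _ , refl , refl = x , ∈-middle us , s , s′ , r
        where
        ∈-middle : ∀ us {ws} → x ∈ us ++ x ∷ ws
        ∈-middle []       = here refl
        ∈-middle (_ ∷ us) = there (∈-middle us)

      some∈ᵉ : ∀ {R : Set} a xs → value⟦ a ⟧ ρ ≡ encs c xs → Sat ok (Some φ a) ρ →
               (∀ x → x ∈ xs → ∀ {s s′} → Sat ok φ (s′ ∷ enc c x ∷ s ∷ ρ) → R) → R
      some∈ᵉ a xs eq p k = let x , x∈ , _ , _ , q = some⁻∈ a xs eq p in k x x∈ q

      some⁺∈ : ∀ a xs {x} → value⟦ a ⟧ ρ ≡ encs c xs → length (encs c xs) ≤ B → x ∈ xs →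
               (length (enc c x) ≤ B → ∀ s s′ → Sat (_≤ B) φ (s′ ∷ enc c x ∷ s ∷ ρ)) → Sat (_≤ B) (Some φ a) ρ
      some⁺∈ {B} a xs {x} eq le x∈ p with split x∈
        where
        split : ∀ {xs} → x ∈ xs → ∃₂ λ us ws → xs ≡ us ++ x ∷ ws
        split {_ ∷ ws} (here refl) = [] , ws , refl
        split (there x∈) with split x∈
        ... | us , ws , refl = _ ∷ us , ws , refl
      ... | us , ws , refl = word (encs c (x ∷ ws)) tail≤
          (allTo⁺ (wk 1 a) [ 𝐯 #0 ] us (x ∷ ws) (trans (value-wk a) eq) refl le (All.universal (λ _ _ _ → same refl) us) &
           some∶⁺ c x x≤ (word (encs c ws) (fitʳ (enc c x) _ tail≤)
             (≜⁺ refl & p x≤ _ _)))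
        where
        tail≤ : length (encs c (x ∷ ws)) ≤ B
        tail≤ = fitʳ (encs c us) _ (subst (λ w → length w ≤ B) (encs-++ c us (x ∷ ws)) le)
        x≤ = fitˡ (enc c x) _ tail≤

  -- ZipTo c d φ a b a′ b′: the lists a and b have the suffixes a′ and b′, and
  -- the elements before them are paired by φ.
  module _ (c : Code X) (d : Code Y) where

    private
      step : Fm (6 + n) → Fm (4 + n)
      step φ = some∶ c (some∶ d ((suc (suc #2) ≜ 𝐯 #1 ∷ 𝐯 #2 ∷ []) ⩓ (suc (suc #3) ≜ 𝐯 #0 ∷ 𝐯 #3 ∷ []) ⩓ φ))

    ZipTo : Fm (6 + n) → (a b a′ b′ : Expr n) → Fm n
    ZipTo φ a b a′ b′ = tc (step φ) a b a′ b′

    module _ {φ : Fm (6 + n)} {ρ : Store n} where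

      private
        R : (ℕ → Set) → Letters × Letters → Letters × Letters → Set
        R ok (x , y) (x′ , y′) = Sat ok (step φ) (x′ ∷ y′ ∷ x ∷ y ∷ ρ)

      zipTo⁻ : ∀ {P : X → Y → Set} a b a′ b′ xs ys → value⟦ a ⟧ ρ ≡ encs c xs → value⟦ b ⟧ ρ ≡ encs d ys →
               (∀ x y (σ : Store 4) → Sat ok φ (enc d y ∷ enc c x ∷ (σ Vec.++ ρ)) → P x y) →
               Sat ok (ZipTo φ a b a′ b′) ρ →
               ∃₂ λ us ws → ∃₂ λ us′ ws′ → xs ≡ us ++ ws × ys ≡ us′ ++ ws′ ×
                 value⟦ a′ ⟧ ρ ≡ encs c ws × value⟦ b′ ⟧ ρ ≡ encs d ws′ × Pointwise P us us′
      zipTo⁻ {ok} {P} a b a′ b′ xs ys eq eq′ φ⇒P (chain _ _ ch)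
        with go xs ys ch (trans (eval-value a ρ) eq) (trans (eval-value b ρ) eq′)
        where
        go : ∀ {ℓ p q} xs ys → Chain ok (R ok) ℓ p q → proj₁ p ≡ encs c xs → proj₂ p ≡ encs d ys →
             ∃₂ λ us ws → ∃₂ λ us′ ws′ → xs ≡ us ++ ws × ys ≡ us′ ++ ws′ ×
               proj₁ q ≡ encs c ws × proj₂ q ≡ encs d ws′ × Pointwise P us us′
        go xs ys end eq eq′ = [] , xs , [] , ys , refl , refl , eq , eq′ , []
        go xs ys (link {q = s , t} _ _ p ch) eq eq′ with some∶⁻ c p
        ... | x , p′ with some∶⁻ d p′
        ... | y , e & e′ & r
          with uncons c xs (trans (sym eq) (≜⁻ e))
             | uncons d ys (trans (sym eq′) (≜⁻ e′))
        ... | xs′ , refl , refl | ys′ , refl , refl with go xs′ ys′ ch refl refl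
        ... | us , ws , us′ , ws′ , refl , refl , eq₁ , eq₂ , Ps =
          x ∷ us , ws , y ∷ us′ , ws′ , refl , refl , eq₁ , eq₂ , φ⇒P x y (_ ∷ _ ∷ _ ∷ _ ∷ []) r ∷ Ps
      ... | us , ws , us′ , ws′ , e₁ , e₂ , e₃ , e₄ , Ps =
        us , ws , us′ , ws′ , e₁ , e₂ , trans (sym (eval-value a′ ρ)) e₃ , trans (sym (eval-value b′ ρ)) e₄ , Ps

      zipTo⁺ : ∀ a b a′ b′ us ws us′ ws′ → value⟦ a ⟧ ρ ≡ encs c (us ++ ws) → value⟦ b ⟧ ρ ≡ encs d (us′ ++ ws′) →
               value⟦ a′ ⟧ ρ ≡ encs c ws → value⟦ b′ ⟧ ρ ≡ encs d ws′ →
               length (encs c (us ++ ws)) ≤ B → length (encs d (us′ ++ ws′)) ≤ B →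
               Pointwise (λ x y → length (enc c x) ≤ B → length (enc d y) ≤ B → ∀ (σ : Store 4) →
                           Sat (_≤ B) φ (enc d y ∷ enc c x ∷ (σ Vec.++ ρ))) us us′ →
               Sat (_≤ B) (ZipTo φ a b a′ b′) ρ
      zipTo⁺ {B} a b a′ b′ us ws us′ ws′ eq₁ eq₂ eq₃ eq₄ le le′ Ps = chain (length us)
          (ℕ.≤-trans (ℕ.≤-trans (ℕ.≤-trans (ℕ.m≤m+n _ _) (ℕ.≤-reflexive (sym (List.length-++ us)))) (length≤encs c (us ++ ws))) le)
          (subst₄ (trans (eval-value a ρ) eq₁) (trans (eval-value b ρ) eq₂)
                  (trans (eval-value a′ ρ) eq₃) (trans (eval-value b′ ρ) eq₄) (go us us′ le le′ Ps))
        where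
        subst₄ : ∀ {s s′ t t′ u u′ w w′ ℓ} → s ≡ t → s′ ≡ t′ → u ≡ w → u′ ≡ w′ →
                 Chain (_≤ B) (R (_≤ B)) ℓ (t , t′) (w , w′) → Chain (_≤ B) (R (_≤ B)) ℓ (s , s′) (u , u′)
        subst₄ refl refl refl refl ch = ch
        go : ∀ us us′ → length (encs c (us ++ ws)) ≤ B → length (encs d (us′ ++ ws′)) ≤ B →
             Pointwise (λ x y → length (enc c x) ≤ B → length (enc d y) ≤ B → ∀ (σ : Store 4) →
                           Sat (_≤ B) φ (enc d y ∷ enc c x ∷ (σ Vec.++ ρ))) us us′ →
             Chain (_≤ B) (R (_≤ B)) (length us) (encs c (us ++ ws) , encs d (us′ ++ ws′)) (encs c ws , encs d ws′)
        go [] [] _ _ [] = end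
        go (x ∷ us) (y ∷ us′) le le′ (P ∷ Ps) = link (fitʳ (enc c x) _ le) (fitʳ (enc d y) _ le′)
          (some∶⁺ c x x≤ (some∶⁺ d y y≤
            (≜⁺ refl & ≜⁺ refl &
             P x≤ y≤ (_ ∷ _ ∷ _ ∷ _ ∷ []))))
          (go us us′ (fitʳ (enc c x) _ le) (fitʳ (enc d y) _ le′) Ps)
          where
          x≤ = fitˡ (enc c x) _ le
          y≤ = fitˡ (enc d y) _ le′

    Zip : Fm (6 + n) → (a b : Expr n) → Fm n
    Zip φ a b = ZipTo φ a b [] []

    module _ {φ : Fm (6 + n)} {ρ : Store n} where

      zip⁻ : ∀ {P : X → Y → Set} a b xs ys → value⟦ a ⟧ ρ ≡ encs c xs → value⟦ b ⟧ ρ ≡ encs d ys →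
             (∀ x y (σ : Store 4) → Sat ok φ (enc d y ∷ enc c x ∷ (σ Vec.++ ρ)) → P x y) →
             Sat ok (Zip φ a b) ρ → Pointwise P xs ys
      zip⁻ a b xs ys eq eq′ φ⇒P p with zipTo⁻ a b [] [] xs ys eq eq′ φ⇒P p
      ... | us , ws , us′ , ws′ , refl , refl , e , e′ , Ps with encs≡[] c ws (sym e) | encs≡[] d ws′ (sym e′)
      ... | refl | refl = Pointwise.++⁺ Ps []

      zip⁺ : ∀ a b xs ys → value⟦ a ⟧ ρ ≡ encs c xs → value⟦ b ⟧ ρ ≡ encs d ys →
             length (encs c xs) ≤ B → length (encs d ys) ≤ B →
             Pointwise (λ x y → length (enc c x) ≤ B → length (enc d y) ≤ B → ∀ (σ : Store 4) →
                         Sat (_≤ B) φ (enc d y ∷ enc c x ∷ (σ Vec.++ ρ))) xs ys →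
             Sat (_≤ B) (Zip φ a b) ρ
      zip⁺ {B} a b xs ys eq eq′ le le′ Ps = zipTo⁺ a b [] [] xs [] ys []
        (trans eq (cong (encs c) (sym (List.++-identityʳ xs)))) (trans eq′ (cong (encs d) (sym (List.++-identityʳ ys)))) refl refl
        (subst (λ zs → length (encs c zs) ≤ B) (sym (List.++-identityʳ xs)) le)
        (subst (λ zs → length (encs d zs) ≤ B) (sym (List.++-identityʳ ys)) le′) Ps

  module _ (c : Code X) where

    -- Brackets delimit a list inside a larger word, but a chain has to consume bare codes. Here the
    -- brackets are removed.
    open∶ : Fin n → Fm (suc n) → Fm n
    open∶ x φ = ex ((suc x ≜ 𝐥 ‹ ∷ 𝐯 #0 ∷ 𝐥 › ∷ []) ⩓ φ)

    module _ {φ : Fm (suc n)} {ρ : Store n} where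

      open⁻ : ∀ x xs → lookup ρ x ≡ enc (listC c) xs → Sat ok (open∶ x φ) ρ → Sat ok φ (encs c xs ∷ ρ)
      open⁻ {ok} x xs eq (word w _ (p & q)) = subst (λ w → Sat ok φ (w ∷ ρ))
        (unwrap w (encs c xs) (trans (sym (≜⁻ p)) eq)) q

      open⁺ : ∀ x xs → lookup ρ x ≡ enc (listC c) xs → length (enc (listC c) xs) ≤ B →
              (length (encs c xs) ≤ B → Sat (_≤ B) φ (encs c xs ∷ ρ)) → Sat (_≤ B) (open∶ x φ) ρ
      open⁺ x xs eq le p = word (encs c xs) le′ (≜⁺ eq & p le′)
        where le′ = fitˡ (encs c xs) _ (ℕ.≤-trans (ℕ.n≤1+n _) le)

    -- Two variables are bound: `#0` is the content of the list and `#1` its code with brackets.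
    some∷ : Fm (2 + n) → Fm n
    some∷ φ = some∶ (listC c) (open∶ #0 φ)

    module _ {φ : Fm (2 + n)} {ρ : Store n} where

      some∷⁻ : Sat ok (some∷ φ) ρ → ∃[ xs ] Sat ok φ (encs c xs ∷ enc (listC c) xs ∷ ρ)
      some∷⁻ p with some∶⁻ (listC c) p
      ... | xs , q = xs , open⁻ #0 xs refl q

      some∷ᵉ : ∀ {R : Set} → Sat ok (some∷ φ) ρ → (∀ xs → Sat ok φ (encs c xs ∷ enc (listC c) xs ∷ ρ) → R) → R
      some∷ᵉ p k = let xs , q = some∷⁻ p in k xs q

      some∷⁺ : ∀ xs → length (enc (listC c) xs) ≤ B →
               (length (encs c xs) ≤ B → Sat (_≤ B) φ (encs c xs ∷ enc (listC c) xs ∷ ρ)) → Sat (_≤ B) (some∷ φ) ρ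
      some∷⁺ xs le p = some∶⁺ (listC c) xs le (open⁺ #0 xs refl le p)

  or : (Fin 4 → Fm n) → Fm n
  or φ = φ 𝟘 ⩔ φ 𝟙 ⩔ φ ‹ ⩔ φ ›

  or⁻ : ∀ {φ : Fin 4 → Fm n} {ρ} → Sat ok (or φ) ρ → ∃[ a ] Sat ok (φ a) ρ
  or⁻ (left p)                  = _ , p
  or⁻ (right (left p))          = _ , p
  or⁻ (right (right (left p)))  = _ , p
  or⁻ (right (right (right p))) = _ , p

  or⁺ : ∀ (φ : Fin 4 → Fm n) {ρ} a → Sat ok (φ a) ρ → Sat ok (or φ) ρ
  or⁺ φ 𝟘 p = left p
  or⁺ φ 𝟙 p = right (left p)
  or⁺ φ ‹ p = right (right (left p))
  or⁺ φ › p = right (right (right p))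

  ++-no-extension : ∀ (u : Letters) {a w} → u ≢ u ++ a ∷ w
  ++-no-extension (b ∷ u) eq = ++-no-extension u (List.∷-injectiveʳ eq)

  -- The logic lacks negation, so inequality of words needs positive witnesses: a common prefix
  -- followed by different letters, or one word extending the other.
  data Apart : Letters → Letters → Set where
    differing : ∀ p {a b u w} → a ≢ b → Apart (p ++ a ∷ u) (p ++ b ∷ w)
    shorter   : ∀ u {a w} → Apart u (u ++ a ∷ w)
    longer    : ∀ u {a w} → Apart (u ++ a ∷ w) u

  apart : ∀ u w → u ≢ w → Apart u w
  apart []      []      u≢w = contradiction refl u≢w
  apart []      (b ∷ w) _   = shorter []
  apart (a ∷ u) []      _   = longer []
  apart (a ∷ u) (b ∷ w) u≢w with a Fin.≟ b
  ... | no a≢b = differing [] a≢b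
  ... | yes refl with apart u w (λ eq → u≢w (cong (a ∷_) eq))
  ... | differing p ≢ = differing (a ∷ p) ≢
  ... | shorter _     = shorter (a ∷ u)
  ... | longer _      = longer (a ∷ w)

  opaque

    differ : (a b : Fin 4) → Fin n → Fin n → Fm (3 + n)
    differ a b x y with a Fin.≟ b
    -- The disjunction in `Neq` runs over all pairs of letters; equal letters get an unsatisfiable
    -- formula.
    ... | yes _ = [] ≐ [ 𝐥 𝟘 ]
    ... | no _  = (suc (suc (suc x)) ≜ 𝐯 #2 ∷ 𝐥 a ∷ 𝐯 #1 ∷ []) ⩓ (suc (suc (suc y)) ≜ 𝐯 #2 ∷ 𝐥 b ∷ 𝐯 #0 ∷ [])

    Extends Neq : Fin n → Fin n → Fm n
    Extends x y = ex (or λ a → suc y ≜ 𝐯 (suc x) ∷ 𝐥 a ∷ 𝐯 #0 ∷ [])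
    Neq x y = ex (ex (ex (or λ a → or λ b → differ a b x y))) ⩔ Extends x y ⩔ Extends y x

    neq⁻ : ∀ (x y : Fin n) {ρ} → Sat ok (Neq x y) ρ → lookup ρ x ≢ lookup ρ y
    neq⁻ x y (left (word s _ (word r _ (word p _ sat)))) eq with or⁻ {φ = λ a → or λ b → differ a b x y} sat
    ... | a , sat′ with or⁻ {φ = λ b → differ a b x y} sat′
    ... | b , sat″ with a Fin.≟ b
    neq⁻ x y (left (word s _ (word r _ (word p _ sat)))) eq | a , sat′ | b , same () | yes _
    neq⁻ x y (left (word s _ (word r _ (word p _ sat)))) eq | a , sat′ | b , (e & e′) | no a≢b =
      a≢b (List.∷-injectiveˡ (List.++-cancelˡ s _ _ (trans (sym (≜⁻ e))
        (trans eq (≜⁻ e′)))))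
    neq⁻ x y {ρ} (right (left (word w _ sat))) eq with or⁻ {φ = λ a → suc y ≜ 𝐯 (suc x) ∷ 𝐥 a ∷ 𝐯 #0 ∷ []} sat
    ... | a , e = ++-no-extension (lookup ρ x) (trans eq (≜⁻ e))
    neq⁻ x y {ρ} (right (right (word w _ sat))) eq with or⁻ {φ = λ a → suc x ≜ 𝐯 (suc y) ∷ 𝐥 a ∷ 𝐯 #0 ∷ []} sat
    ... | a , e = ++-no-extension (lookup ρ y) (trans (sym eq) (≜⁻ e))

    neq⁺ : ∀ (x y : Fin n) {ρ u w} → lookup ρ x ≡ u → lookup ρ y ≡ w → u ≢ w →
           length u ≤ B → length w ≤ B → Sat (_≤ B) (Neq x y) ρ
    neq⁺ {B = B} x y {ρ} {u} {w} eq eq′ u≢w u≤ w≤ with apart u w u≢w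
    ... | differing p {a} {b} {u} {w} a≢b = left (word p (fitˡ p _ u≤) (word u (tail u≤) (word w (tail w≤)
          (or⁺ (λ a → or λ b → differ a b x y) a (or⁺ (λ b → differ a b x y) b sat)))))
      where
      tail : ∀ {a w} → length (p ++ a ∷ w) ≤ B → length w ≤ B
      tail le = ℕ.≤-trans (ℕ.n≤1+n _) (fitʳ p _ le)
      sat : Sat (_≤ B) (differ a b x y) (w ∷ u ∷ p ∷ ρ)
      sat with a Fin.≟ b
      ... | yes a≡b = contradiction a≡b a≢b
      ... | no _ = ≜⁺ eq & ≜⁺ eq′
    ... | shorter u {a} {w} = right (left (word w (ℕ.≤-trans (ℕ.n≤1+n _) (fitʳ u _ w≤))
          (or⁺ (λ a → suc y ≜ 𝐯 (suc x) ∷ 𝐥 a ∷ 𝐯 #0 ∷ []) a (≜⁺ (trans eq′ (cong (_++ a ∷ w) (sym eq)))))))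
    ... | longer w {a} {u} = right (right (word u (ℕ.≤-trans (ℕ.n≤1+n _) (fitʳ w _ u≤))
          (or⁺ (λ a → suc x ≜ 𝐯 (suc y) ∷ 𝐥 a ∷ 𝐯 #0 ∷ []) a (≜⁺ (trans eq (cong (_++ a ∷ u) (sym eq′)))))))

open Codes

-- Coded syntax, environments and the evaluation of terms

module RawSyntax where

  private variable
    n : ℕ
    ok : ℕ → Set
    B : ℕ
    ρ : Store n

  -- Raw syntax, without reference to a signature

  RConst RTerm RPred RFact RVal RAtom RLit RLeaf RBinder Chunk : Set
  RConst  = Word ⊎ Word
  RTerm   = Var ⊎ RConst
  RPred   = Word × (⊤ ⊎ Word)
  RFact   = RPred × List Word
  -- A fact used as a value stands for its identifier. Different facts then have different
  -- identifiers automatically, and `id` need not be guessed. The arguments of a fact are bare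
  -- words, since datasets contain no identifiers.
  RVal    = RConst ⊎ RFact
  RAtom   = RPred × List RTerm
  RLit    = RAtom ⊎ (RTerm × RTerm)
  RLeaf   = (RAtom ⊎ (Var × RAtom)) ⊎ (Var × RTerm)
  RBinder = ⊤ ⊎ Var
  -- Rules are flattened into one list of tokens: a header with the two distinguished variables,
  -- then the body in prefix notation. Nested bodies would need a recursive code, while a list of
  -- tokens can be scanned by a chain.
  Chunk   = (RLeaf ⊎ RBinder) ⊎ (Var × Var)

  pattern idn w    = inj₁ w
  pattern vlu w    = inj₂ w
  pattern val w    = inj₁ (vlu w)
  pattern fid f    = inj₂ f
  pattern plain    = inj₁ tt
  pattern metaAt b = inj₂ b
  pattern rrel α    = inj₁ α
  pattern rneq s t  = inj₂ (s , t)
  pattern lrel α    = inj₁ (inj₁ α)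
  pattern lidEq x α = inj₁ (inj₂ (x , α))
  pattern lneq x t  = inj₂ (x , t)
  pattern leaf l    = inj₁ (inj₁ l)
  pattern and       = inj₁ (inj₂ (inj₁ tt))
  pattern exq x     = inj₁ (inj₂ (inj₂ x))
  pattern header x y = inj₂ (x , y)

  RConstraint : Set
  RConstraint = List RLit

  Env : Set
  Env = List (Var × RVal)

  wordC : Code Word
  wordC = listC bitC

  constC : Code RConst
  constC = sumC (tagC 𝟘 (λ ()) wordC) (tagC 𝟙 (λ ()) wordC) λ _ _ ()

  termC : Code RTerm
  termC = sumC (tagC 𝟘 (λ ()) wordC) (tagC 𝟙 (λ ()) constC) λ _ _ ()

  predC : Code RPred
  predC = wordC ×C sumC (litC 𝟘 λ ()) (tagC 𝟙 (λ ()) wordC) λ _ _ ()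

  -- With this tag the code of an argument `w` is also the code of the value `val w`, so that the
  -- formulas for values apply to arguments of facts directly.
  argC : Code Word
  argC = tagC 𝟙 (λ ()) wordC

  factC : Code RFact
  factC = predC ×C listC argC

  valC : Code RVal
  valC = sumC constC factC λ { (inj₁ _) _ () ; (inj₂ _) _ () }

  atomC : Code RAtom
  atomC = predC ×C listC termC

  literalC : Code RLit
  literalC = sumC (tagC 𝟘 (λ ()) atomC) (tagC 𝟙 (λ ()) (termC ×C termC)) λ _ _ ()

  constraintC : Code RConstraint
  constraintC = listC literalC

  leafC : Code RLeaf
  leafC = sumC (tagC 𝟘 (λ ()) (sumC (tagC 𝟘 (λ ()) atomC) (tagC 𝟙 (λ ()) (wordC ×C atomC)) (λ _ _ ())))
               (tagC 𝟙 (λ ()) (tagC 𝟘 (λ ()) (wordC ×C termC))) λ _ _ ()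

  binderC : Code RBinder
  binderC = tagC 𝟙 (λ ()) (tagC 𝟙 (λ ()) (sumC (litC 𝟘 λ ()) (tagC 𝟙 (λ ()) wordC) λ _ _ ()))

  -- A header starts with an opening bracket and every other chunk with a bit. This tells rules
  -- apart without any separator.
  chunkC : Code Chunk
  chunkC = sumC (sumC leafC binderC λ { (lrel _) _ () ; (lidEq _ _) _ () ; (lneq _ _) _ () }) (wordC ×C wordC)
                λ { (inj₁ (lrel _)) _ () ; (inj₁ (lidEq _ _)) _ () ; (inj₁ (lneq _ _)) _ ()
                  ; (inj₂ (inj₁ _)) _ () ; (inj₂ (inj₂ _)) _ () }

  entryC : Code (Var × RVal)
  entryC = wordC ×C valC

  envC : Code Env
  envC = listC entryC

  -- Evaluation of terms in environments

  data Look : Env → Var → RVal → Set where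
    here  : ∀ {E x u} → Look ((x , u) ∷ E) x u
    there : ∀ {E x u y t} → x ≢ y → Look E x u → Look ((y , t) ∷ E) x u

  look-split : ∀ {E x u} → Look E x u → ∃₂ λ us ws → E ≡ us ++ (x , u) ∷ ws × All (λ e → proj₁ e ≢ x) us
  look-split here = [] , _ , refl , []
  look-split (there x≢y l) with look-split l
  ... | us , ws , refl , Ps = _ ∷ us , ws , refl , (x≢y ∘ sym) ∷ Ps

  look-join : ∀ us {ws x u} → All (λ e → proj₁ e ≢ x) us → Look (us ++ (x , u) ∷ ws) x u
  look-join []       []       = here
  look-join (_ ∷ us) (≢ ∷ Ps) = there (≢ ∘ sym) (look-join us Ps)

  look-fits : ∀ {E x u} → Look E x u → length (encs entryC E) ≤ B → length (enc wordC x) ≤ B × length (enc valC u) ≤ B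
  look-fits {E = (x , u) ∷ E} here le =
    let le′ = fitˡ (enc entryC (x , u)) (encs entryC E) le in fitˡ (enc wordC x) _ le′ , fitʳ (enc wordC x) _ le′
  look-fits {E = e ∷ E} (there _ l) le = look-fits l (fitʳ (enc entryC e) (encs entryC E) le)

  opaque

    OtherKey : Fin n → Fm (6 + n)
    OtherKey x = some∶ wordC (some∶ valC ((#2 ≜ 𝐯 #1 ∷ 𝐯 #0 ∷ []) ⩓ Neq #1 (8 ↑ʳ x)))

    Lookᶠ : (e x u : Fin n) → Fm n
    Lookᶠ e x u = ex (AllTo entryC (OtherKey x) [ 𝐯 (1 ↑ʳ e) ] [ 𝐯 #0 ] ⩓ ex (#1 ≜ 𝐯 (2 ↑ʳ x) ∷ 𝐯 (2 ↑ʳ u) ∷ 𝐯 #0 ∷ []))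

    look⁻ : ∀ {e x u : Fin n} {E X U} → lookup ρ e ≡ encs entryC E → lookup ρ x ≡ enc wordC X → lookup ρ u ≡ enc valC U →
            Sat ok (Lookᶠ e x u) ρ → Look E X U
    look⁻ {ρ = ρ} {ok} {x = x} {E = E} {X} {U} e≡ x≡ u≡ (word s _ (p & word s′ _ q))
      with allTo⁻ entryC {P = λ e → proj₁ e ≢ X} _ _ E e≡ skipped p
      where
      skipped : ∀ y (σ : Store 4) → Sat ok (OtherKey x) (enc entryC y ∷ (σ Vec.++ (s ∷ ρ))) → proj₁ y ≢ X
      skipped y (_ ∷ _ ∷ _ ∷ _ ∷ []) r with some∶⁻ wordC r
      ... | x′ , r′ with some∶⁻ valC r′
      ... | u′ , e & nq with enc-injective entryC {y} {x′ , u′} (≜⁻ e)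
      ... | refl = λ { refl → neq⁻ _ _ nq (sym x≡) }
    ... | us , ws , refl , eq , Ps
      with uncons entryC ws {X , U} {s′} (trans (sym eq) (trans (≜⁻ q)
             (trans (cong₂ (λ a b → a ++ b ++ s′) x≡ u≡) (sym (List.++-assoc (enc wordC X) (enc valC U) s′)))))
    ... | ws′ , refl , _ = look-join us Ps

    look⁺ : ∀ {e x u : Fin n} {E X U} → lookup ρ e ≡ encs entryC E → lookup ρ x ≡ enc wordC X → lookup ρ u ≡ enc valC U →
            length (encs entryC E) ≤ B → Look E X U → Sat (_≤ B) (Lookᶠ e x u) ρ
    look⁺ {n} {ρ} {B} {x = x} {X = X} {U} e≡ x≡ u≡ le l with look-fits l le | look-split l
    ... | X≤ , _ | us , ws , refl , Ps = word (encs entryC ((X , U) ∷ ws)) s≤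
        (allTo⁺ entryC _ _ us ((X , U) ∷ ws) e≡ refl le (All.map (λ {y} → skipped y) Ps) &
         word (encs entryC ws) (fitʳ (enc entryC (X , U)) _ s≤)
           (≜⁺ (trans (List.++-assoc (enc wordC X) (enc valC U) _)
                      (cong₂ (λ a b → a ++ b ++ encs entryC ws) (sym x≡) (sym u≡)))))
      where
      s≤ : length (encs entryC ((X , U) ∷ ws)) ≤ B
      s≤ = fitʳ (encs entryC us) _ (subst (λ w → length w ≤ B) (encs-++ entryC us ((X , U) ∷ ws)) le)
      skipped : ∀ y → proj₁ y ≢ X → length (enc entryC y) ≤ B → ∀ (σ : Store 4) →
                Sat (_≤ B) (OtherKey x) (enc entryC y ∷ (σ Vec.++ (encs entryC ((X , U) ∷ ws) ∷ ρ)))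
      skipped (y , t) ≢ y≤ (_ ∷ _ ∷ _ ∷ _ ∷ []) =
        some∶⁺ wordC y (fitˡ (enc wordC y) _ y≤) (some∶⁺ valC t (fitʳ (enc wordC y) _ y≤)
          (≜⁺ refl & neq⁺ _ _ refl x≡ (≢ ∘ enc-injective wordC) (fitˡ (enc wordC y) _ y≤) X≤))

  Value : Env → RTerm → RVal → Set
  Value E (inj₁ x) u = Look E x u
  Value E (inj₂ c) u = u ≡ inj₁ c

  value-fits : ∀ {E} T {U} → Value E T U → length (encs entryC E) ≤ B → length (enc termC T) ≤ B → length (enc valC U) ≤ B
  value-fits (inj₁ x) l    le _  = proj₂ (look-fits l le)
  value-fits (inj₂ c) refl le t≤ = ℕ.≤-trans (ℕ.n≤1+n _) t≤

  opaque

    -- The code of a constant term is one letter followed by the code of the constant as a value, so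
    -- the second disjunct needs no quantifier.
    Valueᶠ : (e t u : Fin n) → Fm n
    Valueᶠ e t u = some∶ wordC ((1 ↑ʳ t ≜ 𝐥 𝟘 ∷ 𝐯 #0 ∷ []) ⩓ Lookᶠ (1 ↑ʳ e) #0 (1 ↑ʳ u)) ⩔ (t ≜ 𝐥 𝟙 ∷ 𝐯 u ∷ [])

    value⁻ : ∀ {e t u : Fin n} {E T U} → lookup ρ e ≡ encs entryC E → lookup ρ t ≡ enc termC T → lookup ρ u ≡ enc valC U →
             Sat ok (Valueᶠ e t u) ρ → Value E T U
    value⁻ {T = T} e≡ t≡ u≡ (left p) with some∶⁻ wordC p
    ... | x , eq & q with enc-injective termC {T} {inj₁ x} (trans (sym t≡) (≜⁻ eq))
    ... | refl = look⁻ e≡ refl u≡ q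
    value⁻ {T = inj₁ x} e≡ t≡ u≡ (right q) with trans (sym t≡) (≜⁻ q)
    ... | ()
    value⁻ {T = inj₂ c} {U} e≡ t≡ u≡ (right q) =
      enc-injective valC {U} {inj₁ c} (trans (sym u≡) (sym (List.∷-injectiveʳ (trans (sym t≡) (≜⁻ q)))))

    value⁺ : ∀ {e t u : Fin n} {E T U} → lookup ρ e ≡ encs entryC E → lookup ρ t ≡ enc termC T → lookup ρ u ≡ enc valC U →
             length (encs entryC E) ≤ B → Value E T U → Sat (_≤ B) (Valueᶠ e t u) ρ
    value⁺ {T = inj₁ x} e≡ t≡ u≡ le l = left (some∶⁺ wordC x (proj₁ (look-fits l le)) (≜⁺ t≡ & look⁺ e≡ refl u≡ le l))
    value⁺ {T = inj₂ c} e≡ t≡ u≡ le refl = right (≜⁺ (trans t≡ (cong (𝟙 ∷_) (sym u≡))))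

  Values : Env → List RTerm → List Word → Set
  Values E = Pointwise λ t w → Value E t (val w)

  opaque

    Valuesᶠ : (e ts ws : Fin n) → Fm n
    Valuesᶠ e ts ws = Zip termC argC (Valueᶠ (6 ↑ʳ e) #1 #0) [ 𝐯 ts ] [ 𝐯 ws ]

    values⁻ : ∀ {e ts ws : Fin n} {E Ts Ws} → lookup ρ e ≡ encs entryC E → lookup ρ ts ≡ encs termC Ts →
              lookup ρ ws ≡ encs argC Ws → Sat ok (Valuesᶠ e ts ws) ρ → Values E Ts Ws
    values⁻ e≡ ts≡ ws≡ p =
      zip⁻ termC argC _ _ _ _ ts≡ ws≡ (λ { t w (_ ∷ _ ∷ _ ∷ _ ∷ []) q → value⁻ e≡ refl refl q }) p

    values⁺ : ∀ {e ts ws : Fin n} {E Ts Ws} → lookup ρ e ≡ encs entryC E → lookup ρ ts ≡ encs termC Ts →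
              lookup ρ ws ≡ encs argC Ws → length (encs entryC E) ≤ B → length (encs termC Ts) ≤ B →
              length (encs argC Ws) ≤ B → Values E Ts Ws → Sat (_≤ B) (Valuesᶠ e ts ws) ρ
    values⁺ e≡ ts≡ ws≡ e≤ ts≤ ws≤ Vs = zip⁺ termC argC _ _ _ _ ts≡ ws≡ ts≤ ws≤
      (Pointwise.map (λ { q _ _ (_ ∷ _ ∷ _ ∷ _ ∷ []) → value⁺ e≡ refl refl e≤ q }) Vs)

  isId : RVal → Bool
  isId (inj₁ (idn _)) = true
  isId (val _)        = false
  isId (fid _)        = true

  Sorts : Env → List RTerm → List Bool → Set
  Sorts E = Pointwise λ t b → ∃[ u ] Value E t u × isId u ≡ b

  opaque

    Sortᶠ : (u b : Fin n) → Fm n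
    Sortᶠ u b = ((b ≜ [ 𝐥 𝟙 ]) ⩓ (some∶ wordC (1 ↑ʳ u ≜ 𝐥 𝟘 ∷ 𝐯 #0 ∷ []) ⩔ is factC u))
              ⩔ ((b ≜ [ 𝐥 𝟘 ]) ⩓ is argC u)

    sort⁻ : ∀ {u b : Fin n} {U b′} → lookup ρ u ≡ enc valC U → lookup ρ b ≡ enc bitC b′ →
            Sat ok (Sortᶠ u b) ρ → isId U ≡ b′
    sort⁻ {b′ = false} u≡ b≡ (left (e & _)) with trans (sym b≡) (≜⁻ e)
    ... | ()
    sort⁻ {U = U} {true} u≡ b≡ (left (_ & left p)) with some∶⁻ wordC p
    ... | w , e with enc-injective valC {U} {inj₁ (idn w)} (trans (sym u≡) (≜⁻ e))
    ... | refl = refl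
    sort⁻ {u = u} {U = U} {true} u≡ b≡ (left (_ & right p)) with is⁻ factC p
    ... | f , e with enc-injective valC {U} {fid f} (trans (sym u≡) e)
    ... | refl = refl
    sort⁻ {b′ = true} u≡ b≡ (right (e & _)) with trans (sym b≡) (≜⁻ e)
    ... | ()
    sort⁻ {u = u} {U = U} {false} u≡ b≡ (right (_ & p)) with is⁻ argC p
    ... | w , e with enc-injective valC {U} {val w} (trans (sym u≡) e)
    ... | refl = refl

    sort⁺ : ∀ {u b : Fin n} {U} → lookup ρ u ≡ enc valC U → lookup ρ b ≡ enc bitC (isId U) →
            length (enc valC U) ≤ B → Sat (_≤ B) (Sortᶠ u b) ρ
    sort⁺ {U = inj₁ (idn w)} u≡ b≡ le = left (≜⁺ b≡ & left (some∶⁺ wordC w (ℕ.≤-trans (ℕ.n≤1+n _) le) (≜⁺ u≡)))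
    sort⁺ {u = u} {U = fid f} u≡ b≡ le = left (≜⁺ b≡ & right (is⁺ factC f u≡ le))
    sort⁺ {u = u} {U = val w} u≡ b≡ le = right (≜⁺ b≡ & is⁺ argC w u≡ le)

  opaque

    Sortsᶠ : (e ts bs : Fin n) → Fm n
    Sortsᶠ e ts bs = Zip termC bitC (some∶ valC (Valueᶠ (7 ↑ʳ e) #2 #0 ⩓ Sortᶠ #0 #1)) [ 𝐯 ts ] [ 𝐯 bs ]

    sorts⁻ : ∀ {e ts bs : Fin n} {E Ts Bs} → lookup ρ e ≡ encs entryC E → lookup ρ ts ≡ encs termC Ts →
             lookup ρ bs ≡ encs bitC Bs → Sat ok (Sortsᶠ e ts bs) ρ → Sorts E Ts Bs
    sorts⁻ e≡ ts≡ bs≡ p = zip⁻ termC bitC _ _ _ _ ts≡ bs≡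
      (λ { t b (_ ∷ _ ∷ _ ∷ _ ∷ []) q → case some∶⁻ valC q of λ
        { (u , r & r′) → u , value⁻ e≡ refl refl r , sort⁻ refl refl r′ } }) p

    sorts⁺ : ∀ {e ts bs : Fin n} {E Ts Bs} → lookup ρ e ≡ encs entryC E → lookup ρ ts ≡ encs termC Ts →
             lookup ρ bs ≡ encs bitC Bs → length (encs entryC E) ≤ B → length (encs termC Ts) ≤ B →
             length (encs bitC Bs) ≤ B → Sorts E Ts Bs → Sat (_≤ B) (Sortsᶠ e ts bs) ρ
    sorts⁺ e≡ ts≡ bs≡ e≤ ts≤ bs≤ Ss = zip⁺ termC bitC _ _ _ _ ts≡ bs≡ ts≤ bs≤
      (Pointwise.map (λ { {t} (u , q , refl) t≤ _ (_ ∷ _ ∷ _ ∷ _ ∷ []) →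
         let u≤ = value-fits t q e≤ t≤ in some∶⁺ valC u u≤ (value⁺ e≡ refl refl e≤ q & sort⁺ {U = u} refl refl u≤) }) Ss)

open RawSyntax

-- Truth of rule bodies and violation of constraints

module Conditions where

  private variable
    n : ℕ
    ok : ℕ → Set
    B : ℕ
    ρ : Store n

  -- What remains of an atom when facts and metafacts may be added at will. An atom over an ordinary
  -- predicate only asks that its arguments are no identifiers, and an atom over a metadata
  -- predicate only that identifiers stand exactly at the identifier positions. Positivity makes
  -- such additions harmless.
  LeafHolds : Env → RLeaf → Set
  LeafHolds E (lrel ((_ , plain) , ts))     = All (λ t → ∃[ w ] Value E t (val w)) ts
  LeafHolds E (lrel ((_ , metaAt bs) , ts)) = Sorts E ts bs
  LeafHolds E (lidEq x (p , ts))            = ∃[ ws ] Values E ts ws × Look E x (fid (p , ws))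
  LeafHolds E (lneq x t)                    = ∃₂ λ u u′ → Look E x u × Value E t u′ × u ≢ u′

  predArgs-fit : ∀ {X} (c : Code X) p xs → length (enc predC p ++ enc (listC c) xs) ≤ B →
                 length (enc predC p) ≤ B × length (enc (listC c) xs) ≤ B × length (encs c xs) ≤ B
  predArgs-fit c p xs le = fitˡ (enc predC p) _ le , le′ , fitˡ (encs c xs) _ (ℕ.≤-trans (ℕ.n≤1+n _) le′)
    where le′ = fitʳ (enc predC p) _ le

  drop₁ : ∀ {m} → suc m ≤ B → m ≤ B
  drop₁ = ℕ.<⇒≤

  opaque

    Plainᶠ Metaᶠ : (e p ts : Fin n) → Fm n
    Plainᶠ e p ts = some∶ wordC ((1 ↑ʳ p ≜ 𝐯 #0 ∷ 𝐥 𝟘 ∷ []) ⩓ Every termC (some∶ argC (Valueᶠ (7 ↑ʳ e) #1 #0)) [ 𝐯 (1 ↑ʳ ts) ])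
    Metaᶠ e p ts  = some∶ wordC (some∷ bitC ((3 ↑ʳ p ≜ 𝐯 #2 ∷ 𝐥 𝟙 ∷ 𝐯 #1 ∷ []) ⩓ Sortsᶠ (3 ↑ʳ e) (3 ↑ʳ ts) #0))

    Relᶠ IdEqᶠ Neqᶠ Leafᶠ : (e l : Fin n) → Fm n
    Relᶠ e l = some∶ predC (some∷ termC ((3 ↑ʳ l ≜ 𝐥 𝟘 ∷ 𝐥 𝟘 ∷ 𝐯 #2 ∷ 𝐯 #1 ∷ []) ⩓
      (Plainᶠ (3 ↑ʳ e) #2 #0 ⩔ Metaᶠ (3 ↑ʳ e) #2 #0)))
    IdEqᶠ e l = some∶ wordC (some∶ predC (some∷ termC ((4 ↑ʳ l ≜ 𝐥 𝟘 ∷ 𝐥 𝟙 ∷ 𝐯 #3 ∷ 𝐯 #2 ∷ 𝐯 #1 ∷ []) ⩓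
      some∷ argC (Valuesᶠ (6 ↑ʳ e) #2 #0 ⩓ some∶ factC ((#0 ≜ 𝐯 #5 ∷ 𝐯 #2 ∷ []) ⩓ Lookᶠ (7 ↑ʳ e) #6 #0)))))
    Neqᶠ e l = some∶ wordC (some∶ termC ((2 ↑ʳ l ≜ 𝐥 𝟙 ∷ 𝐥 𝟘 ∷ 𝐯 #1 ∷ 𝐯 #0 ∷ []) ⩓
      some∶ valC (some∶ valC (Lookᶠ (4 ↑ʳ e) #3 #1 ⩓ Valueᶠ (4 ↑ʳ e) #2 #0 ⩓ Neq #1 #0))))
    Leafᶠ e l = Relᶠ e l ⩔ IdEqᶠ e l ⩔ Neqᶠ e l

    plain⁻ : ∀ {e p ts : Fin n} {E P Ts} → lookup ρ e ≡ encs entryC E → lookup ρ p ≡ enc predC P → lookup ρ ts ≡ encs termC Ts →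
             Sat ok (Plainᶠ e p ts) ρ → LeafHolds E (lrel (P , Ts))
    plain⁻ {E = E} {P} {Ts} e≡ p≡ ts≡ q = some∶ᵉ wordC q λ m q₁ →
      subst (λ P → LeafHolds E (lrel (P , Ts))) (sym (enc-injective predC {P} {m , plain} (trans (sym p≡) (≜⁻ (conjˡ q₁)))))
        (every⁻ termC _ Ts ts≡ (λ { t (_ ∷ _ ∷ _ ∷ _ ∷ []) r → some∶ᵉ argC r λ w r′ → w , value⁻ e≡ refl refl r′ }) (conjʳ q₁))

    meta⁻ : ∀ {e p ts : Fin n} {E P Ts} → lookup ρ e ≡ encs entryC E → lookup ρ p ≡ enc predC P → lookup ρ ts ≡ encs termC Ts →
            Sat ok (Metaᶠ e p ts) ρ → LeafHolds E (lrel (P , Ts))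
    meta⁻ {E = E} {P} {Ts} e≡ p≡ ts≡ q = some∶ᵉ wordC q λ m q₁ → some∷ᵉ bitC q₁ λ bs q₂ →
      subst (λ P → LeafHolds E (lrel (P , Ts))) (sym (enc-injective predC {P} {m , metaAt bs} (trans (sym p≡) (≜⁻ (conjˡ q₂)))))
        (sorts⁻ e≡ ts≡ refl (conjʳ q₂))

    rel⁻ : ∀ {e l : Fin n} {E L} → lookup ρ e ≡ encs entryC E → lookup ρ l ≡ enc leafC L → Sat ok (Relᶠ e l) ρ → LeafHolds E L
    rel⁻ {E = E} {L} e≡ l≡ p = some∶ᵉ predC p λ P p₁ → some∷ᵉ termC p₁ λ Ts p₂ →
      subst (LeafHolds E) (sym (enc-injective leafC {L} {lrel (P , Ts)} (trans (sym l≡) (≜⁻ (conjˡ p₂)))))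
        (disj (plain⁻ e≡ refl refl) (meta⁻ e≡ refl refl) (conjʳ p₂))

    idEq⁻ : ∀ {e l : Fin n} {E L} → lookup ρ e ≡ encs entryC E → lookup ρ l ≡ enc leafC L → Sat ok (IdEqᶠ e l) ρ → LeafHolds E L
    idEq⁻ {E = E} {L} e≡ l≡ p = some∶ᵉ wordC p λ x p₁ → some∶ᵉ predC p₁ λ P p₂ → some∷ᵉ termC p₂ λ Ts p₃ →
      subst (LeafHolds E) (sym (enc-injective leafC {L} {lidEq x (P , Ts)} (trans (sym l≡) (≜⁻ (conjˡ p₃)))))
        (some∷ᵉ argC (conjʳ p₃) λ Ws q → some∶ᵉ factC (conjʳ q) λ f r →
          Ws , values⁻ e≡ refl refl (conjˡ q) ,
          subst (λ f → Look E x (fid f)) (enc-injective factC {f} {P , Ws} (≜⁻ (conjˡ r))) (look⁻ e≡ refl refl (conjʳ r)))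

    neqLeaf⁻ : ∀ {e l : Fin n} {E L} → lookup ρ e ≡ encs entryC E → lookup ρ l ≡ enc leafC L → Sat ok (Neqᶠ e l) ρ → LeafHolds E L
    neqLeaf⁻ {E = E} {L} e≡ l≡ p = some∶ᵉ wordC p λ x p₁ → some∶ᵉ termC p₁ λ t p₂ →
      subst (LeafHolds E) (sym (enc-injective leafC {L} {lneq x t} (trans (sym l≡) (≜⁻ (conjˡ p₂)))))
        (some∶ᵉ valC (conjʳ p₂) λ u q → some∶ᵉ valC q λ u′ r →
          u , u′ , look⁻ e≡ refl refl (conjˡ r) , value⁻ e≡ refl refl (conjˡ (conjʳ r)) ,
          λ eq → neq⁻ _ _ (conjʳ (conjʳ r)) (cong (enc valC) eq))

    leaf⁻ : ∀ {e l : Fin n} {E L} → lookup ρ e ≡ encs entryC E → lookup ρ l ≡ enc leafC L → Sat ok (Leafᶠ e l) ρ → LeafHolds E L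
    leaf⁻ {L = L} e≡ l≡ = disj (rel⁻ {L = L} e≡ l≡) (disj (idEq⁻ {L = L} e≡ l≡) (neqLeaf⁻ {L = L} e≡ l≡))

    leaf⁺ : ∀ {e l : Fin n} {E L} → lookup ρ e ≡ encs entryC E → lookup ρ l ≡ enc leafC L →
            length (encs entryC E) ≤ B → length (enc leafC L) ≤ B → LeafHolds E L → Sat (_≤ B) (Leafᶠ e l) ρ
    leaf⁺ {B = B} {E = E} {lrel ((n , plain) , Ts)} e≡ l≡ e≤ l≤ holds =
      left (some∶⁺ predC (n , plain) p≤ (some∷⁺ termC Ts T≤ λ i≤ → ≜⁺ l≡ & left
        (some∶⁺ wordC n (fitˡ (enc wordC n) _ p≤) (≜⁺ refl & every⁺ termC _ Ts refl i≤ (All.map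
          (λ { {t} (w , q) t≤ (_ ∷ _ ∷ _ ∷ _ ∷ []) →
               some∶⁺ argC w (value-fits t q e≤ t≤) (value⁺ e≡ refl refl e≤ q) }) holds)))))
      where
      p≤ : length (enc predC (n , plain)) ≤ B
      p≤ = proj₁ (predArgs-fit termC (n , plain) Ts (drop₁ (drop₁ l≤)))
      T≤ : length (enc (listC termC) Ts) ≤ B
      T≤ = proj₁ (proj₂ (predArgs-fit termC (n , plain) Ts (drop₁ (drop₁ l≤))))
    leaf⁺ {B = B} {E = E} {lrel ((n , metaAt bs) , Ts)} e≡ l≡ e≤ l≤ holds =
      left (some∶⁺ predC (n , metaAt bs) p≤ (some∷⁺ termC Ts T≤ λ i≤ → ≜⁺ l≡ & right
        (some∶⁺ wordC n (fitˡ (enc wordC n) _ p≤) (some∷⁺ bitC bs (drop₁ (fitʳ (enc wordC n) _ p≤)) λ b≤ →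
          ≜⁺ refl & sorts⁺ e≡ refl refl e≤ i≤ b≤ holds))))
      where
      p≤ : length (enc predC (n , metaAt bs)) ≤ B
      p≤ = proj₁ (predArgs-fit termC (n , metaAt bs) Ts (drop₁ (drop₁ l≤)))
      T≤ : length (enc (listC termC) Ts) ≤ B
      T≤ = proj₁ (proj₂ (predArgs-fit termC (n , metaAt bs) Ts (drop₁ (drop₁ l≤))))
    leaf⁺ {B = B} {E = E} {lidEq x (p , Ts)} e≡ l≡ e≤ l≤ (Ws , vs , lk) =
      right (left (some∶⁺ wordC x x≤ (some∶⁺ predC p p≤ (some∷⁺ termC Ts T≤ λ i≤ → ≜⁺ l≡ &
        some∷⁺ argC Ws W≤ λ j≤ → values⁺ e≡ refl refl e≤ i≤ j≤ vs &
          some∶⁺ factC (p , Ws) f≤ (≜⁺ refl & look⁺ e≡ refl refl e≤ lk)))))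
      where
      x≤ : length (enc wordC x) ≤ B
      x≤ = fitˡ (enc wordC x) _ (drop₁ (drop₁ l≤))
      p≤ : length (enc predC p) ≤ B
      p≤ = proj₁ (predArgs-fit termC p Ts (fitʳ (enc wordC x) _ (drop₁ (drop₁ l≤))))
      T≤ : length (enc (listC termC) Ts) ≤ B
      T≤ = proj₁ (proj₂ (predArgs-fit termC p Ts (fitʳ (enc wordC x) _ (drop₁ (drop₁ l≤)))))
      f≤ : length (enc factC (p , Ws)) ≤ B
      f≤ = proj₂ (look-fits lk e≤)
      W≤ : length (enc (listC argC) Ws) ≤ B
      W≤ = proj₁ (proj₂ (predArgs-fit argC p Ws f≤))
    leaf⁺ {B = B} {E = E} {lneq x t} e≡ l≡ e≤ l≤ (u , u′ , lk , vl , ≢) =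
      right (right (some∶⁺ wordC x x≤ (some∶⁺ termC t t≤ (≜⁺ l≡ & some∶⁺ valC u u≤ (some∶⁺ valC u′ u′≤
        (look⁺ e≡ refl refl e≤ lk & value⁺ e≡ refl refl e≤ vl & neq⁺ _ _ refl refl (≢ ∘ enc-injective valC) u≤ u′≤))))))
      where
      x≤ : length (enc wordC x) ≤ B
      x≤ = fitˡ (enc wordC x) _ (drop₁ (drop₁ l≤))
      t≤ : length (enc termC t) ≤ B
      t≤ = fitʳ (enc wordC x) _ (drop₁ (drop₁ l≤))
      u≤ : length (enc valC u) ≤ B
      u≤ = proj₂ (look-fits lk e≤)
      u′≤ : length (enc valC u′) ≤ B
      u′≤ = value-fits t vl e≤ t≤

  -- A formula in prefix notation is checked with a stack of environments, one
  -- for each subformula that is still to be read.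
  data Step : List Chunk × List Env → List Chunk × List Env → Set where
    onAnd  : ∀ {C E S} → Step (and ∷ C , E ∷ S) (C , E ∷ E ∷ S)
    onEx   : ∀ {C E S x} u → Step (exq x ∷ C , E ∷ S) (C , ((x , u) ∷ E) ∷ S)
    onLeaf : ∀ {C E S l} → LeafHolds E l → Step (leaf l ∷ C , E ∷ S) (C , S)

  -- Checking ends when no environment is left. Chunks of later rules may remain, so the end of a
  -- body needs no mark.
  data Exec : List Chunk × List Env → Set where
    done : ∀ {C} → Exec (C , [])
    _∷_  : ∀ {p q} → Step p q → Exec q → Exec p

  data ExecWithin (B : ℕ) : ℕ → List Chunk × List Env → Set where
    done : ∀ {C} → length (encs chunkC C) ≤ B → ExecWithin B 0 (C , [])
    step : ∀ {k C S q} → length (encs chunkC C) ≤ B → length (encs envC S) ≤ B →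
           Step (C , S) q → ExecWithin B k q → ExecWithin B (suc k) (C , S)

  Next : List Chunk → List Env → Letters → Letters → Set
  Next C 𝐄 cs s = ∃₂ λ C′ 𝐄′ → Step (C , 𝐄) (C′ , 𝐄′) × cs ≡ encs chunkC C′ × s ≡ encs envC 𝐄′

  next-state : ∀ C 𝐄 {c E cs s s′} (grow : List Env → List Env) → (∀ {C′ 𝐄′} → Step (c ∷ C′ , E ∷ 𝐄′) (C′ , grow 𝐄′)) →
               encs chunkC C ≡ enc chunkC c ++ cs → encs envC 𝐄 ≡ enc envC E ++ s →
               (∀ 𝐄′ → s ≡ encs envC 𝐄′ → s′ ≡ encs envC (grow 𝐄′)) → Next C 𝐄 cs s′
  next-state C 𝐄 {c} {E} grow st c≡ s≡ s′≡ with uncons chunkC C {c} c≡ | uncons envC 𝐄 {E} s≡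
  ... | C′ , refl , cs≡ | 𝐄′ , refl , eq = C′ , grow 𝐄′ , st , cs≡ , s′≡ 𝐄′ eq

  grow-env : ∀ x u E r → ‹ ∷ enc wordC x ++ enc valC u ++ encs entryC E ++ › ∷ r ≡ enc envC ((x , u) ∷ E) ++ r
  grow-env x u E r = cong (‹ ∷_) (begin
    enc wordC x ++ enc valC u ++ encs entryC E ++ › ∷ r ≡⟨ List.++-assoc (enc wordC x) (enc valC u) _ ⟨
    enc entryC (x , u) ++ encs entryC E ++ › ∷ r        ≡⟨ List.++-assoc (enc entryC (x , u)) (encs entryC E) _ ⟨
    encs entryC ((x , u) ∷ E) ++ › ∷ r                  ≡⟨ List.++-assoc (encs entryC ((x , u) ∷ E)) [ › ] r ⟨
    (encs entryC ((x , u) ∷ E) ++ [ › ]) ++ r           ∎)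
    where open ≡-Reasoning

  opaque

    -- As in every step of `tc`, `#0` and `#1` are the next chunks and stack, `#2` and `#3` the
    -- current ones; each `ex` or `some∶` inside shifts them by one, and each `some∷` by two.
    andStep exStep leafStep Stepᶠ : Fm (4 + n)
    andStep = (#2 ≜ 𝐥 𝟙 ∷ 𝐥 𝟙 ∷ 𝐥 𝟘 ∷ 𝐯 #0 ∷ []) ⩓
      some∶ envC (ex ((#5 ≜ 𝐯 #1 ∷ 𝐯 #0 ∷ []) ⩓ (#3 ≜ 𝐯 #1 ∷ 𝐯 #1 ∷ 𝐯 #0 ∷ [])))
    exStep = some∶ wordC (some∶ valC (some∷ entryC (ex (
      (#7 ≜ 𝐥 𝟙 ∷ 𝐥 𝟙 ∷ 𝐥 𝟙 ∷ 𝐯 #4 ∷ 𝐯 #5 ∷ []) ⩓ (#8 ≜ 𝐯 #2 ∷ 𝐯 #0 ∷ []) ⩓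
      (#6 ≜ 𝐥 ‹ ∷ 𝐯 #4 ∷ 𝐯 #3 ∷ 𝐯 #1 ∷ 𝐥 › ∷ 𝐯 #0 ∷ [])))))
    leafStep = some∶ leafC (some∷ entryC ((#5 ≜ 𝐯 #2 ∷ 𝐯 #3 ∷ []) ⩓ (#6 ≜ 𝐯 #1 ∷ 𝐯 #4 ∷ []) ⩓ Leafᶠ #0 #2))
    Stepᶠ = andStep ⩔ exStep ⩔ leafStep

    step⁻ : ∀ {cs S cs′ S′ C 𝐄} → cs ≡ encs chunkC C → S ≡ encs envC 𝐄 → Sat ok Stepᶠ (cs′ ∷ S′ ∷ cs ∷ S ∷ ρ) →
            Next C 𝐄 cs′ S′
    step⁻ {C = C} {𝐄} c≡ s≡ = disj
      (λ p → some∶ᵉ envC (conjʳ p) λ E q → exᵉ q λ s r →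
        next-state C 𝐄 {and} {E} (λ 𝐄 → E ∷ E ∷ 𝐄) onAnd (trans (sym c≡) (≜⁻ (conjˡ p))) (trans (sym s≡) (≜⁻ (conjˡ r)))
          λ 𝐄′ eq → trans (≜⁻ (conjʳ r)) (cong (λ s → enc envC E ++ enc envC E ++ s) eq))
      (disj
      (λ p → some∶ᵉ wordC p λ x p₁ → some∶ᵉ valC p₁ λ u p₂ → some∷ᵉ entryC p₂ λ E p₃ → exᵉ p₃ λ s r →
        next-state C 𝐄 {exq x} {E} (((x , u) ∷ E) ∷_) (onEx u) (trans (sym c≡) (≜⁻ (conjˡ r))) (trans (sym s≡) (≜⁻ (conjˡ (conjʳ r))))
          λ 𝐄′ eq → trans (≜⁻ (conjʳ (conjʳ r))) (trans (grow-env x u E s) (cong (enc envC ((x , u) ∷ E) ++_) eq)))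
      (λ p → some∶ᵉ leafC p λ l p₁ → some∷ᵉ entryC p₁ λ E r →
        next-state C 𝐄 {leaf l} {E} (λ 𝐄 → 𝐄) (onLeaf (leaf⁻ {E = E} {l} refl refl (conjʳ (conjʳ r)))) (trans (sym c≡) (≜⁻ (conjˡ r))) (trans (sym s≡) (≜⁻ (conjˡ (conjʳ r))))
          λ 𝐄′ eq → eq))

    step⁺ : ∀ {C 𝐄 C′ 𝐄′} → length (encs chunkC C) ≤ B → length (encs envC 𝐄) ≤ B → length (encs envC 𝐄′) ≤ B →
            Step (C , 𝐄) (C′ , 𝐄′) → Sat (_≤ B) Stepᶠ (encs chunkC C′ ∷ encs envC 𝐄′ ∷ encs chunkC C ∷ encs envC 𝐄 ∷ ρ)
    step⁺ {𝐄 = E ∷ 𝐄} c≤ s≤ s′≤ onAnd = left (≜⁺ refl & some∶⁺ envC E (fitˡ (enc envC E) _ s≤)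
      (word (encs envC 𝐄) (fitʳ (enc envC E) _ s≤) (≜⁺ refl & ≜⁺ refl)))
    step⁺ {B = B} {𝐄 = E ∷ 𝐄} c≤ s≤ s′≤ (onEx {C = C} {x = x} u) = right (left (some∶⁺ wordC x x≤ (some∶⁺ valC u u≤
      (some∷⁺ entryC E (fitˡ (enc envC E) _ s≤) λ _ → word (encs envC 𝐄) (fitʳ (enc envC E) _ s≤)
        (≜⁺ refl & ≜⁺ refl & ≜⁺ (cong (‹ ∷_) eq))))))
      where
      open ≡-Reasoning
      eq : (encs entryC ((x , u) ∷ E) ++ [ › ]) ++ encs envC 𝐄 ≡
           enc wordC x ++ enc valC u ++ encs entryC E ++ › ∷ encs envC 𝐄
      eq = begin
        (encs entryC ((x , u) ∷ E) ++ [ › ]) ++ encs envC 𝐄            ≡⟨ List.++-assoc (encs entryC ((x , u) ∷ E)) [ › ] _ ⟩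
        encs entryC ((x , u) ∷ E) ++ › ∷ encs envC 𝐄                   ≡⟨ List.++-assoc (enc entryC (x , u)) (encs entryC E) _ ⟩
        enc entryC (x , u) ++ encs entryC E ++ › ∷ encs envC 𝐄         ≡⟨ List.++-assoc (enc wordC x) (enc valC u) _ ⟩
        enc wordC x ++ enc valC u ++ encs entryC E ++ › ∷ encs envC 𝐄  ∎
      xu≤ : length (enc entryC (x , u)) ≤ B
      xu≤ = fitˡ (enc entryC (x , u)) _ (fitˡ (encs entryC ((x , u) ∷ E)) _
              (drop₁ (fitˡ (enc envC ((x , u) ∷ E)) (encs envC 𝐄) s′≤)))
      x≤ : length (enc wordC x) ≤ B
      x≤ = fitˡ (enc wordC x) _ xu≤
      u≤ : length (enc valC u) ≤ B
      u≤ = fitʳ (enc wordC x) _ xu≤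
    step⁺ {B = B} {𝐄 = E ∷ 𝐄} c≤ s≤ s′≤ (onLeaf {C = C} {l = l} holds) = right (right (some∶⁺ leafC l l≤
      (some∷⁺ entryC E (fitˡ (enc envC E) _ s≤) λ i≤ → ≜⁺ refl & ≜⁺ refl & leaf⁺ refl refl i≤ l≤ holds)))
      where
      l≤ : length (enc leafC l) ≤ B
      l≤ = fitˡ (enc leafC l) _ c≤

  opaque

    Execᶠ : (cs s : Fin n) → Fm n
    Execᶠ cs s = ex (tc Stepᶠ [ 𝐯 (1 ↑ʳ cs) ] [ 𝐯 (1 ↑ʳ s) ] [ 𝐯 #0 ] [])

    exec⁻ : ∀ {cs s : Fin n} {C S} → lookup ρ cs ≡ encs chunkC C → lookup ρ s ≡ encs envC S → Sat ok (Execᶠ cs s) ρ → Exec (C , S)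
    exec⁻ {ρ = ρ} {ok} {C = C} {S} c≡ s≡ (word w _ (chain _ _ ch)) =
      go C S ch (trans (List.++-identityʳ _) c≡) (trans (List.++-identityʳ _) s≡) refl
      where
      go : ∀ {k p q} C S → Chain ok (λ (x , y) (x′ , y′) → Sat ok Stepᶠ (x′ ∷ y′ ∷ x ∷ y ∷ w ∷ ρ)) k p q →
           proj₁ p ≡ encs chunkC C → proj₂ p ≡ encs envC S → proj₂ q ≡ [] → Exec (C , S)
      go C S end c≡ s≡ q≡ with encs≡[] envC S (trans (sym s≡) q≡)
      ... | refl = done
      go C S (link _ _ p ch) c≡ s≡ q≡ with step⁻ {C = C} {S} c≡ s≡ p
      ... | C′ , S′ , st , c′≡ , s′≡ = st ∷ go C′ S′ ch c′≡ s′≡ q≡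

    exec⁺ : ∀ {cs s : Fin n} {k C S} → lookup ρ cs ≡ encs chunkC C → lookup ρ s ≡ encs envC S → k ≤ B →
            ExecWithin B k (C , S) → Sat (_≤ B) (Execᶠ cs s) ρ
    exec⁺ {ρ = ρ} {B} {k = k} {C} {S} c≡ s≡ k≤ r =
      word (proj₁ last′) (proj₁ (proj₂ last′)) (chain k k≤ (subst₃ (trans (List.++-identityʳ _) c≡)
        (trans (List.++-identityʳ _) s≡) (List.++-identityʳ _) (proj₂ (proj₂ last′))))
      where
      R : Letters → Letters × Letters → Letters × Letters → Set
      R w (x , y) (x′ , y′) = Sat (_≤ B) Stepᶠ (x′ ∷ y′ ∷ x ∷ y ∷ w ∷ ρ)
      subst₃ : ∀ {w s s′ t t′ u u′ k} → s ≡ t → s′ ≡ t′ → u ≡ u′ →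
               Chain (_≤ B) (R w) k (t , t′) (u′ , []) → Chain (_≤ B) (R w) k (s , s′) (u , [])
      subst₃ refl refl refl ch = ch
      sizes : ∀ {k q} → ExecWithin B k q → length (encs chunkC (proj₁ q)) ≤ B × length (encs envC (proj₂ q)) ≤ B
      sizes (done c≤)        = c≤ , z≤n
      sizes (step c≤ s≤ _ _) = c≤ , s≤
      last′ : ∃[ w ] length w ≤ B × Chain (_≤ B) (R w) k (encs chunkC C , encs envC S) (w , [])
      last′ = final r , final≤ r , go (final r) r refl
        where
        final : ∀ {k q} → ExecWithin B k q → Letters
        final (done {C} _)     = encs chunkC C
        final (step _ _ _ r)   = final r
        final≤ : ∀ {k q} (r : ExecWithin B k q) → length (final r) ≤ B
        final≤ (done c≤)       = c≤
        final≤ (step _ _ _ r)  = final≤ r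
        go : ∀ {k C S} w (r : ExecWithin B k (C , S)) → final r ≡ w → Chain (_≤ B) (R w) k (encs chunkC C , encs envC S) (w , [])
        go w (done _) refl = end
        go w (step {q = C′ , S′} c≤ s≤ st r) eq =
          link (proj₁ (sizes r)) (proj₂ (sizes r)) (step⁺ c≤ s≤ (proj₂ (sizes r)) st) (go w r eq)

  LitHolds : Env → RFact → RFact → RLit → Set
  LitHolds E f g (rrel (p , ts)) = ∃[ ws ] ((p , ws) ≡ f ⊎ (p , ws) ≡ g) × Values E ts ws
  LitHolds E f g (rneq s t)      = ∃₂ λ u u′ → Value E s u × Value E t u′ × u ≢ u′

  opaque

    Litᶠ : (e f g l : Fin n) → Fm n
    Litᶠ e f g l =
      some∶ predC (some∷ termC ((3 ↑ʳ l ≜ 𝐥 𝟘 ∷ 𝐯 #2 ∷ 𝐯 #1 ∷ []) ⩓ some∷ argC (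
        ((5 ↑ʳ f ≜ 𝐯 #4 ∷ 𝐯 #1 ∷ []) ⩔ (5 ↑ʳ g ≜ 𝐯 #4 ∷ 𝐯 #1 ∷ [])) ⩓ Valuesᶠ (5 ↑ʳ e) #2 #0))) ⩔
      some∶ termC (some∶ termC ((2 ↑ʳ l ≜ 𝐥 𝟙 ∷ 𝐯 #1 ∷ 𝐯 #0 ∷ []) ⩓
        some∶ valC (some∶ valC (Valueᶠ (4 ↑ʳ e) #3 #1 ⩓ Valueᶠ (4 ↑ʳ e) #2 #0 ⩓ Neq #1 #0))))

    lit⁻ : ∀ {e f g l : Fin n} {E F G L} → lookup ρ e ≡ encs entryC E → lookup ρ f ≡ enc factC F → lookup ρ g ≡ enc factC G →
           lookup ρ l ≡ enc literalC L → Sat ok (Litᶠ e f g l) ρ → LitHolds E F G L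
    lit⁻ {E = E} {F} {G} {L} e≡ f≡ g≡ l≡ = disj
      (λ p → some∶ᵉ predC p λ P p₁ → some∷ᵉ termC p₁ λ Ts q →
        subst (LitHolds E F G) (sym (enc-injective literalC {L} {rrel (P , Ts)} (trans (sym l≡) (≜⁻ (conjˡ q)))))
          (some∷ᵉ argC (conjʳ q) λ Ws r → Ws ,
            disj (λ e → inj₁ (sym (enc-injective factC {F} {P , Ws} (trans (sym f≡) (≜⁻ e)))))
                 (λ e → inj₂ (sym (enc-injective factC {G} {P , Ws} (trans (sym g≡) (≜⁻ e))))) (conjˡ r) ,
            values⁻ e≡ refl refl (conjʳ r)))
      (λ p → some∶ᵉ termC p λ s p₁ → some∶ᵉ termC p₁ λ t q →
        subst (LitHolds E F G) (sym (enc-injective literalC {L} {rneq s t} (trans (sym l≡) (≜⁻ (conjˡ q)))))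
          (some∶ᵉ valC (conjʳ q) λ u q₁ → some∶ᵉ valC q₁ λ u′ r →
            u , u′ , value⁻ e≡ refl refl (conjˡ r) , value⁻ e≡ refl refl (conjˡ (conjʳ r)) ,
            λ eq → neq⁻ _ _ (conjʳ (conjʳ r)) (cong (enc valC) eq)))

    lit⁺ : ∀ {e f g l : Fin n} {E F G L} → lookup ρ e ≡ encs entryC E → lookup ρ f ≡ enc factC F → lookup ρ g ≡ enc factC G →
           lookup ρ l ≡ enc literalC L → length (encs entryC E) ≤ B → length (enc factC F) ≤ B → length (enc factC G) ≤ B →
           length (enc literalC L) ≤ B → LitHolds E F G L → Sat (_≤ B) (Litᶠ e f g l) ρ
    lit⁺ {B = B} {F = F} {G} {rrel (p , Ts)} e≡ f≡ g≡ l≡ e≤ f≤ g≤ l≤ (Ws , which , vs) =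
      left (some∶⁺ predC p p≤ (some∷⁺ termC Ts T≤ λ i≤ → ≜⁺ l≡ &
        some∷⁺ argC Ws (W≤ which) λ j≤ →
          Sum.[ (λ { refl → left (≜⁺ f≡) }) , (λ { refl → right (≜⁺ g≡) }) ] which & values⁺ e≡ refl refl e≤ i≤ j≤ vs))
      where
      p≤ : length (enc predC p) ≤ B
      p≤ = proj₁ (predArgs-fit termC p Ts (drop₁ l≤))
      T≤ : length (enc (listC termC) Ts) ≤ B
      T≤ = proj₁ (proj₂ (predArgs-fit termC p Ts (drop₁ l≤)))
      W≤ : (p , Ws) ≡ F ⊎ (p , Ws) ≡ G → length (enc (listC argC) Ws) ≤ B
      W≤ (inj₁ refl) = proj₁ (proj₂ (predArgs-fit argC p Ws f≤))
      W≤ (inj₂ refl) = proj₁ (proj₂ (predArgs-fit argC p Ws g≤))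
    lit⁺ {B = B} {L = rneq s t} e≡ f≡ g≡ l≡ e≤ f≤ g≤ l≤ (u , u′ , v₁ , v₂ , ≢) =
      right (some∶⁺ termC s s≤ (some∶⁺ termC t t≤ (≜⁺ l≡ & some∶⁺ valC u u≤ (some∶⁺ valC u′ u′≤
        (value⁺ e≡ refl refl e≤ v₁ & value⁺ e≡ refl refl e≤ v₂ & neq⁺ _ _ refl refl (≢ ∘ enc-injective valC) u≤ u′≤)))))
      where
      s≤ : length (enc termC s) ≤ B
      s≤ = fitˡ (enc termC s) _ (drop₁ l≤)
      t≤ : length (enc termC t) ≤ B
      t≤ = fitʳ (enc termC s) _ (drop₁ l≤)
      u≤ : length (enc valC u) ≤ B
      u≤ = value-fits s v₁ e≤ s≤
      u′≤ : length (enc valC u′) ≤ B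
      u′≤ = value-fits t v₂ e≤ t≤

  Violated : RFact → RFact → RConstraint → Set
  Violated f g κ = ∃[ E ] All (LitHolds E f g) κ

  opaque

    Pairᶠ : (k f g : Fin n) → Fm n
    Pairᶠ k f g = Some constraintC (open∶ literalC #1 (some∷ entryC
      (Every literalC (Litᶠ #5 (11 ↑ʳ f) (11 ↑ʳ g) #0) [ 𝐯 #2 ]))) [ 𝐯 k ]

    pair⁻ : ∀ {k f g : Fin n} {K F G} → lookup ρ k ≡ encs constraintC K → lookup ρ f ≡ enc factC F → lookup ρ g ≡ enc factC G →
            Sat ok (Pairᶠ k f g) ρ → ∃[ κ ] κ ∈ K × Violated F G κ
    pair⁻ {k = k} {K = K} k≡ f≡ g≡ p = let κ , κ∈ , _ , _ , q = some⁻∈ constraintC [ 𝐯 k ] K k≡ p in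
      some∷ᵉ entryC (open⁻ literalC #1 κ refl q) λ E r →
        κ , κ∈ , E , every⁻ literalC _ κ refl (λ { l (_ ∷ _ ∷ _ ∷ _ ∷ []) → lit⁻ refl f≡ g≡ refl }) r

    pair⁺ : ∀ {k f g : Fin n} {K F G κ} → lookup ρ k ≡ encs constraintC K → lookup ρ f ≡ enc factC F → lookup ρ g ≡ enc factC G →
            length (encs constraintC K) ≤ B → length (enc factC F) ≤ B → length (enc factC G) ≤ B →
            κ ∈ K → (vio : Violated F G κ) → length (enc envC (proj₁ vio)) ≤ B → Sat (_≤ B) (Pairᶠ k f g) ρ
    pair⁺ {k = k} {K = K} {F} {G} {κ} k≡ f≡ g≡ k≤ f≤ g≤ κ∈ (E , holds) E≤ = some⁺∈ constraintC [ 𝐯 k ] K k≡ k≤ κ∈ λ κ≤ s s′ →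
      open⁺ literalC #1 κ refl κ≤ λ i≤ → some∷⁺ entryC E E≤ λ e≤ →
        every⁺ literalC _ κ refl i≤ (All.map (λ { {l} h l≤ (_ ∷ _ ∷ _ ∷ _ ∷ []) →
          lit⁺ {E = E} {F} {G} {l} refl f≡ g≡ refl e≤ f≤ g≤ l≤ h }) holds)

open Conditions

-- Constraints that one fact, or no fact at all, cannot violate

module Refutation where

  private variable
    n : ℕ
    ok : ℕ → Set
    B : ℕ
    ρ : Store n

  -- When all relational atoms of `κ` are mapped to one fact, the terms in them have no freedom
  -- left. That a violation is impossible then shows in the words at the positions of the terms,
  -- without quantifying over assignments.
  Occurs : RConstraint → RFact → RTerm → Word → Set
  Occurs κ (p , ws) t w = ∃[ ts ] rrel (p , ts) ∈ κ × (t , w) ∈ List.zip ts ws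

  Forced : RConstraint → RFact → RTerm → RVal → Set
  Forced κ f t u = (∃[ c ] t ≡ inj₂ c × u ≡ inj₁ c) ⊎ (∃[ w ] Occurs κ f t w × u ≡ val w)

  -- The reasons why κ cannot be violated with all its relational atoms mapped
  -- to f.
  data Refuted (f : RFact) (κ : RConstraint) : Set where
    predicate  : ∀ {p ts} → rrel (p , ts) ∈ κ → p ≢ proj₁ f → Refuted f κ
    clash      : ∀ {t w u} → Occurs κ f t w → Forced κ f t u → val w ≢ u → Refuted f κ
    identical  : ∀ {t} → rneq t t ∈ κ → Refuted f κ
    collapse   : ∀ {s t u} → rneq s t ∈ κ → Forced κ f s u → Forced κ f t u → Refuted f κ

  heads-zip : ∀ {us us′} vs vs′ {t u r r′} → Pointwise (λ (_ : RTerm) (_ : Word) → ⊤) us us′ →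
              encs termC vs ≡ enc termC t ++ r → encs argC vs′ ≡ enc valC u ++ r′ →
              ∃[ w ] (t , w) ∈ List.zip (us ++ vs) (us′ ++ vs′) × u ≡ val w
  heads-zip vs [] {t} {u} ps eq eq′ with head valC u
  ... | l , w , e , _ with trans eq′ (cong (_++ _) e)
  ... | ()
  heads-zip vs (w ∷ vs′) {t} {u} {r′ = r′} ps eq eq′ with uncons termC vs {t} eq | prefix valC (val w) u {encs argC vs′} {r′} eq′
  ... | vs″ , refl , _ | refl , _ = w , ∈-zip ps , refl
    where
    ∈-zip : ∀ {us us′} → Pointwise (λ _ _ → ⊤) us us′ → (t , w) ∈ List.zip (us ++ t ∷ vs″) (us′ ++ w ∷ vs′)
    ∈-zip []       = here refl
    ∈-zip (_ ∷ ps) = there (∈-zip ps)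

  opaque

    -- A `ZipTo` that accepts all pairs cuts both lists at the same position; the heads behind the
    -- cuts are the pair in question.
    NthPairᶠ : (ts ws t u : Fin n) → Fm n
    NthPairᶠ ts ws t u = ex (ex (ZipTo termC argC true′ [ 𝐯 (2 ↑ʳ ts) ] [ 𝐯 (2 ↑ʳ ws) ] [ 𝐯 #1 ] [ 𝐯 #0 ] ⩓
      ex (ex ((#3 ≜ 𝐯 (4 ↑ʳ t) ∷ 𝐯 #1 ∷ []) ⩓ (#2 ≜ 𝐯 (4 ↑ʳ u) ∷ 𝐯 #0 ∷ [])))))

    nthPair⁻ : ∀ {ts ws t u : Fin n} {Ts Ws T U} → lookup ρ ts ≡ encs termC Ts → lookup ρ ws ≡ encs argC Ws →
               lookup ρ t ≡ enc termC T → lookup ρ u ≡ enc valC U → Sat ok (NthPairᶠ ts ws t u) ρ →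
               ∃[ w ] (T , w) ∈ List.zip Ts Ws × U ≡ val w
    nthPair⁻ {ts = ts} {ws} {Ts = Ts} {Ws} {T} {U} ts≡ ws≡ t≡ u≡ p =
      exᵉ p λ a p₁ → exᵉ p₁ λ b p₂ → exᵉ (conjʳ p₂) λ r p₃ → exᵉ p₃ λ r′ q →
        let us , vs , us′ , vs′ , Ts≡ , Ws≡ , a≡ , b≡ , ps =
              zipTo⁻ termC argC {P = λ _ _ → ⊤} [ 𝐯 (2 ↑ʳ ts) ] [ 𝐯 (2 ↑ʳ ws) ] [ 𝐯 #1 ] [ 𝐯 #0 ] Ts Ws ts≡ ws≡ (λ _ _ _ _ → tt) (conjˡ p₂)
            w , ∈zip , U≡ = heads-zip vs vs′ {T} {U} ps (trans (sym a≡) (trans (≜⁻ (conjˡ q)) (cong (_++ r) t≡)))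
                                                       (trans (sym b≡) (trans (≜⁻ (conjʳ q)) (cong (_++ r′) u≡)))
        in w , subst₂ (λ Ts Ws → (T , w) ∈ List.zip Ts Ws) (sym Ts≡) (sym Ws≡) ∈zip , U≡

    nthPair⁺ : ∀ {ts ws t u : Fin n} {Ts Ws T w} → lookup ρ ts ≡ encs termC Ts → lookup ρ ws ≡ encs argC Ws →
               lookup ρ t ≡ enc termC T → lookup ρ u ≡ enc argC w → length (encs termC Ts) ≤ B → length (encs argC Ws) ≤ B →
               (T , w) ∈ List.zip Ts Ws → Sat (_≤ B) (NthPairᶠ ts ws t u) ρ
    nthPair⁺ {B = B} {ts = ts} {ws} {Ts = Ts} {Ws} {T} {w} ts≡ ws≡ t≡ u≡ ts≤ ws≤ ∈zip with split Ts Ws ∈zip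
      where
      split : ∀ Ts Ws → (T , w) ∈ List.zip Ts Ws → ∃₂ λ us vs → ∃₂ λ us′ vs′ →
              Ts ≡ us ++ T ∷ vs × Ws ≡ us′ ++ w ∷ vs′ × Pointwise (λ _ _ → ⊤) us us′
      split (_ ∷ Ts) (_ ∷ Ws) (here refl) = [] , Ts , [] , Ws , refl , refl , []
      split (_ ∷ Ts) (_ ∷ Ws) (there ∈zip) with split Ts Ws ∈zip
      ... | us , vs , us′ , vs′ , refl , refl , ps = _ ∷ us , vs , _ ∷ us′ , vs′ , refl , refl , tt ∷ ps
    ... | us , vs , us′ , vs′ , refl , refl , ps =
      word (encs termC (T ∷ vs)) a≤ (word (encs argC (w ∷ vs′)) b≤
        (zipTo⁺ termC argC [ 𝐯 (2 ↑ʳ ts) ] [ 𝐯 (2 ↑ʳ ws) ] [ 𝐯 #1 ] [ 𝐯 #0 ] us (T ∷ vs) us′ (w ∷ vs′) ts≡ ws≡ refl refl ts≤ ws≤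
           (Pointwise.map (λ _ _ _ _ → same refl) ps) &
         word (encs termC vs) (fitʳ (enc termC T) _ a≤) (word (encs argC vs′) (fitʳ (enc argC w) _ b≤)
           (≜⁺ (cong (_++ encs termC vs) (sym t≡)) & ≜⁺ (cong (_++ encs argC vs′) (sym u≡))))))
      where
      a≤ : length (encs termC (T ∷ vs)) ≤ B
      a≤ = fitʳ (encs termC us) _ (subst (λ w → length w ≤ B) (encs-++ termC us (T ∷ vs)) ts≤)
      b≤ : length (encs argC (w ∷ vs′)) ≤ B
      b≤ = fitʳ (encs argC us′) _ (subst (λ w → length w ≤ B) (encs-++ argC us′ (w ∷ vs′)) ws≤)

  constant-term : ∀ t {u} → enc termC t ≡ 𝟙 ∷ enc valC u → ∃[ c ] t ≡ inj₂ c × u ≡ inj₁ c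
  constant-term (inj₂ c) {u} eq = c , refl , enc-injective valC {u} {inj₁ c} (sym (List.∷-injectiveʳ eq))

  opaque

    Occursᶠ : (k f t u : Fin n) → Fm n
    Occursᶠ k f t u = Some literalC (some∶ predC (some∷ termC ((#4 ≜ 𝐥 𝟘 ∷ 𝐯 #2 ∷ 𝐯 #1 ∷ []) ⩓
      some∷ argC ((8 ↑ʳ f ≜ 𝐯 #4 ∷ 𝐯 #1 ∷ []) ⩓ NthPairᶠ #2 #0 (8 ↑ʳ t) (8 ↑ʳ u))))) [ 𝐯 k ]

    occurs⁻ : ∀ {k f t u : Fin n} {K F T U} → lookup ρ k ≡ encs literalC K → lookup ρ f ≡ enc factC F →
              lookup ρ t ≡ enc termC T → lookup ρ u ≡ enc valC U → Sat ok (Occursᶠ k f t u) ρ →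
              ∃[ w ] Occurs K F T w × U ≡ val w
    occurs⁻ {k = k} {K = K} {F} {T} {U} k≡ f≡ t≡ u≡ p =
      some∈ᵉ literalC [ 𝐯 k ] K k≡ p λ L L∈ p₁ → some∶ᵉ predC p₁ λ P p₂ → some∷ᵉ termC p₂ λ Ts p₃ → some∷ᵉ argC (conjʳ p₃) λ Ws q →
        let w , ∈zip , U≡ = nthPair⁻ {Ts = Ts} {Ws} {T} {U} refl refl t≡ u≡ (conjʳ q) in
        w , subst (λ F → Occurs K F T w) (sym (enc-injective factC {F} {P , Ws} (trans (sym f≡) (≜⁻ (conjˡ q)))))
              (Ts , subst (_∈ K) (enc-injective literalC {L} {rrel (P , Ts)} (≜⁻ (conjˡ p₃))) L∈ , ∈zip) , U≡

    occurs⁺ : ∀ {k f t u : Fin n} {K F T w} → lookup ρ k ≡ encs literalC K → lookup ρ f ≡ enc factC F →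
              lookup ρ t ≡ enc termC T → lookup ρ u ≡ enc argC w → length (encs literalC K) ≤ B →
              length (enc factC F) ≤ B → Occurs K F T w → Sat (_≤ B) (Occursᶠ k f t u) ρ
    occurs⁺ {B = B} {k = k} {K = K} {F = p , Ws} k≡ f≡ t≡ u≡ k≤ f≤ (Ts , L∈ , ∈zip) = some⁺∈ literalC [ 𝐯 k ] K k≡ k≤ L∈ λ l≤ s s′ →
      some∶⁺ predC p (proj₁ (predArgs-fit argC p Ws f≤)) (some∷⁺ termC Ts (proj₁ (proj₂ (predArgs-fit termC p Ts (drop₁ l≤)))) λ i≤ →
        ≜⁺ refl & some∷⁺ argC Ws (proj₁ (proj₂ (predArgs-fit argC p Ws f≤))) λ j≤ →
          ≜⁺ f≡ & nthPair⁺ {Ts = Ts} {Ws} refl refl t≡ u≡ i≤ j≤ ∈zip)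

    Forcedᶠ : (k f t u : Fin n) → Fm n
    Forcedᶠ k f t u = (t ≜ 𝐥 𝟙 ∷ 𝐯 u ∷ []) ⩔ Occursᶠ k f t u

    forced⁻ : ∀ {k f t u : Fin n} {K F T U} → lookup ρ k ≡ encs literalC K → lookup ρ f ≡ enc factC F →
              lookup ρ t ≡ enc termC T → lookup ρ u ≡ enc valC U → Sat ok (Forcedᶠ k f t u) ρ → Forced K F T U
    forced⁻ {K = K} {F} {T} {U} k≡ f≡ t≡ u≡ = disj
      (λ p → inj₁ (constant-term T {U} (trans (sym t≡) (trans (≜⁻ p) (cong (𝟙 ∷_) u≡)))))
      (λ p → inj₂ (occurs⁻ {K = K} {F} {T} {U} k≡ f≡ t≡ u≡ p))

    forced⁺ : ∀ {k f t u : Fin n} {K F T U} → lookup ρ k ≡ encs literalC K → lookup ρ f ≡ enc factC F →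
              lookup ρ t ≡ enc termC T → lookup ρ u ≡ enc valC U → length (encs literalC K) ≤ B →
              length (enc factC F) ≤ B → Forced K F T U → Sat (_≤ B) (Forcedᶠ k f t u) ρ
    forced⁺ k≡ f≡ t≡ u≡ k≤ f≤ (inj₁ (c , refl , refl)) = left (≜⁺ (trans t≡ (cong (𝟙 ∷_) (sym u≡))))
    forced⁺ {K = K} {F} {T} k≡ f≡ t≡ u≡ k≤ f≤ (inj₂ (w , o , refl)) = right (occurs⁺ {K = K} {F} {T} {w} k≡ f≡ t≡ u≡ k≤ f≤ o)

  encs-∈-fit : ∀ {X} (c : Code X) {xs x} → x ∈ xs → length (encs c xs) ≤ B → length (enc c x) ≤ B
  encs-∈-fit c {x ∷ xs} (here refl) le = fitˡ (enc c x) _ le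
  encs-∈-fit c {y ∷ xs} (there x∈) le = encs-∈-fit c x∈ (fitʳ (enc c y) _ le)

  zip-∈ : ∀ {X Y : Set} {x : X} {y : Y} xs ys → (x , y) ∈ List.zip xs ys → x ∈ xs × y ∈ ys
  zip-∈ (_ ∷ xs) (_ ∷ ys) (here refl) = here refl , here refl
  zip-∈ (_ ∷ xs) (_ ∷ ys) (there ∈zip) = Product.map there there (zip-∈ xs ys ∈zip)

  occurs-fits : ∀ {K} F {t w} → Occurs K F t w → length (encs literalC K) ≤ B → length (enc factC F) ≤ B →
                length (enc termC t) ≤ B × length (enc argC w) ≤ B
  occurs-fits (p , ws) (ts , L∈ , ∈zip) k≤ f≤ =
    encs-∈-fit termC (proj₁ (zip-∈ ts ws ∈zip)) (proj₂ (proj₂ (predArgs-fit termC p ts (drop₁ (encs-∈-fit literalC L∈ k≤))))) ,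
    encs-∈-fit argC (proj₂ (zip-∈ ts ws ∈zip)) (proj₂ (proj₂ (predArgs-fit argC p ws f≤)))

  forced-fits : ∀ {K} F {t u} → Forced K F t u → length (encs literalC K) ≤ B → length (enc factC F) ≤ B →
                length (enc termC t) ≤ B → length (enc valC u) ≤ B
  forced-fits F (inj₁ (c , refl , refl)) k≤ f≤ t≤ = drop₁ t≤
  forced-fits F (inj₂ (w , o , refl))    k≤ f≤ t≤ = proj₂ (occurs-fits F o k≤ f≤)

  opaque

    PredRefᶠ ClashRefᶠ EqualRefᶠ Refutedᶠ : (k f : Fin n) → Fm n
    PredRefᶠ k f = Some literalC (some∶ predC (some∶ (listC termC) ((#3 ≜ 𝐥 𝟘 ∷ 𝐯 #1 ∷ 𝐯 #0 ∷ []) ⩓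
      some∶ predC (some∶ (listC argC) ((7 ↑ʳ f ≜ 𝐯 #1 ∷ 𝐯 #0 ∷ []) ⩓ Neq #3 #1))))) [ 𝐯 k ]
    ClashRefᶠ k f = some∶ termC (some∶ valC (some∶ valC (Occursᶠ (3 ↑ʳ k) (3 ↑ʳ f) #2 #1 ⩓ Forcedᶠ (3 ↑ʳ k) (3 ↑ʳ f) #2 #0 ⩓ Neq #1 #0)))
    EqualRefᶠ k f = Some literalC (some∶ termC (some∶ termC ((#3 ≜ 𝐥 𝟙 ∷ 𝐯 #1 ∷ 𝐯 #0 ∷ []) ⩓
      ((#1 ≜ [ 𝐯 #0 ]) ⩔ some∶ valC (Forcedᶠ (6 ↑ʳ k) (6 ↑ʳ f) #2 #0 ⩓ Forcedᶠ (6 ↑ʳ k) (6 ↑ʳ f) #1 #0))))) [ 𝐯 k ]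
    Refutedᶠ k f = PredRefᶠ k f ⩔ ClashRefᶠ k f ⩔ EqualRefᶠ k f

    refuted⁻ : ∀ {k f : Fin n} {K F} → lookup ρ k ≡ encs literalC K → lookup ρ f ≡ enc factC F →
               Sat ok (Refutedᶠ k f) ρ → Refuted F K
    refuted⁻ {k = k} {K = K} {F} k≡ f≡ = disj
      (λ p → some∈ᵉ literalC [ 𝐯 k ] K k≡ p λ L L∈ p₁ → some∶ᵉ predC p₁ λ P p₂ → some∶ᵉ (listC termC) p₂ λ Ts p₃ →
        some∶ᵉ predC (conjʳ p₃) λ P′ p₄ → some∶ᵉ (listC argC) p₄ λ Ws q →
          subst (λ F → Refuted F K) (sym (enc-injective factC {F} {P′ , Ws} (trans (sym f≡) (≜⁻ (conjˡ q)))))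
            (predicate (subst (_∈ K) (enc-injective literalC {L} {rrel (P , Ts)} (≜⁻ (conjˡ p₃))) L∈)
              λ eq → neq⁻ _ _ (conjʳ q) (cong (enc predC) eq)))
      (disj
      (λ p → some∶ᵉ termC p λ t p₁ → some∶ᵉ valC p₁ λ u p₂ → some∶ᵉ valC p₂ λ u′ q →
        let w , o , u≡ = occurs⁻ {K = K} {F} {t} {u} k≡ f≡ refl refl (conjˡ q) in
        clash o (forced⁻ {K = K} {F} {t} {u′} k≡ f≡ refl refl (conjˡ (conjʳ q)))
          λ eq → neq⁻ _ _ (conjʳ (conjʳ q)) (cong (enc valC) (trans u≡ eq)))
      (λ p → some∈ᵉ literalC [ 𝐯 k ] K k≡ p λ L L∈ p₁ → some∶ᵉ termC p₁ λ s p₂ → some∶ᵉ termC p₂ λ t q →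
        let ∈K = subst (_∈ K) (enc-injective literalC {L} {rneq s t} (≜⁻ (conjˡ q))) L∈ in
        disj (λ e → identical (subst (λ t → rneq s t ∈ K) (sym (enc-injective termC {s} {t} (≜⁻ e))) ∈K))
             (λ r → some∶ᵉ valC r λ u r′ → collapse ∈K (forced⁻ {K = K} {F} {s} {u} k≡ f≡ refl refl (conjˡ r′))
                                                       (forced⁻ {K = K} {F} {t} {u} k≡ f≡ refl refl (conjʳ r′)))
             (conjʳ q)))

    refuted⁺ : ∀ {k f : Fin n} {K F} → lookup ρ k ≡ encs literalC K → lookup ρ f ≡ enc factC F →
               length (encs literalC K) ≤ B → length (enc factC F) ≤ B → Refuted F K → Sat (_≤ B) (Refutedᶠ k f) ρ
    refuted⁺ {k = k} {K = K} {F = q , Ws} k≡ f≡ k≤ f≤ (predicate {p} {Ts} L∈ p≢) =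
      left (some⁺∈ literalC [ 𝐯 k ] K k≡ k≤ L∈ λ l≤ _ _ →
        let p≤ , T≤ , _ = predArgs-fit termC p Ts (drop₁ l≤)
            q≤ , W≤ , _ = predArgs-fit argC q Ws f≤ in
        some∶⁺ predC p p≤ (some∶⁺ (listC termC) Ts T≤ (≜⁺ refl & some∶⁺ predC q q≤ (some∶⁺ (listC argC) Ws W≤
          (≜⁺ f≡ & neq⁺ _ _ refl refl (p≢ ∘ enc-injective predC) p≤ q≤)))))
    refuted⁺ {K = K} {F} k≡ f≡ k≤ f≤ (clash {t} {w} {u} o fo ≢) =
      let t≤ , w≤ = occurs-fits F o k≤ f≤
          u≤ = forced-fits F fo k≤ f≤ t≤ in
      right (left (some∶⁺ termC t t≤ (some∶⁺ valC (val w) w≤ (some∶⁺ valC u u≤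
        (occurs⁺ {K = K} {F} {t} {w} k≡ f≡ refl refl k≤ f≤ o & forced⁺ {K = K} {F} {t} {u} k≡ f≡ refl refl k≤ f≤ fo &
         neq⁺ _ _ refl refl (≢ ∘ enc-injective valC) w≤ u≤)))))
    refuted⁺ {k = k} {K = K} {F} k≡ f≡ k≤ f≤ (identical {t} L∈) =
      right (right (some⁺∈ literalC [ 𝐯 k ] K k≡ k≤ L∈ λ l≤ _ _ →
        some∶⁺ termC t (fitˡ (enc termC t) _ (drop₁ l≤)) (some∶⁺ termC t (fitʳ (enc termC t) _ (drop₁ l≤))
          (≜⁺ refl & left (≜⁺ refl)))))
    refuted⁺ {k = k} {K = K} {F} k≡ f≡ k≤ f≤ (collapse {s} {t} {u} L∈ fo fo′) =
      right (right (some⁺∈ literalC [ 𝐯 k ] K k≡ k≤ L∈ λ l≤ _ _ →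
        let s≤ = fitˡ (enc termC s) _ (drop₁ l≤)
            t≤ = fitʳ (enc termC s) _ (drop₁ l≤) in
        some∶⁺ termC s s≤ (some∶⁺ termC t t≤ (≜⁺ refl & right (some∶⁺ valC u (forced-fits F fo k≤ f≤ s≤)
          (forced⁺ {K = K} {F} {s} {u} k≡ f≡ refl refl k≤ f≤ fo & forced⁺ {K = K} {F} {t} {u} k≡ f≡ refl refl k≤ f≤ fo′))))))

  -- The reasons why the empty dataset does not violate κ.
  data Harmless (κ : RConstraint) : Set where
    relational : ∀ {α} → rrel α ∈ κ → Harmless κ
    identical  : ∀ {t} → rneq t t ∈ κ → Harmless κ

  opaque

    Harmlessᶠ : (k : Fin n) → Fm n
    Harmlessᶠ k = Some literalC (some∶ atomC (#2 ≜ 𝐥 𝟘 ∷ 𝐯 #0 ∷ []) ⩔ some∶ termC (#2 ≜ 𝐥 𝟙 ∷ 𝐯 #0 ∷ 𝐯 #0 ∷ [])) [ 𝐯 k ]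

    harmless⁻ : ∀ {k : Fin n} {K} → lookup ρ k ≡ encs literalC K → Sat ok (Harmlessᶠ k) ρ → Harmless K
    harmless⁻ {k = k} {K = K} k≡ p = some∈ᵉ literalC [ 𝐯 k ] K k≡ p λ L L∈ → disj
      (λ q → some∶ᵉ atomC q λ α e → relational (subst (_∈ K) (enc-injective literalC {L} {rrel α} (≜⁻ e)) L∈))
      (λ q → some∶ᵉ termC q λ t e → identical (subst (_∈ K) (enc-injective literalC {L} {rneq t t} (≜⁻ e)) L∈))

    harmless⁺ : ∀ {k : Fin n} {K} → lookup ρ k ≡ encs literalC K → length (encs literalC K) ≤ B → Harmless K →
                Sat (_≤ B) (Harmlessᶠ k) ρ
    harmless⁺ {k = k} {K = K} k≡ k≤ (relational {α} L∈) = some⁺∈ literalC [ 𝐯 k ] K k≡ k≤ L∈ λ l≤ _ _ →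
      left (some∶⁺ atomC α (drop₁ l≤) (≜⁺ refl))
    harmless⁺ {k = k} {K = K} k≡ k≤ (identical {t} L∈) = some⁺∈ literalC [ 𝐯 k ] K k≡ k≤ L∈ λ l≤ _ _ →
      right (some∶⁺ termC t (fitˡ (enc termC t) _ (drop₁ l≤)) (≜⁺ refl))

open Refutation

-- Conflicts, preference edges and cycles as formulas

module Cycles where

  private variable
    n : ℕ
    ok : ℕ → Set
    B : ℕ
    ρ : Store n

  -- The distinguished variables are bound in front of `E`, so they take precedence over entries of
  -- `E` with the same name.
  Start : Var → Var → RFact → RFact → Env → List Env
  Start x y f g E = ((x , fid f) ∷ (y , fid g) ∷ E) ∷ []

  record Prefers (ℛ : List Chunk) (f g : RFact) : Set where
    field
      {before} : List Chunk
      {x y}    : Var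
      {body}   : List Chunk
      rule     : ℛ ≡ before ++ header x y ∷ body
      env      : Env
      run      : Exec (body , Start x y f g env)

  record PrefersWithin (B : ℕ) (ℛ : List Chunk) (f g : RFact) : Set where
    field
      {before} : List Chunk
      {x y}    : Var
      {body}   : List Chunk
      rule     : ℛ ≡ before ++ header x y ∷ body
      env      : Env
      {steps}  : ℕ
      steps≤   : steps ≤ B
      start≤   : length (encs envC (Start x y f g env)) ≤ B
      run      : ExecWithin B steps (body , Start x y f g env)

  start-string : ∀ (a b c d e : Letters) →
                 ((((a ++ b) ++ (c ++ d) ++ e) ++ [ › ]) ++ []) ≡ a ++ b ++ c ++ d ++ e ++ [ › ]
  start-string a b c d e = begin
    ((((a ++ b) ++ (c ++ d) ++ e) ++ [ › ]) ++ []) ≡⟨ List.++-identityʳ _ ⟩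
    ((a ++ b) ++ (c ++ d) ++ e) ++ [ › ]           ≡⟨ List.++-assoc (a ++ b) _ _ ⟩
    (a ++ b) ++ ((c ++ d) ++ e) ++ [ › ]           ≡⟨ List.++-assoc a b _ ⟩
    a ++ b ++ ((c ++ d) ++ e) ++ [ › ]             ≡⟨ cong (λ w → a ++ b ++ w) (List.++-assoc (c ++ d) e _) ⟩
    a ++ b ++ (c ++ d) ++ e ++ [ › ]               ≡⟨ cong (λ w → a ++ b ++ w) (List.++-assoc c d _) ⟩
    a ++ b ++ c ++ d ++ e ++ [ › ]                 ∎
    where open ≡-Reasoning

  opaque

    -- A rule is chosen by guessing a suffix of the chunks that starts with a header.
    Prefersᶠ : (r f g : Fin n) → Fm n
    Prefersᶠ r f g = ex (AllTo chunkC true′ [ 𝐯 (1 ↑ʳ r) ] [ 𝐯 #0 ] ⩓ some∶ wordC (some∶ wordC (ex (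
      (#3 ≜ 𝐯 #2 ∷ 𝐯 #1 ∷ 𝐯 #0 ∷ []) ⩓ some∷ entryC (ex (
        (#0 ≜ 𝐥 ‹ ∷ 𝐯 #5 ∷ 𝐯 (7 ↑ʳ f) ∷ 𝐯 #4 ∷ 𝐯 (7 ↑ʳ g) ∷ 𝐯 #1 ∷ 𝐥 › ∷ []) ⩓ Execᶠ #3 #0))))))

    prefers⁻ : ∀ {r f g : Fin n} {ℛ F G} → lookup ρ r ≡ encs chunkC ℛ → lookup ρ f ≡ enc factC F → lookup ρ g ≡ enc factC G →
               Sat ok (Prefersᶠ r f g) ρ → Prefers ℛ F G
    prefers⁻ {r = r} {ℛ = ℛ} {F} {G} r≡ f≡ g≡ p = exᵉ p λ s p₁ →
      some∶ᵉ wordC (conjʳ p₁) λ x p₂ → some∶ᵉ wordC p₂ λ y p₃ → exᵉ p₃ λ c p₄ → some∷ᵉ entryC (conjʳ p₄) λ E p₅ → exᵉ p₅ λ t q →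
        let us , ws , ℛ≡ , s≡ , _ = allTo⁻ chunkC {P = λ _ → ⊤} [ 𝐯 (1 ↑ʳ r) ] [ 𝐯 #0 ] ℛ r≡ (λ _ _ _ → tt) (conjˡ p₁)
            body , ws≡ , c≡ = uncons chunkC ws {header x y} {c}
              (trans (sym s≡) (trans (≜⁻ (conjˡ p₄)) (sym (List.++-assoc (enc wordC x) (enc wordC y) c))))
        in record
          { rule = trans ℛ≡ (cong (us ++_) ws≡) ; env = E
          ; run = exec⁻ {C = body} {S = Start x y F G E} c≡ (trans (≜⁻ (conjˡ q)) (cong (‹ ∷_) (trans
              (cong₂ (λ f g → enc wordC x ++ f ++ enc wordC y ++ g ++ encs entryC E ++ [ › ]) f≡ g≡)
              (sym (start-string (enc wordC x) (enc factC F) (enc wordC y) (enc factC G) (encs entryC E)))))) (conjʳ q) }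

    prefers⁺ : ∀ {r f g : Fin n} {ℛ F G} → lookup ρ r ≡ encs chunkC ℛ → lookup ρ f ≡ enc factC F → lookup ρ g ≡ enc factC G →
               length (encs chunkC ℛ) ≤ B → PrefersWithin B ℛ F G → Sat (_≤ B) (Prefersᶠ r f g) ρ
    prefers⁺ {B = B} {r = r} {ℛ = ℛ} {F} {G} r≡ f≡ g≡ r≤
      record { before = us ; x = x ; y = y ; body = body ; rule = refl ; env = E ; steps≤ = k≤ ; start≤ = s≤ ; run = run } =
      word (encs chunkC (header x y ∷ body)) tail≤
        (allTo⁺ chunkC [ 𝐯 (1 ↑ʳ r) ] [ 𝐯 #0 ] us (header x y ∷ body) r≡ refl r≤ (All.universal (λ _ _ _ → same refl) us) &
         some∶⁺ wordC x (fitˡ (enc wordC x) _ hdr≤) (some∶⁺ wordC y (fitʳ (enc wordC x) _ hdr≤)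
           (word (encs chunkC body) (fitʳ (enc chunkC (header x y)) _ tail≤)
             (≜⁺ (List.++-assoc (enc wordC x) (enc wordC y) _) & some∷⁺ entryC E E≤ λ _ →
               word (encs envC (Start x y F G E)) s≤ (≜⁺ (cong (‹ ∷_) (trans
                   (start-string (enc wordC x) (enc factC F) (enc wordC y) (enc factC G) (encs entryC E))
                   (cong₂ (λ f g → enc wordC x ++ f ++ enc wordC y ++ g ++ encs entryC E ++ [ › ]) (sym f≡) (sym g≡)))) &
                 exec⁺ {C = body} {S = Start x y F G E} refl refl k≤ run)))))
      where
      tail≤ : length (encs chunkC (header x y ∷ body)) ≤ B
      tail≤ = fitʳ (encs chunkC us) _ (subst (λ w → length w ≤ B) (encs-++ chunkC us (header x y ∷ body)) r≤)
      hdr≤ : length (enc wordC x ++ enc wordC y) ≤ B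
      hdr≤ = fitˡ (enc chunkC (header x y)) _ tail≤
      E≤ : length (enc envC E) ≤ B
      E≤ = ℕ.≤-trans (s≤s (fitʳ (X ++ F′ ++ Y ++ G′) (e′ ++ [ › ]) (ℕ.≤-reflexive (cong length (trans
        (trans (List.++-assoc X _ _) (cong (X ++_) (trans (List.++-assoc F′ _ _) (cong (F′ ++_) (List.++-assoc Y G′ _)))))
        (sym (start-string X F′ Y G′ e′))))))) s≤
        where
        F′ G′ e′ X Y : Letters
        F′ = enc factC F
        G′ = enc factC G
        e′ = encs entryC E
        X  = enc wordC x
        Y  = enc wordC y

  Plain : RFact → Set
  Plain f = ∃₂ λ n ws → f ≡ ((n , plain) , ws)

  Stable : List RConstraint → RFact → Set
  Stable 𝒯 f = All (Refuted f) 𝒯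

  -- For two different facts minimality means that neither violates a constraint alone, hence that
  -- each refutes all constraints. For a single fact it means that the empty dataset violates none;
  -- this does not depend on the edge and is checked once, in `Cyclic`.
  record Conflicting (𝒯 : List RConstraint) (f h : RFact) : Set where
    field
      {κ}      : RConstraint
      κ∈       : κ ∈ 𝒯
      violated : Violated f h κ
      minimal  : f ≡ h ⊎ Stable 𝒯 f × Stable 𝒯 h
      plainˡ   : Plain f
      plainʳ   : Plain h

  -- A fact can be preferred to itself inside a conflict of two facts, so the partner of `f` in the
  -- conflict need not be `g`.
  record Edge (𝒯 : List RConstraint) (ℛ : List Chunk) (f g : RFact) : Set where
    field
      {partner}   : RFact
      either      : g ≡ f ⊎ g ≡ partner
      conflicting : Conflicting 𝒯 f partner
      prefers     : Prefers ℛ f g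

  record EdgeWithin (B : ℕ) (𝒯 : List RConstraint) (ℛ : List Chunk) (f g : RFact) : Set where
    field
      {partner}   : RFact
      partner≤    : length (enc factC partner) ≤ B
      either      : g ≡ f ⊎ g ≡ partner
      conflicting : Conflicting 𝒯 f partner
      env≤        : length (enc envC (proj₁ (Conflicting.violated conflicting))) ≤ B
      prefers     : PrefersWithin B ℛ f g

  plain-string : ∀ m ws → enc factC ((m , plain) , ws) ≡ enc wordC m ++ 𝟘 ∷ enc (listC argC) ws
  plain-string m ws = List.++-assoc (enc wordC m) [ 𝟘 ] (enc (listC argC) ws)

  opaque

    PlainFactᶠ : Fin n → Fm n
    PlainFactᶠ f = some∶ wordC (some∶ (listC argC) (2 ↑ʳ f ≜ 𝐯 #1 ∷ 𝐥 𝟘 ∷ 𝐯 #0 ∷ []))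

    plainFact⁻ : ∀ {f : Fin n} {F} → lookup ρ f ≡ enc factC F → Sat ok (PlainFactᶠ f) ρ → Plain F
    plainFact⁻ {F = F} f≡ p = some∶ᵉ wordC p λ m q → some∶ᵉ (listC argC) q λ ws e →
      m , ws , enc-injective factC {F} {(m , plain) , ws} (trans (sym f≡) (trans (≜⁻ e) (sym (plain-string m ws))))

    plainFact⁺ : ∀ {f : Fin n} {F} → lookup ρ f ≡ enc factC F → length (enc factC F) ≤ B → Plain F → Sat (_≤ B) (PlainFactᶠ f) ρ
    plainFact⁺ f≡ f≤ (m , ws , refl) =
      let p≤ , W≤ , _ = predArgs-fit argC (m , plain) ws f≤ in
      some∶⁺ wordC m (fitˡ (enc wordC m) _ p≤) (some∶⁺ (listC argC) ws W≤ (≜⁺ (trans f≡ (plain-string m ws))))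

    Stableᶠ : (t f : Fin n) → Fm n
    Stableᶠ t f = Every constraintC (open∶ literalC #0 (Refutedᶠ #0 (6 ↑ʳ f))) [ 𝐯 t ]

    stable⁻ : ∀ {t f : Fin n} {𝒯 F} → lookup ρ t ≡ encs constraintC 𝒯 → lookup ρ f ≡ enc factC F →
              Sat ok (Stableᶠ t f) ρ → Stable 𝒯 F
    stable⁻ {t = t} {𝒯 = 𝒯} {F} t≡ f≡ p = every⁻ constraintC [ 𝐯 t ] 𝒯 t≡
      (λ { κ (_ ∷ _ ∷ _ ∷ _ ∷ []) q → refuted⁻ {K = κ} {F} refl f≡ (open⁻ literalC #0 κ refl q) }) p

    stable⁺ : ∀ {t f : Fin n} {𝒯 F} → lookup ρ t ≡ encs constraintC 𝒯 → lookup ρ f ≡ enc factC F →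
              length (encs constraintC 𝒯) ≤ B → length (enc factC F) ≤ B → Stable 𝒯 F → Sat (_≤ B) (Stableᶠ t f) ρ
    stable⁺ {t = t} {𝒯 = 𝒯} {F} t≡ f≡ t≤ f≤ st = every⁺ constraintC [ 𝐯 t ] 𝒯 t≡ t≤
      (All.map (λ { {κ} r κ≤ (_ ∷ _ ∷ _ ∷ _ ∷ []) → open⁺ literalC #0 κ refl κ≤ λ k≤ →
        refuted⁺ {K = κ} {F} refl f≡ k≤ f≤ r }) st)

    AllHarmlessᶠ : (t : Fin n) → Fm n
    AllHarmlessᶠ t = Every constraintC (open∶ literalC #0 (Harmlessᶠ #0)) [ 𝐯 t ]

    allHarmless⁻ : ∀ {t : Fin n} {𝒯} → lookup ρ t ≡ encs constraintC 𝒯 → Sat ok (AllHarmlessᶠ t) ρ → All Harmless 𝒯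
    allHarmless⁻ {t = t} {𝒯 = 𝒯} t≡ p = every⁻ constraintC [ 𝐯 t ] 𝒯 t≡
      (λ { κ (_ ∷ _ ∷ _ ∷ _ ∷ []) q → harmless⁻ {K = κ} refl (open⁻ literalC #0 κ refl q) }) p

    allHarmless⁺ : ∀ {t : Fin n} {𝒯} → lookup ρ t ≡ encs constraintC 𝒯 → length (encs constraintC 𝒯) ≤ B →
                   All Harmless 𝒯 → Sat (_≤ B) (AllHarmlessᶠ t) ρ
    allHarmless⁺ {t = t} {𝒯 = 𝒯} t≡ t≤ hs = every⁺ constraintC [ 𝐯 t ] 𝒯 t≡ t≤
      (All.map (λ { {κ} h κ≤ (_ ∷ _ ∷ _ ∷ _ ∷ []) → open⁺ literalC #0 κ refl κ≤ λ k≤ → harmless⁺ {K = κ} refl k≤ h }) hs)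

  opaque

    Edgeᶠ : (t r f g : Fin n) → Fm n
    Edgeᶠ t r f g = some∶ factC (
      ((1 ↑ʳ g ≜ [ 𝐯 (1 ↑ʳ f) ]) ⩔ (1 ↑ʳ g ≜ [ 𝐯 #0 ])) ⩓
      Pairᶠ (1 ↑ʳ t) (1 ↑ʳ f) #0 ⩓
      ((1 ↑ʳ f ≜ [ 𝐯 #0 ]) ⩔ (Stableᶠ (1 ↑ʳ t) (1 ↑ʳ f) ⩓ Stableᶠ (1 ↑ʳ t) #0)) ⩓
      PlainFactᶠ (1 ↑ʳ f) ⩓ PlainFactᶠ #0 ⩓ Prefersᶠ (1 ↑ʳ r) (1 ↑ʳ f) (1 ↑ʳ g))

    edge⁻ : ∀ {t r f g : Fin n} {𝒯 ℛ F G} → lookup ρ t ≡ encs constraintC 𝒯 → lookup ρ r ≡ encs chunkC ℛ →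
            lookup ρ f ≡ enc factC F → lookup ρ g ≡ enc factC G → Sat ok (Edgeᶠ t r f g) ρ → Edge 𝒯 ℛ F G
    edge⁻ {𝒯 = 𝒯} {ℛ} {F} {G} t≡ r≡ f≡ g≡ p = some∶ᵉ factC p λ H q →
      let κ , κ∈ , vio = pair⁻ {K = 𝒯} {F} {H} t≡ f≡ refl (conjˡ (conjʳ q)) in record
      { either = disj (λ e → inj₁ (enc-injective factC {G} {F} (trans (sym g≡) (trans (≜⁻ e) f≡))))
                      (λ e → inj₂ (enc-injective factC {G} {H} (trans (sym g≡) (≜⁻ e)))) (conjˡ q)
      ; conflicting = record
        { κ∈ = κ∈ ; violated = vio
        ; minimal = disj (λ e → inj₁ (enc-injective factC {F} {H} (trans (sym f≡) (≜⁻ e))))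
                         (λ s → inj₂ (stable⁻ t≡ f≡ (conjˡ s) , stable⁻ t≡ refl (conjʳ s))) (conjˡ (conjʳ (conjʳ q)))
        ; plainˡ = plainFact⁻ f≡ (conjˡ (conjʳ (conjʳ (conjʳ q))))
        ; plainʳ = plainFact⁻ refl (conjˡ (conjʳ (conjʳ (conjʳ (conjʳ q))))) }
      ; prefers = prefers⁻ r≡ f≡ g≡ (conjʳ (conjʳ (conjʳ (conjʳ (conjʳ q))))) }

    edge⁺ : ∀ {t r f g : Fin n} {𝒯 ℛ F G} → lookup ρ t ≡ encs constraintC 𝒯 → lookup ρ r ≡ encs chunkC ℛ →
            lookup ρ f ≡ enc factC F → lookup ρ g ≡ enc factC G → length (encs constraintC 𝒯) ≤ B →
            length (encs chunkC ℛ) ≤ B → length (enc factC F) ≤ B → EdgeWithin B 𝒯 ℛ F G → Sat (_≤ B) (Edgeᶠ t r f g) ρ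
    edge⁺ {𝒯 = 𝒯} {ℛ} {F} {G} t≡ r≡ f≡ g≡ t≤ r≤ f≤
      record { partner = H ; partner≤ = h≤ ; either = e ; env≤ = env≤ ; prefers = pr
             ; conflicting = record { κ = κ ; κ∈ = κ∈ ; violated = vio ; minimal = m ; plainˡ = p₁ ; plainʳ = p₂ } } =
      some∶⁺ factC H h≤
        (Sum.[ (λ { refl → left (≜⁺ (trans g≡ (sym f≡))) }) , (λ { refl → right (≜⁺ g≡) }) ] e &
         pair⁺ {K = 𝒯} {F} {H} {κ} t≡ f≡ refl t≤ f≤ h≤ κ∈ vio env≤ &
         Sum.[ (λ { refl → left (≜⁺ f≡) }) , (λ (s , s′) → right (stable⁺ t≡ f≡ t≤ f≤ s & stable⁺ {F = H} t≡ refl t≤ h≤ s′)) ] m &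
         plainFact⁺ f≡ f≤ p₁ & plainFact⁺ {F = H} refl h≤ p₂ & prefers⁺ r≡ f≡ g≡ r≤ pr)

  data Walk (R : RFact → RFact → Set) : ℕ → RFact → RFact → Set where
    []  : ∀ {f} → Walk R 0 f f
    _∷_ : ∀ {k f g h} → R f g → Walk R k g h → Walk R (suc k) f h

  record Cyclic (𝒯 : List RConstraint) (ℛ : List Chunk) : Set where
    field
      harmless : All Harmless 𝒯
      {f g}    : RFact
      first    : Edge 𝒯 ℛ f g
      {rest}   : ℕ
      walk     : Walk (Edge 𝒯 ℛ) rest g f

  SizedEdge : ℕ → List RConstraint → List Chunk → RFact → RFact → Set
  SizedEdge B 𝒯 ℛ f g = length (enc factC f) ≤ B × length (enc factC g) ≤ B × EdgeWithin B 𝒯 ℛ f g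

  record CyclicWithin (B : ℕ) (𝒯 : List RConstraint) (ℛ : List Chunk) : Set where
    field
      harmless : All Harmless 𝒯
      {f g}    : RFact
      first    : SizedEdge B 𝒯 ℛ f g
      {rest}   : ℕ
      rest≤    : rest ≤ B
      walk     : Walk (SizedEdge B 𝒯 ℛ) rest g f

  inputOf : List RConstraint → List Chunk → Letters
  inputOf 𝒯 ℛ = enc (listC constraintC) 𝒯 ++ enc (listC chunkC) ℛ

  opaque

    -- The first edge stands outside the closure because chains may be empty. A chain ranges over
    -- arbitrary words, hence the demand that each new one is the code of a fact.
    Cycleᶠ : (t r : Fin n) → Fm n
    Cycleᶠ t r = some∶ factC (some∶ factC (Edgeᶠ (2 ↑ʳ t) (2 ↑ʳ r) #1 #0 ⩓
      tc (is factC #0 ⩓ Edgeᶠ (6 ↑ʳ t) (6 ↑ʳ r) #2 #0) [ 𝐯 #0 ] [] [ 𝐯 #1 ] []))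

    Cyclicᶠ : Fm 1
    Cyclicᶠ = some∷ constraintC (some∷ chunkC ((4 ↑ʳ #0 ≜ 𝐯 #3 ∷ 𝐯 #1 ∷ []) ⩓ AllHarmlessᶠ #2 ⩓ Cycleᶠ #2 #0))

    cycle⁻ : ∀ {t r : Fin n} {𝒯 ℛ} → lookup ρ t ≡ encs constraintC 𝒯 → lookup ρ r ≡ encs chunkC ℛ →
             All Harmless 𝒯 → Sat ok (Cycleᶠ t r) ρ → Cyclic 𝒯 ℛ
    cycle⁻ {ρ = ρ} {ok} {t = t} {r} {𝒯} {ℛ} t≡ r≡ hs p = some∶ᵉ factC p λ f p₁ → some∶ᵉ factC p₁ λ g q →
      tcᵉ (conjʳ q) λ ch → record
        { harmless = hs ; first = edge⁻ {𝒯 = 𝒯} {ℛ} {f} {g} t≡ r≡ refl refl (conjˡ q)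
        ; walk = proj₂ (go f g g ch (List.++-identityʳ _) (List.++-identityʳ _)) }
      where
      go : ∀ f g g′ {k p q} → Chain ok (λ (x , y) (x′ , y′) →
             Sat ok (is factC #0 ⩓ Edgeᶠ (6 ↑ʳ t) (6 ↑ʳ r) #2 #0) (x′ ∷ y′ ∷ x ∷ y ∷ enc factC g ∷ enc factC f ∷ ρ)) k p q →
           proj₁ p ≡ enc factC g′ → proj₁ q ≡ enc factC f → ∃[ k ] Walk (Edge 𝒯 ℛ) k g′ f
      go f g g′ end eq eq′ = 0 , subst (Walk (Edge 𝒯 ℛ) 0 g′) (enc-injective factC {g′} {f} (trans (sym eq) eq′)) []
      go f g g′ (link _ _ s ch) eq eq′ =
        let h , h≡ = is⁻ factC (conjˡ s)
            k , w  = go f g h ch h≡ eq′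
        in suc k , edge⁻ {𝒯 = 𝒯} {ℛ} {g′} {h} t≡ r≡ eq h≡ (conjʳ s) ∷ w

    cyclic⁻ : ∀ 𝒯 ℛ → Sat ok Cyclicᶠ (inputOf 𝒯 ℛ ∷ []) → Cyclic 𝒯 ℛ
    cyclic⁻ 𝒯 ℛ p = some∷ᵉ constraintC p λ 𝒯′ p₁ → some∷ᵉ chunkC p₁ λ ℛ′ q →
      let 𝒯≡ , eq = prefix (listC constraintC) 𝒯 𝒯′ {enc (listC chunkC) ℛ} {enc (listC chunkC) ℛ′} (≜⁻ (conjˡ q))
          ℛ≡ = enc-injective (listC chunkC) {ℛ} {ℛ′} eq
      in subst₂ Cyclic (sym 𝒯≡) (sym ℛ≡) (cycle⁻ refl refl (allHarmless⁻ refl (conjˡ (conjʳ q))) (conjʳ (conjʳ q)))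

    cyclic⁺ : ∀ 𝒯 ℛ → length (inputOf 𝒯 ℛ) ≤ B → CyclicWithin B 𝒯 ℛ → Sat (_≤ B) Cyclicᶠ (inputOf 𝒯 ℛ ∷ [])
    cyclic⁺ {B = B} 𝒯 ℛ le record { harmless = hs ; f = f ; g = g ; first = f≤ , g≤ , e ; rest = k ; rest≤ = k≤ ; walk = w } =
      some∷⁺ constraintC 𝒯 (fitˡ (enc (listC constraintC) 𝒯) _ le) λ t≤ →
      some∷⁺ chunkC ℛ (fitʳ (enc (listC constraintC) 𝒯) _ le) λ r≤ →
        ≜⁺ refl & allHarmless⁺ refl t≤ hs &
        some∶⁺ factC f f≤ (some∶⁺ factC g g≤ (edge⁺ {𝒯 = 𝒯} {ℛ} {f} {g} refl refl refl refl t≤ r≤ f≤ e &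
          chain k k≤ (ends (List.++-identityʳ _) (List.++-identityʳ _) (go t≤ r≤ g≤ w))))
      where
      R : Letters × Letters → Letters × Letters → Set
      R (x , y) (x′ , y′) = Sat (_≤ B) (is factC #0 ⩓ Edgeᶠ (6 ↑ʳ #2) (6 ↑ʳ #0) #2 #0)
        (x′ ∷ y′ ∷ x ∷ y ∷ enc factC g ∷ enc factC f ∷ encs chunkC ℛ ∷ enc (listC chunkC) ℛ ∷
         encs constraintC 𝒯 ∷ enc (listC constraintC) 𝒯 ∷ inputOf 𝒯 ℛ ∷ [])
      ends : ∀ {s s′ t t′ k} → s ≡ t → s′ ≡ t′ → Chain (_≤ B) R k (t , []) (t′ , []) → Chain (_≤ B) R k (s , []) (s′ , [])
      ends refl refl ch = ch
      go : ∀ {k g′ f′} → length (encs constraintC 𝒯) ≤ B → length (encs chunkC ℛ) ≤ B → length (enc factC g′) ≤ B →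
           Walk (SizedEdge B 𝒯 ℛ) k g′ f′ → Chain (_≤ B) R k (enc factC g′ , []) (enc factC f′ , [])
      go t≤ r≤ g≤ [] = end
      go {g′ = g′} t≤ r≤ g≤ (_∷_ {g = h} (_ , h≤ , e) w) = link h≤ z≤n
        (is⁺ factC h refl h≤ & edge⁺ {𝒯 = 𝒯} {ℛ} {g′} {h} refl refl refl refl t≤ r≤ g≤ e) (go t≤ r≤ h≤ w)

open Cycles

-- The correspondence between instances over a signature and cycles of coded facts

module Reduction (S : Signature) where

  open Signature S
  open Preferences S

  -- The raw syntax of an instance

  rawConst : Const → RConst
  rawConst (ident w) = idn w
  rawConst (value w) = vlu w

  rawTerm : Term → RTerm
  rawTerm (var x) = inj₁ x
  rawTerm (con c) = inj₂ (rawConst c)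

  rawPred : Pred → RPred
  rawPred P = name P , (if meta? P then inj₂ (Vec.toList (posID P)) else inj₁ tt)

  rawAtom : Atom Term → RAtom
  rawAtom (P · ts) = rawPred P , map rawTerm (Vec.toList ts)

  rawLiteral : Literal → RLit
  rawLiteral (rel α)   = inj₁ (rawAtom α)
  rawLiteral (neq s t) = inj₂ (rawTerm s , rawTerm t)

  rawConstraint : DenialConstraint → RConstraint
  rawConstraint = map rawLiteral

  rawCond : Cond → List Chunk
  rawCond (rel α)      = leaf (lrel (rawAtom α)) ∷ []
  rawCond (idEq x α _) = leaf (lidEq x (rawAtom α)) ∷ []
  rawCond (neq x t)    = leaf (lneq x (rawTerm t)) ∷ []
  rawCond (φ ∧ ψ)      = and ∷ rawCond φ ++ rawCond ψ
  rawCond (ex x φ)     = exq x ∷ rawCond φ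

  rawRule : Rule → List Chunk
  rawRule r = header x₁ x₂ ∷ rawCond body
    where open Rule r

  rawTheory : Theory → List RConstraint
  rawTheory = map rawConstraint

  rawRules : List Rule → List Chunk
  rawRules = concatMap rawRule

  module _ {A X : Set} (c : Code X) (g : A → X) (f : A → List Letter) (f≡ : ∀ a → f a ≡ enc c (g a)) where

    concatMap-encs : ∀ as → concatMap f as ≡ encs c (map g as)
    concatMap-encs []       = refl
    concatMap-encs (a ∷ as) = cong₂ _++_ (f≡ a) (concatMap-encs as)

    encodeList-enc : ∀ as → encodeList f as ≡ enc (listC c) (map g as)
    encodeList-enc as = cong (λ w → ‹ ∷ w ++ [ › ]) (concatMap-encs as)

  encodeWord-enc : ∀ w → encodeWord w ≡ enc wordC w
  encodeWord-enc w = trans (encodeList-enc bitC (λ b → b) _ (λ { false → refl ; true → refl }) w)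
                           (cong (enc wordC) (List.map-id w))

  encodeTerm-enc : ∀ t → encodeTerm t ≡ enc termC (rawTerm t)
  encodeTerm-enc (var x)         = cong (𝟘 ∷_) (encodeWord-enc x)
  encodeTerm-enc (con (ident w)) = cong (λ w → 𝟙 ∷ 𝟘 ∷ w) (encodeWord-enc w)
  encodeTerm-enc (con (value w)) = cong (λ w → 𝟙 ∷ 𝟙 ∷ w) (encodeWord-enc w)

  encodePred-enc : ∀ P → encodePred P ≡ enc predC (rawPred P)
  encodePred-enc P with meta? P
  ... | false = cong (_++ [ 𝟘 ]) (encodeWord-enc (name P))
  ... | true  = cong₂ (λ u w → u ++ 𝟙 ∷ w) (encodeWord-enc (name P)) (encodeWord-enc (Vec.toList (posID P)))

  encodeAtom-enc : ∀ α → encodeAtom α ≡ enc atomC (rawAtom α)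
  encodeAtom-enc (P · ts) = cong₂ _++_ (encodePred-enc P) (encodeList-enc termC rawTerm _ encodeTerm-enc (Vec.toList ts))

  encodeLiteral-enc : ∀ ℓ → encodeLiteral ℓ ≡ enc literalC (rawLiteral ℓ)
  encodeLiteral-enc (rel α)   = cong (𝟘 ∷_) (encodeAtom-enc α)
  encodeLiteral-enc (neq s t) = cong₂ (λ u w → 𝟙 ∷ u ++ w) (encodeTerm-enc s) (encodeTerm-enc t)

  encodeCond-enc : ∀ φ → encodeCond φ ≡ encs chunkC (rawCond φ)
  encodeCond-enc (rel α)      = trans (cong (λ w → 𝟘 ∷ 𝟘 ∷ w) (encodeAtom-enc α)) (sym (List.++-identityʳ _))
  encodeCond-enc (idEq x α _) = trans (cong₂ (λ u w → 𝟘 ∷ 𝟙 ∷ u ++ w) (encodeWord-enc x) (encodeAtom-enc α)) (sym (List.++-identityʳ _))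
  encodeCond-enc (neq x t)    = trans (cong₂ (λ u w → 𝟙 ∷ 𝟘 ∷ u ++ w) (encodeWord-enc x) (encodeTerm-enc t)) (sym (List.++-identityʳ _))
  encodeCond-enc (φ ∧ ψ)      = cong (λ w → 𝟙 ∷ 𝟙 ∷ 𝟘 ∷ w)
    (trans (cong₂ _++_ (encodeCond-enc φ) (encodeCond-enc ψ)) (sym (encs-++ chunkC (rawCond φ) (rawCond ψ))))
  encodeCond-enc (ex x φ)     = cong₂ (λ u w → 𝟙 ∷ 𝟙 ∷ 𝟙 ∷ u ++ w) (encodeWord-enc x) (encodeCond-enc φ)

  encodeRule-enc : ∀ r → encodeRule r ≡ encs chunkC (rawRule r)
  encodeRule-enc r = trans (cong₂ _++_ (encodeWord-enc x₁) (cong₂ _++_ (encodeWord-enc x₂) (encodeCond-enc body)))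
                           (sym (List.++-assoc (enc wordC x₁) (enc wordC x₂) _))
    where open Rule r

  -- The codes follow the encoding of instances letter by letter, so the formula about raw syntax
  -- speaks of the very words that the machine receives.
  encode-enc : ∀ I → encode I ≡ inputOf (rawTheory (theory I)) (rawRules (rules I))
  encode-enc I = cong₂ _++_
    (encodeList-enc constraintC rawConstraint _ (encodeList-enc literalC rawLiteral _ encodeLiteral-enc) (theory I))
    (cong (λ w → ‹ ∷ w ++ [ › ]) (rules-enc (rules I)))
    where
    rules-enc : ∀ rs → concatMap encodeRule rs ≡ encs chunkC (rawRules rs)
    rules-enc []       = refl
    rules-enc (r ∷ rs) = trans (cong₂ _++_ (encodeRule-enc r) (rules-enc rs)) (sym (encs-++ chunkC (rawRule r) (rawRules rs)))

  rawConst-injective : ∀ {c d} → rawConst c ≡ rawConst d → c ≡ d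
  rawConst-injective {ident _} {ident _} refl = refl
  rawConst-injective {value _} {value _} refl = refl

  rawTerm-injective : ∀ {s t} → rawTerm s ≡ rawTerm t → s ≡ t
  rawTerm-injective {var _} {var _} refl = refl
  rawTerm-injective {con c} {con d} eq = cong con (rawConst-injective (inj₂-injective eq))

  rawPred-injective : ∀ {P Q} → rawPred P ≡ rawPred Q → P ≡ Q
  rawPred-injective eq = name-injective (cong proj₁ eq)

  rawPred-plain : ∀ P {m} → rawPred P ≡ (m , plain) → ¬ IsMeta P
  rawPred-plain P eq meta with meta? P
  rawPred-plain P () meta | true

  plain-rawPred : ∀ P → ¬ IsMeta P → rawPred P ≡ (name P , plain)
  plain-rawPred P ¬meta with meta? P
  ... | false = refl
  ... | true  = contradiction tt ¬meta

  meta-rawPred : ∀ P → IsMeta P → rawPred P ≡ (name P , metaAt (Vec.toList (posID P)))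
  meta-rawPred P meta with meta? P
  ... | true = refl

  meta-dec : ∀ P → Dec (IsMeta P)
  meta-dec P with meta? P
  ... | true  = yes tt
  ... | false = no λ ()

  rawFact : Atom Word → RFact
  rawFact (P · ws) = rawPred P , Vec.toList ws

  toList-injective : ∀ {A : Set} {n} {u v : Vec A n} → Vec.toList u ≡ Vec.toList v → u ≡ v
  toList-injective {u = []}    {[]}    _  = refl
  toList-injective {u = _ ∷ _} {_ ∷ _} eq = cong₂ _∷_ (List.∷-injectiveˡ eq) (toList-injective (List.∷-injectiveʳ eq))

  rawFact-injective : ∀ {a b} → rawFact a ≡ rawFact b → a ≡ b
  rawFact-injective {P · us} {Q · ws} eq with rawPred-injective (cong proj₁ eq)
  ... | refl = cong (P ·_) (toList-injective (cong proj₂ eq))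

  -- The values of the quantified variables are taken from G.
  module _ (G : RVal → Set) where

    HoldsIn : Env → Cond → Set
    HoldsIn E (rel α)      = LeafHolds E (lrel (rawAtom α))
    HoldsIn E (idEq x α _) = LeafHolds E (lidEq x (rawAtom α))
    HoldsIn E (neq x t)    = LeafHolds E (lneq x (rawTerm t))
    HoldsIn E (φ ∧ ψ)      = HoldsIn E φ × HoldsIn E ψ
    HoldsIn E (ex x φ)     = ∃[ u ] G u × HoldsIn ((x , u) ∷ E) φ

  Always : RVal → Set
  Always _ = ⊤

  -- Processing the tokens of `φ` consumes exactly the topmost environment. The remaining chunks and
  -- stack are arbitrary, as needed for the second half of a conjunction.
  exec-sound : ∀ φ {C E 𝐄} → Exec (rawCond φ ++ C , E ∷ 𝐄) → HoldsIn Always E φ × Exec (C , 𝐄)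
  exec-sound (rel α)      (onLeaf h ∷ r) = h , r
  exec-sound (idEq x α _) (onLeaf h ∷ r) = h , r
  exec-sound (neq x t)    (onLeaf h ∷ r) = h , r
  exec-sound (φ ∧ ψ) {C} {E} {𝐄} (onAnd ∷ r)
    with exec-sound φ {rawCond ψ ++ C} (subst (λ L → Exec (L , E ∷ E ∷ 𝐄)) (List.++-assoc (rawCond φ) (rawCond ψ) C) r)
  ... | h , r′ with exec-sound ψ r′
  ... | h′ , r″ = (h , h′) , r″
  exec-sound (ex x φ) (onEx u ∷ r) = Product.map₁ (λ h → u , tt , h) (exec-sound φ r)

  data NoHeader : Chunk → Set where
    isLeaf   : ∀ {l} → NoHeader (leaf l)
    isBinder : ∀ {b} → NoHeader (inj₁ (inj₂ b))

  rawCond-noHeader : ∀ φ → All NoHeader (rawCond φ)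
  rawCond-noHeader (rel α)      = isLeaf ∷ []
  rawCond-noHeader (idEq x α _) = isLeaf ∷ []
  rawCond-noHeader (neq x t)    = isLeaf ∷ []
  rawCond-noHeader (φ ∧ ψ)      = isBinder ∷ All.++⁺ (rawCond-noHeader φ) (rawCond-noHeader ψ)
  rawCond-noHeader (ex x φ)     = isBinder ∷ rawCond-noHeader φ

  skip-noHeader : ∀ {us} → All NoHeader us → ∀ {ws} before {x y body} → us ++ ws ≡ before ++ header x y ∷ body →
                  ∃[ before′ ] ws ≡ before′ ++ header x y ∷ body
  skip-noHeader []       before eq = before , eq
  skip-noHeader (() ∷ _) []     refl
  skip-noHeader (_ ∷ ps) (_ ∷ before) eq = skip-noHeader ps before (List.∷-injectiveʳ eq)

  -- Bodies contain no header, so a guessed suffix that starts with one cannot begin inside a body.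
  find-rule : ∀ rs before {x y body} → rawRules rs ≡ before ++ header x y ∷ body →
              ∃[ r ] r ∈ rs × x ≡ Rule.x₁ r × y ≡ Rule.x₂ r × ∃[ C ] body ≡ rawCond (Rule.body r) ++ C
  find-rule [] [] ()
  find-rule [] (_ ∷ _) ()
  find-rule (r ∷ rs) [] refl = r , here refl , refl , refl , rawRules rs , refl
  find-rule (r ∷ rs) (_ ∷ before) eq with skip-noHeader (rawCond-noHeader (Rule.body r)) before (List.∷-injectiveʳ eq)
  ... | before′ , eq′ with find-rule rs before′ eq′
  ... | r′ , r∈ , rest = r′ , there r∈ , rest

  look-functional : ∀ {E x u u′} → Look E x u → Look E x u′ → u ≡ u′
  look-functional here        here         = refl
  look-functional here        (there ≠ _)  = contradiction refl ≠
  look-functional (there ≠ _) here         = contradiction refl ≠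
  look-functional (there _ l) (there _ l′) = look-functional l l′

  value-functional : ∀ {E} t {u u′} → Value E t u → Value E t u′ → u ≡ u′
  value-functional (inj₁ x) l    l′   = look-functional l l′
  value-functional (inj₂ c) refl refl = refl

  pointwise-zip : ∀ {A B : Set} {R : A → B → Set} {xs ys x y} → Pointwise R xs ys → (x , y) ∈ List.zip xs ys → R x y
  pointwise-zip (r ∷ rs) (here refl) = r
  pointwise-zip (r ∷ rs) (there xy∈) = pointwise-zip rs xy∈

  module _ {E f κ} (holds : All (LitHolds E f f) κ) where

    occurs-value : ∀ {t w} → Occurs κ f t w → Value E t (val w)
    occurs-value (ts , α∈ , tw∈) with All.lookup holds α∈
    ... | ws , inj₁ refl , vs = pointwise-zip vs tw∈
    ... | ws , inj₂ refl , vs = pointwise-zip vs tw∈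

    forced-value : ∀ {t u} → Forced κ f t u → Value E t u
    forced-value (inj₁ (c , refl , refl)) = refl
    forced-value (inj₂ (w , o , refl))    = occurs-value o

    -- A term has at most one value in an environment, so forced values are the actual ones.
    refuted-sound : ¬ Refuted f κ
    refuted-sound (predicate α∈ p≢) with All.lookup holds α∈
    ... | ws , inj₁ refl , _ = p≢ refl
    ... | ws , inj₂ refl , _ = p≢ refl
    refuted-sound (clash {t} o fo ≠) = ≠ (value-functional t (occurs-value o) (forced-value fo))
    refuted-sound (identical {t} ∈κ) with All.lookup holds ∈κ
    ... | u , u′ , v₁ , v₂ , ≠ = ≠ (value-functional t v₁ v₂)
    refuted-sound (collapse {s} {t} ∈κ fo fo′) with All.lookup holds ∈κ
    ... | u , u′ , v₁ , v₂ , ≠ = ≠ (trans (value-functional s v₁ (forced-value fo)) (value-functional t (forced-value fo′) v₂))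

  -- Environments given by functions

  envOf : (Var → RVal) → List Var → Env
  envOf f = map λ x → x , f x

  envOf-look : ∀ f {xs x} → x ∈ xs → Look (envOf f xs) x (f x)
  envOf-look f {y ∷ xs} {x} x∈ with x ≟ᵛ y
  ... | yes refl = here
  envOf-look f (here refl) | no ≠ = contradiction refl ≠
  envOf-look f (there x∈)  | no ≠ = there ≠ (envOf-look f x∈)

  termVars : Term → List Var
  termVars (var x) = [ x ]
  termVars (con _) = []

  argVars : ∀ {n} → Vec Term n → List Var
  argVars ts = concatMap termVars (Vec.toList ts)

  literalVars : Literal → List Var
  literalVars (rel (P · ts)) = argVars ts
  literalVars (neq s t)      = termVars s ++ termVars t

  constraintVars : DenialConstraint → List Var
  constraintVars = concatMap literalVars

  constVal : Const → RVal
  constVal c = inj₁ (rawConst c)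

  constVal-injective : ∀ {c d} → constVal c ≡ constVal d → c ≡ d
  constVal-injective {ident _} {ident _} refl = refl
  constVal-injective {value _} {value _} refl = refl

  toFact : Atom Word → Fact
  toFact = mapAtom value

  value-injective : ∀ {u w} → value u ≡ value w → u ≡ w
  value-injective refl = refl

  mapVec-injective : ∀ {A B : Set} {f : A → B} → (∀ {x y} → f x ≡ f y → x ≡ y) → ∀ {n} (u w : Vec A n) → Vec.map f u ≡ Vec.map f w → u ≡ w
  mapVec-injective inj []      []      _  = refl
  mapVec-injective inj (_ ∷ u) (_ ∷ w) eq = cong₂ _∷_ (inj (Vec.∷-injectiveˡ eq)) (mapVec-injective inj u w (Vec.∷-injectiveʳ eq))

  ·-injective : ∀ {A : Set} {P} {us ws : Vec A (arity P)} → _≡_ {A = Atom A} (P · us) (P · ws) → us ≡ ws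
  ·-injective refl = refl

  toFact-injective : ∀ {a b} → toFact a ≡ toFact b → a ≡ b
  toFact-injective {P · us} {Q · ws} eq = go eq
    where
    go : ∀ {Q} {ws : Vec Word (arity Q)} → P · Vec.map value us ≡ Q · Vec.map value ws → P · us ≡ Q · ws
    go {Q} {ws} eq with cong pred eq
    ... | refl = cong (P ·_) (mapVec-injective value-injective us ws (·-injective eq))

  LitTrue : Assignment → List Fact → Literal → Set
  LitTrue ν C (rel α)   = mapAtom (value-of ν) α ∈ C
  LitTrue ν C (neq s t) = value-of ν s ≢ value-of ν t

  module _ (ν : Assignment) where

    private
      E : List Var → Env
      E = envOf (constVal ∘ ν)

    value-envOf : ∀ {xs} t → termVars t ⊆ xs → Value (E xs) (rawTerm t) (constVal (value-of ν t))
    value-envOf (var x) t⊆ = envOf-look (constVal ∘ ν) (t⊆ (here refl))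
    value-envOf (con c) t⊆ = refl

    values-envOf : ∀ {xs n} (ts : Vec Term n) ws → argVars ts ⊆ xs → Vec.map (value-of ν) ts ≡ Vec.map value ws →
                   Values (E xs) (map rawTerm (Vec.toList ts)) (Vec.toList ws)
    values-envOf []       []       _  _  = []
    values-envOf {xs} (t ∷ ts) (w ∷ ws) ts⊆ eq =
      subst (λ c → Value (E xs) (rawTerm t) (constVal c)) (Vec.∷-injectiveˡ eq) (value-envOf t (ts⊆ ∘ ∈-++⁺ˡ)) ∷
      values-envOf ts ws (ts⊆ ∘ ∈-++⁺ʳ (termVars t)) (Vec.∷-injectiveʳ eq)

    atom-envOf : ∀ {xs} α a → argVars (args α) ⊆ xs → mapAtom (value-of ν) α ≡ toFact a →
                 ∃[ ws ] (rawPred (pred α) , ws) ≡ rawFact a × Values (E xs) (map rawTerm (Vec.toList (args α))) ws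
    atom-envOf (P · ts) (Q · ws) ts⊆ eq with cong pred eq
    ... | refl = Vec.toList ws , refl , values-envOf ts ws ts⊆ (·-injective eq)

    literal-envOf : ∀ {xs C a b} ℓ → literalVars ℓ ⊆ xs → (∀ {φ} → φ ∈ C → φ ≡ toFact a ⊎ φ ≡ toFact b) →
                    LitTrue ν C ℓ → LitHolds (E xs) (rawFact a) (rawFact b) (rawLiteral ℓ)
    literal-envOf {a = a} {b} (rel α) ⊆xs C⊆ p with C⊆ p
    ... | inj₁ eq = let ws , e , vs = atom-envOf α a ⊆xs eq in ws , inj₁ e , vs
    ... | inj₂ eq = let ws , e , vs = atom-envOf α b ⊆xs eq in ws , inj₂ e , vs
    literal-envOf (neq s t) ⊆xs C⊆ ≠ =
      _ , _ , value-envOf s (⊆xs ∘ ∈-++⁺ˡ) , value-envOf t (⊆xs ∘ ∈-++⁺ʳ (termVars s)) , ≠ ∘ constVal-injective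

    constraint-envOf : ∀ {C a b} κ → (∀ {φ} → φ ∈ C → φ ≡ toFact a ⊎ φ ≡ toFact b) → All (LitTrue ν C) κ →
                       All (LitHolds (E (constraintVars κ)) (rawFact a) (rawFact b)) (rawConstraint κ)
    constraint-envOf {C} {a} {b} κ C⊆ = go κ (λ x∈ → x∈)
      where
      go : ∀ κ′ → concatMap literalVars κ′ ⊆ constraintVars κ → All (LitTrue ν C) κ′ →
           All (LitHolds (E (constraintVars κ)) (rawFact a) (rawFact b)) (rawConstraint κ′)
      go []       ⊆κ []       = []
      go (ℓ ∷ κ′) ⊆κ (p ∷ ps) = literal-envOf {a = a} {b} ℓ (⊆κ ∘ ∈-++⁺ˡ) C⊆ p ∷ go κ′ (⊆κ ∘ ∈-++⁺ʳ (literalVars ℓ)) ps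

  -- Inconsistency

  module _ (𝔄 : Structure) where
    open Structure 𝔄

    term-constant : ∀ (ν : Assignment) t → term (constant ∘ ν) t ≡ constant (value-of ν t)
    term-constant ν (var x) = refl
    term-constant ν (con c) = refl

    atom-constant : ∀ (ν : Assignment) α → mapAtom (term (constant ∘ ν)) α ≡ mapAtom constant (mapAtom (value-of ν) α)
    atom-constant ν (P · ts) = cong (P ·_) (trans (Vec.map-cong (term-constant ν) ts) (Vec.map-∘ constant (value-of ν) ts))

    literal-constant : ∀ {ν C} ℓ → All SatisfiesFact C → LitTrue ν C ℓ → ⟦ ℓ ⟧ (constant ∘ ν)
    literal-constant {ν} (rel α)   facts p = subst True (sym (atom-constant ν α)) (All.lookup facts p)
    literal-constant {ν} (neq s t) facts p eq =
      p (unique-names (trans (sym (term-constant ν s)) (trans eq (term-constant ν t))))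

  violation-inconsistent : ∀ {𝒯 C κ ν} → κ ∈ 𝒯 → All (LitTrue ν C) κ → Inconsistent C 𝒯
  violation-inconsistent κ∈ ps (𝔄 , facts , constraints) =
    All.lookup constraints κ∈ _ (All.map (λ {ℓ} → literal-constant 𝔄 ℓ facts) ps)

  herbrand : List Fact → Structure
  herbrand C = record
    { Dom = Const ; constant = λ c → c ; unique-names = λ eq → eq ; relation = λ P cs → (P · cs) ∈ C }

  herbrand-literal : ∀ {C} ν ℓ → Structure.⟦_⟧ (herbrand C) ℓ ν → LitTrue ν C ℓ
  herbrand-literal {C} ν (rel (P · ts)) p = subst (λ cs → (P · cs) ∈ C) (Vec.map-cong (herbrand-term ν) ts) p
    where
    herbrand-term : ∀ ν t → Structure.term (herbrand C) ν t ≡ value-of ν t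
    herbrand-term ν (var x) = refl
    herbrand-term ν (con c) = refl
  herbrand-literal ν (neq (var _) (var _)) p = p
  herbrand-literal ν (neq (var _) (con _)) p = p
  herbrand-literal ν (neq (con _) (var _)) p = p
  herbrand-literal ν (neq (con _) (con _)) p = p

  -- The Herbrand structure of `C` is a model. Inconsistency thus comes down to assignments of
  -- constants, though only in this contrapositive form.
  consistent : ∀ {C 𝒯} → (∀ {κ} → κ ∈ 𝒯 → ∀ ν → ¬ All (LitTrue ν C) κ) → ¬ Inconsistent C 𝒯
  consistent {C} safe inc = inc (herbrand C ,
    All.tabulate (λ { {P · cs} φ∈ → subst (λ cs → (P · cs) ∈ C) (sym (Vec.map-id cs)) φ∈ }) ,
    All.tabulate (λ κ∈ ν ps → safe κ∈ ν (All.map (λ {ℓ} → herbrand-literal ν ℓ) ps)))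

  raw∈ : ∀ {𝒯 κ} → κ ∈ 𝒯 → rawConstraint κ ∈ rawTheory 𝒯
  raw∈ = ∈-map⁺ rawConstraint

  stable-consistent : ∀ {𝒯 C a} → Stable (rawTheory 𝒯) (rawFact a) → (∀ {φ} → φ ∈ C → φ ≡ toFact a) → ¬ Inconsistent C 𝒯
  stable-consistent {a = a} st C⊆ = consistent λ {κ} κ∈ ν ps →
    refuted-sound (constraint-envOf ν {a = a} {a} κ (inj₁ ∘ C⊆) ps) (All.lookup st (raw∈ κ∈))

  harmless-consistent : ∀ {𝒯} → All Harmless (rawTheory 𝒯) → ¬ Inconsistent [] 𝒯
  harmless-consistent {𝒯} hs = consistent λ κ∈ ν ps → go ps (All.lookup hs (raw∈ κ∈))
    where
    go : ∀ {ν κ} → All (LitTrue ν []) κ → ¬ Harmless (rawConstraint κ)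
    go ps (relational α∈) with ∈-map⁻ rawLiteral α∈
    ... | rel _ , ∈κ , refl with All.lookup ps ∈κ
    ... | ()
    go {ν} ps (identical t∈) with ∈-map⁻ rawLiteral t∈
    ... | neq s t , ∈κ , eq = All.lookup ps ∈κ (cong (value-of ν)
          (rawTerm-injective {s} {t} (trans (sym (cong (Sum.[ (λ _ → rawTerm s) , proj₁ ]) eq)) (cong (Sum.[ (λ _ → rawTerm t) , proj₂ ]) eq))))

  _≟ᵖ_ : (P Q : Pred) → Dec (P ≡ Q)
  P ≟ᵖ Q with List.≡-dec Bool._≟_ (name P) (name Q)
  ... | yes eq = yes (name-injective eq)
  ... | no ≠ = no λ { refl → ≠ refl }

  _≟ᶜ_ : (c d : Const) → Dec (c ≡ d)
  ident u ≟ᶜ ident w with List.≡-dec Bool._≟_ u w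
  ... | yes refl = yes refl
  ... | no ≠     = no λ { refl → ≠ refl }
  value u ≟ᶜ value w with List.≡-dec Bool._≟_ u w
  ... | yes refl = yes refl
  ... | no ≠     = no λ { refl → ≠ refl }
  ident _ ≟ᶜ value _ = no λ ()
  value _ ≟ᶜ ident _ = no λ ()

  _≟ᶠ_ : (φ ψ : Fact) → Dec (φ ≡ ψ)
  (P · cs) ≟ᶠ (Q · ds) with P ≟ᵖ Q
  ... | no ≠ = no (≠ ∘ cong pred)
  ... | yes refl with Vec.≡-dec _≟ᶜ_ cs ds
  ... | yes refl = yes refl
  ... | no ≠ = no (≠ ∘ ·-injective)

  _∈ᶠ?_ : ∀ φ C → Dec (φ ∈ C)
  φ ∈ᶠ? C = Any.any? (φ ≟ᶠ_) C

  -- Conflicts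

  Genuine : RFact → Set
  Genuine f = ∃[ a ] f ≡ rawFact a × ¬ IsMeta (pred a)

  genuine-atom : ∀ {E f} α {ws} → Plain f → (proj₁ (rawAtom α) , ws) ≡ f → Values E (proj₂ (rawAtom α)) ws → Genuine f
  genuine-atom (P · ts) {ws} (m , ws′ , refl) eq vs with atArity ts vs
    where
    atArity : ∀ {E n} (ts : Vec Term n) {ws} → Values E (map rawTerm (Vec.toList ts)) ws → ∃[ us ] Vec.toList {n = n} us ≡ ws
    atArity []       []       = [] , refl
    atArity (t ∷ ts) (_ ∷ vs) with atArity ts vs
    ... | us , refl = _ ∷ us , refl
  ... | us , refl = P · us , sym eq , rawPred-plain P (cong proj₁ eq)

  -- Nothing in a guessed word guarantees that its predicate exists and has that many arguments.
  -- Both follow from an atom of the violated constraint that is mapped to the fact. If no atom is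
  -- mapped to one of two different facts, the other violates the constraint alone, against its
  -- stability; if the facts are equal and there is no atom at all, harmlessness is contradicted.
  conflicting-genuine : ∀ {𝒯 f h} → All Harmless (rawTheory 𝒯) → Conflicting (rawTheory 𝒯) f h → Genuine f × Genuine h
  conflicting-genuine {𝒯} {f} {h} hs record { κ∈ = κ∈ ; violated = E , vio ; minimal = m ; plainˡ = pˡ ; plainʳ = pʳ }
    with ∈-map⁻ rawConstraint κ∈
  ... | κ₀ , κ₀∈ , refl = left-genuine m (matchˡ κ₀ vio) , right-genuine m (matchʳ κ₀ vio)
    where
    matchˡ : ∀ κ → All (LitHolds E f h) (rawConstraint κ) → Genuine f ⊎ All (LitHolds E h h) (rawConstraint κ)
    matchˡ [] [] = inj₂ []
    matchˡ (rel α ∷ κ) ((ws , inj₁ eq , vs) ∷ ps) = inj₁ (genuine-atom {E} α pˡ eq vs)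
    matchˡ (rel α ∷ κ) ((ws , inj₂ eq , vs) ∷ ps) = Sum.map₂ (_∷_ (ws , inj₂ eq , vs)) (matchˡ κ ps)
    matchˡ (neq s t ∷ κ) (p ∷ ps) = Sum.map₂ (p ∷_) (matchˡ κ ps)
    matchʳ : ∀ κ → All (LitHolds E f h) (rawConstraint κ) → Genuine h ⊎ All (LitHolds E f f) (rawConstraint κ)
    matchʳ [] [] = inj₂ []
    matchʳ (rel α ∷ κ) ((ws , inj₂ eq , vs) ∷ ps) = inj₁ (genuine-atom {E} α pʳ eq vs)
    matchʳ (rel α ∷ κ) ((ws , inj₁ eq , vs) ∷ ps) = Sum.map₂ (_∷_ (ws , inj₁ eq , vs)) (matchʳ κ ps)
    matchʳ (neq s t ∷ κ) (p ∷ ps) = Sum.map₂ (p ∷_) (matchʳ κ ps)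
    self : ∀ {g κ} → Plain g → Harmless (rawConstraint κ) → All (LitHolds E g g) (rawConstraint κ) → Genuine g
    self pl (relational α∈) ps with ∈-map⁻ rawLiteral α∈
    ... | rel α , ∈κ , refl with All.lookup ps α∈
    ... | ws , inj₁ eq , vs = genuine-atom {E} α pl eq vs
    ... | ws , inj₂ eq , vs = genuine-atom {E} α pl eq vs
    self pl (identical {t} t∈) ps with All.lookup ps t∈
    ... | u , u′ , v₁ , v₂ , ≠ = contradiction (value-functional t v₁ v₂) ≠
    left-genuine : f ≡ h ⊎ Stable _ f × Stable _ h → Genuine f ⊎ All (LitHolds E h h) (rawConstraint κ₀) → Genuine f
    left-genuine _ (inj₁ g) = g
    left-genuine (inj₁ refl) (inj₂ ps) = self pʳ (All.lookup hs κ∈) ps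
    left-genuine (inj₂ (_ , st)) (inj₂ ps) = contradiction (All.lookup st κ∈) (refuted-sound ps)
    right-genuine : f ≡ h ⊎ Stable _ f × Stable _ h → Genuine h ⊎ All (LitHolds E f f) (rawConstraint κ₀) → Genuine h
    right-genuine _ (inj₁ g) = g
    right-genuine (inj₁ refl) (inj₂ ps) = self pʳ (All.lookup hs κ∈) ps
    right-genuine (inj₂ (st , _)) (inj₂ ps) = contradiction (All.lookup st κ∈) (refuted-sound ps)

  -- Constants for the values of an environment. Identifiers of facts are
  -- longer than N, and those of the instance are not.
  high low : Fin 4 → Bool
  high 𝟘 = false
  high 𝟙 = false
  high _ = true
  low 𝟘 = false
  low ‹ = false
  low _ = true

  bits-injective : ∀ a b → high a ≡ high b → low a ≡ low b → a ≡ b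
  bits-injective a b eq eq′ = trans (sym (letter-bits a)) (trans (cong₂ letter eq eq′) (letter-bits b))
    where
    letter : Bool → Bool → Fin 4
    letter false false = 𝟘
    letter false true  = 𝟙
    letter true  false = ‹
    letter true  true  = ›
    letter-bits : ∀ a → letter (high a) (low a) ≡ a
    letter-bits 𝟘 = refl
    letter-bits 𝟙 = refl
    letter-bits ‹ = refl
    letter-bits › = refl

  flat : Letters → Word
  flat []      = []
  flat (a ∷ w) = high a ∷ low a ∷ flat w

  flat-injective : ∀ u w → flat u ≡ flat w → u ≡ w
  flat-injective []      []      _  = refl
  flat-injective (a ∷ u) (b ∷ w) eq = cong₂ _∷_
    (bits-injective a b (List.∷-injectiveˡ eq) (List.∷-injectiveˡ (List.∷-injectiveʳ eq)))
    (flat-injective u w (List.∷-injectiveʳ (List.∷-injectiveʳ eq)))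

  long : ℕ → Word → Word
  long N w = replicate (suc N) true ++ w

  long-injective : ∀ N {u w} → long N u ≡ long N w → u ≡ w
  long-injective N = List.++-cancelˡ (replicate (suc N) true) _ _

  long-long : ∀ N w → N < length (long N w)
  long-long N w = s≤s (ℕ.≤-trans (ℕ.≤-trans (ℕ.≤-reflexive (sym (List.length-replicate N))) (ℕ.m≤m+n _ _))
                                 (ℕ.≤-reflexive (sym (List.length-++ (replicate N true)))))

  enc-fit-word : ∀ w → length w ≤ length (enc wordC w)
  enc-fit-word w = ℕ.≤-trans (length≤encs bitC w) (ℕ.≤-trans (ℕ.≤-trans (ℕ.m≤m+n _ 1)
                     (ℕ.≤-reflexive (sym (List.length-++ (encs bitC w))))) (ℕ.n≤1+n _))

  module Realise (N : ℕ) where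

    -- Identifiers of at most `N` letters may occur in the instance and are kept. Longer ones are
    -- recoded together with the facts, since otherwise one of them could coincide with the new
    -- identifier of a fact.
    idOf : RVal → Word
    idOf (inj₁ (idn w)) with length w ≤? N
    ... | yes _ = w
    ... | no _  = long N (flat (enc valC (inj₁ (idn w))))
    idOf (val w) = long N (flat (enc valC (val w)))
    idOf (fid f) = long N (flat (enc valC (fid f)))

    idOf-short : ∀ {w} → length w ≤ N → idOf (inj₁ (idn w)) ≡ w
    idOf-short {w} w≤ with length w ≤? N
    ... | yes _ = refl
    ... | no ≰ = contradiction w≤ ≰

    private
      data View : RVal → Word → Set where
        short : ∀ {w} → length w ≤ N → View (inj₁ (idn w)) w
        code  : ∀ {u} → View u (long N (flat (enc valC u)))

      view : ∀ u → View u (idOf u)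
      view (inj₁ (idn w)) with length w ≤? N
      ... | yes w≤ = short w≤
      ... | no _   = code
      view (val w) = code
      view (fid f) = code

      view-injective : ∀ {u u′ w w′} → View u w → View u′ w′ → w ≡ w′ → u ≡ u′
      view-injective (short _)  (short _)  refl = refl
      view-injective (short w≤) (code {u}) refl = contradiction w≤ (ℕ.<⇒≱ (long-long N (flat (enc valC u))))
      view-injective (code {u}) (short w≤) refl = contradiction w≤ (ℕ.<⇒≱ (long-long N (flat (enc valC u))))
      view-injective (code {u}) (code {u′}) eq = enc-injective valC {u} {u′} (flat-injective _ _ (long-injective N eq))

    idOf-injective : ∀ {u u′} → idOf u ≡ idOf u′ → u ≡ u′
    idOf-injective {u} {u′} = view-injective (view u) (view u′)

    realise : RVal → Const
    realise (val w)            = value w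
    realise u@(inj₁ (idn _)) = ident (idOf u)
    realise u@(fid _)         = ident (idOf u)

    ident-injective : ∀ {u w} → ident u ≡ ident w → u ≡ w
    ident-injective refl = refl

    realise-injective : ∀ {u u′} → realise u ≡ realise u′ → u ≡ u′
    realise-injective {val _} {val _} refl = refl
    realise-injective {inj₁ (idn _)} {inj₁ (idn _)} eq = idOf-injective (ident-injective eq)
    realise-injective {inj₁ (idn w)} {fid f} eq = idOf-injective {inj₁ (idn w)} {fid f} (ident-injective eq)
    realise-injective {fid f} {inj₁ (idn w)} eq = idOf-injective {fid f} {inj₁ (idn w)} (ident-injective eq)
    realise-injective {fid _} {fid _} eq = idOf-injective (ident-injective eq)

    assign : Env → Assignment
    assign []            = λ _ → value []
    assign ((x , u) ∷ E) = assign E [ x ≔ realise u ]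

    assign-look : ∀ {E x u} → Look E x u → assign E x ≡ realise u
    assign-look {x = x} here with x ≟ᵛ x
    ... | yes _ = refl
    ... | no ≠  = contradiction refl ≠
    assign-look {x = x} (there {y = y} x≢y l) with y ≟ᵛ x
    ... | yes refl = contradiction refl x≢y
    ... | no _     = assign-look l

    assign-value : ∀ {E u} t → length (enc termC (rawTerm t)) ≤ N → Value E (rawTerm t) u → value-of (assign E) t ≡ realise u
    assign-value (var x) _  l    = assign-look l
    assign-value (con (value w)) _  refl = refl
    assign-value (con (ident w)) t≤ refl =
      cong ident (sym (idOf-short (ℕ.≤-trans (enc-fit-word w) (ℕ.<⇒≤ (ℕ.<⇒≤ t≤)))))

    assign-values : ∀ {E n} (ts : Vec Term n) ws → length (encs termC (map rawTerm (Vec.toList ts))) ≤ N →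
                    Values E (map rawTerm (Vec.toList ts)) (Vec.toList ws) → Vec.map (value-of (assign E)) ts ≡ Vec.map value ws
    assign-values []       []       _  _        = refl
    assign-values (t ∷ ts) (w ∷ ws) t≤ (v ∷ vs) =
      cong₂ _∷_ (assign-value t (fitˡ (enc termC (rawTerm t)) _ t≤) v) (assign-values ts ws (fitʳ (enc termC (rawTerm t)) _ t≤) vs)

    assign-atom : ∀ {E} α {ws} a → length (enc atomC (rawAtom α)) ≤ N → (proj₁ (rawAtom α) , ws) ≡ rawFact a →
                  Values E (proj₂ (rawAtom α)) ws → mapAtom (value-of (assign E)) α ≡ toFact a
    assign-atom (P · ts) (Q · us) α≤ eq vs with rawPred-injective {P} {Q} (cong proj₁ eq)
    assign-atom (P · ts) (P · us) α≤ refl vs | refl =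
      cong (P ·_) (assign-values ts us (proj₂ (proj₂ (predArgs-fit termC (rawPred P) (map rawTerm (Vec.toList ts)) α≤))) vs)

    assign-literal : ∀ {E a b} ℓ → length (enc literalC (rawLiteral ℓ)) ≤ N →
                     LitHolds E (rawFact a) (rawFact b) (rawLiteral ℓ) → LitTrue (assign E) (toFact a ∷ toFact b ∷ []) ℓ
    assign-literal {a = a} (rel α) ℓ≤ (ws , inj₁ eq , vs) = here (assign-atom α a (ℕ.<⇒≤ ℓ≤) eq vs)
    assign-literal {b = b} (rel α) ℓ≤ (ws , inj₂ eq , vs) = there (here (assign-atom α b (ℕ.<⇒≤ ℓ≤) eq vs))
    assign-literal (neq s t) ℓ≤ (u , u′ , v₁ , v₂ , ≠) eq = ≠ (realise-injective
      (trans (sym (assign-value s (fitˡ (enc termC (rawTerm s)) _ (ℕ.<⇒≤ ℓ≤)) v₁))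
        (trans eq (assign-value t (fitʳ (enc termC (rawTerm s)) _ (ℕ.<⇒≤ ℓ≤)) v₂))))

    assign-constraint : ∀ {E a b} κ → length (encs literalC (rawConstraint κ)) ≤ N →
                        All (LitHolds E (rawFact a) (rawFact b)) (rawConstraint κ) →
                        All (LitTrue (assign E) (toFact a ∷ toFact b ∷ [])) κ
    assign-constraint []      _  []       = []
    assign-constraint {a = a} {b} (ℓ ∷ κ) κ≤ (p ∷ ps) =
      assign-literal {a = a} {b} ℓ (fitˡ (enc literalC (rawLiteral ℓ)) _ κ≤) p ∷
      assign-constraint {a = a} {b} κ (fitʳ (enc literalC (rawLiteral ℓ)) _ κ≤) ps

  both-∈ : ∀ {φ ψ : Fact} {C} → φ ∈ C → ψ ∈ C → φ ∷ ψ ∷ [] ⊆ C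
  both-∈ φ∈ ψ∈ (here refl)         = φ∈
  both-∈ φ∈ ψ∈ (there (here refl)) = ψ∈

  others : ∀ {φ ψ : Fact} {C} → C ⊆ φ ∷ ψ ∷ [] → φ ∉ C → ∀ {χ} → χ ∈ C → χ ≡ ψ
  others C⊆ φ∉ χ∈ with C⊆ χ∈
  ... | here refl         = contradiction χ∈ φ∉
  ... | there (here refl) = refl

  swap-pair : ∀ {φ ψ : Fact} {C} → C ⊆ φ ∷ ψ ∷ [] → C ⊆ ψ ∷ φ ∷ []
  swap-pair C⊆ χ∈ with C⊆ χ∈
  ... | here eq         = there (here eq)
  ... | there (here eq) = here eq

  no-member : ∀ {C : List Fact} → (∀ {χ} → χ ∉ C) → C ≡ []
  no-member {[]}    ∉C = refl
  no-member {_ ∷ _} ∉C = contradiction (here refl) ∉C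

  -- A subset of the pair without one member contains at most the other one, which is stable; if
  -- both are equal, nothing is left and harmlessness applies.
  incomplete-consistent : ∀ {𝒯 a b C} → All Harmless (rawTheory 𝒯) → C ⊆ toFact a ∷ toFact b ∷ [] → toFact a ∉ C →
                          rawFact a ≡ rawFact b ⊎ Stable (rawTheory 𝒯) (rawFact b) → ¬ Inconsistent C 𝒯
  incomplete-consistent {𝒯} {a} {b} hs C⊆ a∉ (inj₁ eq) inc = harmless-consistent hs (subst (λ C → Inconsistent C 𝒯)
    (no-member λ χ∈ → a∉ (subst (_∈ _) (trans (others C⊆ a∉ χ∈) (cong toFact (sym (rawFact-injective {a} {b} eq)))) χ∈)) inc)
  incomplete-consistent {b = b} hs C⊆ a∉ (inj₂ st) = stable-consistent {a = b} st (others C⊆ a∉)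

  -- Minimality compares the pair only with its own subsets. The dataset `D` matters through
  -- inclusion alone, so enlarging it for other edges keeps the conflict.
  conflict-sound : ∀ {𝒯 a b} {D : List Fact} → All Harmless (rawTheory 𝒯) → Conflicting (rawTheory 𝒯) (rawFact a) (rawFact b) →
                   toFact a ∈ D → toFact b ∈ D → IsConflict D 𝒯 (toFact a ∷ toFact b ∷ [])
  conflict-sound {𝒯} {a} {b} hs record { κ∈ = κ∈ ; violated = E , vio ; minimal = m } a∈ b∈ with ∈-map⁻ rawConstraint κ∈
  ... | κ , κ∈𝒯 , refl = record
    { subset = both-∈ a∈ b∈
    -- Facts contain no identifiers and look the same for every `N`. The bound chosen here only has
    -- to protect the identifiers in this constraint.
    ; inconsistent = violation-inconsistent κ∈𝒯 (Realise.assign-constraint (length (encs literalC (rawConstraint κ))) {E} {a} {b} κ ℕ.≤-refl vio)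
    ; minimal = λ {C′} C′⊆ inc → both-∈
        (decidable-stable (toFact a ∈ᶠ? C′) λ a∉ → incomplete-consistent {a = a} {b} hs C′⊆ a∉ (Sum.map₂ proj₂ m) inc)
        (decidable-stable (toFact b ∈ᶠ? C′) λ b∉ → incomplete-consistent {a = b} {a} hs (swap-pair C′⊆) b∉ (Sum.map sym proj₁ m) inc) }

  -- Datasets and meta-databases for environments

  NFact MFact : Set
  NFact = Σ (Atom Word) λ a → ¬ IsMeta (pred a)
  MFact = Σ (Atom RVal) λ m → IsMeta (pred m) × (∀ j → isId (lookup (args m) j) ≡ lookup (posID (pred m)) j)

  _≟ʳ_ : (u u′ : RVal) → Dec (u ≡ u′)
  u ≟ʳ u′ = Dec.map′ (enc-injective valC {u} {u′}) (λ { refl → refl }) (enc valC u ≟ˡ enc valC u′)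

  unvalue : Const → Word
  unvalue (ident w) = w
  unvalue (value w) = w

  rawOf : Fact → RFact
  rawOf (P · cs) = rawPred P , map unvalue (Vec.toList cs)

  rawOf-toFact : ∀ a → rawOf (toFact a) ≡ rawFact a
  rawOf-toFact (P · ws) = cong (rawPred P ,_) (go ws)
    where
    go : ∀ {n} (ws : Vec Word n) → map unvalue (Vec.toList (Vec.map value ws)) ≡ Vec.toList ws
    go []       = refl
    go (w ∷ ws) = cong (w ∷_) (go ws)

  ∈-replicate : ∀ {A : Set} {x y : A} n → y Vec∈.∈ Vec.replicate n x → y ≡ x
  ∈-replicate (suc n) (VecAny.here eq)  = eq
  ∈-replicate (suc n) (VecAny.there y∈) = ∈-replicate n y∈

  ∈-mapVec : ∀ {A B : Set} {f : A → B} {y n} (xs : Vec A n) → y Vec∈.∈ Vec.map f xs → ∃[ x ] x ∈ Vec.toList xs × y ≡ f x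
  ∈-mapVec (x ∷ xs) (VecAny.here eq)  = x , here refl , eq
  ∈-mapVec (x ∷ xs) (VecAny.there y∈) = Product.map₂ (Product.map₁ there) (∈-mapVec xs y∈)

  length-concat : ∀ {ws : List Word} {w} → w ∈ ws → length w ≤ length (List.concat ws)
  length-concat {w ∷ ws} (here refl) = ℕ.≤-trans (ℕ.m≤m+n _ _) (ℕ.≤-reflexive (sym (List.length-++ w)))
  length-concat {v ∷ ws} (there w∈)  =
    ℕ.≤-trans (length-concat w∈) (ℕ.≤-trans (ℕ.m≤n+m _ (length v)) (ℕ.≤-reflexive (sym (List.length-++ v))))

  module Build (N : ℕ) (nf : List NFact) (mf : List MFact) where
    open Realise N

    nfacts : List Fact
    nfacts = map (toFact ∘ proj₁) nf

    known : List RVal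
    known = map (fid ∘ rawFact ∘ proj₁) nf

    -- Identifiers in metafacts must belong to facts of the dataset. These are the ones for which a
    -- fact has yet to be supplied.
    Extra : RVal → Set
    Extra u = isId u ≡ true × u ∉ known

    extra? : ∀ u → Dec (Extra u)
    extra? u = (isId u Bool.≟ true) ×-dec ¬? (Any.any? (u ≟ʳ_) known)

    extras : List RVal
    extras = List.filter extra? (concatMap (Vec.toList ∘ args ∘ proj₁) mf)

    words : List Word
    words = concatMap (Vec.toList ∘ args ∘ proj₁) nf

    Q : Pred
    Q = proj₁ someNonMeta

    -- Longer than every constant of `nf`, hence in no fact of `nf`; and different for different
    -- identifiers.
    fresh : RVal → Word
    fresh u = long (length (List.concat words)) (flat (enc valC u))

    -- A fact for each identifier that is not the identifier of a fact in nf.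
    dummy : RVal → Fact
    dummy u = Q · Vec.replicate (arity Q) (value (fresh u))

    fresh-∉ : ∀ u → fresh u ∉ words
    fresh-∉ u ∈ws = ℕ.<⇒≱ (long-long _ (flat (enc valC u))) (length-concat ∈ws)

    replicate-≡ : ∀ {m} {c : Const} {cs : Vec Const m} → 1 ≤ m → Vec.replicate m c ≡ cs → c ∈ Vec.toList cs
    replicate-≡ {suc m} {cs = d ∷ cs} _ eq = here (Vec.∷-injectiveˡ eq)

    dummy-injective : ∀ {u u′} → dummy u ≡ dummy u′ → u ≡ u′
    dummy-injective {u} {u′} eq = enc-injective valC {u} {u′} (flat-injective _ _ (long-injective (length (List.concat words))
      (value-injective (∈-replicate′ (arity Q) (replicate-≡ (arity≥1 Q) (·-injective eq))))))
      where
      ∈-replicate′ : ∀ {c d : Const} n → c ∈ Vec.toList (Vec.replicate n d) → c ≡ d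
      ∈-replicate′ (suc n) (here eq)  = eq
      ∈-replicate′ (suc n) (there c∈) = ∈-replicate′ n c∈

    dummy-∉ : ∀ u → dummy u ∉ nfacts
    dummy-∉ u ∈nf with ∈-map⁻ (toFact ∘ proj₁) ∈nf
    ... | (a , ¬meta) , a∈ , eq = go a a∈ eq
      where
      unmap : ∀ {n} {w} (ws : Vec Word n) → value w ∈ Vec.toList (Vec.map value ws) → w ∈ Vec.toList ws
      unmap (w ∷ ws) (here refl) = here refl
      unmap (w ∷ ws) (there w∈)  = there (unmap ws w∈)
      go : ∀ a {¬meta} → (a , ¬meta) ∈ nf → dummy u ≢ toFact a
      go (P · ws) a∈ eq with cong pred eq
      ... | refl = fresh-∉ u (∈-concat⁺′ (unmap ws (replicate-≡ (arity≥1 Q) (·-injective eq))) (∈-map⁺ (Vec.toList ∘ args ∘ proj₁) a∈))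

    dataset : Dataset
    dataset = record
      { facts = nfacts ++ map dummy extras
      ; no-metadata = λ α∈ → case ∈-++⁻ nfacts α∈ of λ
          { (inj₁ ∈nf) → case ∈-map⁻ (toFact ∘ proj₁) ∈nf of λ { ((_ · _ , ¬meta) , _ , refl) → ¬meta }
          ; (inj₂ ∈ex) → case ∈-map⁻ dummy ∈ex of λ { (_ , _ , refl) → proj₂ someNonMeta } }
      ; no-ids = λ α∈ c∈ → case ∈-++⁻ nfacts α∈ of λ
          { (inj₁ ∈nf) → case ∈-map⁻ (toFact ∘ proj₁) ∈nf of λ
              { ((_ · ws , _) , _ , refl) → case ∈-mapVec ws c∈ of λ { (_ , _ , refl) () } }
          ; (inj₂ ∈ex) → case ∈-map⁻ dummy ∈ex of λ
              { (_ , _ , refl) → case ∈-replicate (arity Q) c∈ of λ { refl () } } } }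

    dummyId : Fact → List RVal → ID
    dummyId φ []       = []
    dummyId φ (u ∷ us) with φ ≟ᶠ dummy u
    ... | yes _ = idOf u
    ... | no _  = dummyId φ us

    dummyId-dummy : ∀ {u us} → u ∈ us → dummyId (dummy u) us ≡ idOf u
    dummyId-dummy {u} {u′ ∷ us} u∈ with dummy u ≟ᶠ dummy u′
    ... | yes eq = cong idOf (sym (dummy-injective {u} {u′} eq))
    dummyId-dummy (here refl) | no ≠ = contradiction refl ≠
    dummyId-dummy (there u∈)  | no _ = dummyId-dummy u∈

    identifier : Fact → ID
    identifier φ with φ ∈ᶠ? nfacts
    ... | yes _ = idOf (fid (rawOf φ))
    ... | no _  = dummyId φ extras

    identifier-nfact : ∀ {a} → toFact a ∈ nfacts → identifier (toFact a) ≡ idOf (fid (rawFact a))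
    identifier-nfact {a} a∈ with toFact a ∈ᶠ? nfacts
    ... | yes _ = cong (idOf ∘ fid) (rawOf-toFact a)
    ... | no a∉ = contradiction a∈ a∉

    identifier-dummy : ∀ {u} → u ∈ extras → identifier (dummy u) ≡ idOf u
    identifier-dummy {u} u∈ with dummy u ∈ᶠ? nfacts
    ... | yes ∈nf = contradiction ∈nf (dummy-∉ u)
    ... | no _    = dummyId-dummy u∈

    -- Every fact of the dataset is labelled by the value that its identifier realises. Injectivity
    -- of `id` reduces to labels being distinct, which for `extras` is the condition of not being
    -- `known`.
    data Origin : Fact → RVal → Set where
      nfact : ∀ a → toFact a ∈ nfacts → Origin (toFact a) (fid (rawFact a))
      extra : ∀ {u} → u ∈ extras → Origin (dummy u) u

    origin : ∀ {φ} → φ ∈ facts dataset → ∃[ u ] Origin φ u × identifier φ ≡ idOf u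
    origin φ∈ with ∈-++⁻ nfacts φ∈
    ... | inj₁ ∈nf with ∈-map⁻ (toFact ∘ proj₁) ∈nf
    ... | (a , _) , _ , refl = _ , nfact a ∈nf , identifier-nfact {a} ∈nf
    origin φ∈ | inj₂ ∈ex with ∈-map⁻ dummy ∈ex
    ... | u , u∈ , refl = u , extra u∈ , identifier-dummy u∈

    known-nfact : ∀ a → toFact a ∈ nfacts → fid (rawFact a) ∈ known
    known-nfact a a∈ with ∈-map⁻ (toFact ∘ proj₁) a∈
    ... | (b , ¬meta) , b∈ , eq with toFact-injective {a} {b} eq
    ... | refl = ∈-map⁺ (fid ∘ rawFact ∘ proj₁) b∈

    extra-∉ : ∀ {u} → u ∈ extras → u ∉ known
    extra-∉ u∈ = proj₂ (proj₂ (∈-filter⁻ extra? {xs = concatMap (Vec.toList ∘ args ∘ proj₁) mf} u∈))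

    origin-injective : ∀ {φ ψ u u′} → Origin φ u → Origin ψ u′ → u ≡ u′ → φ ≡ ψ
    origin-injective (nfact a _) (nfact b _) eq = cong toFact (rawFact-injective {a} {b} (inj₂-injective eq))
    origin-injective (extra _) (extra _) refl = refl
    origin-injective (nfact a a∈) (extra u∈) refl = contradiction (known-nfact a a∈) (extra-∉ u∈)
    origin-injective (extra u∈) (nfact a a∈) refl = contradiction (known-nfact a a∈) (extra-∉ u∈)

    realise-isId : ∀ u → IsId (realise u) → isId u ≡ true
    realise-isId (inj₁ (idn _)) _ = refl
    realise-isId (fid _)        _ = refl

    isId-realise : ∀ u → isId u ≡ true → IsId (realise u)
    isId-realise (inj₁ (idn _)) _ = tt
    isId-realise (fid _)        _ = tt

    realise-ident : ∀ u {i} → ident i ≡ realise u → isId u ≡ true × i ≡ idOf u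
    realise-ident (inj₁ (idn _)) refl = refl , refl
    realise-ident (fid _)        refl = refl , refl

    metaDatabase : MetaDatabase dataset
    metaDatabase = record
      { id = identifier
      ; id-injective = λ α∈ β∈ eq → let u , oα , eα = origin α∈ ; u′ , oβ , eβ = origin β∈ in
          origin-injective oα oβ (idOf-injective {u} {u′} (trans (sym eα) (trans eq eβ)))
      ; metafacts = map (mapAtom realise ∘ proj₁) mf
      ; metadata = λ φ∈ → case ∈-map⁻ (mapAtom realise ∘ proj₁) φ∈ of λ { ((_ · _ , meta , _) , _ , refl) → meta }
      ; positions = λ φ∈ j → case ∈-map⁻ (mapAtom realise ∘ proj₁) φ∈ of λ
          { ((_ · us , _ , pos) , _ , refl) → mk⇔
              (λ i → Vec.lookup⇒[]= j _ (trans (sym (pos j))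
                       (realise-isId (lookup us j) (subst IsId (Vec.lookup-map j realise us) i))))
              (λ j∈ → subst IsId (sym (Vec.lookup-map j realise us))
                        (isId-realise (lookup us j) (trans (pos j) (Vec.[]=⇒lookup j∈)))) }
      ; known-ids = λ φ∈ i∈ → case ∈-map⁻ (mapAtom realise ∘ proj₁) φ∈ of λ
          { (m@(_ · us , _) , m∈ , refl) → case ∈-mapVec us i∈ of λ
            { (u , u∈ , eq) → known-id u (∈-concat⁺′ u∈ (∈-map⁺ (Vec.toList ∘ args ∘ proj₁) m∈)) (realise-ident u eq) } } }
      where
      known-id : ∀ u {i} → u ∈ concatMap (Vec.toList ∘ args ∘ proj₁) mf → isId u ≡ true × i ≡ idOf u →
                 ∃[ α ] α ∈ facts dataset × i ≡ identifier α
      known-id u u∈ (isid , refl) with Any.any? (u ≟ʳ_) known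
      ... | no u∉ = dummy u , ∈-++⁺ʳ nfacts (∈-map⁺ dummy u∈ex) , sym (identifier-dummy u∈ex)
        where u∈ex = ∈-filter⁺ extra? u∈ (isid , u∉)
      ... | yes u∈k with ∈-map⁻ (fid ∘ rawFact ∘ proj₁) u∈k
      ... | (a , ¬meta) , a∈ , refl = toFact a , ∈-++⁺ˡ a∈nf , sym (identifier-nfact {a} a∈nf)
        where a∈nf = ∈-map⁺ (toFact ∘ proj₁) a∈

  Needs : Set
  Needs = List NFact × List MFact

  Enough : Needs → List NFact → List MFact → Set
  Enough (nf₀ , mf₀) nf mf = nf₀ ⊆ nf × mf₀ ⊆ mf

  _⊎ⁿ_ : Needs → Needs → Needs
  (nf , mf) ⊎ⁿ (nf′ , mf′) = nf ++ nf′ , mf ++ mf′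

  enoughˡ : ∀ {n n′ nf mf} → Enough (n ⊎ⁿ n′) nf mf → Enough n nf mf
  enoughˡ (⊆nf , ⊆mf) = ⊆nf ∘ ∈-++⁺ˡ , ⊆mf ∘ ∈-++⁺ˡ

  enoughʳ : ∀ {n n′ nf mf} → Enough (n ⊎ⁿ n′) nf mf → Enough n′ nf mf
  enoughʳ {n} (⊆nf , ⊆mf) = ⊆nf ∘ ∈-++⁺ʳ (proj₁ n) , ⊆mf ∘ ∈-++⁺ʳ (proj₂ n)

  module _ (N : ℕ) where
    open Realise N
    open Build N

    values-vec : ∀ {E n} (ts : Vec Term n) → All (λ t → ∃[ w ] Value E t (val w)) (map rawTerm (Vec.toList ts)) →
                 ∃[ ws ] Values E (map rawTerm (Vec.toList ts)) (Vec.toList {n = n} ws)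
    values-vec []       []             = [] , []
    values-vec (t ∷ ts) ((w , v) ∷ vs) = let ws , vs′ = values-vec ts vs in w ∷ ws , v ∷ vs′

    values-toList : ∀ {E n} (ts : Vec Term n) {ws} → Values E (map rawTerm (Vec.toList ts)) ws → ∃[ us ] ws ≡ Vec.toList {n = n} us
    values-toList []       []       = [] , refl
    values-toList (t ∷ ts) (_ ∷ vs) with values-toList ts vs
    ... | us , refl = _ ∷ us , refl

    sorts-vec : ∀ {E n} (ts : Vec Term n) (bs : Vec Bool n) → length (encs termC (map rawTerm (Vec.toList ts))) ≤ N →
                Sorts E (map rawTerm (Vec.toList ts)) (Vec.toList bs) →
                ∃[ us ] Vec.map (value-of (assign E)) ts ≡ Vec.map realise us × (∀ j → isId (lookup us j) ≡ lookup bs j)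
    sorts-vec []       []       _  []                   = [] , refl , λ ()
    sorts-vec (t ∷ ts) (b ∷ bs) t≤ ((u , v , isid) ∷ ss) with sorts-vec ts bs (fitʳ (enc termC (rawTerm t)) _ t≤) ss
    ... | us , eq , ids = u ∷ us , cong₂ _∷_ (assign-value t (fitˡ (enc termC (rawTerm t)) _ t≤) v) eq , λ
      { zero → isid ; (suc j) → ids j }

    -- Here positivity is used: a finite supply of facts and metafacts makes the body true, and it
    -- stays true in every larger supply. The quantification over all larger supplies is what allows
    -- the needs of several edges to be united.
    holds-build : ∀ {E} φ → length (encs chunkC (rawCond φ)) ≤ N → HoldsIn Always E φ →
                  ∃[ n ] ∀ {nf mf} → Enough n nf mf → Holds (metaDatabase nf mf) (assign E) φ
    holds-build {E} (rel (P · ts)) φ≤ h with meta-dec P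
    ... | no ¬meta = plainCase (values-vec ts (subst (λ p → LeafHolds E (lrel (p , map rawTerm (Vec.toList ts)))) (plain-rawPred P ¬meta) h))
      where
      ts≤ : length (encs termC (map rawTerm (Vec.toList ts))) ≤ N
      ts≤ = proj₂ (proj₂ (predArgs-fit termC (rawPred P) (map rawTerm (Vec.toList ts))
              (fitˡ (enc atomC (rawAtom (P · ts))) [] (ℕ.<⇒≤ (ℕ.<⇒≤ φ≤)))))
      plainCase : ∃[ ws ] Values E (map rawTerm (Vec.toList ts)) (Vec.toList {n = arity P} ws) →
                  ∃[ n ] ∀ {nf mf} → Enough n nf mf → Holds (metaDatabase nf mf) (assign E) (rel (P · ts))
      plainCase (ws , vs) = ((P · ws , ¬meta) ∷ [] , []) , λ {nf} {mf} enough →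
        inj₂ (subst (λ cs → (P · cs) ∈ facts (dataset nf mf)) (sym (assign-values ts ws ts≤ vs))
          (∈-++⁺ˡ (∈-map⁺ (toFact ∘ proj₁) (proj₁ enough (here refl)))))
    ... | yes meta = metaCase (sorts-vec ts (posID P) ts≤ (subst (λ p → LeafHolds E (lrel (p , map rawTerm (Vec.toList ts)))) (meta-rawPred P meta) h))
      where
      ts≤ : length (encs termC (map rawTerm (Vec.toList ts))) ≤ N
      ts≤ = proj₂ (proj₂ (predArgs-fit termC (rawPred P) (map rawTerm (Vec.toList ts))
              (fitˡ (enc atomC (rawAtom (P · ts))) [] (ℕ.<⇒≤ (ℕ.<⇒≤ φ≤)))))
      metaCase : ∃[ us ] Vec.map (value-of (assign E)) ts ≡ Vec.map realise us × (∀ j → isId (lookup us j) ≡ lookup (posID P) j) →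
                 ∃[ n ] ∀ {nf mf} → Enough n nf mf → Holds (metaDatabase nf mf) (assign E) (rel (P · ts))
      metaCase (us , eq , ids) = ([] , (P · us , meta , ids) ∷ []) , λ {nf} {mf} enough →
        inj₁ (subst (λ cs → (P · cs) ∈ MetaDatabase.metafacts (metaDatabase nf mf)) (sym eq)
          (∈-map⁺ (mapAtom realise ∘ proj₁) (proj₂ enough (here refl))))
    holds-build {E} (idEq x (P · ts) ¬meta) φ≤ (ws , vs , l) with values-toList ts vs
    ... | us , refl = ((P · us , ¬meta) ∷ [] , []) , λ {nf} {mf} enough →
      let ∈nf = ∈-map⁺ (toFact ∘ proj₁) (proj₁ enough (here refl)) in
      subst (λ cs → (P · cs) ∈ facts (dataset nf mf) × assign E x ≡ ident (identifier nf mf (P · cs)))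
        (sym (assign-values ts us ts≤ vs))
        (∈-++⁺ˡ ∈nf , trans (assign-look l) (cong ident (sym (identifier-nfact nf mf {P · us} ∈nf))))
      where
      ts≤ : length (encs termC (map rawTerm (Vec.toList ts))) ≤ N
      ts≤ = proj₂ (proj₂ (predArgs-fit termC (rawPred P) (map rawTerm (Vec.toList ts))
              (fitʳ (enc wordC x) _ (fitˡ (enc (wordC ×C atomC) (x , rawAtom (P · ts))) [] (ℕ.<⇒≤ (ℕ.<⇒≤ φ≤))))))
    holds-build {E} (neq x t) φ≤ (u , u′ , l , v , ≠) = ([] , []) , λ _ eq → ≠ (realise-injective
      (trans (sym (assign-look l)) (trans eq (assign-value t t≤ v))))
      where
      t≤ : length (enc termC (rawTerm t)) ≤ N
      t≤ = fitʳ (enc wordC x) _ (fitˡ (enc (wordC ×C termC) (x , rawTerm t)) [] (ℕ.<⇒≤ (ℕ.<⇒≤ φ≤)))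
    holds-build (φ ∧ ψ) φ≤ (h , h′) =
      let le = subst (λ w → length w ≤ N) (encs-++ chunkC (rawCond φ) (rawCond ψ)) (ℕ.<⇒≤ (ℕ.<⇒≤ (ℕ.<⇒≤ φ≤)))
          n , H = holds-build φ (fitˡ (encs chunkC (rawCond φ)) _ le) h
          n′ , H′ = holds-build ψ (fitʳ (encs chunkC (rawCond φ)) _ le) h′ in
      n ⊎ⁿ n′ , λ enough → H (enoughˡ {n} {n′} enough) , H′ (enoughʳ {n} {n′} enough)
    holds-build (ex x φ) φ≤ (u , _ , h) =
      let n , H = holds-build φ (fitʳ (enc chunkC (exq x)) _ φ≤) h in
      n , λ enough → realise u , H enough

  rule-fits : ∀ {B rs r} → r ∈ rs → length (encs chunkC (rawRules rs)) ≤ B → length (encs chunkC (rawCond (Rule.body r))) ≤ B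
  rule-fits {B} {r ∷ rs} (here refl) le =
    fitʳ (enc chunkC (header (Rule.x₁ r) (Rule.x₂ r))) _ (fitˡ (encs chunkC (rawRule r)) _ (subst (λ w → length w ≤ B) (encs-++ chunkC (rawRule r) (rawRules rs)) le))
  rule-fits {B} {r ∷ rs} (there r∈) le =
    rule-fits r∈ (fitʳ (encs chunkC (rawRule r)) _ (subst (λ w → length w ≤ B) (encs-++ chunkC (rawRule r) (rawRules rs)) le))

  module _ (I : Instance) (harmless : All Harmless (rawTheory (theory I))) where

    private
      N : ℕ
      -- Large enough that every identifier occurring in a rule body is kept by `idOf`.
      N = length (encs chunkC (rawRules (rules I)))

      ℰ : RFact → RFact → Set
      ℰ = Edge (rawTheory (theory I)) (rawRules (rules I))

    open Realise N
    open Build N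

    private opaque

      Prefs : List NFact → List MFact → Atom Word → Atom Word → Set
      Prefs nf mf a b = toFact a ∈ nfacts nf mf → toFact b ∈ nfacts nf mf →
        Pref (metaDatabase nf mf) (rules I) (identifier nf mf (toFact a)) (identifier nf mf (toFact b))

      prefs⁺ : ∀ {r E a b nf mf} → r ∈ rules I →
               Holds (metaDatabase nf mf) (assign ((Rule.x₁ r , fid (rawFact a)) ∷ (Rule.x₂ r , fid (rawFact b)) ∷ E)) (Rule.body r) →
               Prefs nf mf a b
      prefs⁺ {r} {E} {a} {b} {nf} {mf} r∈ h a∈ b∈ = r , r∈ , assign E₀ ,
        trans (assign-look {E₀} {x₁} {fid (rawFact a)} here) (cong ident (sym (identifier-nfact nf mf {a} a∈))) ,
        trans (assign-look {E₀} {x₂} {fid (rawFact b)} (there (x₁≢x₂ ∘ sym) here)) (cong ident (sym (identifier-nfact nf mf {b} b∈))) ,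
        h
        where
        open Rule r
        E₀ : Env
        E₀ = (x₁ , fid (rawFact a)) ∷ (x₂ , fid (rawFact b)) ∷ E

      Reaches : List NFact → List MFact → Atom Word → Atom Word → Set₁
      Reaches nf mf a b = TransClosure (Preferred (metaDatabase nf mf) (theory I) (rules I)) (toFact a) (toFact b)

      reaches-edge : ∀ {a b c nf mf} → Conflicting (rawTheory (theory I)) (rawFact a) (rawFact b) → c ≡ a ⊎ c ≡ b →
                     toFact a ∈ nfacts nf mf → toFact b ∈ nfacts nf mf → Prefs nf mf a c → Reaches nf mf a c
      reaches-edge {a} {b} cf (inj₁ refl) a∈ b∈ p =
        [ p a∈ a∈ , (_ , conflict-sound {theory I} {a} {b} harmless cf (∈-++⁺ˡ a∈) (∈-++⁺ˡ b∈) , here refl , here refl) ]⁺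
      reaches-edge {a} {b} cf (inj₂ refl) a∈ b∈ p =
        [ p a∈ b∈ , (_ , conflict-sound {theory I} {a} {b} harmless cf (∈-++⁺ˡ a∈) (∈-++⁺ˡ b∈) , here refl , there (here refl)) ]⁺

      reaches-trans : ∀ {a b c nf mf} → Reaches nf mf a b → Reaches nf mf b c → Reaches nf mf a c
      reaches-trans p q = p ++⁺ q

      reaches-cyclic : ∀ {a nf mf} → Reaches nf mf a a → ¬ IsAcyclic I
      reaches-cyclic {a} p acyclic = acyclic _ _ (toFact a) p

    prefers-build : ∀ {a b} → Prefers (rawRules (rules I)) (rawFact a) (rawFact b) →
                    ∃[ n ] ∀ {nf mf} → Enough n nf mf → Prefs nf mf a b
    prefers-build {a} {b} record { before = us ; rule = r≡ ; env = E ; run = run } with find-rule (rules I) us r≡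
    ... | r , r∈ , refl , refl , C , refl =
      let n , h = holds-build N (Rule.body r) (rule-fits r∈ ℕ.≤-refl) (proj₁ (exec-sound (Rule.body r) run)) in
      n , λ enough → prefs⁺ {r} {E} {a} {b} r∈ (h enough)

    Realised : RFact → RFact → Set₁
    Realised f g = ∃₂ λ a b → f ≡ rawFact a × g ≡ rawFact b × ∃[ n ] ∀ {nf mf} → Enough n nf mf → Reaches nf mf a b

    edge-realised : ∀ {a b c} → ¬ IsMeta (pred a) → ¬ IsMeta (pred b) →
                    Conflicting (rawTheory (theory I)) (rawFact a) (rawFact b) → c ≡ a ⊎ c ≡ b →
                    Prefers (rawRules (rules I)) (rawFact a) (rawFact c) → Realised (rawFact a) (rawFact c)
    edge-realised {a} {b} {c} ¬ma ¬mb cf e p =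
      let needs = (a , ¬ma) ∷ (b , ¬mb) ∷ [] , []
          n , P = prefers-build {a} {c} p in
      a , c , refl , refl , needs ⊎ⁿ n , λ enough →
        reaches-edge {a} {b} cf e (∈-map⁺ (toFact ∘ proj₁) (proj₁ (enoughˡ {needs} {n} enough) (here refl)))
          (∈-map⁺ (toFact ∘ proj₁) (proj₁ (enoughˡ {needs} {n} enough) (there (here refl)))) (P (enoughʳ {needs} {n} enough))

    edge-build : ∀ {f g} → ℰ f g → Realised f g
    edge-build record { either = e ; conflicting = c ; prefers = p } with conflicting-genuine {theory I} harmless c
    edge-build record { either = inj₁ refl ; conflicting = c ; prefers = p } | (a , refl , ¬ma) , (b , refl , ¬mb) =
      edge-realised {a} {b} ¬ma ¬mb c (inj₁ refl) p
    edge-build record { either = inj₂ refl ; conflicting = c ; prefers = p } | (a , refl , ¬ma) , (b , refl , ¬mb) =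
      edge-realised {a} {b} ¬ma ¬mb c (inj₂ refl) p

    realised-trans : ∀ {f g h} → Realised f g → Realised g h → Realised f h
    realised-trans (a , b , refl , refl , n , P) (b′ , c , eq , refl , n′ , P′) with rawFact-injective {b} {b′} eq
    ... | refl = a , c , refl , refl , n ⊎ⁿ n′ , λ enough → reaches-trans (P (enoughˡ {n} {n′} enough)) (P′ (enoughʳ {n} {n′} enough))

    walk-build : ∀ {f g h k} → Realised f g → Walk ℰ k g h → Realised f h
    walk-build r []      = r
    walk-build r (e ∷ w) = walk-build (realised-trans r (edge-build e)) w

    -- Only now is a dataset fixed: the collected needs of the whole cycle.
    realised-cyclic : ∀ {f} → Realised f f → ¬ IsAcyclic I
    realised-cyclic (a , b , refl , eq , (nf , mf) , P) with rawFact-injective {a} {b} eq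
    ... | refl = reaches-cyclic (P {nf} {mf} ((λ x∈ → x∈) , (λ x∈ → x∈)))

  cyclic-sound : ∀ I → Cyclic (rawTheory (theory I)) (rawRules (rules I)) → ¬ IsAcyclic I
  cyclic-sound I record { harmless = hs ; first = e ; walk = w } = realised-cyclic I hs (walk-build I hs (edge-build I hs e) w)

  -- From genuine cycles to raw cycles, under double negation

  infixl 1 _>>=_

  -- A violated constraint can be extracted from `Inconsistent` only up to double negation. The
  -- conclusions stay there until decidability of the bounded formula releases them.
  _>>=_ : ∀ {a b} {A : Set a} {B : Set b} → ¬ ¬ A → (A → ¬ ¬ B) → ¬ ¬ B
  m >>= k = λ ¬b → m λ a → k a ¬b

  return : ∀ {a} {A : Set a} → A → ¬ ¬ A
  return a ¬a = ¬a a

  all-¬¬ : ∀ {A : Set} {P : A → Set} {xs} → (∀ {x} → x ∈ xs → ¬ ¬ P x) → ¬ ¬ All P xs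
  all-¬¬ {xs = []}     f = return []
  all-¬¬ {xs = x ∷ xs} f = f (here refl) >>= λ p → all-¬¬ (f ∘ there) >>= λ ps → return (p ∷ ps)

  -- Most general assignments: a variable that occurs in no relational atom gets
  -- a value of its own.
  module MostGeneral (κ : DenialConstraint) (f : RFact)
                     (same-pred : ∀ {p ts} → rrel (p , ts) ∈ rawConstraint κ → p ≡ proj₁ f) where

    private
      K : RConstraint
      K = rawConstraint κ

    occurrences : RConstraint → List (RTerm × Word)
    occurrences []                  = []
    occurrences (rrel (p , ts) ∷ K) = List.zip ts (proj₂ f) ++ occurrences K
    occurrences (rneq _ _ ∷ K)      = occurrences K

    occurrences⁻ : ∀ {t w} K′ → K′ ⊆ K → (t , w) ∈ occurrences K′ → Occurs K f t w
    occurrences⁻ (rrel (p , ts) ∷ K′) ⊆K tw∈ with ∈-++⁻ (List.zip ts (proj₂ f)) tw∈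
    ... | inj₂ ∈K   = occurrences⁻ K′ (⊆K ∘ there) ∈K
    ... | inj₁ ∈zip with same-pred (⊆K (here refl))
    ... | refl = ts , ⊆K (here refl) , ∈zip
    occurrences⁻ (rneq _ _ ∷ K′) ⊆K tw∈ = occurrences⁻ K′ (⊆K ∘ there) tw∈

    occurrences⁺ : ∀ {t w p ts} K′ → rrel (p , ts) ∈ K′ → (t , w) ∈ List.zip ts (proj₂ f) → (t , w) ∈ occurrences K′
    occurrences⁺ (rrel (p , ts) ∷ K′) (here refl) ∈zip = ∈-++⁺ˡ ∈zip
    occurrences⁺ (rrel (p , ts) ∷ K′) (there α∈)  ∈zip = ∈-++⁺ʳ (List.zip ts (proj₂ f)) (occurrences⁺ K′ α∈ ∈zip)
    occurrences⁺ (rneq _ _ ∷ K′)      (there α∈)  ∈zip = occurrences⁺ K′ α∈ ∈zip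

    at? : ∀ x (tw : RTerm × Word) → Dec (proj₁ tw ≡ inj₁ x)
    at? x (inj₁ y , _) = Dec.map′ (cong inj₁) (λ { refl → refl }) (y ≟ᵛ x)
    at? x (inj₂ _ , _) = no λ ()

    N : ℕ
    -- This bounds the words of all constants in inequalities of `κ` and all arguments of `f`, so a
    -- variable's own value, which is longer, equals no forced value there.
    N = length (encs literalC K) + length (List.concat (proj₂ f))

    ν : Assignment
    ν x with Any.any? (at? x) (occurrences K)
    ... | yes p = value (proj₂ (Any.lookup p))
    ... | no _  = value (long N x)

    data VarValue (x : Var) : Const → Set where
      forced : ∀ {w} → Occurs K f (inj₁ x) w → VarValue x (value w)
      own    : ¬ Any (λ tw → proj₁ tw ≡ inj₁ x) (occurrences K) → VarValue x (value (long N x))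

    varValue : ∀ x → VarValue x (ν x)
    varValue x with Any.any? (at? x) (occurrences K)
    ... | no ∉  = own ∉
    ... | yes p = forced (occurrences⁻ K (λ ∈K → ∈K) (lookup-∈ p))
      where
      lookup-∈ : ∀ {tws} (p : Any (λ tw → proj₁ tw ≡ inj₁ x) tws) → (inj₁ x , proj₂ (Any.lookup p)) ∈ tws
      lookup-∈ (here refl) = here refl
      lookup-∈ (there p)   = there (lookup-∈ p)

    Own : Term → Const → Set
    Own t c = ∃[ x ] t ≡ var x × c ≡ value (long N x) × ¬ Any (λ tw → proj₁ tw ≡ inj₁ x) (occurrences K)

    termValue : ∀ t → Forced K f (rawTerm t) (constVal (value-of ν t)) ⊎ Own t (value-of ν t)
    termValue (con c) = inj₁ (inj₁ (rawConst c , refl , refl))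
    termValue (var x) with ν x | varValue x
    ... | _ | forced o = inj₁ (inj₂ (_ , o , refl))
    ... | _ | own ∉    = inj₂ (x , refl , refl , ∉)

    short-forced : ∀ {t w} → length (enc termC t) ≤ N → Forced K f t (val w) → length w ≤ N
    short-forced t≤ (inj₁ (vlu w , refl , refl)) = ℕ.≤-trans (enc-fit-word w) (ℕ.<⇒≤ (ℕ.<⇒≤ t≤))
    short-forced t≤ (inj₂ (w , (ts , _ , tw∈) , refl)) =
      ℕ.≤-trans (length-concat (proj₂ (zip-∈ ts (proj₂ f) tw∈))) (ℕ.m≤n+m _ (length (encs literalC K)))

    literal-fits : ∀ {s t} → rneq s t ∈ K → length (enc termC s) ≤ N × length (enc termC t) ≤ N
    literal-fits {s} {t} ∈K = fitˡ (enc termC s) _ le , fitʳ (enc termC s) _ le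
      where
      le : length (enc termC s ++ enc termC t) ≤ N
      le = ℕ.≤-trans (ℕ.<⇒≤ (encs-∈-fit literalC ∈K ℕ.≤-refl)) (ℕ.m≤m+n _ _)

    -- Equal values can arise in two ways only: both are forced, which is a collapse, or both terms
    -- are the same variable with a value of its own. A forced value and an own value differ in
    -- length.
    refuted-neq : ∀ {s t} → neq s t ∈ κ → value-of ν s ≡ value-of ν t → Refuted f K
    refuted-neq {s} {t} ∈κ eq = go (∈-map⁺ rawLiteral ∈κ) (termValue s) (termValue t)
      where
      forced-own : ∀ {s t} → length (enc termC (rawTerm s)) ≤ N → value-of ν s ≡ value-of ν t →
                   Forced K f (rawTerm s) (constVal (value-of ν s)) → ¬ Own t (value-of ν t)
      forced-own {s} s≤ eq fo (x , _ , e , _) =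
        ℕ.<⇒≱ (long-long N x) (short-forced s≤ (subst (λ c → Forced K f (rawTerm s) (constVal c)) (trans eq e) fo))
      own-own : ∀ {s t c} → Own s c → Own t c → s ≡ t
      own-own (x , s≡ , e , _) (y , t≡ , e′ , _) =
        trans s≡ (trans (cong var (long-injective N (value-injective (trans (sym e) e′)))) (sym t≡))
      go : rawLiteral (neq s t) ∈ K → Forced K f (rawTerm s) (constVal (value-of ν s)) ⊎ Own s (value-of ν s) →
           Forced K f (rawTerm t) (constVal (value-of ν t)) ⊎ Own t (value-of ν t) → Refuted f K
      go ∈K (inj₁ fs) (inj₁ ft) = collapse ∈K fs (subst (λ c → Forced K f (rawTerm t) (constVal c)) (sym eq) ft)
      go ∈K (inj₁ fs) (inj₂ ot) = contradiction ot (forced-own {s} {t} (proj₁ (literal-fits {rawTerm s} {rawTerm t} ∈K)) eq fs)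
      go ∈K (inj₂ os) (inj₁ ft) = contradiction os (forced-own {t} {s} (proj₂ (literal-fits {rawTerm s} {rawTerm t} ∈K)) (sym eq) ft)
      go ∈K (inj₂ os) (inj₂ ot) =
        identical (subst (λ t → rneq (rawTerm s) (rawTerm t) ∈ K) (sym (own-own os (subst (Own t) (sym eq) ot))) ∈K)

    mismatch : ∀ {n} (ts : Vec Term n) ws → Vec.map (value-of ν) ts ≢ Vec.map value ws →
               ∃₂ λ t w → (rawTerm t , w) ∈ List.zip (map rawTerm (Vec.toList ts)) (Vec.toList ws) × value-of ν t ≢ value w
    mismatch []       []       ≠ = contradiction refl ≠
    mismatch (t ∷ ts) (w ∷ ws) ≠ with value-of ν t ≟ᶜ value w
    ... | no t≠w = t , w , here refl , t≠w
    ... | yes eq with mismatch ts ws (≠ ∘ cong₂ _∷_ eq)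
    ... | t′ , w′ , ∈zip , t≠w = t′ , w′ , there ∈zip , t≠w

    refuted-rel : ∀ {P ts ws} → rel (P · ts) ∈ κ → f ≡ rawFact (P · ws) → Vec.map (value-of ν) ts ≢ Vec.map value ws → Refuted f K
    refuted-rel {P} {ts} {ws} ∈κ refl ≠ with mismatch ts ws ≠
    ... | t , w , ∈zip , t≠w with occurrences⁺ K (∈-map⁺ rawLiteral ∈κ) ∈zip
    ... | ∈occ with termValue t
    ... | inj₁ fo = clash (occurrences⁻ K (λ ∈K → ∈K) ∈occ) fo (λ eq → t≠w (constVal-injective {value-of ν t} {value w} (sym eq)))
    ... | inj₂ (x , refl , _ , ∉) = contradiction (Any.map (λ { refl → refl }) ∈occ) ∉

  -- Completeness of the list of reasons: when none applies, the most general assignment satisfies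
  -- every literal.
  unrefuted : ∀ {κ a} → ¬ Refuted (rawFact a) (rawConstraint κ) → ∃[ ν ] All (LitTrue ν (toFact a ∷ [])) κ
  unrefuted {κ} {a} ¬ref = MG.ν , All.tabulate literal
    where
    f = rawFact a
    same-pred : ∀ {p ts} → rrel (p , ts) ∈ rawConstraint κ → p ≡ proj₁ f
    same-pred {p} α∈ with enc predC p ≟ˡ enc predC (proj₁ f)
    ... | yes eq = enc-injective predC {p} {proj₁ f} eq
    ... | no ≠ = contradiction (predicate α∈ λ { refl → ≠ refl }) ¬ref
    module MG = MostGeneral κ f same-pred
    literal : ∀ {ℓ} → ℓ ∈ κ → LitTrue MG.ν (toFact a ∷ []) ℓ
    literal {neq s t} ∈κ eq = ¬ref (MG.refuted-neq ∈κ eq)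
    literal {rel (P · ts)} ∈κ = go a refl (rawPred-injective {P} {pred a} (same-pred (∈-map⁺ rawLiteral ∈κ)))
      where
      go : ∀ b → rawFact b ≡ f → P ≡ pred b → (P · Vec.map (value-of MG.ν) ts) ∈ toFact b ∷ []
      go (P · ws) eq refl with Vec.≡-dec _≟ᶜ_ (Vec.map (value-of MG.ν) ts) (Vec.map value ws)
      ... | yes e = here (cong (P ·_) e)
      ... | no ≠  = contradiction (MG.refuted-rel ∈κ (sym eq) ≠) ¬ref

  unharmless : ∀ {κ} → ¬ Harmless (rawConstraint κ) → ∃[ ν ] All (LitTrue ν []) κ
  unharmless {κ} ¬h = MG.ν , All.tabulate literal
    where
    -- There are no relational atoms, so the fact is irrelevant.
    f : RFact
    f = ([] , plain) , []
    module MG = MostGeneral κ f (λ α∈ → contradiction (relational α∈) ¬h)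
    harmful : Refuted f (rawConstraint κ) → Harmless (rawConstraint κ)
    harmful (predicate α∈ _)         = relational α∈
    harmful (clash (_ , α∈ , _) _ _) = relational α∈
    harmful (identical t∈)           = identical t∈
    harmful (collapse _ (inj₂ (_ , (_ , α∈ , _) , _)) _) = relational α∈
    harmful (collapse _ (inj₁ _) (inj₂ (_ , (_ , α∈ , _) , _))) = relational α∈
    harmful (collapse st∈ (inj₁ (c , refl , refl)) (inj₁ (_ , refl , refl))) = identical st∈
    literal : ∀ {ℓ} → ℓ ∈ κ → LitTrue MG.ν [] ℓ
    literal {neq s t} ∈κ eq = ¬h (harmful (MG.refuted-neq ∈κ eq))
    literal {rel α} ∈κ = contradiction (relational (∈-map⁺ rawLiteral ∈κ)) ¬h

  -- Raw edges of an instance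

  condVars : Cond → List Var
  condVars (rel (P · ts))      = argVars ts
  condVars (idEq x (P · ts) _) = x ∷ argVars ts
  condVars (neq x t)           = x ∷ termVars t
  condVars (φ ∧ ψ)             = condVars φ ++ condVars ψ
  condVars (ex x φ)            = condVars φ

  module RawEdges (I : Instance) where

    𝒯 = rawTheory (theory I)

    Shape : Set
    Shape = RPred × ℕ

    shapes : List Shape
    shapes = map (λ P → rawPred P , arity P) (preds I)

    -- Only predicates of the instance have controlled arity. Facts over other predicates must
    -- therefore not enter as values.
    GoodFact : RFact → Set
    GoodFact (p , ws) = (p , length ws) ∈ shapes

    GoodVal : RVal → Set
    GoodVal (inj₁ _) = ⊤
    GoodVal (fid f)  = GoodFact f

    good-raw : ∀ {a} → pred a ∈ preds I → GoodFact (rawFact a)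
    good-raw {P · ws} P∈ = subst (λ n → (rawPred P , n) ∈ shapes) (sym (Vec.length-toList ws)) (∈-map⁺ _ P∈)

    -- The field `keys` restricts the environment to the variables of the constraint, so that the
    -- input bounds its length. The predicate `G` is later strengthened from well-formed values to
    -- values over the pool.
    record RawConflict (G : RVal → Set) (f h : RFact) : Set where
      field
        {κ}      : DenialConstraint
        κ∈       : κ ∈ theory I
        env      : Env
        keys     : map proj₁ env ≡ constraintVars κ
        good     : All (G ∘ proj₂) env
        violated : All (LitHolds env f h) (rawConstraint κ)
        minimal  : f ≡ h ⊎ Stable 𝒯 f × Stable 𝒯 h
        plainˡ   : Plain f
        plainʳ   : Plain h
        goodˡ    : G (fid f)
        goodʳ    : G (fid h)

    record RawEdge (G : RVal → Set) (f g : RFact) : Set where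
      field
        {partner} : RFact
        either    : g ≡ f ⊎ g ≡ partner
        conflict  : RawConflict G f partner
        {rule}    : Rule
        rule∈     : rule ∈ rules I
        env       : Env
        keys      : map proj₁ env ≡ condVars (Rule.body rule)
        good      : All (G ∘ proj₂) env
        holds     : HoldsIn G ((Rule.x₁ rule , fid f) ∷ (Rule.x₂ rule , fid g) ∷ env) (Rule.body rule)

    envOf-keys : ∀ (f : Var → RVal) xs → map proj₁ (envOf f xs) ≡ xs
    envOf-keys f xs = trans (sym (List.map-∘ xs)) (List.map-id xs)

    envOf-good : ∀ {f : Var → RVal} xs → (∀ x → GoodVal (f x)) → All (GoodVal ∘ proj₂) (envOf f xs)
    envOf-good xs g = All.map⁺ (All.universal g xs)

  -- Conflicts are raw conflicts

  idFree : ∀ {n} (cs : Vec Const n) → (∀ {c} → c Vec∈.∈ cs → ¬ IsId c) → ∃[ ws ] cs ≡ Vec.map value ws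
  idFree []             free = [] , refl
  idFree (ident _ ∷ cs) free = contradiction tt (free (VecAny.here refl))
  idFree (value w ∷ cs) free = let ws , eq = idFree cs (free ∘ VecAny.there) in w ∷ ws , cong (value w ∷_) eq

  dataset-fact : ∀ (D : Dataset) {φ} → φ ∈ facts D → ∃[ a ] φ ≡ toFact a × ¬ IsMeta (pred a)
  dataset-fact D {P · cs} φ∈ with idFree cs (no-ids D φ∈)
  ... | ws , refl = P · ws , refl , no-metadata D φ∈

  relational-∈ : ∀ {ν C} κ {φ} → All (LitTrue ν C) κ → φ ∈ map (mapAtom (value-of ν)) (relationalAtoms κ) → φ ∈ C
  relational-∈ (rel α ∷ κ)   (p ∷ ps) (here refl) = p
  relational-∈ (rel α ∷ κ)   (p ∷ ps) (there φ∈)  = relational-∈ κ ps φ∈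
  relational-∈ (neq s t ∷ κ) (p ∷ ps) φ∈          = relational-∈ κ ps φ∈

  -- Inequalities do not depend on the dataset, so a violation survives in the facts that its
  -- relational atoms hit. By minimality these make up the whole conflict.
  relational-true : ∀ {ν C} κ → All (LitTrue ν C) κ → All (LitTrue ν (map (mapAtom (value-of ν)) (relationalAtoms κ))) κ
  relational-true {ν} {C} κ = go κ (λ φ∈ → φ∈)
    where
    go : ∀ κ′ → relationalAtoms κ′ ⊆ relationalAtoms κ → All (LitTrue ν C) κ′ →
         All (LitTrue ν (map (mapAtom (value-of ν)) (relationalAtoms κ))) κ′
    go []             _ []       = []
    go (rel α ∷ κ′)   ⊆κ (p ∷ ps) = ∈-map⁺ (mapAtom (value-of ν)) (⊆κ (here refl)) ∷ go κ′ (⊆κ ∘ there) ps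
    go (neq s t ∷ κ′) ⊆κ (p ∷ ps) = p ∷ go κ′ ⊆κ ps

  module _ (I : Instance) where
    open RawEdges I

    constraint-preds : ∀ {κ α} → κ ∈ theory I → α ∈ relationalAtoms κ → pred α ∈ preds I
    constraint-preds κ∈ α∈ = ∈-++⁺ˡ (∈-concatMap⁺ (map pred ∘ relationalAtoms) (Any.map (λ { refl → ∈-map⁺ pred α∈ }) κ∈))

    -- A conflict lies within the at most two facts hit by a violated binary constraint. The rest is
    -- a matter of which of them is `α`; the other one becomes the partner, also when `β` equals
    -- `α`.
    conflict-raw : ∀ {D : Dataset} {C α β} → IsConflict (facts D) (theory I) C → α ∈ C → β ∈ C →
                   ∃₂ λ a b → α ≡ toFact a × β ≡ toFact b ×
                   ¬ ¬ (∃[ h ] (rawFact b ≡ rawFact a ⊎ rawFact b ≡ h) × RawConflict GoodVal (rawFact a) h)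
    conflict-raw {D} {C} {α} {β} cf α∈ β∈ with dataset-fact D (IsConflict.subset cf α∈) | dataset-fact D (IsConflict.subset cf β∈)
    ... | a , refl , ¬ma | b , refl , ¬mb = a , b , refl , refl , (violation >>= go)
      where
      open IsConflict cf

      Violation : Set
      Violation = ∃₂ λ κ ν → κ ∈ theory I × All (LitTrue ν C) κ

      violation : ¬ ¬ Violation
      violation ¬v = consistent (λ κ∈ ν ps → ¬v (_ , ν , κ∈ , ps)) inconsistent

      stable : ∀ {c} → toFact c ∈ C → ¬ (C ⊆ toFact c ∷ []) → ¬ ¬ Stable 𝒯 (rawFact c)
      stable {c} c∈ C⊈ = all-¬¬ λ κ∈ ¬ref → case ∈-map⁻ rawConstraint κ∈ of λ
        { (κ , κ∈I , refl) → C⊈ (minimal (λ { (here refl) → c∈ })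
            (violation-inconsistent κ∈I (proj₂ (unrefuted {κ} {c} ¬ref)))) }

      assemble : ∀ {κ ν c} → κ ∈ theory I → All (LitTrue ν (map (mapAtom (value-of ν)) (relationalAtoms κ))) κ →
              C ⊆ map (mapAtom (value-of ν)) (relationalAtoms κ) →
              toFact c ∈ C → (∀ {φ} → φ ∈ map (mapAtom (value-of ν)) (relationalAtoms κ) → φ ≡ toFact a ⊎ φ ≡ toFact c) →
              ¬ IsMeta (pred c) → ¬ ¬ RawConflict GoodVal (rawFact a) (rawFact c)
      assemble {κ} {ν} {c} κ∈ ps C⊆ c∈ used ¬mc = minimality >>= λ m → return record
        { κ∈ = κ∈ ; env = envOf (constVal ∘ ν) (constraintVars κ) ; keys = envOf-keys _ _
        ; good = envOf-good (constraintVars κ) (λ _ → tt)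
        ; violated = constraint-envOf ν {a = a} {c} κ used ps ; minimal = m
        ; plainˡ = plain-of a ¬ma ; plainʳ = plain-of c ¬mc
        ; goodˡ = good-of a α∈ ; goodʳ = good-of c c∈ }
        where
        plain-of : ∀ c → ¬ IsMeta (pred c) → Plain (rawFact c)
        plain-of (P · ws) ¬m = name P , Vec.toList ws , cong (_, Vec.toList ws) (plain-rawPred P ¬m)
        good-of : ∀ c → toFact c ∈ C → GoodFact (rawFact c)
        good-of (P · ws) c∈ with ∈-map⁻ (mapAtom (value-of ν)) (C⊆ c∈)
        ... | r@(_ · _) , r∈ , eq = good-raw {P · ws} (subst (_∈ preds I) (sym (cong pred eq)) (constraint-preds {κ} {r} κ∈ r∈))
        minimality : ¬ ¬ (rawFact a ≡ rawFact c ⊎ Stable 𝒯 (rawFact a) × Stable 𝒯 (rawFact c))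
        minimality with toFact a ≟ᶠ toFact c
        ... | yes eq = return (inj₁ (cong rawFact (toFact-injective {a} {c} eq)))
        ... | no a≠c = stable {a} α∈ (λ C⊆a → case C⊆a c∈ of λ { (here eq) → a≠c (sym eq) }) >>= λ sa →
                       stable {c} c∈ (λ C⊆c → case C⊆c α∈ of λ { (here eq) → a≠c eq }) >>= λ sc →
                       return (inj₂ (sa , sc))

      Goal : Set
      Goal = ∃[ h ] (rawFact b ≡ rawFact a ⊎ rawFact b ≡ h) × RawConflict GoodVal (rawFact a) h

      go : Violation → ¬ ¬ Goal
      go (κ , ν , κ∈ , ps) = split (map (mapAtom (value-of ν)) (relationalAtoms κ)) refl
          (subst (_≤ 2) (sym (List.length-map (mapAtom (value-of ν)) (relationalAtoms κ))) (All.lookup (binary I) κ∈))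
          (minimal (relational-∈ κ ps) (violation-inconsistent κ∈ (relational-true κ ps)))
        where
        make : ∀ {c} → C ⊆ map (mapAtom (value-of ν)) (relationalAtoms κ) → toFact c ∈ C →
               (∀ {φ} → φ ∈ map (mapAtom (value-of ν)) (relationalAtoms κ) → φ ≡ toFact a ⊎ φ ≡ toFact c) →
               ¬ IsMeta (pred c) → rawFact b ≡ rawFact a ⊎ rawFact b ≡ rawFact c → ¬ ¬ Goal
        make {c} C⊆ c∈ used ¬mc e = assemble {κ} {ν} {c} κ∈ (relational-true κ ps) C⊆ c∈ used ¬mc >>= λ rc → return (_ , e , rc)

        rawEq : ∀ {c d} → toFact c ≡ toFact d → rawFact c ≡ rawFact d
        rawEq {c} {d} eq = cong rawFact (toFact-injective {c} {d} eq)

        used-pair : ∀ {c φ ψ} {us : List Fact} → us ≡ φ ∷ ψ ∷ [] → toFact c ≡ ψ → toFact a ≡ φ →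
                    ∀ {χ} → χ ∈ us → χ ≡ toFact a ⊎ χ ≡ toFact c
        used-pair refl refl refl (here e)         = inj₁ e
        used-pair refl refl refl (there (here e)) = inj₂ e

        used-pair′ : ∀ {c φ ψ} {us : List Fact} → us ≡ φ ∷ ψ ∷ [] → toFact c ≡ φ → toFact a ≡ ψ →
                     ∀ {χ} → χ ∈ us → χ ≡ toFact a ⊎ χ ≡ toFact c
        used-pair′ refl refl refl (here e)         = inj₂ e
        used-pair′ refl refl refl (there (here e)) = inj₁ e

        either-of : ∀ {c φ ψ} → toFact b ∈ φ ∷ ψ ∷ [] → φ ≡ toFact a → ψ ≡ toFact c → rawFact b ≡ rawFact a ⊎ rawFact b ≡ rawFact c
        either-of (here e)             e′ _  = inj₁ (rawEq {b} {a} (trans e e′))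
        either-of {c} (there (here e)) _  e′ = inj₂ (rawEq {b} {c} (trans e e′))

        two : ∀ {φ ψ} → map (mapAtom (value-of ν)) (relationalAtoms κ) ≡ φ ∷ ψ ∷ [] →
              C ⊆ map (mapAtom (value-of ν)) (relationalAtoms κ) → φ ∈ C → ψ ∈ C →
              toFact a ∈ φ ∷ ψ ∷ [] → toFact b ∈ φ ∷ ψ ∷ [] →
              ∃[ p ] φ ≡ toFact p × ¬ IsMeta (pred p) → ∃[ q ] ψ ≡ toFact q × ¬ IsMeta (pred q) → ¬ ¬ Goal
        two eq C⊆ φ∈ ψ∈ (here ea) b∈ _ (q , eq-q , ¬mq) =
          make {q} C⊆ (subst (_∈ C) eq-q ψ∈) (used-pair {q} eq (sym eq-q) ea) ¬mq (either-of {q} b∈ (sym ea) eq-q)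
        two eq C⊆ φ∈ ψ∈ (there (here ea)) b∈ (p , eq-p , ¬mp) _ =
          make {p} C⊆ (subst (_∈ C) eq-p φ∈) (used-pair′ {p} eq (sym eq-p) ea) ¬mp (either-of {p} (swapped b∈) (sym ea) eq-p)
          where
          swapped : ∀ {χ φ ψ : Fact} → χ ∈ φ ∷ ψ ∷ [] → χ ∈ ψ ∷ φ ∷ []
          swapped (here e)         = there (here e)
          swapped (there (here e)) = here e

        one : ∀ {φ} → map (mapAtom (value-of ν)) (relationalAtoms κ) ≡ φ ∷ [] →
              C ⊆ map (mapAtom (value-of ν)) (relationalAtoms κ) → toFact a ∈ φ ∷ [] → toFact b ∈ φ ∷ [] → ¬ ¬ Goal
        one eq C⊆ (here ea) (here eb) = make {a} C⊆ α∈ (λ χ∈ → inj₁ (only eq ea χ∈)) ¬ma (inj₁ (rawEq {b} {a} (trans eb (sym ea))))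
          where
          only : ∀ {φ ψ χ : Fact} {us} → us ≡ φ ∷ [] → ψ ≡ φ → χ ∈ us → χ ≡ ψ
          only refl refl (here e) = e

        split : ∀ us → map (mapAtom (value-of ν)) (relationalAtoms κ) ≡ us → length us ≤ 2 →
                C ⊆ map (mapAtom (value-of ν)) (relationalAtoms κ) → ¬ ¬ Goal
        split [] eq _ C⊆ = contradiction (subst (toFact a ∈_) eq (C⊆ α∈)) λ ()
        split (φ ∷ []) eq _ C⊆ = one eq C⊆ (subst (toFact a ∈_) eq (C⊆ α∈)) (subst (toFact b ∈_) eq (C⊆ β∈))
        split (φ ∷ ψ ∷ []) eq _ C⊆ =
          let φ∈ = relational-∈ κ ps (subst (φ ∈_) (sym eq) (here refl))
              ψ∈ = relational-∈ κ ps (subst (ψ ∈_) (sym eq) (there (here refl)))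
          in two eq C⊆ φ∈ ψ∈ (subst (toFact a ∈_) eq (C⊆ α∈)) (subst (toFact b ∈_) eq (C⊆ β∈))
               (dataset-fact D (subset φ∈)) (dataset-fact D (subset ψ∈))
        split (_ ∷ _ ∷ _ ∷ _) eq (s≤s (s≤s ())) C⊆

    -- If the empty dataset violated a constraint, minimality would leave no room for the element
    -- `α` of a conflict.
    conflict-harmless : ∀ {D : Dataset} {C α} → IsConflict (facts D) (theory I) C → α ∈ C → ¬ ¬ All Harmless 𝒯
    conflict-harmless cf α∈ = all-¬¬ λ κ∈ ¬h → case ∈-map⁻ rawConstraint κ∈ of λ
      { (κ , κ∈I , refl) → case IsConflict.minimal cf (λ ()) (violation-inconsistent κ∈I (proj₂ (unharmless {κ} ¬h))) α∈ of λ () }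

  -- Preferences are raw preferences

  module _ (I : Instance) {D : Dataset} (M : MetaDatabase D) where
    open RawEdges I
    open MetaDatabase M

    Relevant : ID → Fact → Set
    Relevant i φ = id φ ≡ i × pred φ ∈ preds I

    relevant? : ∀ i φ → Dec (Relevant i φ)
    relevant? i φ = List.≡-dec Bool._≟_ (id φ) i ×-dec Any.any? (pred φ ≟ᵖ_) (preds I)

    -- Identifiers of facts over predicates outside the instance stay mere constants. No atom
    -- `x = id(…)` of a rule can refer to such facts, and their arity is not bounded.
    abstraction : Const → RVal
    abstraction (value w) = val w
    abstraction (ident i) with Any.any? (relevant? i) (facts D)
    ... | yes p = fid (rawOf (Any.lookup p))
    ... | no _  = inj₁ (idn i)

    data Abstraction : Const → RVal → Set where
      value   : ∀ {w} → Abstraction (value w) (val w)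
      known   : ∀ {φ} → φ ∈ facts D → pred φ ∈ preds I → Abstraction (ident (id φ)) (fid (rawOf φ))
      unknown : ∀ {i} → ¬ Any (Relevant i) (facts D) → Abstraction (ident i) (inj₁ (idn i))

    abstraction-view : ∀ c → Abstraction c (abstraction c)
    abstraction-view (value w) = value
    abstraction-view (ident i) with Any.any? (relevant? i) (facts D)
    ... | no ∉  = unknown ∉
    ... | yes p with Any.lookup p | lookup-any p
      where
      lookup-any : ∀ {φs} (p : Any (Relevant i) φs) → Any.lookup p ∈ φs × Relevant i (Any.lookup p)
      lookup-any (here r)  = here refl , r
      lookup-any (there p) = Product.map₁ there (lookup-any p)
    ... | φ | φ∈ , refl , P∈ = known φ∈ P∈

    rawOf-injective : ∀ {φ ψ} → φ ∈ facts D → ψ ∈ facts D → rawOf φ ≡ rawOf ψ → φ ≡ ψ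
    rawOf-injective φ∈ ψ∈ eq with dataset-fact D φ∈ | dataset-fact D ψ∈
    ... | a , refl , _ | b , refl , _ =
      cong toFact (rawFact-injective {a} {b} (trans (sym (rawOf-toFact a)) (trans eq (rawOf-toFact b))))

    -- Inequality atoms need distinct constants to become distinct values. For two identified facts
    -- this holds because a fact of a dataset is determined by its raw form.
    same-abstraction : ∀ {c d u u′} → Abstraction c u → Abstraction d u′ → u ≡ u′ → c ≡ d
    same-abstraction value value refl = refl
    same-abstraction (known φ∈ _) (known ψ∈ _) eq = cong (ident ∘ id) (rawOf-injective φ∈ ψ∈ (inj₂-injective eq))
    same-abstraction (unknown _) (unknown _) refl = refl
    same-abstraction value (known _ _) ()
    same-abstraction value (unknown _) ()
    same-abstraction (known _ _) value ()
    same-abstraction (known _ _) (unknown _) ()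
    same-abstraction (unknown _) value ()
    same-abstraction (unknown _) (known _ _) ()

    abstraction-const : ∀ {c d u} → Abstraction c u → u ≡ constVal d → c ≡ d
    abstraction-const {d = value _} value       refl = refl
    abstraction-const {d = ident _} (unknown _) refl = refl
    abstraction-const {d = ident _} value ()
    abstraction-const {d = ident _} (known _ _) ()
    abstraction-const {d = value _} (known _ _) ()
    abstraction-const {d = value _} (unknown _) ()

    abstraction-id : ∀ {φ} → φ ∈ facts D → pred φ ∈ preds I → abstraction (ident (id φ)) ≡ fid (rawOf φ)
    abstraction-id {φ} φ∈ P∈ with Any.any? (relevant? (id φ)) (facts D)
    ... | no ∉  = contradiction (Any.map (λ { refl → refl , P∈ }) φ∈) ∉
    ... | yes p = cong (fid ∘ rawOf) (proj₁ (lookup-any p (λ ∈D → ∈D)))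
      where
      lookup-any : ∀ {φs} (p : Any (Relevant (id φ)) φs) → φs ⊆ facts D → Any.lookup p ≡ φ × ⊤
      lookup-any (here (eq , _)) ⊆D = id-injective (⊆D (here refl)) φ∈ eq , tt
      lookup-any (there p)       ⊆D = lookup-any p (⊆D ∘ there)

    abstraction-good : ∀ c → GoodVal (abstraction c)
    abstraction-good c with abstraction c | abstraction-view c
    ... | _ | value     = tt
    ... | _ | unknown _ = tt
    ... | _ | known φ∈ P∈ with dataset-fact D φ∈
    ... | a , refl , _ = subst GoodFact (sym (rawOf-toFact a)) (good-raw {a} P∈)

    abstraction-isId : ∀ c → isId (abstraction c) ≡ true → IsId c
    abstraction-isId (ident _) _ = tt

    isId-abstraction : ∀ c → IsId c → isId (abstraction c) ≡ true
    isId-abstraction (ident i) _ with Any.any? (relevant? i) (facts D)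
    ... | yes _ = refl
    ... | no _  = refl

    -- An identifier written in the instance stays a constant even if it identifies a fact, whereas
    -- a variable with the same value becomes the fact. The mismatch does no harm: metadata atoms
    -- only look at sorts, and inequality atoms can only gain from it.
    termVal : Assignment → Term → RVal
    termVal ν (var x) = abstraction (ν x)
    termVal ν (con c) = constVal c

    termVal-value : ∀ ν t {w} → value-of ν t ≡ value w → termVal ν t ≡ val w
    termVal-value ν (var x) eq = cong abstraction eq
    termVal-value ν (con (value w)) refl = refl

    termVal-isId : ∀ ν t → isId (termVal ν t) ≡ true → IsId (value-of ν t)
    termVal-isId ν (var x) eq = abstraction-isId (ν x) eq
    termVal-isId ν (con (ident w)) eq = tt

    isId-termVal : ∀ ν t → IsId (value-of ν t) → isId (termVal ν t) ≡ true
    isId-termVal ν (var x) i = isId-abstraction (ν x) i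
    isId-termVal ν (con (ident w)) i = refl

    Covers : Assignment → Env → List Var → Set
    Covers ν E xs = ∀ {x} → x ∈ xs → Look E x (abstraction (ν x))

    term-value : ∀ {ν E} t → Covers ν E (termVars t) → Value E (rawTerm t) (termVal ν t)
    term-value (var x) cov = cov (here refl)
    term-value (con c) cov = refl

    plain-values : ∀ {ν E n} (ts : Vec Term n) → Covers ν E (argVars ts) →
                   (∀ {c} → c Vec∈.∈ Vec.map (value-of ν) ts → ¬ IsId c) →
                   ∃[ ws ] Values E (map rawTerm (Vec.toList ts)) (Vec.toList ws) × Vec.map (value-of ν) ts ≡ Vec.map value ws
    plain-values [] cov free = [] , [] , refl
    plain-values {ν} {E} (t ∷ ts) cov free with value-of ν t in eq
    ... | ident _ = contradiction tt (free (VecAny.here refl))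
    ... | value w = let ws , vs , e = plain-values ts (cov ∘ ∈-++⁺ʳ (termVars t)) (free ∘ VecAny.there) in
        w ∷ ws , subst (Value E (rawTerm t)) (termVal-value ν t eq) (term-value t (cov ∘ ∈-++⁺ˡ)) ∷ vs , cong (value w ∷_) e

    meta-sorts : ∀ {ν E n} (ts : Vec Term n) bs → Covers ν E (argVars ts) →
                 (∀ j → IsId (lookup (Vec.map (value-of ν) ts) j) → lookup bs j ≡ true) →
                 (∀ j → lookup bs j ≡ true → IsId (lookup (Vec.map (value-of ν) ts) j)) →
                 Sorts E (map rawTerm (Vec.toList ts)) (Vec.toList bs)
    meta-sorts [] [] cov to from = []
    meta-sorts {ν} (t ∷ ts) (b ∷ bs) cov to from =
      (termVal ν t , term-value t (cov ∘ ∈-++⁺ˡ) , sort b (isId-termVal ν t) (termVal-isId ν t) (to zero) (from zero)) ∷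
      meta-sorts ts bs (cov ∘ ∈-++⁺ʳ (termVars t)) (to ∘ suc) (from ∘ suc)
      where
      sort : ∀ {i A} b → (A → i ≡ true) → (i ≡ true → A) → (A → b ≡ true) → (b ≡ true → A) → i ≡ b
      sort {false} false _ _ _ _ = refl
      sort {true}  false _ f g _ = sym (g (f refl))
      sort {false} true  f _ _ g = f (g refl)
      sort {true}  true  _ _ _ _ = refl

    holds-raw : ∀ {ν E} φ → predsCond φ ⊆ preds I → Covers ν E (condVars φ) → Holds M ν φ → HoldsIn GoodVal E φ
    holds-raw {ν} {E} (rel (P · ts)) _ cov (inj₁ φ∈) =
      subst (λ p → LeafHolds E (lrel (p , map rawTerm (Vec.toList ts)))) (sym (meta-rawPred P (metadata φ∈)))
        (meta-sorts ts (posID P) cov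
          (λ j i → Vec.[]=⇒lookup (Equivalence.to (positions φ∈ j) i))
          (λ j eq → Equivalence.from (positions φ∈ j) (Vec.lookup⇒[]= j (posID P) eq)))
    holds-raw {ν} {E} (rel (P · ts)) _ cov (inj₂ φ∈) with plain-values ts cov (no-ids D φ∈)
    ... | ws , vs , _ = subst (λ p → LeafHolds E (lrel (p , map rawTerm (Vec.toList ts))))
      (sym (plain-rawPred P (no-metadata D φ∈))) (all-values vs)
      where
      all-values : ∀ {ts ws} → Values E ts ws → All (λ t → ∃[ w ] Value E t (val w)) ts
      all-values []       = []
      all-values (v ∷ vs) = (_ , v) ∷ all-values vs
    holds-raw {ν} {E} (idEq x (P · ts) _) P∈ cov (φ∈ , eq) with plain-values ts (cov ∘ there) (no-ids D φ∈)
    ... | ws , vs , e = Vec.toList ws , vs , subst (Look E x) look-eq (cov (here refl))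
      where
      look-eq : abstraction (ν x) ≡ fid (rawFact (P · ws))
      look-eq = trans (cong abstraction eq) (trans (abstraction-id φ∈ (P∈ (here refl)))
        (cong fid (trans (cong (λ cs → rawOf (P · cs)) e) (rawOf-toFact (P · ws)))))
    holds-raw {ν} {E} (neq x t) _ cov ≠ =
      _ , _ , cov (here refl) , term-value t (cov ∘ there) , ≠ ∘ differ′ t
      where
      differ′ : ∀ t → abstraction (ν x) ≡ termVal ν t → ν x ≡ value-of ν t
      differ′ (var y) eq = same-abstraction (abstraction-view (ν x)) (abstraction-view (ν y)) eq
      differ′ (con c) eq = abstraction-const (abstraction-view (ν x)) eq
    holds-raw (φ ∧ ψ) P∈ cov (h , h′) =
      holds-raw φ (P∈ ∘ ∈-++⁺ˡ) (cov ∘ ∈-++⁺ˡ) h , holds-raw ψ (P∈ ∘ ∈-++⁺ʳ (predsCond φ)) (cov ∘ ∈-++⁺ʳ (condVars φ)) h′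
    holds-raw {ν} {E} (ex x φ) P∈ cov (c , h) = abstraction c , abstraction-good c , holds-raw φ P∈ extended h
      where
      extended : Covers (ν [ x ≔ c ]) ((x , abstraction c) ∷ E) (condVars φ)
      extended {y} y∈ with x ≟ᵛ y
      ... | yes refl = here
      ... | no x≠y   = there (x≠y ∘ sym) (cov y∈)

    good-pred : ∀ {a} → GoodFact (rawFact a) → pred a ∈ preds I
    good-pred {P · ws} g with ∈-map⁻ (λ P → rawPred P , arity P) g
    ... | Q , Q∈ , eq = subst (_∈ preds I) (sym (rawPred-injective {P} {Q} (cong proj₁ eq))) Q∈

    preferred-raw : ∀ {α β} → Preferred M (theory I) (rules I) α β →
                    ∃₂ λ a b → α ≡ toFact a × β ≡ toFact b × ¬ ¬ RawEdge GoodVal (rawFact a) (rawFact b)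
    preferred-raw ((r , r∈ , ν , ν₁ , ν₂ , h) , C , cf , α∈ , β∈) with conflict-raw I {D} cf α∈ β∈
    ... | a , b , refl , refl , m = a , b , refl , refl , (m >>= λ (h′ , e , rc) → return (edge e rc))
      where
      open Rule r
      E : Env
      E = envOf (abstraction ∘ ν) (condVars body)

      edge : ∀ {h′} → rawFact b ≡ rawFact a ⊎ rawFact b ≡ h′ → RawConflict GoodVal (rawFact a) h′ → RawEdge GoodVal (rawFact a) (rawFact b)
      edge e rc = record
        { either = e ; conflict = rc ; rule∈ = r∈ ; env = E ; keys = envOf-keys _ _
        ; good = envOf-good (condVars body) (abstraction-good ∘ ν)
        ; holds = holds-raw body (λ P∈ → ∈-++⁺ʳ (concatMap (map pred ∘ relationalAtoms) (theory I))
                    (∈-concatMap⁺ (predsCond ∘ Rule.body) (Any.map (λ { refl → P∈ }) r∈))) covered h }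
        where
        good-b : ∀ {h′} → rawFact b ≡ rawFact a ⊎ rawFact b ≡ h′ → RawConflict GoodVal (rawFact a) h′ → GoodFact (rawFact b)
        good-b (inj₁ eq) rc = subst GoodFact (sym eq) (RawConflict.goodˡ rc)
        good-b (inj₂ eq) rc = subst GoodFact (sym eq) (RawConflict.goodʳ rc)
        at₁ : abstraction (ν x₁) ≡ fid (rawFact a)
        at₁ = trans (cong abstraction ν₁) (trans (abstraction-id (IsConflict.subset cf α∈) (good-pred′ a (RawConflict.goodˡ rc)))
                (cong fid (rawOf-toFact a)))
          where
          good-pred′ : ∀ a → GoodFact (rawFact a) → pred (toFact a) ∈ preds I
          good-pred′ a@(_ · _) g = good-pred {a} g
        at₂ : abstraction (ν x₂) ≡ fid (rawFact b)
        at₂ = trans (cong abstraction ν₂) (trans (abstraction-id (IsConflict.subset cf β∈) (good-pred′ b (good-b e rc)))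
                (cong fid (rawOf-toFact b)))
          where
          good-pred′ : ∀ a → GoodFact (rawFact a) → pred (toFact a) ∈ preds I
          good-pred′ a@(_ · _) g = good-pred {a} g
        covered : Covers ν ((x₁ , fid (rawFact a)) ∷ (x₂ , fid (rawFact b)) ∷ E) (condVars body)
        covered {y} y∈ with y ≟ᵛ x₁
        ... | yes refl = subst (Look ((x₁ , fid (rawFact a)) ∷ (x₂ , fid (rawFact b)) ∷ E) x₁) (sym at₁) here
        ... | no y≠x₁ with y ≟ᵛ x₂
        ... | yes refl = subst (Look ((x₁ , fid (rawFact a)) ∷ (x₂ , fid (rawFact b)) ∷ E) x₂) (sym at₂) (there y≠x₁ here)
        ... | no y≠x₂ = there y≠x₁ (there y≠x₂ (envOf-look (abstraction ∘ ν) y∈))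

    -- Edges are translated one at a time and meet because a raw fact determines the fact; the
    -- double negations are collected along the way.
    cycle-raw : ∀ {α} → TransClosure (Preferred M (theory I) (rules I)) α α →
                ¬ ¬ (All Harmless 𝒯 × ∃₂ λ k f → Walk (RawEdge GoodVal) (suc k) f f)
    cycle-raw c with walk c
      where
      walk : ∀ {α β} → TransClosure (Preferred M (theory I) (rules I)) α β →
             ∃₂ λ a b → α ≡ toFact a × β ≡ toFact b × ¬ ¬ (∃[ k ] Walk (RawEdge GoodVal) (suc k) (rawFact a) (rawFact b))
      walk [ p ]⁺ with preferred-raw p
      ... | a , b , eq , eq′ , m = a , b , eq , eq′ , (m >>= λ e → return (_ , e ∷ []))
      walk (p ∷⁺ ps) with preferred-raw p | walk ps
      ... | a , b , eq , refl , m | b′ , d , eq₁ , eq₂ , m′ with toFact-injective {b} {b′} eq₁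
      ... | refl = a , d , eq , eq₂ , (m >>= λ e → m′ >>= λ (k , w) → return (_ , e ∷ w))
    ... | a , b , refl , eq , m with toFact-injective {a} {b} eq
    ... | refl = first c >>= λ hs → m >>= λ (k , w) → return (hs , k , _ , w)
      where
      harmless : ∀ {α β} → Preferred M (theory I) (rules I) α β → ¬ ¬ All Harmless 𝒯
      harmless (_ , _ , cf , α∈ , _) = conflict-harmless I {D} cf α∈
      first : ∀ {α β} → TransClosure (Preferred M (theory I) (rules I)) α β → ¬ ¬ All Harmless 𝒯
      first [ p ]⁺    = harmless p
      first (p ∷⁺ ps) = harmless p

  -- Renaming of constants

  constWord : RConst → Word
  constWord (idn w) = w
  constWord (vlu w) = w

  termWords : RTerm → List Word
  termWords (inj₁ _) = []
  termWords (inj₂ c) = [ constWord c ]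

  literalWords : RLit → List Word
  literalWords (rrel (_ , ts)) = concatMap termWords ts
  literalWords (rneq s t)      = termWords s ++ termWords t

  leafWords : RLeaf → List Word
  leafWords (lrel (_ , ts))    = concatMap termWords ts
  leafWords (lidEq _ (_ , ts)) = concatMap termWords ts
  leafWords (lneq _ t)         = termWords t

  condWords : Cond → List Word
  condWords (rel α)      = leafWords (lrel (rawAtom α))
  condWords (idEq x α _) = leafWords (lidEq x (rawAtom α))
  condWords (neq x t)    = leafWords (lneq x (rawTerm t))
  condWords (φ ∧ ψ)      = condWords φ ++ condWords ψ
  condWords (ex x φ)     = condWords φ

  core : Instance → List Word
  core I = concatMap (concatMap literalWords) (rawTheory (theory I)) ++ concatMap (condWords ∘ Rule.body) (rules I)

  valWords : RVal → List Word
  valWords (inj₁ c)        = [ constWord c ]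
  valWords (fid (_ , ws))  = ws

  envWords : Env → List Word
  envWords = concatMap (valWords ∘ proj₂)

  Fixes : (Word → Word) → List Word → Set
  Fixes h ws = ∀ {w} → w ∈ ws → h w ≡ w

  map-fixed : ∀ {h ws} → Fixes h ws → map h ws ≡ ws
  map-fixed {ws = []}    fix = refl
  map-fixed {ws = w ∷ ws} fix = cong₂ _∷_ (fix (here refl)) (map-fixed (fix ∘ there))

  ∈-concatMap : ∀ {A B : Set} (f : A → List B) {xs x y} → x ∈ xs → y ∈ f x → y ∈ concatMap f xs
  ∈-concatMap f x∈ y∈ = ∈-concatMap⁺ f (Any.map (λ { refl → y∈ }) x∈)

  -- All raw notions compare words only with each other and with the constants of the instance. They
  -- are therefore invariant under injective renamings that fix the latter.
  module Rename (h : Word → Word) (h-injective : ∀ {u w} → h u ≡ h w → u ≡ w) where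

    renameVal : RVal → RVal
    renameVal (inj₁ (idn w))  = inj₁ (idn (h w))
    renameVal (val w)         = val (h w)
    renameVal (fid (p , ws))  = fid (p , map h ws)

    renameFact : RFact → RFact
    renameFact (p , ws) = p , map h ws

    renameEnv : Env → Env
    renameEnv = map (Product.map₂ renameVal)

    vlu-injective : ∀ {u w} → _≡_ {A = RVal} (val u) (val w) → u ≡ w
    vlu-injective refl = refl

    idn-injective : ∀ {u w} → _≡_ {A = RVal} (inj₁ (idn u)) (inj₁ (idn w)) → u ≡ w
    idn-injective refl = refl

    renameVal-injective : ∀ {u u′} → renameVal u ≡ renameVal u′ → u ≡ u′
    renameVal-injective {inj₁ (idn _)} {inj₁ (idn _)} eq = cong (λ w → inj₁ (idn w)) (h-injective (idn-injective eq))
    renameVal-injective {val _} {val _} eq = cong (λ w → val w) (h-injective (vlu-injective eq))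
    renameVal-injective {fid (p , us)} {fid (q , ws)} eq =
      cong fid (cong₂ _,_ (cong predOf eq) (List.map-injective h-injective (cong valWords eq)))
      where
      predOf : RVal → RPred
      predOf (fid (p , _)) = p
      predOf _             = [] , plain
    renameVal-injective {inj₁ (idn _)} {val _} ()
    renameVal-injective {val _} {inj₁ (idn _)} ()
    renameVal-injective {fid _} {inj₁ (idn _)} ()
    renameVal-injective {fid _} {val _} ()
    renameVal-injective {inj₁ (idn _)} {fid _} ()
    renameVal-injective {val _} {fid _} ()

    renameVal-const : ∀ c → h (constWord c) ≡ constWord c → renameVal (inj₁ c) ≡ inj₁ c
    renameVal-const (idn w) eq = cong (λ w → inj₁ (idn w)) eq
    renameVal-const (vlu w) eq = cong (λ w → val w) eq

    renameVal-fixed : ∀ u → Fixes h (valWords u) → renameVal u ≡ u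
    renameVal-fixed (inj₁ c)       fix = renameVal-const c (fix (here refl))
    renameVal-fixed (fid (p , ws)) fix = cong (λ ws → fid (p , ws)) (map-fixed fix)

    renameFact-fixed : ∀ f → Fixes h (proj₂ f) → renameFact f ≡ f
    renameFact-fixed (p , ws) fix = cong (p ,_) (map-fixed fix)

    renameEnv-fixed : ∀ E → Fixes h (envWords E) → renameEnv E ≡ E
    renameEnv-fixed []            fix = refl
    renameEnv-fixed ((x , u) ∷ E) fix =
      cong₂ _∷_ (cong (x ,_) (renameVal-fixed u (fix ∘ ∈-++⁺ˡ))) (renameEnv-fixed E (fix ∘ ∈-++⁺ʳ (valWords u)))

    renameVal-words : ∀ u → valWords (renameVal u) ≡ map h (valWords u)
    renameVal-words (inj₁ (idn _)) = refl
    renameVal-words (val _)        = refl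
    renameVal-words (fid _)        = refl

    isId-rename : ∀ u → isId (renameVal u) ≡ isId u
    isId-rename (inj₁ (idn _)) = refl
    isId-rename (val _)        = refl
    isId-rename (fid _)        = refl

    look-rename : ∀ {E x u} → Look E x u → Look (renameEnv E) x (renameVal u)
    look-rename here        = here
    look-rename (there ≠ l) = there ≠ (look-rename l)

    value-rename : ∀ {E} t {u} → Fixes h (termWords t) → Value E t u → Value (renameEnv E) t (renameVal u)
    value-rename (inj₁ x) fix l    = look-rename l
    value-rename (inj₂ c) fix refl = renameVal-const c (fix (here refl))

    values-rename : ∀ {E ts ws} → Fixes h (concatMap termWords ts) → Values E ts ws → Values (renameEnv E) ts (map h ws)
    values-rename fix []                 = []
    values-rename {ts = t ∷ _} fix (v ∷ vs) = value-rename t (fix ∘ ∈-++⁺ˡ) v ∷ values-rename (fix ∘ ∈-++⁺ʳ (termWords t)) vs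

    leaf-rename : ∀ {E} l → Fixes h (leafWords l) → LeafHolds E l → LeafHolds (renameEnv E) l
    leaf-rename (lrel ((_ , plain) , ts)) fix vs = go ts fix vs
      where
      go : ∀ {E} ts → Fixes h (concatMap termWords ts) → All (λ t → ∃[ w ] Value E t (val w)) ts →
           All (λ t → ∃[ w ] Value (renameEnv E) t (val w)) ts
      go []       fix []             = []
      go (t ∷ ts) fix ((w , v) ∷ vs) = (h w , value-rename t (fix ∘ ∈-++⁺ˡ) v) ∷ go ts (fix ∘ ∈-++⁺ʳ (termWords t)) vs
    leaf-rename (lrel ((_ , metaAt bs) , ts)) fix ss = go fix ss
      where
      go : ∀ {E ts bs} → Fixes h (concatMap termWords ts) → Sorts E ts bs → Sorts (renameEnv E) ts bs
      go fix [] = []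
      go {ts = t ∷ _} fix ((u , v , eq) ∷ ss) =
        (renameVal u , value-rename t (fix ∘ ∈-++⁺ˡ) v , trans (isId-rename u) eq) ∷ go (fix ∘ ∈-++⁺ʳ (termWords t)) ss
    leaf-rename (lidEq x (p , ts)) fix (ws , vs , l) = map h ws , values-rename fix vs , look-rename l
    leaf-rename (lneq x t) fix (u , u′ , l , v , ≠) =
      renameVal u , renameVal u′ , look-rename l , value-rename t fix v , ≠ ∘ renameVal-injective

    holds-rename : ∀ {G : RVal → Set} → (∀ u → G u → G (renameVal u)) → ∀ {E} φ → Fixes h (condWords φ) →
                   HoldsIn G E φ → HoldsIn G (renameEnv E) φ
    holds-rename G-rename (rel α)      fix p = leaf-rename (lrel (rawAtom α)) fix p
    holds-rename G-rename (idEq x α _) fix p = leaf-rename (lidEq x (rawAtom α)) fix p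
    holds-rename G-rename (neq x t)    fix p = leaf-rename (lneq x (rawTerm t)) fix p
    holds-rename G-rename (φ ∧ ψ) fix (p , q) =
      holds-rename G-rename φ (fix ∘ ∈-++⁺ˡ) p , holds-rename G-rename ψ (fix ∘ ∈-++⁺ʳ (condWords φ)) q
    holds-rename G-rename (ex x φ) fix (u , g , p) = renameVal u , G-rename u g , holds-rename G-rename φ fix p

    literal-rename : ∀ {E f g} ℓ → Fixes h (literalWords ℓ) → LitHolds E f g ℓ →
                     LitHolds (renameEnv E) (renameFact f) (renameFact g) ℓ
    literal-rename (rrel (p , ts)) fix (ws , which , vs) =
      map h ws , Sum.map (cong renameFact) (cong renameFact) which , values-rename fix vs
    literal-rename (rneq s t) fix (u , u′ , v , v′ , ≠) =
      renameVal u , renameVal u′ , value-rename s (fix ∘ ∈-++⁺ˡ) v , value-rename t (fix ∘ ∈-++⁺ʳ (termWords s)) v′ ,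
      ≠ ∘ renameVal-injective

    constraint-rename : ∀ {E f g} κ → Fixes h (concatMap literalWords κ) → All (LitHolds E f g) κ →
                        All (LitHolds (renameEnv E) (renameFact f) (renameFact g)) κ
    constraint-rename []      fix []       = []
    constraint-rename (ℓ ∷ κ) fix (p ∷ ps) =
      literal-rename ℓ (fix ∘ ∈-++⁺ˡ) p ∷ constraint-rename κ (fix ∘ ∈-++⁺ʳ (literalWords ℓ)) ps

    zip-rename : ∀ {t : RTerm} {w} ts ws → (t , w) ∈ List.zip ts ws → (t , h w) ∈ List.zip ts (map h ws)
    zip-rename (_ ∷ ts) (_ ∷ ws) (here refl) = here refl
    zip-rename (_ ∷ ts) (_ ∷ ws) (there tw∈) = there (zip-rename ts ws tw∈)

    occurs-rename : ∀ {κ f t w} → Occurs κ f t w → Occurs κ (renameFact f) t (h w)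
    occurs-rename {f = _ , ws} (ts , α∈ , tw∈) = ts , α∈ , zip-rename ts ws tw∈

    forced-rename : ∀ {κ f t u} → Fixes h (termWords t) → Forced κ f t u → Forced κ (renameFact f) t (renameVal u)
    forced-rename fix (inj₁ (c , refl , refl)) = inj₁ (c , refl , renameVal-const c (fix (here refl)))
    forced-rename {f = f} fix (inj₂ (w , o , refl)) = inj₂ (h w , occurs-rename {f = f} o , refl)

    refuted-rename : ∀ {κ f} → Fixes h (concatMap literalWords κ) → Refuted f κ → Refuted (renameFact f) κ
    refuted-rename fix (predicate α∈ ≠) = predicate α∈ ≠
    refuted-rename {f = f} fix (clash {t} o@(ts , α∈ , tw∈) fo ≠) = clash (occurs-rename {f = f} o)
      (forced-rename {f = f} (λ w∈ → fix (∈-concatMap literalWords α∈ (∈-concatMap termWords (proj₁ (zip-∈ ts (proj₂ f) tw∈)) w∈))) fo)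
      (≠ ∘ renameVal-injective)
    refuted-rename fix (identical t∈) = identical t∈
    refuted-rename {f = f} fix (collapse {s} {t} st∈ fo fo′) = collapse st∈
      (forced-rename {f = f} (λ w∈ → fix (∈-concatMap literalWords st∈ (∈-++⁺ˡ w∈))) fo)
      (forced-rename {f = f} (λ w∈ → fix (∈-concatMap literalWords st∈ (∈-++⁺ʳ (termWords s) w∈))) fo′)

    stable-rename : ∀ {𝒯 f} → Fixes h (concatMap (concatMap literalWords) 𝒯) → Stable 𝒯 f → Stable 𝒯 (renameFact f)
    stable-rename fix st = All.tabulate λ κ∈ → refuted-rename (λ w∈ → fix (∈-concatMap (concatMap literalWords) κ∈ w∈)) (All.lookup st κ∈)

    plain-rename : ∀ {f} → Plain f → Plain (renameFact f)
    plain-rename (m , ws , refl) = m , map h ws , refl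

    renameEnv-keys : ∀ E → map proj₁ (renameEnv E) ≡ map proj₁ E
    renameEnv-keys E = sym (List.map-∘ E)

    module _ (I : Instance) (fix : Fixes h (core I)) where
      open RawEdges I

      good-rename : ∀ u → GoodVal u → GoodVal (renameVal u)
      good-rename (inj₁ (idn _)) g = tt
      good-rename (val _)        g = tt
      good-rename (fid (p , ws)) g = subst (λ n → (p , n) ∈ shapes) (sym (List.length-map h ws)) g

      goodEnv-rename : ∀ {E} → All (GoodVal ∘ proj₂) E → All (GoodVal ∘ proj₂) (renameEnv E)
      goodEnv-rename gs = All.map⁺ (All.map (λ {e} → good-rename (proj₂ e)) gs)

      fix-theory : Fixes h (concatMap (concatMap literalWords) 𝒯)
      fix-theory w∈ = fix (∈-++⁺ˡ w∈)

      fix-rule : ∀ {r} → r ∈ rules I → Fixes h (condWords (Rule.body r))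
      fix-rule r∈ w∈ = fix (∈-++⁺ʳ (concatMap (concatMap literalWords) 𝒯) (∈-concatMap (condWords ∘ Rule.body) r∈ w∈))

      fix-constraint : ∀ {κ} → κ ∈ theory I → Fixes h (concatMap literalWords (rawConstraint κ))
      fix-constraint κ∈ w∈ = fix-theory (∈-concatMap (concatMap literalWords) (raw∈ κ∈) w∈)

      conflict-rename : ∀ {f g} → RawConflict GoodVal f g → RawConflict GoodVal (renameFact f) (renameFact g)
      conflict-rename {f} {g} record { κ = κ ; κ∈ = κ∈ ; env = E ; keys = ks ; good = gs ; violated = vs ; minimal = mi
                             ; plainˡ = p ; plainʳ = q ; goodˡ = gf ; goodʳ = gg } = record
        { κ∈ = κ∈ ; env = renameEnv E ; keys = trans (renameEnv-keys E) ks ; good = goodEnv-rename gs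
        ; violated = constraint-rename _ (fix-constraint κ∈) vs
        ; minimal = Sum.map (cong renameFact) (Product.map (stable-rename fix-theory) (stable-rename fix-theory)) mi
        ; plainˡ = plain-rename p ; plainʳ = plain-rename q
        ; goodˡ = good-rename (fid f) gf ; goodʳ = good-rename (fid g) gg }

      edge-rename : ∀ {f g} → RawEdge GoodVal f g → RawEdge GoodVal (renameFact f) (renameFact g)
      edge-rename record { either = e ; conflict = c ; rule = r ; rule∈ = r∈ ; env = E ; keys = ks ; good = gs ; holds = hs } = record
        { either = Sum.map (cong renameFact) (cong renameFact) e ; conflict = conflict-rename c ; rule∈ = r∈
        ; env = renameEnv E ; keys = trans (renameEnv-keys E) ks ; good = goodEnv-rename gs
        ; holds = holds-rename good-rename (Rule.body r) (fix-rule r∈) hs }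

      walk-rename : ∀ {k f g} → Walk (RawEdge GoodVal) k f g → Walk (RawEdge GoodVal) k (renameFact f) (renameFact g)
      walk-rename []      = []
      walk-rename (e ∷ w) = edge-rename e ∷ walk-rename w

  -- Renaming into a pool of constants

  swap : Word → Word → Word → Word
  swap a b w with w ≟ᵛ a | w ≟ᵛ b
  ... | yes _ | _     = b
  ... | no _  | yes _ = a
  ... | no _  | no _  = w

  swap-left : ∀ a b → swap a b a ≡ b
  swap-left a b with a ≟ᵛ a
  ... | yes _ = refl
  ... | no ≠  = contradiction refl ≠

  swap-other : ∀ {a b w} → w ≢ a → w ≢ b → swap a b w ≡ w
  swap-other {a} {b} {w} w≠a w≠b with w ≟ᵛ a | w ≟ᵛ b
  ... | yes eq | _      = contradiction eq w≠a
  ... | no _   | yes eq = contradiction eq w≠b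
  ... | no _   | no _   = refl

  swap-involutive : ∀ a b w → swap a b (swap a b w) ≡ w
  swap-involutive a b w with w ≟ᵛ a | w ≟ᵛ b
  ... | no w≠a | no w≠b = swap-other w≠a w≠b
  ... | no w≠a | yes refl = swap-left a w
  ... | yes refl | _ with b ≟ᵛ w | b ≟ᵛ b
  ... | yes refl | _ = refl
  ... | no _ | yes _ = refl
  ... | no _ | no ≠ = contradiction refl ≠

  swap-injective : ∀ a b {u w} → swap a b u ≡ swap a b w → u ≡ w
  swap-injective a b {u} {w} eq = trans (sym (swap-involutive a b u)) (trans (cong (swap a b) eq) (swap-involutive a b w))

  unary : ℕ → Word
  unary i = replicate i true

  freshWords : ℕ → List Word
  freshWords F = map unary (List.upTo F)

  -- If all `F` unary words occurred in the shorter list `ws`, two of them would share a position.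
  unused : ∀ {F} (ws : List Word) → length ws < F → ∃[ i ] i < F × unary i ∉ ws
  unused {F} ws ws<F with Fin.any? {n = F} (λ i → ¬? (Any.any? (unary (Fin.toℕ i) ≟ᵛ_) ws))
  ... | yes (i , ∉ws) = Fin.toℕ i , Fin.toℕ<n i , ∉ws
  ... | no ¬any with Fin.pigeonhole ws<F (λ i → Any.index (in-ws i))
    where
    in-ws : (i : Fin F) → unary (Fin.toℕ i) ∈ ws
    in-ws i = Dec.decidable-stable (Any.any? (unary (Fin.toℕ i) ≟ᵛ_) ws) (λ ∉ws → ¬any (i , ∉ws))
  ... | i , j , i<j , eq = contradiction (Fin.toℕ-injective (unary-injective (same-index (in-ws i) (in-ws j) eq))) (Fin.<⇒≢ i<j)
    where
    in-ws : (i : Fin F) → unary (Fin.toℕ i) ∈ ws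
    in-ws i = Dec.decidable-stable (Any.any? (unary (Fin.toℕ i) ≟ᵛ_) ws) (λ ∉ws → ¬any (i , ∉ws))
    unary-injective : ∀ {m n} → unary m ≡ unary n → m ≡ n
    unary-injective {m} {n} eq = trans (sym (List.length-replicate m)) (trans (cong length eq) (List.length-replicate n))
    same-index : ∀ {ws u w} (u∈ : u ∈ ws) (w∈ : w ∈ ws) → Any.index u∈ ≡ Any.index w∈ → u ≡ w
    same-index (here refl) (here refl) eq = refl
    same-index (there u∈) (there w∈) eq = same-index u∈ w∈ (Fin.suc-injective eq)

  record Renaming (K L Pool : List Word) : Set where
    field
      rename    : Word → Word
      injective : ∀ {u w} → rename u ≡ rename w → u ≡ w
      fixes     : Fixes rename K
      into      : ∀ {w} → w ∈ L → rename w ∈ Pool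

  -- A word that is still outside the pool is exchanged with a unary word that neither `K` nor the
  -- renamed words use; there is one because `F` exceeds their number. Exchanging, unlike
  -- substituting, keeps the renaming injective on all words.
  compress : ∀ {Pool F} → (∀ {i} → i < F → unary i ∈ Pool) → ∀ K L → K ⊆ Pool → length K + length L < F → Renaming K L Pool
  compress fresh∈ K [] K⊆ _ = record { rename = λ w → w ; injective = λ eq → eq ; fixes = λ _ → refl ; into = λ () }
  compress {Pool} {F} fresh∈ K (w ∷ L) K⊆ lt with compress {Pool} {F} fresh∈ K L K⊆ (ℕ.<-trans (ℕ.+-monoʳ-< (length K) ℕ.≤-refl) lt)
  ... | record { rename = h ; injective = inj ; fixes = fix ; into = into } with Any.any? (h w ≟ᵛ_) Pool
  ... | yes hw∈ = record { rename = h ; injective = inj ; fixes = fix ; into = λ { (here refl) → hw∈ ; (there w∈) → into w∈ } }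
  ... | no hw∉ with unused (K ++ map h L) (ℕ.≤-<-trans (ℕ.≤-reflexive (trans (List.length-++ K) (cong (length K +_) (List.length-map h L))))
                      (ℕ.<-trans (ℕ.+-monoʳ-< (length K) ℕ.≤-refl) lt))
  ... | i , i<F , b∉ = record
    { rename = swap (h w) b ∘ h
    ; injective = inj ∘ swap-injective (h w) b
    ; fixes = λ k∈ → trans (swap-other (λ eq → hw∉ (subst (_∈ Pool) (trans (sym (fix k∈)) eq) (K⊆ k∈)))
                                      (λ eq → b∉ (∈-++⁺ˡ (subst (_∈ K) (trans (sym (fix k∈)) eq) k∈)))) (fix k∈)
    ; into = λ
      { (here refl) → subst (_∈ Pool) (sym (swap-left (h w) b)) (fresh∈ i<F)
      ; (there w∈) → subst (_∈ Pool) (sym (swap-other (λ eq → hw∉ (subst (_∈ Pool) eq (into w∈)))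
                        (λ eq → b∉ (∈-++⁺ʳ K (subst (_∈ map h L) eq (∈-map⁺ h w∈)))))) (into w∈) } }
    where
    b = unary i

  -- Short cycles over a pool of constants

  _++ʷ_ : ∀ {R k l f g h} → Walk R k f g → Walk R l g h → Walk R (k + l) f h
  []      ++ʷ w′ = w′
  (e ∷ w) ++ʷ w′ = e ∷ (w ++ʷ w′)

  ∈-++-⊆ : ∀ {A : Set} {xs ys zs : List A} → xs ⊆ zs → ys ⊆ zs → xs ++ ys ⊆ zs
  ∈-++-⊆ {xs = xs} xs⊆ ys⊆ w∈ = Sum.[ xs⊆ , ys⊆ ] (∈-++⁻ xs w∈)

  module Shrink (I : Instance) (n m : ℕ) (1≤m : 1 ≤ m)
    (core≤  : length (core I) ≤ n)
    (arity≤ : ∀ {p a} → (p , a) ∈ RawEdges.shapes I → a ≤ m)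
    (vars≤  : ∀ {κ} → κ ∈ theory I → length (constraintVars κ) ≤ n)
    (body≤  : ∀ {r} → r ∈ rules I → length (condVars (Rule.body r)) ≤ n)
    (size≤  : ∀ {r} → r ∈ rules I → length (rawCond (Rule.body r)) ≤ n) where

    open RawEdges I

    -- `D` bounds environments during the check of a body: two distinguished variables, at most `n`
    -- entries for the variables of the body and at most `n` for quantifiers passed. `F` exceeds the
    -- number of words to be kept apart at any time: those of the instance, of `D` values and of one
    -- new value, each value having at most `m`.
    D F : ℕ
    D = 2 + (n + n)
    F = suc (n + suc D * m)

    Pool : List Word
    Pool = core I ++ freshWords F

    fresh∈ : ∀ {i} → i < F → unary i ∈ Pool
    fresh∈ i<F = ∈-++⁺ʳ (core I) (∈-map⁺ unary (∈-upTo⁺ i<F))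

    SmallVal : RVal → Set
    SmallVal u = GoodVal u × valWords u ⊆ Pool

    val-length : ∀ u → GoodVal u → length (valWords u) ≤ m
    val-length (inj₁ _) _ = 1≤m
    val-length (fid _)  g = arity≤ g

    env-length : ∀ {E} → All (GoodVal ∘ proj₂) E → length (envWords E) ≤ length E * m
    env-length []                       = z≤n
    env-length {(_ , u) ∷ E} (g ∷ gs) =
      ℕ.≤-trans (ℕ.≤-reflexive (List.length-++ (valWords u))) (ℕ.+-mono-≤ (val-length u g) (env-length gs))

    env-small : ∀ {E} → All (SmallVal ∘ proj₂) E → envWords E ⊆ Pool
    env-small []              ()
    env-small ((_ , s) ∷ ss) = ∈-++-⊆ s (env-small ss)

    small-good : ∀ {E : Env} → All (SmallVal ∘ proj₂) E → All (GoodVal ∘ proj₂) E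
    small-good = All.map proj₁

    -- K is kept, L is renamed into the pool.
    intoPool : ∀ K L {j} → K ⊆ Pool → length K + length L ≤ j * m → j ≤ suc D → Renaming (core I ++ K) L Pool
    intoPool K L {j} K⊆ le j≤ = compress fresh∈ (core I ++ K) L (∈-++-⊆ ∈-++⁺ˡ K⊆) (s≤s (begin
      length (core I ++ K) + length L         ≡⟨ cong (_+ length L) (List.length-++ (core I)) ⟩
      length (core I) + length K + length L   ≡⟨ ℕ.+-assoc (length (core I)) _ _ ⟩
      length (core I) + (length K + length L) ≤⟨ ℕ.+-mono-≤ core≤ (ℕ.≤-trans le (ℕ.*-monoˡ-≤ m j≤)) ⟩
      n + suc D * m                           ∎))
      where open ℕ.≤-Reasoning

    module Use {K L} (ren : Renaming (core I ++ K) L Pool) where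
      open Renaming ren public
      open Rename rename injective public

      fix-core : Fixes rename (core I)
      fix-core w∈ = fixes (∈-++⁺ˡ w∈)

      fix-kept : ∀ {ws} → ws ⊆ K → Fixes rename ws
      fix-kept ws⊆ w∈ = fixes (∈-++⁺ʳ (core I) (ws⊆ w∈))

      small-val : ∀ u → GoodVal u → valWords u ⊆ L → SmallVal (renameVal u)
      small-val u g ws⊆ = good-rename I fix-core u g , λ w∈ →
        case ∈-map⁻ rename (subst (_ ∈_) (renameVal-words u) w∈) of λ { (w , w∈u , refl) → into (ws⊆ w∈u) }

      small-env : ∀ {E} → All (GoodVal ∘ proj₂) E → envWords E ⊆ L → All (SmallVal ∘ proj₂) (renameEnv E)
      small-env []       ws⊆ = []
      small-env {(_ , u) ∷ E} (g ∷ gs) ws⊆ = small-val u g (ws⊆ ∘ ∈-++⁺ˡ) ∷ small-env gs (ws⊆ ∘ ∈-++⁺ʳ (valWords u))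

    -- Witnesses are moved into the pool one quantifier at a time, with the environment collected so
    -- far kept fixed. Only the values on one branch have to be kept apart, not all the values in
    -- the body, and so `D` values suffice.
    small-holds : ∀ {E} φ → condWords φ ⊆ core I → All (SmallVal ∘ proj₂) E → length E + length (rawCond φ) ≤ D →
                  HoldsIn GoodVal E φ → HoldsIn SmallVal E φ
    small-holds (rel α)      _ _ _ h = h
    small-holds (idEq x α _) _ _ _ h = h
    small-holds (neq x t)    _ _ _ h = h
    small-holds {E} (φ ∧ ψ) ⊆core ss le (h , h′) =
      small-holds φ (⊆core ∘ ∈-++⁺ˡ) ss (ℕ.≤-trans (ℕ.+-monoʳ-≤ (length E) (ℕ.≤-trans (ℕ.m≤m+n _ _) lens)) le) h ,
      small-holds ψ (⊆core ∘ ∈-++⁺ʳ (condWords φ)) ss (ℕ.≤-trans (ℕ.+-monoʳ-≤ (length E) (ℕ.≤-trans (ℕ.m≤n+m _ (length (rawCond φ))) lens)) le) h′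
      where
      lens : length (rawCond φ) + length (rawCond ψ) ≤ length (rawCond (φ ∧ ψ))
      lens = ℕ.≤-trans (ℕ.≤-reflexive (sym (List.length-++ (rawCond φ)))) (ℕ.n≤1+n _)
    small-holds {E} (ex x φ) ⊆core ss le (u , g , h) =
      renameVal u , su ,
      small-holds φ ⊆core (su ∷ ss) (ℕ.≤-trans (ℕ.≤-reflexive (sym (ℕ.+-suc (length E) _))) le)
        (subst (λ E′ → HoldsIn GoodVal ((x , renameVal u) ∷ E′) φ) (renameEnv-fixed E (fix-kept λ w∈ → w∈))
          (holds-rename (good-rename I fix-core) φ (λ w∈ → fix-core (⊆core w∈)) h))
      where
      E≤ : length (envWords E) + length (valWords u) ≤ suc (length E) * m
      E≤ = ℕ.≤-trans (ℕ.+-mono-≤ (env-length (small-good ss)) (val-length u g)) (ℕ.≤-reflexive (ℕ.+-comm (length E * m) m))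
      open Use (intoPool (envWords E) (valWords u) {suc (length E)} (env-small ss) E≤
        (s≤s (ℕ.≤-trans (ℕ.m≤m+n _ _) le)))
      su : SmallVal (renameVal u)
      su = small-val u g (λ w∈ → w∈)

    m+m : ∀ {a b : ℕ} → a ≤ m → b ≤ m → a + b ≤ 2 * m
    m+m {b = b} a≤ b≤ = ℕ.+-mono-≤ a≤ (ℕ.≤-trans b≤ (ℕ.≤-reflexive (sym (ℕ.+-identityʳ m))))

    pair-length : ∀ {f g} → GoodFact f → GoodFact g → length (proj₂ f ++ proj₂ g) ≤ 2 * m
    pair-length {f} {g} gf gg = ℕ.≤-trans (ℕ.≤-reflexive (List.length-++ (proj₂ f))) (m+m (val-length (fid f) gf) (val-length (fid g) gg))

    keys-length : ∀ {E : Env} {xs} → map proj₁ E ≡ xs → length E ≡ length xs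
    keys-length {E} eq = trans (sym (List.length-map proj₁ E)) (cong length eq)

    budget : ∀ {f g E} → GoodFact f → GoodFact g → All (GoodVal ∘ proj₂) E → length E ≤ n →
             length (proj₂ f ++ proj₂ g) + length (envWords E) ≤ (2 + n) * m
    budget {f} {g} gf gg gs E≤ = ℕ.≤-trans (ℕ.+-mono-≤ (pair-length {f} {g} gf gg) (ℕ.≤-trans (env-length gs) (ℕ.*-monoˡ-≤ m E≤)))
      (ℕ.≤-reflexive (sym (ℕ.*-distribʳ-+ m 2 n)))

    2+n≤ : 2 + n ≤ suc D
    2+n≤ = ℕ.≤-trans (ℕ.+-monoʳ-≤ 2 (ℕ.m≤m+n n n)) (ℕ.n≤1+n D)

    small-conflict : ∀ {f h} → SmallVal (fid f) → SmallVal (fid h) → RawConflict GoodVal f h → RawConflict SmallVal f h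
    small-conflict {f} {h} sf sh record { κ = κ ; κ∈ = κ∈ ; env = E ; keys = ks ; good = gs ; violated = vs ; minimal = mi
                                        ; plainˡ = p ; plainʳ = q ; goodˡ = gf ; goodʳ = gh } = record
      { κ∈ = κ∈ ; env = renameEnv E ; keys = trans (renameEnv-keys E) ks ; good = small-env gs (λ w∈ → w∈)
      ; violated = constraint-envs (renameFact-fixed f (fix-kept ∈-++⁺ˡ)) (renameFact-fixed h (fix-kept (∈-++⁺ʳ (proj₂ f))))
                     (constraint-rename _ (fix-constraint I fix-core κ∈) vs)
      ; minimal = mi ; plainˡ = p ; plainʳ = q ; goodˡ = sf ; goodʳ = sh }
      where
      open Use (intoPool (proj₂ f ++ proj₂ h) (envWords E) {2 + n} (∈-++-⊆ (proj₂ sf) (proj₂ sh))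
        (budget {f} {h} gf gh gs (ℕ.≤-trans (ℕ.≤-reflexive (keys-length {E} ks)) (vars≤ κ∈))) 2+n≤)
      constraint-envs : ∀ {E f f′ h h′ K} → f′ ≡ f → h′ ≡ h → All (LitHolds E f′ h′) K → All (LitHolds E f h) K
      constraint-envs refl refl p = p

    edge-good : ∀ {f g} → RawEdge GoodVal f g → GoodFact f × GoodFact g
    edge-good record { either = e ; conflict = c } = gf , Sum.[ (λ { refl → gf }) , (λ { refl → RawConflict.goodʳ c }) ] e
      where gf = RawConflict.goodˡ c

    SmallFact : RFact → Set
    SmallFact f = SmallVal (fid f)

    rule-core : ∀ {r} → r ∈ rules I → condWords (Rule.body r) ⊆ core I
    rule-core r∈ w∈ = ∈-++⁺ʳ (concatMap (concatMap literalWords) 𝒯) (∈-concatMap (condWords ∘ Rule.body) r∈ w∈)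

    small-partner : ∀ {f g} → SmallFact f → SmallFact g → (e : RawEdge GoodVal f g) → SmallFact (RawEdge.partner e) → RawEdge SmallVal f g
    small-partner {f} {g} sf sg record { either = e ; conflict = c ; rule = r ; rule∈ = r∈ ; env = E ; keys = ks ; good = gs ; holds = hs } sh = record
      { either = e ; conflict = small-conflict sf sh c ; rule∈ = r∈ ; env = renameEnv E
      ; keys = trans (renameEnv-keys E) ks ; good = ss
      ; holds = small-holds (Rule.body r) (rule-core r∈) (sf ∷ sg ∷ ss) sized
          (subst₂-facts (renameFact-fixed f (fix-kept ∈-++⁺ˡ)) (renameFact-fixed g (fix-kept (∈-++⁺ʳ (proj₂ f))))
            (holds-rename (good-rename I fix-core) (Rule.body r) (fix-rule I fix-core r∈) hs)) }
      where
      E≤ : length E ≤ n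
      E≤ = ℕ.≤-trans (ℕ.≤-reflexive (keys-length {E} ks)) (body≤ r∈)
      open Use (intoPool (proj₂ f ++ proj₂ g) (envWords E) {2 + n} (∈-++-⊆ (proj₂ sf) (proj₂ sg)) (budget {f} {g} (proj₁ sf) (proj₁ sg) gs E≤) 2+n≤)
      ss : All (SmallVal ∘ proj₂) (renameEnv E)
      ss = small-env gs (λ w∈ → w∈)
      subst₂-facts : ∀ {f′ g′} → f′ ≡ f → g′ ≡ g →
                     HoldsIn GoodVal ((Rule.x₁ r , fid f′) ∷ (Rule.x₂ r , fid g′) ∷ renameEnv E) (Rule.body r) →
                     HoldsIn GoodVal ((Rule.x₁ r , fid f) ∷ (Rule.x₂ r , fid g) ∷ renameEnv E) (Rule.body r)
      subst₂-facts refl refl h = h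
      sized : 2 + length (renameEnv E) + length (rawCond (Rule.body r)) ≤ D
      sized = s≤s (s≤s (ℕ.+-mono-≤ (ℕ.≤-trans (ℕ.≤-reflexive (List.length-map (Product.map₂ renameVal) E)) E≤) (size≤ r∈)))

    3≤ : 3 ≤ suc D
    3≤ = s≤s (s≤s (s≤s z≤n))

    -- Both ends are kept and the partner is moved into the pool; afterwards the environments of the
    -- conflict and of the rule follow, each by a renaming of its own, as no other edge depends on
    -- them.
    small-edge : ∀ {f g} → SmallFact f → SmallFact g → RawEdge GoodVal f g → RawEdge SmallVal f g
    small-edge {f} {g} sf sg e = go (renameFact-fixed f (fix-kept ∈-++⁺ˡ)) (renameFact-fixed g (fix-kept (∈-++⁺ʳ (proj₂ f))))
        (edge-rename I fix-core e) (small-val (fid h) gh (λ w∈ → w∈))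
      where
      h = RawEdge.partner e
      gh : GoodFact h
      gh = RawConflict.goodʳ (RawEdge.conflict e)
      open Use (intoPool (proj₂ f ++ proj₂ g) (proj₂ h) {3} (∈-++-⊆ (proj₂ sf) (proj₂ sg))
        (ℕ.≤-trans (ℕ.+-mono-≤ (pair-length {f} {g} (proj₁ sf) (proj₁ sg)) (val-length (fid h) gh)) (ℕ.≤-reflexive (ℕ.+-comm (2 * m) m))) 3≤)
      go : ∀ {f′ g′} → f′ ≡ f → g′ ≡ g → (e′ : RawEdge GoodVal f′ g′) → SmallFact (RawEdge.partner e′) → RawEdge SmallVal f g
      go refl refl e′ = small-partner sf sg e′

    OnCycle : RFact → Set
    OnCycle f = ∃[ k ] Walk (RawEdge GoodVal) (suc k) f f

    CycleNode : Set
    CycleNode = ∃[ f ] SmallFact f × OnCycle f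

    SmallStep : RFact → RFact → Set
    SmallStep f g = SmallFact f × SmallFact g × RawEdge SmallVal f g

    -- The renaming keeps `f` and moves its successor into the pool. It is applied to the entire
    -- cycle, rotated to start at the successor, so that the new fact lies on a cycle again and the
    -- construction can be repeated forever.
    next : (s : CycleNode) → Σ CycleNode λ s′ → SmallStep (proj₁ s) (proj₁ s′)
    next (f , sf , k , _∷_ {g = b} e w) = (renameFact b , sb , cyc) , sf , sb , small-edge sf sb e′
      where
      open Use (intoPool (proj₂ f) (proj₂ b) {2} (proj₂ sf) (m+m (val-length (fid f) (proj₁ sf)) (val-length (fid b) (proj₂ (edge-good e)))) (s≤s (s≤s z≤n)))
      sb : SmallFact (renameFact b)
      sb = small-val (fid b) (proj₂ (edge-good e)) (λ w∈ → w∈)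
      cyc : OnCycle (renameFact b)
      cyc = k , subst (λ k → Walk (RawEdge GoodVal) k (renameFact b) (renameFact b)) (ℕ.+-comm k 1)
                  (walk-rename I fix-core (w ++ʷ (e ∷ [])))
      e′ : RawEdge GoodVal f (renameFact b)
      e′ = subst (λ f′ → RawEdge GoodVal f′ (renameFact b)) (renameFact-fixed f (fix-kept (λ w∈ → w∈))) (edge-rename I fix-core e)

    start : ∀ {k f} → Walk (RawEdge GoodVal) (suc k) f f → CycleNode
    start {k} {f} w@(e ∷ _) = renameFact f , small-val (fid f) (proj₁ (edge-good e)) (λ w∈ → w∈) , k , walk-rename I fix-core w
      where open Use (intoPool [] (proj₂ f) {1} (λ ()) (ℕ.≤-trans (val-length (fid f) (proj₁ (edge-good e))) (ℕ.≤-reflexive (sym (ℕ.+-identityʳ m)))) (s≤s z≤n))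

    wordLists : ℕ → List (List Word)
    wordLists zero    = [ [] ]
    wordLists (suc a) = concatMap (λ w → map (w ∷_) (wordLists a)) Pool

    wordLists-∈ : ∀ ws → ws ⊆ Pool → ws ∈ wordLists (length ws)
    wordLists-∈ []       _   = here refl
    wordLists-∈ (w ∷ ws) ws⊆ = ∈-concatMap (λ w → map (w ∷_) (wordLists (length ws))) (ws⊆ (here refl))
                                 (∈-map⁺ (w ∷_) (wordLists-∈ ws (ws⊆ ∘ there)))

    universe : List RFact
    universe = concatMap (λ (p , a) → map (p ,_) (wordLists a)) shapes

    universe-∈ : ∀ f → SmallFact f → f ∈ universe
    universe-∈ (p , ws) (g , ws⊆) = ∈-concatMap (λ (p , a) → map (p ,_) (wordLists a)) g (∈-map⁺ (p ,_) (wordLists-∈ ws ws⊆))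

    record SmallCycle : Set where
      field
        {f g}  : RFact
        first  : SmallStep f g
        {rest} : ℕ
        rest≤  : rest ≤ length universe
        walk   : Walk SmallStep rest g f

    -- Repeated renaming gives an endless walk through small facts which need not return to its
    -- start. Among one more nodes than there are small facts two coincide, and the walk between
    -- them closes up.
    short-cycle : ∀ {k f} → Walk (RawEdge GoodVal) (suc k) f f → SmallCycle
    short-cycle w = close (Fin.pigeonhole (ℕ.n<1+n (length universe)) (λ i → Any.index (node-∈ (Fin.toℕ i))))
      where
      state : ℕ → CycleNode
      state zero    = start w
      state (suc i) = proj₁ (next (state i))

      node : ℕ → RFact
      node i = proj₁ (state i)

      node-∈ : ∀ i → node i ∈ universe
      node-∈ i = universe-∈ (node i) (proj₁ (proj₂ (state i)))

      segment : ∀ d i → Walk SmallStep d (node i) (node (d + i))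
      segment zero    i = []
      segment (suc d) i = proj₂ (next (state i)) ∷
        subst (λ j → Walk SmallStep d (node (suc i)) (node j)) (ℕ.+-suc d i) (segment d (suc i))

      index-injective : ∀ {xs} {f g : RFact} (f∈ : f ∈ xs) (g∈ : g ∈ xs) → Any.index f∈ ≡ Any.index g∈ → f ≡ g
      index-injective (here refl) (here refl) _  = refl
      index-injective (there f∈)  (there g∈)  eq = index-injective f∈ g∈ (Fin.suc-injective eq)

      close : (∃₂ λ (i j : Fin (suc (length universe))) → i Fin.< j × Any.index (node-∈ (Fin.toℕ i)) ≡ Any.index (node-∈ (Fin.toℕ j))) → SmallCycle
      close (i , j , i<j , eq) = record
        { first = proj₂ (next (state i′))
        ; rest≤ = ℕ.≤-trans (ℕ.m∸n≤m j′ (suc i′)) (ℕ.≤-pred (Fin.toℕ<n j))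
        ; walk = subst (Walk SmallStep (j′ ∸ suc i′) (node (suc i′))) closed (segment (j′ ∸ suc i′) (suc i′)) }
        where
        i′ = Fin.toℕ i
        j′ = Fin.toℕ j
        closed : node (j′ ∸ suc i′ + suc i′) ≡ node i′
        closed = trans (cong node (ℕ.m∸n+n≡m i<j)) (sym (index-injective (node-∈ i′) (node-∈ j′) eq))

  -- Sizes

  length-encs-++ : ∀ {X} (c : Code X) xs ys → length (encs c (xs ++ ys)) ≡ length (encs c xs) + length (encs c ys)
  length-encs-++ c xs ys = trans (cong length (encs-++ c xs ys)) (List.length-++ (encs c xs))

  module _ {A Y : Set} (d : Code Y) (f : A → List Y) (s : A → Letters)
           (f≤s : ∀ a → length (encs d (f a)) ≤ length (s a)) where

    -- Constants, variables and predicates are all counted in this way: whatever is extracted from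
    -- an object is spelled out, at disjoint places, in its encoding.
    concatMap-fits : ∀ as → length (encs d (concatMap f as)) ≤ length (concatMap s as)
    concatMap-fits []       = z≤n
    concatMap-fits (a ∷ as) = begin
      length (encs d (f a ++ concatMap f as))                 ≡⟨ length-encs-++ d (f a) _ ⟩
      length (encs d (f a)) + length (encs d (concatMap f as)) ≤⟨ ℕ.+-mono-≤ (f≤s a) (concatMap-fits as) ⟩
      length (s a) + length (concatMap s as)                  ≡⟨ List.length-++ (s a) ⟨
      length (s a ++ concatMap s as)                          ∎
      where open ℕ.≤-Reasoning

    encodeList-fits : ∀ as → length (encs d (concatMap f as)) ≤ length (encodeList s as)
    encodeList-fits as = ℕ.≤-trans (concatMap-fits as) (inner≤encodeList s as)
      where
      inner≤encodeList : ∀ (s : A → Letters) as → length (concatMap s as) ≤ length (encodeList s as)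
      inner≤encodeList s as = ℕ.≤-trans (fitˡ (concatMap s as) [ › ] ℕ.≤-refl) (ℕ.n≤1+n _)

  encodeList-∈ : ∀ {A : Set} (s : A → Letters) {a as} → a ∈ as → length (s a) ≤ length (encodeList s as)
  encodeList-∈ s {as = as} a∈ = ℕ.≤-trans (concatMap-∈ a∈) (ℕ.≤-trans (fitˡ (concatMap s as) [ › ] ℕ.≤-refl) (ℕ.n≤1+n _))
    where
    concatMap-∈ : ∀ {a as} → a ∈ as → length (s a) ≤ length (concatMap s as)
    concatMap-∈ {a} (here refl)         = fitˡ (s a) _ ℕ.≤-refl
    concatMap-∈ {as = b ∷ _} (there a∈) = ℕ.≤-trans (concatMap-∈ a∈) (fitʳ (s b) _ ℕ.≤-refl)

  encodeWord-length : ∀ w → length (encs wordC [ w ]) ≡ length (encodeWord w)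
  encodeWord-length w = cong length (trans (List.++-identityʳ _) (sym (encodeWord-enc w)))

  ++-fits : ∀ {X} (c : Code X) {xs ys} {u w : Letters} → length (encs c xs) ≤ length u → length (encs c ys) ≤ length w →
            length (encs c (xs ++ ys)) ≤ length (u ++ w)
  ++-fits c {xs} {ys} {u} xs≤ ys≤ = ℕ.≤-trans (ℕ.≤-reflexive (length-encs-++ c xs ys))
    (ℕ.≤-trans (ℕ.+-mono-≤ xs≤ ys≤) (ℕ.≤-reflexive (sym (List.length-++ u))))

  atom-fits : ∀ {Y : Set} (d : Code Y) (f : Term → List Y) → (∀ t → length (encs d (f t)) ≤ length (encodeTerm t)) →
              ∀ (α : Atom Term) → length (encs d (concatMap f (Vec.toList (args α)))) ≤ length (encodeAtom α)
  atom-fits d f f≤ (P · ts) = ℕ.≤-trans (encodeList-fits d f encodeTerm f≤ (Vec.toList ts)) (fitʳ (encodePred P) _ ℕ.≤-refl)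

  wordsOf : Term → List Word
  wordsOf = termWords ∘ rawTerm

  wordsOf≤ : ∀ t → length (encs wordC (wordsOf t)) ≤ length (encodeTerm t)
  wordsOf≤ (var x)         = z≤n
  wordsOf≤ (con (ident w)) = ℕ.≤-trans (ℕ.≤-reflexive (encodeWord-length w)) (ℕ.≤-trans (ℕ.n≤1+n _) (ℕ.n≤1+n _))
  wordsOf≤ (con (value w)) = ℕ.≤-trans (ℕ.≤-reflexive (encodeWord-length w)) (ℕ.≤-trans (ℕ.n≤1+n _) (ℕ.n≤1+n _))

  atomWords≤ : ∀ α → length (encs wordC (concatMap termWords (proj₂ (rawAtom α)))) ≤ length (encodeAtom α)
  atomWords≤ (P · ts) = subst (λ ws → length (encs wordC ws) ≤ length (encodeAtom (P · ts)))
    (sym (List.concatMap-map termWords rawTerm (Vec.toList ts))) (atom-fits wordC wordsOf wordsOf≤ (P · ts))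

  literalWords≤ : ∀ l → length (encs wordC (literalWords (rawLiteral l))) ≤ length (encodeLiteral l)
  literalWords≤ (rel α)   = ℕ.≤-trans (atomWords≤ α) (ℕ.n≤1+n _)
  literalWords≤ (neq s t) = ℕ.≤-trans (++-fits wordC {wordsOf s} {wordsOf t} {encodeTerm s} (wordsOf≤ s) (wordsOf≤ t)) (ℕ.n≤1+n _)

  1+ : ∀ {a b} → a ≤ b → a ≤ suc b
  1+ = ℕ.m≤n⇒m≤1+n

  condWords≤ : ∀ φ → length (encs wordC (condWords φ)) ≤ length (encodeCond φ)
  condWords≤ (rel α)      = 1+ (1+ (atomWords≤ α))
  condWords≤ (idEq x α _) = 1+ (1+ (ℕ.≤-trans (atomWords≤ α) (fitʳ (encodeWord x) _ ℕ.≤-refl)))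
  condWords≤ (neq x t)    = 1+ (1+ (ℕ.≤-trans (wordsOf≤ t) (fitʳ (encodeWord x) _ ℕ.≤-refl)))
  condWords≤ (φ ∧ ψ)      = 1+ (1+ (1+ (++-fits wordC {condWords φ} {condWords ψ} {encodeCond φ} (condWords≤ φ) (condWords≤ ψ))))
  condWords≤ (ex x φ)     = 1+ (1+ (1+ (ℕ.≤-trans (condWords≤ φ) (fitʳ (encodeWord x) _ ℕ.≤-refl))))

  termVars≤ : ∀ t → length (encs wordC (termVars t)) ≤ length (encodeTerm t)
  termVars≤ (var x) = 1+ (ℕ.≤-reflexive (encodeWord-length x))
  termVars≤ (con _) = z≤n

  literalVars≤ : ∀ l → length (encs wordC (literalVars l)) ≤ length (encodeLiteral l)
  literalVars≤ (rel (P · ts)) = 1+ (atom-fits wordC termVars termVars≤ (P · ts))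
  literalVars≤ (neq s t) = 1+ (++-fits wordC {termVars s} {termVars t} {encodeTerm s} (termVars≤ s) (termVars≤ t))

  constraintVars≤ : ∀ κ → length (encs wordC (constraintVars κ)) ≤ length (encodeList encodeLiteral κ)
  constraintVars≤ = encodeList-fits wordC literalVars encodeLiteral literalVars≤

  condVars≤ : ∀ φ → length (encs wordC (condVars φ)) ≤ length (encodeCond φ)
  condVars≤ (rel (P · ts))      = 1+ (1+ (atom-fits wordC termVars termVars≤ (P · ts)))
  condVars≤ (idEq x (P · ts) _) = 1+ (1+ (++-fits wordC {[ x ]} {argVars ts} {encodeWord x}
    (ℕ.≤-reflexive (encodeWord-length x)) (atom-fits wordC termVars termVars≤ (P · ts))))
  condVars≤ (neq x t)           = 1+ (1+ (++-fits wordC {[ x ]} {termVars t} {encodeWord x} (ℕ.≤-reflexive (encodeWord-length x)) (termVars≤ t)))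
  condVars≤ (φ ∧ ψ)             = 1+ (1+ (1+ (++-fits wordC {condVars φ} {condVars ψ} {encodeCond φ} (condVars≤ φ) (condVars≤ ψ))))
  condVars≤ (ex x φ)            = 1+ (1+ (1+ (ℕ.≤-trans (condVars≤ φ) (fitʳ (encodeWord x) _ ℕ.≤-refl))))

  predC≤ : ∀ α → length (encs predC [ rawPred (pred α) ]) ≤ length (encodeAtom α)
  predC≤ (P · ts) = ℕ.≤-trans (ℕ.≤-reflexive (cong length (trans (List.++-identityʳ _) (sym (encodePred-enc P)))))
    (fitˡ (encodePred P) _ ℕ.≤-refl)

  constraintPreds≤ : ∀ κ → length (encs predC (map rawPred (map pred (relationalAtoms κ)))) ≤ length (concatMap encodeLiteral κ)
  constraintPreds≤ []            = z≤n
  constraintPreds≤ (rel α ∷ κ)   = ++-fits predC {[ rawPred (pred α) ]} {map rawPred (map pred (relationalAtoms κ))} {encodeLiteral (rel α)} (1+ (predC≤ α)) (constraintPreds≤ κ)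
  constraintPreds≤ (neq s t ∷ κ) = ℕ.≤-trans (constraintPreds≤ κ) (fitʳ (encodeLiteral (neq s t)) _ ℕ.≤-refl)

  condPreds≤ : ∀ φ → length (encs predC (map rawPred (predsCond φ))) ≤ length (encodeCond φ)
  condPreds≤ (rel α)      = 1+ (1+ (predC≤ α))
  condPreds≤ (idEq x α _) = 1+ (1+ (ℕ.≤-trans (predC≤ α) (fitʳ (encodeWord x) _ ℕ.≤-refl)))
  condPreds≤ (neq x t)    = z≤n
  condPreds≤ (φ ∧ ψ)      = 1+ (1+ (1+ (subst (λ ps → length (encs predC ps) ≤ length (encodeCond φ ++ encodeCond ψ))
    (sym (List.map-++ rawPred (predsCond φ) (predsCond ψ))) (++-fits predC {map rawPred (predsCond φ)} {map rawPred (predsCond ψ)} {encodeCond φ} (condPreds≤ φ) (condPreds≤ ψ)))))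
  condPreds≤ (ex x φ)     = 1+ (1+ (1+ (ℕ.≤-trans (condPreds≤ φ) (fitʳ (encodeWord x) _ ℕ.≤-refl))))

  rule-body≤ : ∀ r → length (encodeCond (Rule.body r)) ≤ length (encodeRule r)
  rule-body≤ r = ℕ.≤-trans (fitʳ (encodeWord x₂) _ ℕ.≤-refl) (fitʳ (encodeWord x₁) _ ℕ.≤-refl)
    where open Rule r

  module InputSizes (I : Instance) where

    n : ℕ
    n = length (encode I)

    theory≤ : length (encodeList (encodeList encodeLiteral) (theory I)) ≤ n
    theory≤ = fitˡ (encodeList (encodeList encodeLiteral) (theory I)) _ ℕ.≤-refl

    rules≤ : length (encodeList encodeRule (rules I)) ≤ n
    rules≤ = fitʳ (encodeList (encodeList encodeLiteral) (theory I)) _ ℕ.≤-refl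

    core-fits : length (encs wordC (core I)) ≤ n
    core-fits = ++-fits wordC {concatMap (concatMap literalWords) (map rawConstraint (theory I))} {concatMap ruleWords (rules I)}
        {encodeList (encodeList encodeLiteral) (theory I)}
      (subst (λ ws → length (encs wordC ws) ≤ length (encodeList (encodeList encodeLiteral) (theory I)))
        (sym (List.concatMap-map (concatMap literalWords) rawConstraint (theory I)))
        (encodeList-fits wordC (concatMap literalWords ∘ rawConstraint) (encodeList encodeLiteral) (λ κ →
          subst (λ ws → length (encs wordC ws) ≤ length (encodeList encodeLiteral κ)) (sym (List.concatMap-map literalWords rawLiteral κ))
            (encodeList-fits wordC (literalWords ∘ rawLiteral) encodeLiteral literalWords≤ κ)) (theory I)))
      (encodeList-fits wordC ruleWords encodeRule (λ r → ℕ.≤-trans (condWords≤ (Rule.body r)) (rule-body≤ r)) (rules I))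
      where
      ruleWords : Rule → List Word
      ruleWords r = condWords (Rule.body r)

    core≤ : length (core I) ≤ n
    core≤ = ℕ.≤-trans (length≤encs wordC (core I)) core-fits

    constraintVars-fit : ∀ {κ} → κ ∈ theory I → length (encs wordC (constraintVars κ)) ≤ n
    constraintVars-fit {κ} κ∈ = ℕ.≤-trans (constraintVars≤ κ) (ℕ.≤-trans (encodeList-∈ (encodeList encodeLiteral) κ∈) theory≤)

    rule≤ : ∀ {r} → r ∈ rules I → length (encodeRule r) ≤ n
    rule≤ r∈ = ℕ.≤-trans (encodeList-∈ encodeRule r∈) rules≤

    condVars-fit : ∀ {r} → r ∈ rules I → length (encs wordC (condVars (Rule.body r))) ≤ n
    condVars-fit {r} r∈ = ℕ.≤-trans (condVars≤ (Rule.body r)) (ℕ.≤-trans (rule-body≤ r) (rule≤ r∈))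

    preds-fit : length (encs predC (map rawPred (preds I))) ≤ n
    preds-fit = subst (λ ps → length (encs predC ps) ≤ n) (sym (trans (List.map-++ rawPred (concatMap (map pred ∘ relationalAtoms) (theory I)) _)
        (cong₂ _++_ (List.map-concatMap rawPred (map pred ∘ relationalAtoms) (theory I)) (List.map-concatMap rawPred (predsCond ∘ Rule.body) (rules I)))))
      (++-fits predC {concatMap inTheory (theory I)} {concatMap inRule (rules I)} {encodeList (encodeList encodeLiteral) (theory I)}
        (encodeList-fits predC inTheory (encodeList encodeLiteral) (λ κ → ℕ.≤-trans (constraintPreds≤ κ)
          (ℕ.≤-trans (fitˡ (concatMap encodeLiteral κ) [ › ] ℕ.≤-refl) (ℕ.n≤1+n _))) (theory I))
        (encodeList-fits predC inRule encodeRule (λ r → ℕ.≤-trans (condPreds≤ (Rule.body r)) (rule-body≤ r)) (rules I)))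
      where
      inTheory : DenialConstraint → List RPred
      inTheory κ = map rawPred (map pred (relationalAtoms κ))
      inRule : Rule → List RPred
      inRule r = map rawPred (predsCond (Rule.body r))

    input≤ : length (inputOf (rawTheory (theory I)) (rawRules (rules I))) ≤ n
    input≤ = ℕ.≤-reflexive (cong length (sym (encode-enc I)))

    rawRules≤ : length (encs chunkC (rawRules (rules I))) ≤ n
    rawRules≤ = fitˡ (encs chunkC (rawRules (rules I))) _ (ℕ.<⇒≤ (fitʳ (enc (listC constraintC) (rawTheory (theory I))) _ input≤))

    size≤ : ∀ {r} → r ∈ rules I → length (rawCond (Rule.body r)) ≤ n
    size≤ {r} r∈ = ℕ.≤-trans (length≤encs chunkC (rawCond (Rule.body r))) (rule-fits r∈ rawRules≤)

    vars≤ : ∀ {κ} → κ ∈ theory I → length (constraintVars κ) ≤ n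
    vars≤ {κ} κ∈ = ℕ.≤-trans (length≤encs wordC (constraintVars κ)) (constraintVars-fit κ∈)

    body≤ : ∀ {r} → r ∈ rules I → length (condVars (Rule.body r)) ≤ n
    body≤ {r} r∈ = ℕ.≤-trans (length≤encs wordC (condVars (Rule.body r))) (condVars-fit r∈)

    rule-vars≤ : ∀ {r} → r ∈ rules I → length (enc wordC (Rule.x₁ r)) ≤ n × length (enc wordC (Rule.x₂ r)) ≤ n
    rule-vars≤ {r} r∈ = subst (λ w → length w ≤ n) (encodeWord-enc x₁) (fitˡ (encodeWord x₁) _ (rule≤ r∈)) ,
                        subst (λ w → length w ≤ n) (encodeWord-enc x₂) (fitˡ (encodeWord x₂) _ (fitʳ (encodeWord x₁) _ (rule≤ r∈)))
      where open Rule r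

  module _ {X : Set} (c : Code X) where

    encs-bound : ∀ {b xs} → All (λ x → length (enc c x) ≤ b) xs → length (encs c xs) ≤ length xs * b
    encs-bound []       = z≤n
    encs-bound {xs = x ∷ xs} (p ∷ ps) = ℕ.≤-trans (ℕ.≤-reflexive (List.length-++ (enc c x))) (ℕ.+-mono-≤ p (encs-bound ps))

    suffix-fits : ∀ {b} xs ys → length (encs c (xs ++ ys)) ≤ b → length (encs c ys) ≤ b
    suffix-fits xs ys le = fitʳ (encs c xs) (encs c ys) (subst (λ w → length w ≤ _) (encs-++ c xs ys) le)

    list-length : ∀ xs → length (enc (listC c) xs) ≡ 2 + length (encs c xs)
    list-length xs = cong suc (trans (List.length-++ (encs c xs)) (ℕ.+-comm _ 1))

  word-length : ∀ w → length (enc wordC w) ≡ 2 + length w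
  word-length w = trans (list-length bitC w) (cong (2 +_) (bits-length w))
    where
    bits-length : ∀ w → length (encs bitC w) ≡ length w
    bits-length []          = refl
    bits-length (false ∷ w) = cong suc (bits-length w)
    bits-length (true ∷ w)  = cong suc (bits-length w)

  concatMap-length : ∀ {A B : Set} (f : A → List B) {b xs} → (∀ {x} → x ∈ xs → length (f x) ≤ b) →
                     length (concatMap f xs) ≤ length xs * b
  concatMap-length f {xs = []}     f≤ = z≤n
  concatMap-length f {xs = x ∷ xs} f≤ = ℕ.≤-trans (ℕ.≤-reflexive (List.length-++ (f x)))
    (ℕ.+-mono-≤ (f≤ (here refl)) (concatMap-length f (f≤ ∘ there)))

  -- Bounds for inputs of length n and arities up to m: on the number of entries
  -- of an environment, the number of available constants, the lengths of the
  -- codes of constants, values, entries, environments and stacks of these, and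
  -- the number of facts.
  module Bounds (m n : ℕ) where

    envs pool names vals slot env tower tuples bound : ℕ
    envs   = 2 + (n + n)
    pool   = n + suc (n + suc envs * m)
    names  = pool + 2
    -- A fact consists of its predicate, of length at most `n`, two brackets, and at most `m`
    -- arguments, each with one tag. This also covers a constant, since `m` is positive where the
    -- bound is applied.
    vals   = n + (2 + m * suc names)
    slot   = n + vals
    env    = 2 + envs * slot
    tower  = suc n * env
    tuples = n * pool ^ m
    bound  = n + (vals + (tower + tuples))

    n≤ : n ≤ bound
    n≤ = ℕ.m≤m+n n _

    vals≤ : vals ≤ bound
    vals≤ = ℕ.≤-trans (ℕ.m≤m+n vals _) (ℕ.m≤n+m _ n)

    tower≤ : tower ≤ bound
    tower≤ = ℕ.≤-trans (ℕ.m≤m+n tower tuples) (ℕ.≤-trans (ℕ.m≤n+m _ vals) (ℕ.m≤n+m _ n))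

    tuples≤ : tuples ≤ bound
    tuples≤ = ℕ.≤-trans (ℕ.m≤n+m tuples tower) (ℕ.≤-trans (ℕ.m≤n+m _ vals) (ℕ.m≤n+m _ n))

    env≤ : env ≤ tower
    env≤ = ℕ.m≤m+n env _

  poly-bound : ∀ m → PolyBounded (Bounds.bound m)
  poly-bound m = poly-+ poly-id (poly-+ vals (poly-+ tower tuples))
    where
    envs  = poly-+ (poly-const 2) (poly-+ poly-id poly-id)
    pool  = poly-+ poly-id (poly-suc (poly-+ poly-id (poly-* (poly-suc envs) (poly-const m))))
    names = poly-+ pool (poly-const 2)
    vals  = poly-+ poly-id (poly-+ (poly-const 2) (poly-* (poly-const m) (poly-suc names)))
    slot  = poly-+ poly-id vals
    env   = poly-+ (poly-const 2) (poly-* envs slot)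
    tower = poly-* (poly-suc poly-id) env
    tuples = poly-* poly-id (poly-^ m pool)

  module Fit (I : Instance) (k : ℕ) (arities : All (λ P → arity P ≤ k) (preds I)) where

    open RawEdges I
    open InputSizes I

    -- Positive whatever the arities are, because a value that is a constant contributes one word.
    m : ℕ
    m = suc k

    open Bounds m n

    arity≤ : ∀ {p a} → (p , a) ∈ shapes → a ≤ m
    arity≤ pa∈ with ∈-map⁻ (λ P → rawPred P , arity P) pa∈
    ... | P , P∈ , refl = ℕ.m≤n⇒m≤1+n (All.lookup arities P∈)

    open Shrink I n m (s≤s z≤n) core≤ arity≤ vars≤ body≤ size≤

    pred≤ : ∀ {p a} → (p , a) ∈ shapes → length (enc predC p) ≤ n
    pred≤ pa∈ with ∈-map⁻ (λ P → rawPred P , arity P) pa∈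
    ... | P , P∈ , refl = encs-∈-fit predC (∈-map⁺ rawPred P∈) preds-fit

    shapes≤ : length shapes ≤ n
    shapes≤ = ℕ.≤-trans (ℕ.≤-reflexive (trans (List.length-map _ (preds I)) (sym (List.length-map rawPred (preds I)))))
      (ℕ.≤-trans (length≤encs predC (map rawPred (preds I))) preds-fit)

    word≤ : ∀ {w} → w ∈ Pool → length (enc wordC w) ≤ names
    word≤ {w} w∈ = ℕ.≤-trans (ℕ.≤-reflexive (trans (word-length w) (ℕ.+-comm 2 (length w)))) (ℕ.+-monoˡ-≤ 2 (go (∈-++⁻ (core I) w∈)))
      where
      go : w ∈ core I ⊎ w ∈ freshWords F → length w ≤ pool
      go (inj₁ w∈) = ℕ.≤-trans (enc-fit-word w) (ℕ.≤-trans (encs-∈-fit wordC w∈ core-fits) (ℕ.m≤m+n n _))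
      go (inj₂ w∈) with ∈-map⁻ unary w∈
      ... | i , i∈ , refl = ℕ.≤-trans (ℕ.≤-reflexive (List.length-replicate i)) (ℕ.≤-trans (ℕ.<⇒≤ (∈-upTo⁻ i∈)) (ℕ.m≤n+m F n))

    val≤ : ∀ u → SmallVal u → length (enc valC u) ≤ vals
    val≤ (inj₁ (idn w)) (_ , ⊆P) = ℕ.≤-trans (s≤s (word≤ (⊆P (here refl)))) one≤
      where
      one≤ : suc names ≤ vals
      one≤ = ℕ.≤-trans (ℕ.m≤m+n (suc names) _) (ℕ.≤-trans (ℕ.m≤n+m _ 2) (ℕ.m≤n+m _ n))
    val≤ (val w) (_ , ⊆P) = ℕ.≤-trans (s≤s (word≤ (⊆P (here refl)))) one≤
      where
      one≤ : suc names ≤ vals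
      one≤ = ℕ.≤-trans (ℕ.m≤m+n (suc names) _) (ℕ.≤-trans (ℕ.m≤n+m _ 2) (ℕ.m≤n+m _ n))
    val≤ (fid (p , ws)) (good , ⊆P) = ℕ.≤-trans (ℕ.≤-reflexive (List.length-++ (enc predC p)))
      (ℕ.+-mono-≤ (pred≤ good) (ℕ.≤-trans (ℕ.≤-reflexive (list-length argC ws)) (ℕ.+-monoʳ-≤ 2
        (ℕ.≤-trans (encs-bound argC (All.tabulate λ w∈ → s≤s (word≤ (⊆P w∈)))) (ℕ.*-monoˡ-≤ _ (arity≤ good))))))

    fact≤ : ∀ {f} → SmallFact f → length (enc factC f) ≤ vals
    fact≤ {f} sf = val≤ (fid f) sf

    EntryFits : Var × RVal → Set
    EntryFits e = length (enc entryC e) ≤ slot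

    slot≤ : ∀ {x u} → length (enc wordC x) ≤ n → SmallVal u → EntryFits (x , u)
    slot≤ {x} {u} x≤ su = ℕ.≤-trans (ℕ.≤-reflexive (List.length-++ (enc wordC x))) (ℕ.+-mono-≤ x≤ (val≤ u su))

    entries≤ : ∀ {E : Env} {xs} → map proj₁ E ≡ xs → length (encs wordC xs) ≤ n → All (SmallVal ∘ proj₂) E → All EntryFits E
    entries≤ {E} refl xs≤ ss = All.tabulate λ {e} e∈ → slot≤ {proj₁ e} {proj₂ e}
      (encs-∈-fit wordC (∈-map⁺ proj₁ e∈) xs≤) (All.lookup ss e∈)

    env-fits : ∀ {E} → All EntryFits E → length E ≤ D → length (enc envC E) ≤ env
    env-fits {E} es E≤ = ℕ.≤-trans (ℕ.≤-reflexive (list-length entryC E)) (ℕ.+-monoʳ-≤ 2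
      (ℕ.≤-trans (encs-bound entryC es) (ℕ.*-monoˡ-≤ slot E≤)))

    tower-fits : ∀ {𝐄} → All (λ E → length (enc envC E) ≤ env) 𝐄 → length 𝐄 ≤ suc n → length (encs envC 𝐄) ≤ bound
    tower-fits es 𝐄≤ = ℕ.≤-trans (encs-bound envC es) (ℕ.≤-trans (ℕ.*-monoˡ-≤ env 𝐄≤) tower≤)

    -- The stack never outgrows what remains to be executed of the condition.
    exec-within : ∀ φ {C E 𝐄 j} → length (encs chunkC (rawCond φ ++ C)) ≤ n →
                  All EntryFits E → length E + length (rawCond φ) ≤ D →
                  All (λ E → length (enc envC E) ≤ env) 𝐄 → length 𝐄 + length (rawCond φ) ≤ n →
                  HoldsIn SmallVal E φ → ExecWithin bound j (C , 𝐄) →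
                  ExecWithin bound (length (rawCond φ) + j) (rawCond φ ++ C , E ∷ 𝐄)
    exec-within φ {C} {E} {𝐄} {j} C≤ es E≤ 𝐄s 𝐄≤ = go φ C≤ E≤ 𝐄≤
      where
      E∷𝐄≤ : length (encs envC (E ∷ 𝐄)) ≤ bound
      E∷𝐄≤ = tower-fits {E ∷ 𝐄} (env-fits es (ℕ.≤-trans (ℕ.m≤m+n _ _) E≤) ∷ 𝐄s) (s≤s (ℕ.≤-trans (ℕ.m≤m+n _ _) 𝐄≤))
      stepped : ∀ {C q j} → length (encs chunkC C) ≤ n → Step (C , E ∷ 𝐄) q → ExecWithin bound j q → ExecWithin bound (suc j) (C , E ∷ 𝐄)
      stepped C≤ = step (ℕ.≤-trans C≤ n≤) E∷𝐄≤
      go : ∀ φ → length (encs chunkC (rawCond φ ++ C)) ≤ n → length E + length (rawCond φ) ≤ D → length 𝐄 + length (rawCond φ) ≤ n →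
           HoldsIn SmallVal E φ → ExecWithin bound j (C , 𝐄) → ExecWithin bound (length (rawCond φ) + j) (rawCond φ ++ C , E ∷ 𝐄)
      go (rel α)      C≤ _ _ h r = stepped C≤ (onLeaf h) r
      go (idEq x α _) C≤ _ _ h r = stepped C≤ (onLeaf h) r
      go (neq x t)    C≤ _ _ h r = stepped C≤ (onLeaf h) r
      go (φ ∧ ψ) C≤ E≤ 𝐄≤ (h , h′) r = stepped C≤ onAnd
        (subst₂ (λ l L → ExecWithin bound l (L , E ∷ E ∷ 𝐄))
          (trans (sym (ℕ.+-assoc (length (rawCond φ)) _ j)) (cong (_+ j) (sym lens)))
          (sym (List.++-assoc (rawCond φ) (rawCond ψ) C))
          (exec-within φ C″≤ es
            (ℕ.≤-trans (ℕ.+-monoʳ-≤ (length E) (ℕ.≤-trans φ≤ (ℕ.n≤1+n _))) E≤)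
            (env-fits es (ℕ.≤-trans (ℕ.m≤m+n _ _) E≤) ∷ 𝐄s)
            (ℕ.≤-trans (ℕ.≤-reflexive (sym (ℕ.+-suc (length 𝐄) _))) (ℕ.≤-trans (ℕ.+-monoʳ-≤ (length 𝐄) (s≤s φ≤)) 𝐄≤)) h
            (exec-within ψ (suffix-fits chunkC (rawCond φ) (rawCond ψ ++ C) C″≤) es
              (ℕ.≤-trans (ℕ.+-monoʳ-≤ (length E) (ℕ.≤-trans ψ≤ (ℕ.n≤1+n _))) E≤) 𝐄s
              (ℕ.≤-trans (ℕ.+-monoʳ-≤ (length 𝐄) (ℕ.≤-trans ψ≤ (ℕ.n≤1+n _))) 𝐄≤) h′ r)))
        where
        lens : length (rawCond φ ++ rawCond ψ) ≡ length (rawCond φ) + length (rawCond ψ)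
        lens = List.length-++ (rawCond φ)
        φ≤ : length (rawCond φ) ≤ length (rawCond φ ++ rawCond ψ)
        φ≤ = ℕ.≤-trans (ℕ.m≤m+n _ _) (ℕ.≤-reflexive (sym lens))
        ψ≤ : length (rawCond ψ) ≤ length (rawCond φ ++ rawCond ψ)
        ψ≤ = ℕ.≤-trans (ℕ.m≤n+m _ (length (rawCond φ))) (ℕ.≤-reflexive (sym lens))
        C″≤ : length (encs chunkC (rawCond φ ++ rawCond ψ ++ C)) ≤ n
        C″≤ = subst (λ L → length (encs chunkC L) ≤ n) (List.++-assoc (rawCond φ) (rawCond ψ) C)
          (suffix-fits chunkC [ and ] ((rawCond φ ++ rawCond ψ) ++ C) C≤)
      go (ex x φ) C≤ E≤ 𝐄≤ (u , su , h) r = stepped C≤ (onEx u)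
        (exec-within φ (suffix-fits chunkC [ exq x ] (rawCond φ ++ C) C≤)
          (slot≤ {x} {u} (ℕ.≤-trans (ℕ.m≤n⇒m≤1+n (ℕ.m≤n⇒m≤1+n (ℕ.n≤1+n _))) (fitˡ (enc chunkC (exq x)) (encs chunkC (rawCond φ ++ C)) C≤)) su ∷ es)
          (ℕ.≤-trans (ℕ.≤-reflexive (sym (ℕ.+-suc (length E) _))) E≤) 𝐄s
          (ℕ.≤-trans (ℕ.+-monoʳ-≤ (length 𝐄) (ℕ.n≤1+n _)) 𝐄≤) h r)

    rule-split : ∀ {r rs} → r ∈ rs → ∃₂ λ before C → rawRules rs ≡ before ++ header (Rule.x₁ r) (Rule.x₂ r) ∷ rawCond (Rule.body r) ++ C
    rule-split {r} {_ ∷ rs} (here refl) = [] , rawRules rs , refl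
    rule-split {rs = s ∷ _} (there r∈) with rule-split r∈
    ... | before , C , eq = rawRule s ++ before , C , trans (cong (rawRule s ++_) eq) (sym (List.++-assoc (rawRule s) before _))

    short : ∀ {x : ℕ} → x ≤ n → x ≤ D
    short x≤ = ℕ.≤-trans x≤ (ℕ.≤-trans (ℕ.m≤m+n n n) (ℕ.m≤n+m _ 2))

    prefers-within : ∀ {f g r} E → r ∈ rules I → SmallFact f → SmallFact g →
                     map proj₁ E ≡ condVars (Rule.body r) → All (SmallVal ∘ proj₂) E →
                     HoldsIn SmallVal ((Rule.x₁ r , fid f) ∷ (Rule.x₂ r , fid g) ∷ E) (Rule.body r) →
                     PrefersWithin bound (rawRules (rules I)) f g
    prefers-within {f} {g} {r} E r∈ sf sg ks ss h = let before , C , eq = rule-split r∈ in record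
      { rule = eq ; env = E ; steps≤ = ℕ.≤-trans (ℕ.≤-reflexive (ℕ.+-identityʳ _)) (ℕ.≤-trans (size≤ r∈) n≤)
      ; start≤ = tower-fits {E₀ ∷ []} (env-fits es (ℕ.≤-trans (ℕ.m≤m+n _ _) sized) ∷ []) (s≤s z≤n)
      ; run = exec-within (Rule.body r) (body-fits before eq) es sized [] (size≤ r∈) h
          (done (ℕ.≤-trans (suffix-fits chunkC (rawCond (Rule.body r)) C (body-fits before eq)) n≤)) }
      where
      E₀ : Env
      E₀ = (Rule.x₁ r , fid f) ∷ (Rule.x₂ r , fid g) ∷ E
      es : All EntryFits E₀
      es = slot≤ {Rule.x₁ r} {fid f} (proj₁ (rule-vars≤ r∈)) sf ∷ slot≤ {Rule.x₂ r} {fid g} (proj₂ (rule-vars≤ r∈)) sg ∷ entries≤ ks (condVars-fit r∈) ss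
      sized : length E₀ + length (rawCond (Rule.body r)) ≤ D
      sized = s≤s (s≤s (ℕ.+-mono-≤ (ℕ.≤-trans (ℕ.≤-reflexive (keys-length {E} ks)) (body≤ r∈)) (size≤ r∈)))
      body-fits : ∀ before {C} → rawRules (rules I) ≡ before ++ header (Rule.x₁ r) (Rule.x₂ r) ∷ rawCond (Rule.body r) ++ C →
                  length (encs chunkC (rawCond (Rule.body r) ++ C)) ≤ n
      body-fits before {C} eq = suffix-fits chunkC [ header (Rule.x₁ r) (Rule.x₂ r) ] (rawCond (Rule.body r) ++ C)
        (suffix-fits chunkC before (header (Rule.x₁ r) (Rule.x₂ r) ∷ rawCond (Rule.body r) ++ C)
          (subst (λ L → length (encs chunkC L) ≤ n) eq rawRules≤))

    edge-within : ∀ {f g} → SmallStep f g → SizedEdge bound 𝒯 (rawRules (rules I)) f g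
    edge-within {f} {g} (sf , sg , record { partner = h ; either = e ; conflict = c ; rule∈ = r∈ ; env = E ; keys = ks ; good = ss ; holds = hs }) =
      ℕ.≤-trans (fact≤ {f} sf) vals≤ , ℕ.≤-trans (fact≤ {g} sg) vals≤ , record
        { partner≤ = ℕ.≤-trans (fact≤ {h} (RawConflict.goodʳ c)) vals≤ ; either = e
        ; conflicting = record { κ∈ = raw∈ (RawConflict.κ∈ c) ; violated = RawConflict.env c , RawConflict.violated c
                               ; minimal = RawConflict.minimal c ; plainˡ = RawConflict.plainˡ c ; plainʳ = RawConflict.plainʳ c }
        ; env≤ = ℕ.≤-trans (env-fits (entries≤ (RawConflict.keys c) (constraintVars-fit (RawConflict.κ∈ c)) (RawConflict.good c))
            (short (ℕ.≤-trans (ℕ.≤-reflexive (keys-length {RawConflict.env c} (RawConflict.keys c))) (vars≤ (RawConflict.κ∈ c))))) (ℕ.≤-trans env≤ tower≤)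
        ; prefers = prefers-within E r∈ sf sg ks ss hs }

    walk-within : ∀ {j f g} → Walk SmallStep j f g → Walk (SizedEdge bound 𝒯 (rawRules (rules I))) j f g
    walk-within []      = []
    walk-within (e ∷ w) = edge-within e ∷ walk-within w

    Pool≤ : length Pool ≤ pool
    Pool≤ = ℕ.≤-trans (ℕ.≤-reflexive (List.length-++ (core I))) (ℕ.+-mono-≤ core≤
      (ℕ.≤-reflexive (trans (List.length-map unary (List.upTo F)) (List.length-upTo F))))

    wordLists≤ : ∀ a → length (wordLists a) ≤ pool ^ a
    wordLists≤ zero    = ℕ.≤-refl
    wordLists≤ (suc a) = ℕ.≤-trans (concatMap-length (λ w → map (w ∷_) (wordLists a)) {xs = Pool}
        (λ {w} _ → ℕ.≤-reflexive (List.length-map (w ∷_) (wordLists a))))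
      (ℕ.*-mono-≤ Pool≤ (wordLists≤ a))

    universe≤ : length universe ≤ bound
    universe≤ = ℕ.≤-trans (concatMap-length (λ (p , a) → map (p ,_) (wordLists a)) {xs = shapes} λ {(p , a)} pa∈ →
        ℕ.≤-trans (ℕ.≤-reflexive (List.length-map (p ,_) (wordLists a)))
          (ℕ.≤-trans (wordLists≤ a) (ℕ.^-monoʳ-≤ pool {{nonZero}} (arity≤ pa∈))))
      (ℕ.≤-trans (ℕ.*-monoˡ-≤ _ shapes≤) tuples≤)
      where
      nonZero : NonZero pool
      nonZero = subst NonZero (sym (ℕ.+-suc n _)) _

    cyclic-within : All Harmless 𝒯 → SmallCycle → CyclicWithin bound 𝒯 (rawRules (rules I))
    cyclic-within hs record { first = e ; rest≤ = k≤ ; walk = w } = record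
      { harmless = hs ; first = edge-within e ; rest≤ = ℕ.≤-trans k≤ universe≤ ; walk = walk-within w }

    -- The decision procedure and membership in coNP

    Cyclicᴮ : Set
    Cyclicᴮ = Sat (_≤ bound) Cyclicᶠ (encode I ∷ [])

    cyclicᴮ? : Dec Cyclicᴮ
    cyclicᴮ? = sat? bound Cyclicᶠ _

    input-encode : ∀ {P : Letters → Set} → P (inputOf 𝒯 (rawRules (rules I))) → P (encode I)
    input-encode {P} = subst P (sym (encode-enc I))

    -- Acyclicity is itself a negation, so the raw cycle may be used although it is known only under
    -- double negation.
    acyclic : ¬ Cyclicᴮ → IsAcyclic I
    acyclic ¬c D M α w = cycle-raw I M w λ { (hs , _ , _ , w′) →
      ¬c (input-encode {λ w → Sat (_≤ bound) Cyclicᶠ (w ∷ [])}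
        (cyclic⁺ 𝒯 (rawRules (rules I)) (ℕ.≤-trans input≤ n≤) (cyclic-within hs (short-cycle w′)))) }

    -- The failure of a universal statement gives no witness by itself. The bounded formula is
    -- decidable, and hence it suffices to exclude its negation.
    complete : ¬ IsAcyclic I → Cyclicᴮ
    complete ¬acyclic = decidable-stable cyclicᴮ? (¬acyclic ∘ acyclic)

    sound : ∀ {ok} → Sat ok Cyclicᶠ (encode I ∷ []) → ¬ IsAcyclic I
    sound {ok} p = cyclic-sound I (cyclic⁻ 𝒯 (rawRules (rules I)) (subst (λ w → Sat ok Cyclicᶠ (w ∷ [])) (encode-enc I) p))

    acyclic? : Dec (IsAcyclic I)
    acyclic? = from-refutation cyclicᴮ?
      where
      from-refutation : Dec Cyclicᴮ → Dec (IsAcyclic I)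
      from-refutation (yes c) = no (sound c)
      from-refutation (no ¬c) = yes (acyclic ¬c)

  arities-max : ∀ Ps → ∃[ k ] All (λ P → arity P ≤ k) Ps
  arities-max []       = 0 , []
  arities-max (P ∷ Ps) = let k , ps = arities-max Ps in
    arity P ℕ.⊔ k , ℕ.m≤m⊔n _ _ ∷ All.map (λ p≤ → ℕ.≤-trans p≤ (ℕ.m≤n⊔m (arity P) k)) ps

  -- The largest arity in the instance itself serves as the bound. As it varies with the instance,
  -- this yields a finite search but no polynomial one.
  decide : ∀ I → Dec (IsAcyclic I)
  decide I = let k , arities = arities-max (preds I) in Fit.acyclic? I k arities

  module _ (φ : Fm 1) where
    open Recognise φ

    inNP : ∀ {a p} {X : Set a} {code : X → Letters} {P : X → Set p} {g} → PolyBounded g → (∀ n → n ≤ g n) →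
           (∀ x → P x → Sat (_≤ g (length (code x))) φ (code x ∷ [])) →
           (∀ x → Sat Anything φ (code x ∷ []) → P x) → InNP code P
    inNP {code = code} g-poly n≤g P⇒φ φ⇒P = let c , d , steps≤ = poly-normal (poly-steps g-poly) in
      machine , c , d , λ x →
        (λ p → let j , j≤ , run = machine-accepts (n≤g _) (P⇒φ x p) in j , ℕ.≤-trans j≤ (steps≤ _) , run) ,
        (λ j run → φ⇒P x (accepted run))

  coNP : ∀ k → InCoNP {X = BoundedInstance k} (encode ∘ inst) (IsAcyclic ∘ inst)
  coNP k = inNP Cyclicᶠ (poly-bound (suc k)) (Bounds.n≤ (suc k))
    (λ x → Fit.complete (inst x) k (bounded x)) (λ x → Fit.sound (inst x) k (bounded x))

theorem4 : (S : Signature) → let open Preferences S in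
    ((I : Instance) → Dec (IsAcyclic I))
    × ((k : ℕ) → InCoNP {X = BoundedInstance k} (encode ∘ inst) (IsAcyclic ∘ inst))
theorem4 S = Reduction.decide S , Reduction.coNP S
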